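{- Let $\Lambda\subset\mathbb{R}^{16}$ be a strongly perfect lattice, let $r=r(\Lambda)=\min(\Lambda)\min(\Lambda^*)$ and $s=s(\Lambda)=\frac12|\mathrm{Min}(\Lambda)|$. Then either $r=6$, or the pair $(r,s)$ is one of the following (with $a$ ranging over the indicated integers): $r=192/31$, $s=961a$, $a\in\{2,3\}$; $r=144/23$, $s=2116$; $r=32/5$, $s=450a$, $a\in\{2,3,4\}$; $r=72/11$, $s=968$; $r=192/29$, $s=841$; $r=20/3$, $s=1296$; $r=48/7$, $s=196a$, $a\in\{2,\dots,6\}$; $r=7$, $s=1152$; $r=64/9$, $s=729$; $r=36/5$, $s=400a$, $a\in\{1,2,3\}$; $r=22/3$, $s=1296$; $r=96/13$, $s=338a$, $a\in\{1,\dots,4\}$; $r=15/2$, $s=512a$, $a\in\{1,2,3\}$; $r=144/19$, $s=1444$; $r=192/25$, $s=625a$, $a\in\{1,2\}$; $r=54/7$, $s=784$; $r=8$, $s=72a$, $a\in\{2,\dots,30\}$; $r=384/47$, $s=2209$; $r=90/11$, $s=968a$, $a\in\{1,2\}$; $r=33/4$, $s=2048$; $r=192/23$, $s=529a$, $a\in\{1,\dots,4\}$; $r=42/5$, $s=400a$, $a\in\{1,\dots,5\}$; $r=144/17$, $s=1156a$, $a\in\{1,2\}$; $r=128/15$, $s=2025$; $r=60/7$, $s=784a$, $a\in\{1,2\}$; $r=26/3$, $s=648a$, $a\in\{1,2,3\}$; $r=96/11$, $s=242a$, $a\in\{1,\dots,9\}$; $r=150/17$, $s=2312$; $r=384/43$,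 $s=1849$; $r=9$, $s=128a$, $a\in\{2,\dots,26\}$; $r=64/7$, $s=441a$, $a\in\{1,\dots,8\}$.
   Context: For a lattice $\Lambda\subset\mathbb{R}^n$, $\Lambda^*$ is its dual lattice, $\min(\Lambda)$ the minimal nonzero norm $(\lambda,\lambda)$, $\mathrm{Min}(\Lambda)$ the set of vectors of minimal norm. $\Lambda$ is strongly perfect if $\mathrm{Min}(\Lambda)$ forms a spherical 4-design, equivalently $\sum_{x\in S}(x,\alpha)^4=\frac{3|S|}{n(n+2)}\min(\Lambda)^2(\alpha,\alpha)^2$ for all $\alpha\in\mathbb{R}^n$, where $\mathrm{Min}(\Lambda)=S\sqcup -S$. -}

module Defs where

open import Level using (0ℓ)
open import Data.Nat as ℕ using (ℕ; zero; suc)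
open import Data.Integer as ℤ using (ℤ; +_; -[1+_])
open import Data.Fin using (Fin; zero; suc)
open import Data.List using (List; []; _∷_; length; map; foldr)
open import Data.List.Relation.Unary.Any using (Any)
open import Data.List.Relation.Unary.AllPairs using (AllPairs)
open import Data.Product using (Σ; ∃; _×_; _,_)
open import Data.Sum using (_⊎_)
open import Relation.Nullary using (¬_)
open import Relation.Binary.PropositionalEquality using (_≡_)
open import Relation.Binary.Structures using (IsStrictTotalOrder)
open import Algebra.Structures using (IsCommutativeRing)
open import Function.Bundles using (_⇔_)

-- The real numbers: a (Dedekind-)complete ordered field.
-- Since all complete ordered fields are isomorphic, quantifying over
-- every such structure is the same as speaking about ℝ.

record RealField : Set₁ where
  infixl 6 _+_
  infixl 7 _*_
  infix  4 _<_
  field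
    Carrier : Set
    _+_ _*_ : Carrier → Carrier → Carrier
    -_      : Carrier → Carrier
    0ℝ 1ℝ   : Carrier
    _<_     : Carrier → Carrier → Set
    isCommutativeRing : IsCommutativeRing _≡_ _+_ _*_ -_ 0ℝ 1ℝ
    0≢1     : ¬ (0ℝ ≡ 1ℝ)
    inv     : (x : Carrier) → ¬ (x ≡ 0ℝ) → Carrier
    inv-law : (x : Carrier) (p : ¬ (x ≡ 0ℝ)) → x * inv x p ≡ 1ℝ
    isStrictTotalOrder : IsStrictTotalOrder _≡_ _<_
    +-mono-< : ∀ {x y} z → x < y → x + z < y + z
    *-pos    : ∀ {x y} → 0ℝ < x → 0ℝ < y → 0ℝ < x * y
    lub : (P : Carrier → Set) → (∃ λ x → P x) →
          (∃ λ b → ∀ x → P x → ¬ (b < x)) →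
          ∃ λ u → (∀ x → P x → ¬ (u < x)) ×
                  (∀ b → (∀ x → P x → ¬ (b < x)) → ¬ (b < u))

module RealDefs (R : RealField) where
  open RealField R renaming (Carrier to ℝ)

  _≤_ : ℝ → ℝ → Set
  x ≤ y = ¬ (y < x)

  fromℕ : ℕ → ℝ
  fromℕ zero    = 0ℝ
  fromℕ (suc n) = 1ℝ + fromℕ n

  fromℤ : ℤ → ℝ
  fromℤ (+ n)      = fromℕ n
  fromℤ -[1+ n ]   = - (fromℕ (suc n))

  _^_ : ℝ → ℕ → ℝ
  x ^ zero  = 1ℝ
  x ^ suc k = x * (x ^ k)

  IsInteger : ℝ → Set
  IsInteger x = ∃ λ (z : ℤ) → x ≡ fromℤ z

  Σ[_] : ∀ n → (Fin n → ℝ) → ℝ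
  Σ[ zero  ] f = 0ℝ
  Σ[ suc n ] f = f zero + Σ[ n ] (λ i → f (suc i))

  sumList : List ℝ → ℝ
  sumList = foldr _+_ 0ℝ

  Vec : ℕ → Set
  Vec n = Fin n → ℝ

  _≈v_ : ∀ {n} → Vec n → Vec n → Set
  u ≈v w = ∀ j → u j ≡ w j

  _·_ : ∀ {n} → Vec n → Vec n → ℝ
  _·_ {n} u w = Σ[ n ] (λ j → u j * w j)

  norm : ∀ {n} → Vec n → ℝ
  norm u = u · u

  NonZero : ∀ {n} → Vec n → Set
  NonZero u = ¬ (∀ j → u j ≡ 0ℝ)

  -- a lattice of full rank in ℝ^n, given by a basis b₀,…,b_{n-1}
  LinearlyIndependent : ∀ {n} → (Fin n → Vec n) → Set
  LinearlyIndependent {n} b =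
    (c : Fin n → ℝ) → (∀ j → Σ[ n ] (λ i → c i * b i j) ≡ 0ℝ) → ∀ i → c i ≡ 0ℝ

  InLattice : ∀ {n} → (Fin n → Vec n) → Vec n → Set
  InLattice {n} b v = ∃ λ (c : Fin n → ℤ) → ∀ j → v j ≡ Σ[ n ] (λ i → fromℤ (c i) * b i j)

  InDual : ∀ {n} → (Fin n → Vec n) → Vec n → Set
  InDual b y = ∀ x → InLattice b x → IsInteger (x · y)

  IsMin : ∀ {n} → (Vec n → Set) → ℝ → Set
  IsMin P m = (∃ λ v → P v × NonZero v × norm v ≡ m)
            × (∀ v → P v → NonZero v → m ≤ norm v)

  EnumMin : ∀ {n} → (Vec n → Set) → ℝ → List (Vec n) → Set
  EnumMin P m L =
    (∀ v → ((P v × NonZero v × norm v ≡ m) ⇔ Any (λ w → v ≈v w) L))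
    × AllPairs (λ u w → ¬ (u ≈v w)) L

  -- strong perfection: Min(Λ) = S ⊔ -S satisfies
  --   Σ_{x∈S} (x,α)^4 = 3|S|/(n(n+2)) min(Λ)^2 (α,α)^2   for all α,
  -- written over the whole of Min(Λ) (both sides double) and cleared of
  -- denominators.
  StronglyPerfect : ∀ {n} → (Fin n → Vec n) → Set
  StronglyPerfect {n} b =
    ∀ m L → IsMin (InLattice b) m → EnumMin (InLattice b) m L →
      ∀ (α : Vec n) →
        fromℕ (n ℕ.* (n ℕ.+ 2)) * sumList (map (λ x → (x · α) ^ 4) L)
          ≡ fromℕ (3 ℕ.* length L) * (m ^ 2) * ((α · α) ^ 2)

  _≡_/_ : ℝ → ℕ → ℕ → Set
  r ≡ p / q = r * fromℕ q ≡ fromℕ p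

-- The table of theorem 3.11: entries (p , q , t , lo , hi) meaning
-- r = p/q and s = t·a with lo ≤ a ≤ hi.

Entry : Set
Entry = ℕ × ℕ × ℕ × ℕ × ℕ

table : List Entry
table =
    (192 , 31 , 961  , 2 , 3)
  ∷ (144 , 23 , 2116 , 1 , 1)
  ∷ (32  , 5  , 450  , 2 , 4)
  ∷ (72  , 11 , 968  , 1 , 1)
  ∷ (192 , 29 , 841  , 1 , 1)
  ∷ (20  , 3  , 1296 , 1 , 1)
  ∷ (48  , 7  , 196  , 2 , 6)
  ∷ (7   , 1  , 1152 , 1 , 1)
  ∷ (64  , 9  , 729  , 1 , 1)
  ∷ (36  , 5  , 400  , 1 , 3)
  ∷ (22  , 3  , 1296 , 1 , 1)
  ∷ (96  , 13 , 338  , 1 , 4)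
  ∷ (15  , 2  , 512  , 1 , 3)
  ∷ (144 , 19 , 1444 , 1 , 1)
  ∷ (192 , 25 , 625  , 1 , 2)
  ∷ (54  , 7  , 784  , 1 , 1)
  ∷ (8   , 1  , 72   , 2 , 30)
  ∷ (384 , 47 , 2209 , 1 , 1)
  ∷ (90  , 11 , 968  , 1 , 2)
  ∷ (33  , 4  , 2048 , 1 , 1)
  ∷ (192 , 23 , 529  , 1 , 4)
  ∷ (42  , 5  , 400  , 1 , 5)
  ∷ (144 , 17 , 1156 , 1 , 2)
  ∷ (128 , 15 , 2025 , 1 , 1)
  ∷ (60  , 7  , 784  , 1 , 2)
  ∷ (26  , 3  , 648  , 1 , 3)
  ∷ (96  , 11 , 242  , 1 , 9)
  ∷ (150 , 17 , 2312 , 1 , 1)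
  ∷ (384 , 43 , 1849 , 1 , 1)
  ∷ (9   , 1  , 128  , 2 , 26)
  ∷ (64  , 7  , 441  , 1 , 8)
  ∷ []

module Conclusion (R : RealField) where
  open RealField R renaming (Carrier to ℝ)
  open RealDefs R

  Matches : ℝ → ℕ → Entry → Set
  Matches r s (p , q , t , lo , hi) =
    (r ≡ p / q) × ∃ λ a → lo ℕ.≤ a × a ℕ.≤ hi × s ≡ t ℕ.* a

  Allowed : ℝ → ℕ → Set
  Allowed r s = (r ≡ 6 / 1) ⊎ Any (Matches r s) table

-- Let α ∈ Min(Λ*) and let nᵢ count the x ∈ Min(Λ) with (x , α) = i; these inner products are integers
-- of absolute value at most 3 once r < 10. The 4-design identities turn A = n₁ + 4n₂ + 9n₃ and
-- k = n₂ + 6n₃ into r A = 6 (A + 12k) and 3 s (A + 12k) = 8 A². Projected to α^⊥ the shells are spherical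
-- codes, and Delsarte bounds for the shell i = 2 leave finitely many (A , k). All of them are in the
-- table except three with r close to 6, for which n₁ is too large by a linear programming bound in α^⊥.
--
-- That r < 46/5 is a Cohn–Elkies bound for Λ and Λ* at once: multiplying the two density bounds cancels
-- the covolumes and leaves r and powers of π = (∫ e^{-x²})². The auxiliary function is a combination of
-- Gaussians e^{-|x|²/2e} with e dividing 10080. No Fourier transform is used: the kernels
-- (a + a')^{-8} e^{-|x-y|²/(a+a')} are positive semidefinite as limits of Gram matrices of Gaussians,
-- which makes the moments in e completely monotone, and nonnegativity of a polynomial in the Bernstein
-- basis then yields positivity. Likewise, in the variable e^{-|x|²/20160} the sign of the auxiliary
-- function off the origin is a polynomial inequality on an interval. Both polynomials have the form
-- c p = g² q + (remainder), checked in integer arithmetic. Boxes in a Gram–Schmidt frame supply one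
-- point of Λ (or of Λ*) per unit cell.

module Submission where

open import Defs
open import Data.Nat as ℕ using (ℕ; zero; suc)
import Data.Nat.Properties as ℕₚ
open import Data.Integer as ℤ using (ℤ; -[1+_])
import Data.Integer.Properties as ℤₚ
open import Data.Fin as Fin using (Fin; zero; suc)
open import Data.Product using (Σ; ∃; _×_; _,_; proj₁; proj₂)
open import Data.Sum using (_⊎_; inj₁; inj₂; [_,_]′)
open import Data.Empty using (⊥; ⊥-elim)
open import Data.Bool using (Bool; true; false; if_then_else_; _∧_; _∨_; not) renaming (T to IsTrue)
open import Data.Maybe using (Maybe; just; nothing)
open import Relation.Nullary using (¬_; Dec; yes; no; does)
open import Relation.Binary.PropositionalEquality as ≡ using (_≡_; refl; sym; trans; cong; cong₂; subst; subst₂; module ≡-Reasoning)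
open import Relation.Binary.Definitions using (tri<; tri≈; tri>)
open import Relation.Binary.Structures using (IsStrictTotalOrder)
open import Algebra.Bundles using (CommutativeRing)
open import Algebra.Structures using (IsCommutativeRing)
import Algebra.Solver.Ring as RingSolver
import Algebra.Solver.Ring.AlmostCommutativeRing as ACR
import Algebra.Properties.Ring as RingProps
open import Function using (_∘_; id)
open import Level using (0ℓ)
open import Data.List using (List; []; _∷_; map; _++_; concatMap; length; allFin; tabulate; filter; reverse; replicate)
open import Data.List.Relation.Unary.All as All using (All; []; _∷_)
open import Data.List.Relation.Unary.Any as Any using (Any; here; there)
open import Data.List.Membership.Propositional using (_∈_; find; lose)
import Data.List.Properties as Listₚ
import Data.List.Membership.Propositional.Properties as ∈ₚ
import Data.List.Relation.Unary.All.Properties as Allₚ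
open import Data.List.Relation.Unary.AllPairs as AllPairs using (AllPairs; []; _∷_)
import Data.List.Relation.Unary.AllPairs.Properties as AllPairsₚ
open import Function.Bundles using (Equivalence)
open import Data.List.Relation.Binary.Permutation.Propositional using (_↭_; ↭-refl; ↭-sym; ↭-trans; prep)
import Data.List.Relation.Binary.Permutation.Propositional.Properties as ↭ₚ
import Data.Nat.Solver
open import Data.Nat.DivMod using (m/n*n≤m; m*n/n≡m)
open import Data.Nat.Divisibility using (_∣_; divides; ∣m+n∣m⇒∣n; ∣⇒≤)
open import Data.Unit using (tt)

-- `lub` returns suprema without witnesses, and `≤` is a negated `<`. Archimedean bounds, integer
-- parts and the lattice coefficients built from them therefore exist only under double negation.
-- This is harmless, since what is concluded from them is an inequality. A polynomial with
-- nonnegative Bernstein coefficients has no zero inside the interval unless it is 0. Hence the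
-- places where the polynomials nearly vanish are split off as a square g² before the Bernstein
-- test. The certified surplus κ of the quotient q at 1 plays the part of the Fourier transform at
-- 0: it survives in the limit of ever wider Gaussians and is what multiplies the density. The bound
-- 46/5 leaves little room, because r = 64/7 occurs in the table. The code bounds also rely on it,
-- through the sign of their coefficients. For k ≤ 3 the code bounds do not limit A. Finiteness
-- comes from arithmetic there: 3 s (A + 12k) = 8 A² forces A + 12k to divide 1152 k². The cases k =
-- 0 and k = 1 are separate: the first is r = 6, the second would project the only vector of shell 2
-- to 0, that is r = 4.

module OverReals (R : RealField) where

 -- Ordered-field arithmetic and the ring solver over the reals.

 module Field where
  open RealField R renaming (Carrier to ℝ; -_ to infix 8 -_) public
  open RealDefs R renaming (_≤_ to infix 4 _≤_; _^_ to infixr 8 _^_; _·_ to infixl 7 _·ᵈ_; norm to normᵈ) public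
  open IsCommutativeRing isCommutativeRing public using (+-assoc; +-comm; +-identityˡ; +-identityʳ; *-assoc; *-comm; *-identityˡ; *-identityʳ; distribˡ; distribʳ; -‿inverseˡ; -‿inverseʳ; zeroˡ; zeroʳ)
  open IsStrictTotalOrder isStrictTotalOrder public using (compare) renaming (trans to <-trans; irrefl to <-irrefl)

  infixl 6 _-_
  _-_ : ℝ → ℝ → ℝ
  x - y = x + (- y)

  ℝ-ring : CommutativeRing 0ℓ 0ℓ
  ℝ-ring = record { isCommutativeRing = isCommutativeRing }

  open RingProps (CommutativeRing.ring ℝ-ring) public using (-‿distribˡ-*; -‿distribʳ-*; -‿involutive; -0#≈0#; -‿+-comm)

  fromℕ-+ : ∀ m n → fromℕ (m ℕ.+ n) ≡ fromℕ m + fromℕ n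
  fromℕ-+ zero n = sym (+-identityˡ _)
  fromℕ-+ (suc m) n = trans (cong (1ℝ +_) (fromℕ-+ m n)) (sym (+-assoc _ _ _))

  fromℕ-* : ∀ m n → fromℕ (m ℕ.* n) ≡ fromℕ m * fromℕ n
  fromℕ-* zero n = sym (zeroˡ _)
  fromℕ-* (suc m) n = trans (fromℕ-+ n (m ℕ.* n)) (trans (cong₂ _+_ (sym (*-identityˡ _)) (fromℕ-* m n)) (sym (distribʳ _ _ _)))

  private
    cancel : ∀ a b → (1ℝ + a) - (1ℝ + b) ≡ a - b
    cancel a b = begin
      (1ℝ + a) + - (1ℝ + b) ≡⟨ cong₂ _+_ (+-comm 1ℝ a) (sym (-‿+-comm 1ℝ b)) ⟩
      (a + 1ℝ) + (- 1ℝ + - b) ≡⟨ +-assoc a 1ℝ _ ⟩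
      a + (1ℝ + (- 1ℝ + - b)) ≡⟨ cong (a +_) (sym (+-assoc 1ℝ _ _)) ⟩
      a + ((1ℝ + - 1ℝ) + - b) ≡⟨ cong (λ t → a + (t + - b)) (-‿inverseʳ 1ℝ) ⟩
      a + (0ℝ + - b) ≡⟨ cong (a +_) (+-identityˡ _) ⟩
      a + - b ∎ where open ≡-Reasoning

  fromℤ-⊖ : ∀ m n → fromℤ (m ℤ.⊖ n) ≡ fromℕ m - fromℕ n
  fromℤ-⊖ zero zero = trans (sym (-‿inverseʳ 0ℝ)) refl
  fromℤ-⊖ zero (suc n) = sym (+-identityˡ _)
  fromℤ-⊖ (suc m) zero = sym (trans (cong (fromℕ (suc m) +_) -0#≈0#) (+-identityʳ _))
  fromℤ-⊖ (suc m) (suc n) = trans (cong fromℤ (ℤₚ.[1+m]⊖[1+n]≡m⊖n m n)) (trans (fromℤ-⊖ m n) (sym (cancel (fromℕ m) (fromℕ n))))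

  fromℤ-neg : ∀ z → fromℤ (ℤ.- z) ≡ - fromℤ z
  fromℤ-neg (ℤ.+ zero) = sym -0#≈0#
  fromℤ-neg (ℤ.+ suc n) = refl
  fromℤ-neg -[1+ n ] = sym (-‿involutive _)

  fromℤ-+ : ∀ x y → fromℤ (x ℤ.+ y) ≡ fromℤ x + fromℤ y
  fromℤ-+ (ℤ.+ m) (ℤ.+ n) = fromℕ-+ m n
  fromℤ-+ (ℤ.+ m) -[1+ n ] = fromℤ-⊖ m (suc n)
  fromℤ-+ -[1+ m ] (ℤ.+ n) = trans (fromℤ-⊖ n (suc m)) (+-comm _ _)
  fromℤ-+ -[1+ m ] -[1+ n ] = trans (cong (λ k → - (fromℕ k)) (cong suc (sym (ℕₚ.+-suc m n)))) (trans (cong -_ (fromℕ-+ (suc m) (suc n))) (sym (-‿+-comm _ _)))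

  private
    *+neg : ∀ m n → fromℤ (ℤ.+ m ℤ.* -[1+ n ]) ≡ fromℕ m * (- fromℕ (suc n))
    *+neg m n = trans (cong fromℤ (sym (ℤₚ.neg-distribʳ-* (ℤ.+ m) (ℤ.+ suc n)))) (trans (fromℤ-neg (ℤ.+ m ℤ.* ℤ.+ suc n)) (trans (cong (-_ ∘ fromℤ) (sym (ℤₚ.pos-* m (suc n)))) (trans (cong -_ (fromℕ-* m (suc n))) (-‿distribʳ-* _ _))))

  fromℤ-* : ∀ x y → fromℤ (x ℤ.* y) ≡ fromℤ x * fromℤ y
  fromℤ-* (ℤ.+ m) (ℤ.+ n) = trans (cong fromℤ (sym (ℤₚ.pos-* m n))) (fromℕ-* m n)
  fromℤ-* (ℤ.+ m) -[1+ n ] = *+neg m n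
  fromℤ-* -[1+ m ] (ℤ.+ n) = trans (cong fromℤ (ℤₚ.*-comm -[1+ m ] (ℤ.+ n))) (trans (*+neg n m) (*-comm _ _))
  fromℤ-* -[1+ m ] -[1+ n ] = begin
      fromℕ (suc m ℕ.* suc n) ≡⟨ fromℕ-* (suc m) (suc n) ⟩
      a * b ≡⟨ sym (-‿involutive _) ⟩
      - - (a * b) ≡⟨ cong -_ (-‿distribˡ-* a b) ⟩
      - (- a * b) ≡⟨ -‿distribʳ-* (- a) b ⟩
      - a * - b ∎
    where
      open ≡-Reasoning
      a = fromℕ (suc m)
      b = fromℕ (suc n)

  -- Integer coefficients are decidable, which lets the solver normalise identities with numerals
  -- over the abstract field.
  fromℤ-hom : CommutativeRing.rawRing ℤₚ.+-*-commutativeRing ACR.-Raw-AlmostCommutative⟶ ACR.fromCommutativeRing ℝ-ring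
  fromℤ-hom = record
    { ⟦_⟧ = fromℤ ; +-homo = fromℤ-+ ; *-homo = fromℤ-* ; -‿homo = fromℤ-neg
    ; 0-homo = refl ; 1-homo = +-identityʳ 1ℝ }

  private
    dec : ∀ a b → Maybe (fromℤ a ≡ fromℤ b)
    dec a b with a ℤ.≟ b
    ... | yes refl = just refl
    ... | no _ = nothing

  module Sv = RingSolver (CommutativeRing.rawRing ℤₚ.+-*-commutativeRing) (ACR.fromCommutativeRing ℝ-ring) fromℤ-hom dec
  open Sv public using (solve; _:+_; _:*_; :-_; _:-_; _:=_; con; _:^_)

  K : ∀ {n} → ℕ → Sv.Polynomial n
  K k = con (ℤ.+ k)

  -- denotes 1ℝ itself, whereas K 1 denotes fromℕ 1 = 1ℝ + 0ℝ
  𝟙 : ∀ {n} → Sv.Polynomial n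
  𝟙 = K 0 :^ 0

  infix 4 _≤?_
  <-asym : ∀ {x y} → x < y → ¬ (y < x)
  <-asym p q = <-irrefl refl (<-trans p q)

  <⇒≤ : ∀ {x y} → x < y → x ≤ y
  <⇒≤ = <-asym

  ≤-refl : ∀ {x} → x ≤ x
  ≤-refl = <-irrefl refl

  ≡⇒≤ : ∀ {x y} → x ≡ y → x ≤ y
  ≡⇒≤ refl = ≤-refl

  ≤-split : ∀ {x y} → x ≤ y → x < y ⊎ x ≡ y
  ≤-split {x} {y} p with compare x y
  ... | tri< a _ _ = inj₁ a
  ... | tri≈ _ b _ = inj₂ b
  ... | tri> _ _ c = ⊥-elim (p c)

  ≤-<-trans : ∀ {x y z} → x ≤ y → y < z → x < z
  ≤-<-trans p q with ≤-split p
  ... | inj₁ a = <-trans a q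
  ... | inj₂ refl = q

  <-≤-trans : ∀ {x y z} → x < y → y ≤ z → x < z
  <-≤-trans p q with ≤-split q
  ... | inj₁ a = <-trans p a
  ... | inj₂ refl = p

  ≤-trans : ∀ {x y z} → x ≤ y → y ≤ z → x ≤ z
  ≤-trans p q r = p (≤-<-trans q r)

  ≤-antisym : ∀ {x y} → x ≤ y → y ≤ x → x ≡ y
  ≤-antisym p q with ≤-split p
  ... | inj₁ a = ⊥-elim (q a)
  ... | inj₂ b = b

  _≤?_ : ∀ x y → x ≤ y ⊎ y < x
  x ≤? y with compare x y
  ... | tri< a _ c = inj₁ c
  ... | tri≈ _ b c = inj₁ c
  ... | tri> _ _ c = inj₂ c

  ≤-total : ∀ x y → x ≤ y ⊎ y ≤ x
  ≤-total x y with x ≤? y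
  ... | inj₁ p = inj₁ p
  ... | inj₂ p = inj₂ (<⇒≤ p)

  _≟_ : (x y : ℝ) → Dec (x ≡ y)
  x ≟ y with compare x y
  ... | tri< _ b _ = no b
  ... | tri≈ _ b _ = yes b
  ... | tri> _ b _ = no b

  -- A triple negation collapses. This is the usual exit by which facts known only under double
  -- negation return to the argument.
  ≤-stable : ∀ {x y} → ¬ ¬ (x ≤ y) → x ≤ y
  ≤-stable p q = p (λ r → r q)

  +-mono-≤ʳ : ∀ {x y} z → x ≤ y → x + z ≤ y + z
  +-mono-≤ʳ z p with ≤-split p
  ... | inj₁ a = <⇒≤ (+-mono-< z a)
  ... | inj₂ refl = ≤-refl

  +-mono-≤ : ∀ {x y u v} → x ≤ y → u ≤ v → x + u ≤ y + v
  +-mono-≤ {x} {y} {u} {v} p q = ≤-trans (+-mono-≤ʳ u p) (subst₂ _≤_ (+-comm u y) (+-comm v y) (+-mono-≤ʳ y q))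

  +-mono-<-≤ : ∀ {x y u v} → x < y → u ≤ v → x + u < y + v
  +-mono-<-≤ {x} {y} {u} {v} p q = <-≤-trans (+-mono-< u p) (+-mono-≤ (≤-refl {y}) q)

  ≤⇒0≤ : ∀ {x y} → x ≤ y → 0ℝ ≤ y - x
  ≤⇒0≤ {x} {y} p = subst (_≤ y - x) (-‿inverseʳ x) (+-mono-≤ʳ (- x) p)

  0≤⇒≤ : ∀ {x y} → 0ℝ ≤ y - x → x ≤ y
  0≤⇒≤ {x} {y} p = subst₂ _≤_ (+-identityˡ x) (solve 2 (λ x y → (y :- x) :+ x := y) refl x y) (+-mono-≤ʳ x p)

  <⇒0< : ∀ {x y} → x < y → 0ℝ < y - x
  <⇒0< {x} {y} p = subst (_< y - x) (-‿inverseʳ x) (+-mono-< (- x) p)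

  0<⇒< : ∀ {x y} → 0ℝ < y - x → x < y
  0<⇒< {x} {y} p = subst₂ _<_ (+-identityˡ x) (solve 2 (λ x y → (y :- x) :+ x := y) refl x y) (+-mono-< x p)

  ≤-by : ∀ {x y} d → 0ℝ ≤ d → y ≡ x + d → x ≤ y
  ≤-by {x} d p refl = subst (_≤ x + d) (+-identityʳ x) (+-mono-≤ (≤-refl {x}) p)

  <-by : ∀ {x y} d → 0ℝ < d → y ≡ x + d → x < y
  <-by {x} d p refl = subst₂ _<_ (+-identityˡ x) (+-comm d x) (+-mono-< x p)

  0≤+ : ∀ {x y} → 0ℝ ≤ x → 0ℝ ≤ y → 0ℝ ≤ x + y
  0≤+ {x} {y} p q = subst (_≤ x + y) (+-identityˡ 0ℝ) (+-mono-≤ p q)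

  0<+ : ∀ {x y} → 0ℝ < x → 0ℝ ≤ y → 0ℝ < x + y
  0<+ {x} {y} p q = subst (_< x + y) (+-identityˡ 0ℝ) (+-mono-<-≤ p q)

  0≤* : ∀ {x y} → 0ℝ ≤ x → 0ℝ ≤ y → 0ℝ ≤ x * y
  0≤* {x} {y} p q with ≤-split p | ≤-split q
  ... | inj₁ a | inj₁ b = <⇒≤ (*-pos a b)
  ... | inj₂ refl | _ = ≡⇒≤ (sym (zeroˡ y))
  ... | inj₁ _ | inj₂ refl = ≡⇒≤ (sym (zeroʳ x))

  *-mono-≤ˡ : ∀ {x y} z → 0ℝ ≤ z → x ≤ y → z * x ≤ z * y
  *-mono-≤ˡ {x} {y} z p q = 0≤⇒≤ (subst (0ℝ ≤_) (solve 3 (λ x y z → z :* (y :- x) := z :* y :- z :* x) refl x y z) (0≤* p (≤⇒0≤ q)))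

  *-mono-≤ʳ : ∀ {x y} z → 0ℝ ≤ z → x ≤ y → x * z ≤ y * z
  *-mono-≤ʳ {x} {y} z p q = subst₂ _≤_ (*-comm z x) (*-comm z y) (*-mono-≤ˡ z p q)

  *-mono-≤ : ∀ {x y u v} → 0ℝ ≤ x → 0ℝ ≤ v → x ≤ y → u ≤ v → x * u ≤ y * v
  *-mono-≤ {x} {y} {u} {v} p p' q r = ≤-trans (*-mono-≤ˡ x p r) (*-mono-≤ʳ v p' q)

  *-mono-<ˡ : ∀ {x y} z → 0ℝ < z → x < y → z * x < z * y
  *-mono-<ˡ {x} {y} z p q = 0<⇒< (subst (0ℝ <_) (solve 3 (λ x y z → z :* (y :- x) := z :* y :- z :* x) refl x y z) (*-pos p (<⇒0< q)))

  *-cancel-≤ˡ : ∀ {x y} z → 0ℝ < z → z * x ≤ z * y → x ≤ y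
  *-cancel-≤ˡ z p q r = q (*-mono-<ˡ z p r)

  *-cancel-<ˡ : ∀ {x y} z → 0ℝ < z → z * x < z * y → x < y
  *-cancel-<ˡ {x} {y} z p q with compare x y
  ... | tri< a _ _ = a
  ... | tri≈ _ refl _ = ⊥-elim (<-irrefl refl q)
  ... | tri> _ _ c = ⊥-elim (<-asym q (*-mono-<ˡ z p c))

  *-cancel-≤ʳ : ∀ {x y} z → 0ℝ < z → x * z ≤ y * z → x ≤ y
  *-cancel-≤ʳ {x} {y} z p q = *-cancel-≤ˡ z p (subst₂ _≤_ (*-comm x z) (*-comm y z) q)

  neg-mono-≤ : ∀ {x y} → x ≤ y → - y ≤ - x
  neg-mono-≤ {x} {y} p = 0≤⇒≤ (subst (0ℝ ≤_) (solve 2 (λ x y → y :- x := (:- x) :- (:- y)) refl x y) (≤⇒0≤ p))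

  0≤sq : ∀ x → 0ℝ ≤ x * x
  0≤sq x with ≤-total 0ℝ x
  ... | inj₁ p = 0≤* p p
  ... | inj₂ p = subst (0ℝ ≤_) (solve 1 (λ x → (K 0 :- x) :* (K 0 :- x) := x :* x) refl x) (0≤* (≤⇒0≤ p) (≤⇒0≤ p))

  0<1 : 0ℝ < 1ℝ
  0<1 with compare 0ℝ 1ℝ
  ... | tri< a _ _ = a
  ... | tri≈ _ b _ = ⊥-elim (0≢1 b)
  ... | tri> _ _ c = ⊥-elim (0≤sq 1ℝ (subst (_< 0ℝ) (sym (*-identityˡ 1ℝ)) c))

  0≤1 : 0ℝ ≤ 1ℝ
  0≤1 = <⇒≤ 0<1

  0≤ℕ : ∀ n → 0ℝ ≤ fromℕ n
  0≤ℕ zero = ≤-refl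
  0≤ℕ (suc n) = 0≤+ 0≤1 (0≤ℕ n)

  0<ℕ : ∀ n → 0ℝ < fromℕ (suc n)
  0<ℕ n = 0<+ 0<1 (0≤ℕ n)

  fromℕ-mono-≤ : ∀ {m n} → m ℕ.≤ n → fromℕ m ≤ fromℕ n
  fromℕ-mono-≤ {n = n} ℕ.z≤n = 0≤ℕ n
  fromℕ-mono-≤ (ℕ.s≤s p) = +-mono-≤ (≤-refl {1ℝ}) (fromℕ-mono-≤ p)

  fromℕ-mono-< : ∀ {m n} → m ℕ.< n → fromℕ m < fromℕ n
  fromℕ-mono-< {m} p = <-≤-trans (<-by 1ℝ 0<1 (+-comm 1ℝ (fromℕ m))) (fromℕ-mono-≤ p)

  fromℕ-cancel-≤ : ∀ {m n} → fromℕ m ≤ fromℕ n → m ℕ.≤ n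
  fromℕ-cancel-≤ {m} {n} p with m ℕ.≤? n
  ... | yes q = q
  ... | no q = ⊥-elim (p (fromℕ-mono-< (ℕₚ.≰⇒> q)))

  fromℕ-cancel-< : ∀ {m n} → fromℕ m < fromℕ n → m ℕ.< n
  fromℕ-cancel-< {m} {n} p with m ℕ.<? n
  ... | yes q = q
  ... | no q = ⊥-elim (fromℕ-mono-≤ (ℕₚ.≮⇒≥ q) p)

  fromℕ-inj : ∀ {m n} → fromℕ m ≡ fromℕ n → m ≡ n
  fromℕ-inj p = ℕₚ.≤-antisym (fromℕ-cancel-≤ (≡⇒≤ p)) (fromℕ-cancel-≤ (≡⇒≤ (sym p)))

  0≤fromℤ : ∀ {z} → (ℤ.+ 0) ℤ.≤ z → 0ℝ ≤ fromℤ z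
  0≤fromℤ {ℤ.+ n} _ = 0≤ℕ n

  fromℤ-mono-≤ : ∀ {x y} → x ℤ.≤ y → fromℤ x ≤ fromℤ y
  fromℤ-mono-≤ {x} {y} p = 0≤⇒≤ (subst (0ℝ ≤_) (trans (fromℤ-+ y (ℤ.- x)) (cong (fromℤ y +_) (fromℤ-neg x))) (0≤fromℤ (ℤₚ.i≤j⇒0≤j-i p)))

  fromℤ-mono-< : ∀ {x y} → x ℤ.< y → fromℤ x < fromℤ y
  fromℤ-mono-< {x} {y} p = <-≤-trans (<-by (fromℕ 1) (0<ℕ 0) (trans (fromℤ-+ (ℤ.+ 1) x) (+-comm _ _))) (fromℤ-mono-≤ (ℤₚ.i<j⇒suc[i]≤j p))

  fromℤ-cancel-< : ∀ {x y} → fromℤ x < fromℤ y → x ℤ.< y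
  fromℤ-cancel-< {x} {y} p with x ℤ.<? y
  ... | yes q = q
  ... | no q = ⊥-elim (fromℤ-mono-≤ (ℤₚ.≮⇒≥ q) p)

  -- 0 ⁻¹ = 0
  _⁻¹ : ℝ → ℝ
  x ⁻¹ with x ≟ 0ℝ
  ... | yes _ = 0ℝ
  ... | no p = inv x p

  *-inv : ∀ {x} → ¬ (x ≡ 0ℝ) → x * x ⁻¹ ≡ 1ℝ
  *-inv {x} p with x ≟ 0ℝ
  ... | yes q = ⊥-elim (p q)
  ... | no q = inv-law x q

  0<⇒≢ : ∀ {x} → 0ℝ < x → ¬ (x ≡ 0ℝ)
  0<⇒≢ p refl = <-irrefl refl p

  *-inv⁺ : ∀ {x} → 0ℝ < x → x * x ⁻¹ ≡ 1ℝ
  *-inv⁺ p = *-inv (0<⇒≢ p)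

  inv-pos : ∀ {x} → 0ℝ < x → 0ℝ < x ⁻¹
  inv-pos {x} p with compare 0ℝ (x ⁻¹)
  ... | tri< a _ _ = a
  ... | tri≈ _ b _ = ⊥-elim (0≢1 (trans (sym (zeroʳ x)) (trans (cong (x *_) b) (*-inv⁺ p))))
  ... | tri> _ _ c = ⊥-elim (<-asym 0<1 (subst₂ _<_ (*-inv⁺ p) (zeroʳ x) (*-mono-<ˡ x p c)))

  inv-uniq : ∀ {x y} → 0ℝ < x → x * y ≡ 1ℝ → y ≡ x ⁻¹
  inv-uniq {x} {y} p q = begin
    y ≡⟨ sym (*-identityʳ y) ⟩
    y * 1ℝ ≡⟨ cong (y *_) (sym (*-inv⁺ p)) ⟩
    y * (x * x ⁻¹) ≡⟨ solve 3 (λ x y z → y :* (x :* z) := x :* y :* z) refl x y (x ⁻¹) ⟩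
    x * y * x ⁻¹ ≡⟨ cong (_* x ⁻¹) q ⟩
    1ℝ * x ⁻¹ ≡⟨ *-identityˡ _ ⟩
    x ⁻¹ ∎ where open ≡-Reasoning

  *-cancelˡ : ∀ {x y} z → ¬ (z ≡ 0ℝ) → z * x ≡ z * y → x ≡ y
  *-cancelˡ {x} {y} z p q = trans (lem x) (trans (cong (z ⁻¹ *_) q) (sym (lem y)))
    where lem : ∀ t → t ≡ z ⁻¹ * (z * t)
          lem t = trans (sym (*-identityˡ t)) (trans (cong (_* t) (sym (*-inv p))) (solve 3 (λ z i t → z :* i :* t := i :* (z :* t)) refl z (z ⁻¹) t))

  0≤-cancelˡ : ∀ {x} z → 0ℝ < z → 0ℝ ≤ z * x → 0ℝ ≤ x
  0≤-cancelˡ z p q = *-cancel-≤ˡ z p (subst (_≤ _) (sym (zeroʳ z)) q)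

  ^-+ : ∀ x m n → x ^ (m ℕ.+ n) ≡ x ^ m * x ^ n
  ^-+ x zero n = sym (*-identityˡ _)
  ^-+ x (suc m) n = trans (cong (x *_) (^-+ x m n)) (sym (*-assoc _ _ _))

  *-^ : ∀ x y n → (x * y) ^ n ≡ x ^ n * y ^ n
  *-^ x y zero = sym (*-identityˡ _)
  *-^ x y (suc n) = trans (cong ((x * y) *_) (*-^ x y n)) (solve 4 (λ x y a b → x :* y :* (a :* b) := x :* a :* (y :* b)) refl x y (x ^ n) (y ^ n))

  1^ : ∀ n → 1ℝ ^ n ≡ 1ℝ
  1^ zero = refl
  1^ (suc n) = trans (*-identityˡ _) (1^ n)

  0≤^ : ∀ {x} n → 0ℝ ≤ x → 0ℝ ≤ x ^ n
  0≤^ zero p = 0≤1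
  0≤^ (suc n) p = 0≤* p (0≤^ n p)

  0<^ : ∀ {x} n → 0ℝ < x → 0ℝ < x ^ n
  0<^ zero p = 0<1
  0<^ (suc n) p = *-pos p (0<^ n p)

  ^-mono-≤ : ∀ {x y} n → 0ℝ ≤ x → x ≤ y → x ^ n ≤ y ^ n
  ^-mono-≤ zero p q = ≤-refl
  ^-mono-≤ (suc n) p q = *-mono-≤ p (0≤^ n (≤-trans p q)) q (^-mono-≤ n p q)

  ^≤1 : ∀ {x} n → 0ℝ ≤ x → x ≤ 1ℝ → x ^ n ≤ 1ℝ
  ^≤1 {x} n p q = subst (x ^ n ≤_) (1^ n) (^-mono-≤ n p q)

  sq-cancel-≤ : ∀ {x y} → 0ℝ ≤ y → x * x ≤ y * y → x ≤ y
  sq-cancel-≤ {x} {y} p q r = q (≤-<-trans (*-mono-≤ʳ y p (<⇒≤ r)) (*-mono-<ˡ x (≤-<-trans p r) r))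

  infixl 1 _>>=_
  -- The double-negation monad, for witnesses that `lub` does not supply.
  _>>=_ : {A B : Set} → ¬ ¬ A → (A → ¬ ¬ B) → ¬ ¬ B
  (m >>= f) k = m (λ a → f a k)

  pure : {A : Set} → A → ¬ ¬ A
  pure a k = k a

  ¬¬∀Fin : ∀ n {P : Fin n → Set} → (∀ i → ¬ ¬ P i) → ¬ ¬ (∀ i → P i)
  ¬¬∀Fin zero p k = k (λ ())
  ¬¬∀Fin (suc n) {P} p k = p zero (λ p0 → ¬¬∀Fin n (λ i → p (suc i)) (λ ps → k (λ { zero → p0 ; (suc i) → ps i })))

  -- Otherwise the natural numbers have a supremum u. If some n exceeded u - 1, then n + 1 would
  -- exceed u; so u - 1 is a smaller upper bound.
  archimedes : ∀ x → ¬ ¬ (∃ λ n → x < fromℕ n)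
  archimedes x k = least (<-by 1ℝ 0<1 (solve 1 (λ u → u := (u :- 𝟙) :+ 𝟙) refl u))
    where
      P : ℝ → Set
      P y = ∃ λ n → y ≡ fromℕ n
      sup = lub P (0ℝ , 0 , refl) (x , λ { y (n , refl) q → k (n , q) })
      u = proj₁ sup
      least : ¬ (u - 1ℝ < u)
      least = proj₂ (proj₂ sup) (u - 1ℝ) λ { y (n , refl) q →
        proj₁ (proj₂ sup) (1ℝ + fromℕ n) (suc n , refl)
          (subst₂ _<_ (solve 1 (λ u → (u :- 𝟙) :+ 𝟙 := u) refl u) (+-comm (fromℕ n) 1ℝ) (+-mono-< 1ℝ q)) }

 range : ℕ → List ℕ
 range zero = []
 range (suc n) = n ∷ range n

 cons : ∀ {n} {A : Set} → A → (Fin n → A) → Fin (suc n) → A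
 cons k f zero = k
 cons k f (suc i) = f i

 box : ∀ {A : Set} n → List A → List (Fin n → A)
 box zero zs = (λ ()) ∷ []
 box (suc n) zs = concatMap (λ k → map (cons k) (box n zs)) zs

 -- Finite sums, inner products, positive semidefinite kernels and finite products.

 module Sums where
  open Field

  ∑ : {A : Set} → List A → (A → ℝ) → ℝ
  ∑ [] f = 0ℝ
  ∑ (x ∷ xs) f = f x + ∑ xs f

  ∑-cong∈ : {A : Set} (xs : List A) {f g : A → ℝ} → (∀ x → x ∈ xs → f x ≡ g x) → ∑ xs f ≡ ∑ xs g
  ∑-cong∈ [] p = refl
  ∑-cong∈ (x ∷ xs) p = cong₂ _+_ (p x (here refl)) (∑-cong∈ xs (λ y q → p y (there q)))

  ∑-cong : {A : Set} (xs : List A) {f g : A → ℝ} → (∀ x → f x ≡ g x) → ∑ xs f ≡ ∑ xs g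
  ∑-cong xs p = ∑-cong∈ xs (λ x _ → p x)

  ∑-zero : {A : Set} (xs : List A) → ∑ xs (λ _ → 0ℝ) ≡ 0ℝ
  ∑-zero [] = refl
  ∑-zero (x ∷ xs) = trans (+-identityˡ _) (∑-zero xs)

  ∑-+ : {A : Set} (xs : List A) {f g : A → ℝ} → ∑ xs (λ x → f x + g x) ≡ ∑ xs f + ∑ xs g
  ∑-+ [] = sym (+-identityˡ 0ℝ)
  ∑-+ (x ∷ xs) {f} {g} = trans (cong ((f x + g x) +_) (∑-+ xs)) (solve 4 (λ a b c d → a :+ b :+ (c :+ d) := a :+ c :+ (b :+ d)) refl _ _ _ _)

  ∑-*ˡ : {A : Set} (xs : List A) {f : A → ℝ} (c : ℝ) → ∑ xs (λ x → c * f x) ≡ c * ∑ xs f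
  ∑-*ˡ [] c = sym (zeroʳ c)
  ∑-*ˡ (x ∷ xs) c = trans (cong (_ +_) (∑-*ˡ xs c)) (sym (distribˡ c _ _))

  ∑-*ʳ : {A : Set} (xs : List A) {f : A → ℝ} (c : ℝ) → ∑ xs (λ x → f x * c) ≡ ∑ xs f * c
  ∑-*ʳ xs c = trans (∑-cong xs (λ x → *-comm _ c)) (trans (∑-*ˡ xs c) (*-comm c _))

  ∑-neg : {A : Set} (xs : List A) {f : A → ℝ} → ∑ xs (λ x → - f x) ≡ - ∑ xs f
  ∑-neg [] = sym -0#≈0#
  ∑-neg (x ∷ xs) = trans (cong (_ +_) (∑-neg xs)) (-‿+-comm _ _)

  ∑-- : {A : Set} (xs : List A) {f g : A → ℝ} → ∑ xs (λ x → f x - g x) ≡ ∑ xs f - ∑ xs g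
  ∑-- xs = trans (∑-+ xs) (cong (_ +_) (∑-neg xs))

  ∑-swap : {A B : Set} (xs : List A) (ys : List B) {f : A → B → ℝ} → ∑ xs (λ x → ∑ ys (f x)) ≡ ∑ ys (λ y → ∑ xs (λ x → f x y))
  ∑-swap [] ys = sym (∑-zero ys)
  ∑-swap (x ∷ xs) ys {f} = trans (cong (∑ ys (f x) +_) (∑-swap xs ys)) (sym (∑-+ ys))

  ∑-++ : {A : Set} (xs ys : List A) {f : A → ℝ} → ∑ (xs ++ ys) f ≡ ∑ xs f + ∑ ys f
  ∑-++ [] ys = sym (+-identityˡ _)
  ∑-++ (x ∷ xs) ys = trans (cong (_ +_) (∑-++ xs ys)) (sym (+-assoc _ _ _))

  ∑-map : {A B : Set} (g : A → B) (xs : List A) {f : B → ℝ} → ∑ (map g xs) f ≡ ∑ xs (f ∘ g)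
  ∑-map g [] = refl
  ∑-map g (x ∷ xs) = cong (_ +_) (∑-map g xs)

  ∑-concatMap : {A B : Set} (g : A → List B) (xs : List A) {f : B → ℝ} → ∑ (concatMap g xs) f ≡ ∑ xs (λ x → ∑ (g x) f)
  ∑-concatMap g [] = refl
  ∑-concatMap g (x ∷ xs) = trans (∑-++ (g x) _) (cong (_ +_) (∑-concatMap g xs))

  ∑-prod : {A B : Set} (xs : List A) (ys : List B) {f : A → ℝ} {g : B → ℝ} → ∑ xs f * ∑ ys g ≡ ∑ xs (λ x → ∑ ys (λ y → f x * g y))
  ∑-prod xs ys {f} = trans (sym (∑-*ʳ xs _)) (∑-cong xs (λ x → sym (∑-*ˡ ys (f x))))

  ∑-const : {A : Set} (xs : List A) (c : ℝ) → ∑ xs (λ _ → c) ≡ fromℕ (length xs) * c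
  ∑-const [] c = sym (zeroˡ c)
  ∑-const (x ∷ xs) c = trans (cong₂ _+_ (sym (*-identityˡ c)) (∑-const xs c)) (sym (distribʳ c _ _))

  ∑-mono∈ : {A : Set} (xs : List A) {f g : A → ℝ} → (∀ x → x ∈ xs → f x ≤ g x) → ∑ xs f ≤ ∑ xs g
  ∑-mono∈ [] p = ≤-refl
  ∑-mono∈ (x ∷ xs) p = +-mono-≤ (p x (here refl)) (∑-mono∈ xs (λ y q → p y (there q)))

  ∑-mono : {A : Set} (xs : List A) {f g : A → ℝ} → (∀ x → f x ≤ g x) → ∑ xs f ≤ ∑ xs g
  ∑-mono xs p = ∑-mono∈ xs (λ x _ → p x)

  0≤∑∈ : {A : Set} (xs : List A) {f : A → ℝ} → (∀ x → x ∈ xs → 0ℝ ≤ f x) → 0ℝ ≤ ∑ xs f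
  0≤∑∈ xs {f} p = subst (_≤ ∑ xs f) (∑-zero xs) (∑-mono∈ xs p)

  0≤∑ : {A : Set} (xs : List A) {f : A → ℝ} → (∀ x → 0ℝ ≤ f x) → 0ℝ ≤ ∑ xs f
  0≤∑ xs p = 0≤∑∈ xs (λ x _ → p x)

  term≤∑ : {A : Set} (xs : List A) {f : A → ℝ} → (∀ x → x ∈ xs → 0ℝ ≤ f x) → ∀ {x} → x ∈ xs → f x ≤ ∑ xs f
  term≤∑ (x ∷ xs) {f} p (here refl) = ≤-by (∑ xs f) (0≤∑∈ xs (λ y q → p y (there q))) refl
  term≤∑ (x ∷ xs) {f} p (there q) = ≤-trans (term≤∑ xs (λ y r → p y (there r)) q) (≤-by (f x) (p x (here refl)) (+-comm _ _))

  ∑-tabulate : {A : Set} (n : ℕ) (g : Fin n → A) {f : A → ℝ} → ∑ (tabulate g) f ≡ Σ[ n ] (λ i → f (g i))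
  ∑-tabulate zero g = refl
  ∑-tabulate (suc n) g = cong (_ +_) (∑-tabulate n (g ∘ suc))

  Σ≡∑ : ∀ n {f : Fin n → ℝ} → Σ[ n ] f ≡ ∑ (allFin n) f
  Σ≡∑ n = sym (∑-tabulate n id)

  infixl 7 _·_
  -- Opaque, so that type checking never unfolds an inner product into its sixteen terms.
  abstract
    _·_ : ∀ {n} → Vec n → Vec n → ℝ
    u · v = u ·ᵈ v

    ·-def : ∀ {n} (u v : Vec n) → u · v ≡ u ·ᵈ v
    ·-def u v = refl

    Fs : ∀ n → List (Fin n)
    Fs = allFin

    dot : ∀ n {u v : Vec n} → u · v ≡ ∑ (Fs n) (λ i → u i * v i)
    dot n = Σ≡∑ n

    ∑-Fs-const : ∀ n c → ∑ (Fs n) (λ _ → c) ≡ fromℕ n * c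
    ∑-Fs-const n c = trans (∑-const (allFin n) c) (cong (λ k → fromℕ k * c) (Listₚ.length-tabulate {n = n} id))

    ∈Fs : ∀ {n} (i : Fin n) → i ∈ Fs n
    ∈Fs i = ∈ₚ.∈-allFin i

  norm : ∀ {n} → Vec n → ℝ
  norm u = u · u

  ·-cong : ∀ {n} {u u' v v' : Vec n} → u ≈v u' → v ≈v v' → u · v ≡ u' · v'
  ·-cong {n} p q = trans (dot n) (trans (∑-cong (Fs n) (λ i → cong₂ _*_ (p i) (q i))) (sym (dot n)))

  ·-comm : ∀ {n} (u v : Vec n) → u · v ≡ v · u
  ·-comm {n} u v = trans (dot n) (trans (∑-cong (Fs n) (λ i → *-comm (u i) (v i))) (sym (dot n)))

  infixl 6 _⊕_ _⊖_
  infixr 7 _⊙_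
  _⊕_ _⊖_ : ∀ {n} → Vec n → Vec n → Vec n
  (u ⊕ v) i = u i + v i
  (u ⊖ v) i = u i - v i
  _⊙_ : ∀ {n} → ℝ → Vec n → Vec n
  (c ⊙ v) i = c * v i
  𝟎 : ∀ {n} → Vec n
  𝟎 i = 0ℝ

  ⊕-· : ∀ {n} (u v w : Vec n) → (u ⊕ v) · w ≡ u · w + v · w
  ⊕-· {n} u v w = trans (dot n) (trans (trans (∑-cong (Fs n) (λ i → distribʳ (w i) (u i) (v i))) (∑-+ (Fs n))) (sym (cong₂ _+_ (dot n) (dot n))))

  ⊙-· : ∀ {n} c (u w : Vec n) → (c ⊙ u) · w ≡ c * (u · w)
  ⊙-· {n} c u w = trans (dot n) (trans (trans (∑-cong (Fs n) (λ i → *-assoc c (u i) (w i))) (∑-*ˡ (Fs n) c)) (sym (cong (c *_) (dot n))))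

  ⊖-· : ∀ {n} (u v w : Vec n) → (u ⊖ v) · w ≡ u · w - v · w
  ⊖-· {n} u v w = trans (dot n) (trans (trans (∑-cong (Fs n) (λ i → solve 3 (λ a b c → (a :- b) :* c := a :* c :- b :* c) refl (u i) (v i) (w i))) (∑-- (Fs n))) (sym (cong₂ _-_ (dot n) (dot n))))

  ·-⊕ : ∀ {n} (w u v : Vec n) → w · (u ⊕ v) ≡ w · u + w · v
  ·-⊕ w u v = trans (·-comm w _) (trans (⊕-· u v w) (cong₂ _+_ (·-comm u w) (·-comm v w)))

  ·-⊖ : ∀ {n} (w u v : Vec n) → w · (u ⊖ v) ≡ w · u - w · v
  ·-⊖ w u v = trans (·-comm w _) (trans (⊖-· u v w) (cong₂ _-_ (·-comm u w) (·-comm v w)))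

  ·-⊙ : ∀ {n} c (w u : Vec n) → w · (c ⊙ u) ≡ c * (w · u)
  ·-⊙ c w u = trans (·-comm w _) (trans (⊙-· c u w) (cong (c *_) (·-comm u w)))

  𝟎-· : ∀ {n} (w : Vec n) → 𝟎 · w ≡ 0ℝ
  𝟎-· {n} w = trans (dot n) (trans (∑-cong (Fs n) (λ i → zeroˡ (w i))) (∑-zero (Fs n)))

  lincomb : ∀ {n} {A : Set} → List A → (A → ℝ) → (A → Vec n) → Vec n
  lincomb xs c v i = ∑ xs (λ x → c x * v x i)

  lincomb-· : ∀ {n} {A : Set} (xs : List A) (c : A → ℝ) (v : A → Vec n) w → lincomb xs c v · w ≡ ∑ xs (λ x → c x * (v x · w))
  lincomb-· [] c v w = 𝟎-· w
  lincomb-· (x ∷ xs) c v w = trans (⊕-· (c x ⊙ v x) (lincomb xs c v) w) (cong₂ _+_ (⊙-· (c x) (v x) w) (lincomb-· xs c v w))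

  0≤norm : ∀ {n} (u : Vec n) → 0ℝ ≤ norm u
  0≤norm {n} u = subst (0ℝ ≤_) (sym (dot n)) (0≤∑ (Fs n) (λ i → 0≤sq (u i)))

  norm≡0 : ∀ {n} (u : Vec n) → norm u ≡ 0ℝ → ∀ i → u i ≡ 0ℝ
  norm≡0 {n} u p i with u i ≟ 0ℝ
  ... | yes q = q
  ... | no q = ⊥-elim (q (sq0 (≤-antisym term (0≤sq (u i)))))
    where
      term : u i * u i ≤ 0ℝ
      term = subst (u i * u i ≤_) (trans (sym (dot n)) p) (term≤∑ (Fs n) {λ i → u i * u i} (λ j _ → 0≤sq (u j)) (∈Fs i))
      sq0 : u i * u i ≡ 0ℝ → u i ≡ 0ℝ
      sq0 e = *-cancelˡ (u i) q (trans e (sym (zeroʳ (u i))))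

  norm-pos : ∀ {n} (u : Vec n) → NonZero u → 0ℝ < norm u
  norm-pos u nz with ≤-split (0≤norm u)
  ... | inj₁ p = p
  ... | inj₂ p = ⊥-elim (nz (norm≡0 u (sym p)))

  -- Weighted families instead of finite sets: points may repeat, and the index type is free, as for
  -- the disjoint union in `psd-two`.
  PSD : {C : Set} → (C → C → ℝ) → Set₁
  PSD {C} k = {A : Set} (xs : List A) (w : A → ℝ) (p : A → C) → 0ℝ ≤ ∑ xs (λ i → ∑ xs (λ j → (w i * w j) * k (p i) (p j)))

  -- One factor u · v is expanded over the coordinates c and absorbed into the weights
  -- `w i * p i c`. What remains is a sum of instances for the smaller exponent, one for each c;
  -- exponent 0 is the square of the total weight.
  psd-pow : ∀ {n} k → PSD {Vec n} (λ u v → (u · v) ^ k)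
  psd-pow zero xs w p = subst (0ℝ ≤_) (trans (∑-prod xs xs) (∑-cong xs (λ i → ∑-cong xs (λ j → sym (*-identityʳ _))))) (0≤sq (∑ xs w))
  psd-pow {n} (suc k) xs w p = subst (0ℝ ≤_) (sym eq) (0≤∑ (Fs n) (λ c → psd-pow k xs (λ i → w i * p i c) p))
    where
      eq : ∑ xs (λ i → ∑ xs (λ j → (w i * w j) * (p i · p j * (p i · p j) ^ k)))
         ≡ ∑ (Fs n) (λ c → ∑ xs (λ i → ∑ xs (λ j → (w i * p i c) * (w j * p j c) * (p i · p j) ^ k)))
      eq = trans (∑-cong xs (λ i → trans (∑-cong xs (λ j →
               trans (cong (λ t → (w i * w j) * (t * (p i · p j) ^ k)) (dot n))
                (trans (solve 3 (λ a b c → a :* (b :* c) := b :* (a :* c)) refl (w i * w j) (∑ (Fs n) (λ c → p i c * p j c)) ((p i · p j) ^ k))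
                 (trans (sym (∑-*ʳ (Fs n) _)) (∑-cong (Fs n) (λ c →
                   solve 5 (λ a b c d e → c :* d :* (a :* b :* e) := a :* c :* (b :* d) :* e) refl (w i) (w j) (p i c) (p j c) ((p i · p j) ^ k)))))))
               (∑-swap xs (Fs n)))) (∑-swap xs (Fs n))

  -- B(X,X) - 2λ B(X,Y) + λ² B(Y,Y) ≥ 0
  psd-two : {C : Set} (k : C → C → ℝ) → PSD k → (∀ u v → k u v ≡ k v u) → {A B : Set}
    (xs : List A) (w : A → ℝ) (p : A → C) (ys : List B) (v : B → ℝ) (q : B → C) (l : ℝ) →
    0ℝ ≤ ∑ xs (λ i → ∑ xs (λ j → (w i * w j) * k (p i) (p j)))
         - (l + l) * ∑ xs (λ i → ∑ ys (λ j → (w i * v j) * k (p i) (q j)))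
         + l * l * ∑ ys (λ i → ∑ ys (λ j → (v i * v j) * k (q i) (q j)))
  psd-two k psd ksym {A} {B} xs w p ys v q l = subst (0ℝ ≤_) eq (psd zs W P)
    where
      zs = map inj₁ xs ++ map inj₂ ys
      W : A ⊎ B → ℝ
      W (inj₁ a) = w a
      W (inj₂ b) = - (l * v b)
      P : A ⊎ B → _
      P (inj₁ a) = p a
      P (inj₂ b) = q b
      split : ∀ f → ∑ zs f ≡ ∑ xs (f ∘ inj₁) + ∑ ys (f ∘ inj₂)
      split f = trans (∑-++ (map inj₁ xs) (map inj₂ ys)) (cong₂ _+_ (∑-map inj₁ xs) (∑-map inj₂ ys))
      XX = ∑ xs (λ i → ∑ xs (λ j → (w i * w j) * k (p i) (p j)))
      XY = ∑ xs (λ i → ∑ ys (λ j → (w i * v j) * k (p i) (q j)))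
      YY = ∑ ys (λ i → ∑ ys (λ j → (v i * v j) * k (q i) (q j)))
      e12 : ∑ xs (λ i → ∑ ys (λ j → (w i * (- (l * v j))) * k (p i) (q j))) ≡ - l * XY
      e12 = trans (∑-cong xs (λ i → trans (∑-cong ys (λ j → solve 4 (λ w v l k → w :* (:- (l :* v)) :* k := :- l :* (w :* v :* k)) refl (w i) (v j) l (k (p i) (q j)))) (∑-*ˡ ys (- l)))) (∑-*ˡ xs (- l))
      e21 : ∑ ys (λ j → ∑ xs (λ i → ((- (l * v j)) * w i) * k (q j) (p i))) ≡ - l * XY
      e21 = trans (∑-swap ys xs) (trans (∑-cong xs (λ i → ∑-cong ys (λ j → trans (cong (((- (l * v j)) * w i) *_) (ksym (q j) (p i))) (cong (_* k (p i) (q j)) (*-comm _ _))))) e12)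
      e22 : ∑ ys (λ i → ∑ ys (λ j → ((- (l * v i)) * (- (l * v j))) * k (q i) (q j))) ≡ l * l * YY
      e22 = trans (∑-cong ys (λ i → trans (∑-cong ys (λ j → solve 4 (λ w v l k → (:- (l :* w)) :* (:- (l :* v)) :* k := l :* l :* (w :* v :* k)) refl (v i) (v j) l (k (q i) (q j)))) (∑-*ˡ ys (l * l)))) (∑-*ˡ ys (l * l))
      eq : ∑ zs (λ i → ∑ zs (λ j → (W i * W j) * k (P i) (P j))) ≡ XX - (l + l) * XY + l * l * YY
      eq = trans (split _) (trans (cong₂ _+_ (trans (∑-cong xs (λ i → split _)) (∑-+ xs)) (trans (∑-cong ys (λ i → split _)) (∑-+ ys)))
           (trans (cong₂ _+_ (cong (XX +_) e12) (cong₂ _+_ e21 e22))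
             (solve 4 (λ x y z l → x :+ (:- l) :* y :+ ((:- l) :* y :+ l :* l :* z) := x :- (l :+ l) :* y :+ l :* l :* z) refl XX XY YY l)))

  Π : ∀ n → (Fin n → ℝ) → ℝ
  Π zero f = 1ℝ
  Π (suc n) f = f zero * Π n (f ∘ suc)

  Π-cong : ∀ n {f g : Fin n → ℝ} → (∀ i → f i ≡ g i) → Π n f ≡ Π n g
  Π-cong zero p = refl
  Π-cong (suc n) p = cong₂ _*_ (p zero) (Π-cong n (p ∘ suc))

  Π-* : ∀ n {f g : Fin n → ℝ} → Π n (λ i → f i * g i) ≡ Π n f * Π n g
  Π-* zero = sym (*-identityˡ 1ℝ)
  Π-* (suc n) {f} {g} = trans (cong (f zero * g zero *_) (Π-* n)) (solve 4 (λ x y a b → x :* y :* (a :* b) := x :* a :* (y :* b)) refl _ _ _ _)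

  Π-const : ∀ n c → Π n (λ _ → c) ≡ c ^ n
  Π-const zero c = refl
  Π-const (suc n) c = cong (c *_) (Π-const n c)

  0≤Π : ∀ n {f : Fin n → ℝ} → (∀ i → 0ℝ ≤ f i) → 0ℝ ≤ Π n f
  0≤Π zero p = 0≤1
  0≤Π (suc n) p = 0≤* (p zero) (0≤Π n (p ∘ suc))

  0<Π : ∀ n {f : Fin n → ℝ} → (∀ i → 0ℝ < f i) → 0ℝ < Π n f
  0<Π zero p = 0<1
  0<Π (suc n) p = *-pos (p zero) (0<Π n (p ∘ suc))

  Π-mono : ∀ n {f g : Fin n → ℝ} → (∀ i → 0ℝ ≤ f i) → (∀ i → f i ≤ g i) → Π n f ≤ Π n g
  Π-mono zero p q = ≤-refl
  Π-mono (suc n) p q = *-mono-≤ (p zero) (0≤Π n (λ i → ≤-trans (p (suc i)) (q (suc i)))) (q zero) (Π-mono n (p ∘ suc) (q ∘ suc))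

  -- Distributivity over a product grid. With Gaussian factors it reduces n-dimensional Riemann sums
  -- to single axes.
  ∑-box : ∀ {A : Set} n (zs : List A) (φ : Fin n → A → ℝ) → ∑ (box n zs) (λ k → Π n (λ i → φ i (k i))) ≡ Π n (λ i → ∑ zs (φ i))
  ∑-box zero zs φ = +-identityʳ 1ℝ
  ∑-box (suc n) zs φ = trans (∑-concatMap _ zs) (trans (∑-cong zs (λ k → trans (∑-map (cons k) (box n zs)) (trans (∑-*ˡ (box n zs) (φ zero k)) (cong (φ zero k *_) (∑-box n zs (φ ∘ suc)))))) (∑-*ʳ zs _))

  range-< : ∀ K {k} → k ∈ range K → k ℕ.< K
  range-< (suc K) (here refl) = ℕₚ.≤-refl
  range-< (suc K) (there p) = ℕₚ.m≤n⇒m≤1+n (range-< K p)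

 -- Vectors, lattices and the comparison of finite vector sets.

 module Lattice where
  open Field public
  open Sums public

  unit : ∀ {n} → Fin n → Vec n
  unit zero zero = 1ℝ
  unit zero (suc j) = 0ℝ
  unit (suc i) zero = 0ℝ
  unit (suc i) (suc j) = unit i j

  Σ-zero : ∀ n {f : Fin n → ℝ} → (∀ i → f i ≡ 0ℝ) → Σ[ n ] f ≡ 0ℝ
  Σ-zero zero p = refl
  Σ-zero (suc n) p = trans (cong₂ _+_ (p zero) (Σ-zero n (p ∘ suc))) (+-identityˡ 0ℝ)

  unit-· : ∀ {n} (i : Fin n) (u : Vec n) → unit i · u ≡ u i
  unit-· i u = trans (·-def (unit i) u) (go i u)
    where
      go : ∀ {n} (i : Fin n) (u : Vec n) → unit i ·ᵈ u ≡ u i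
      go {suc n} zero u = trans (cong₂ _+_ (*-identityˡ _) (Σ-zero n (λ j → zeroˡ _))) (+-identityʳ _)
      go {suc n} (suc i) u = trans (cong₂ _+_ (zeroˡ _) (go i (u ∘ suc))) (+-identityˡ _)

  ·-unit : ∀ {n} (u : Vec n) (i : Fin n) → u · unit i ≡ u i
  ·-unit u i = trans (·-comm u (unit i)) (unit-· i u)

  unit-norm : ∀ {n} (i : Fin n) → unit i · unit i ≡ 1ℝ
  unit-norm i = trans (unit-· i (unit i)) (diag i)
    where
      diag : ∀ {n} (i : Fin n) → unit i i ≡ 1ℝ
      diag zero = refl
      diag (suc i) = diag i

  cauchy-schwarz : ∀ {n} (u v : Vec n) → (u · v) * (u · v) ≤ norm u * norm v
  cauchy-schwarz u v with norm v ≟ 0ℝ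
  ... | yes p = ≡⇒≤ (trans (cong (λ t → t * t) (trans (·-cong {u = u} (λ i → refl) (norm≡0 v p)) (trans (·-comm u 𝟎) (𝟎-· u)))) (trans (zeroʳ 0ℝ) (sym (trans (cong (norm u *_) p) (zeroʳ _)))))
  ... | no p = *-cancel-≤ˡ (norm v) v>0 (0≤⇒≤ (subst (0ℝ ≤_) eq (0≤norm w)))
    where
      v>0 = norm-pos v (λ q → p (trans (·-cong q (λ i → refl)) (𝟎-· v)))
      -- The component of u orthogonal to v, multiplied by `norm v` to avoid a division.
      w = norm v ⊙ u ⊖ (u · v) ⊙ v
      eq : norm w ≡ norm v * (norm u * norm v) - norm v * ((u · v) * (u · v))
      eq = trans (⊖-· (norm v ⊙ u) ((u · v) ⊙ v) w)
             (trans (cong₂ _-_ (trans (⊙-· (norm v) u w) (cong (norm v *_) (trans (·-⊖ u (norm v ⊙ u) ((u · v) ⊙ v)) (cong₂ _-_ (·-⊙ (norm v) u u) (·-⊙ (u · v) u v)))))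
                               (trans (⊙-· (u · v) v w) (cong ((u · v) *_) (trans (·-⊖ v (norm v ⊙ u) ((u · v) ⊙ v)) (cong₂ _-_ (trans (·-⊙ (norm v) v u) (cong (norm v *_) (·-comm v u))) (·-⊙ (u · v) v v))))))
               (solve 3 (λ a b c → b :* (b :* a :- c :* c) :- c :* (b :* c :- c :* b) := b :* (a :* b) :- b :* (c :* c)) refl (norm u) (norm v) (u · v)))

  ⊙-NonZero : ∀ {n} {u : Vec n} → 0ℝ < norm u → NonZero u
  ⊙-NonZero {u = u} p q = <-irrefl (sym (trans (·-cong q (λ i → refl)) (𝟎-· u))) p

  private
    N1 = fromℕ 1
    N2 = fromℕ 2
    N3 = fromℕ 3

  quartic : ℝ → ℝ → ℝ → ℝ → ℝ → ℝ → ℝ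
  quartic d0 d1 d2 d3 d4 t = d0 + t * d1 + t ^ 2 * d2 + t ^ 3 * d3 + t ^ 4 * d4

  -- Central differences at 0, ±1, ±2 isolate each coefficient exactly. They take the place of
  -- derivatives when identities valid for every t are compared.
  quartic-coeffs : ∀ d0 d1 d2 d3 d4 → (∀ t → quartic d0 d1 d2 d3 d4 t ≡ 0ℝ) → d1 ≡ 0ℝ × d2 ≡ 0ℝ × d3 ≡ 0ℝ
  quartic-coeffs d0 d1 d2 d3 d4 h = c1 , c2 , c3
    where
      H = quartic d0 d1 d2 d3 d4
      Q : ∀ {n} → (a b c d e : Sv.Polynomial n) → ℤ → Sv.Polynomial n
      Q a b c d e k = a :+ con k :* b :+ con k :^ 2 :* c :+ con k :^ 3 :* d :+ con k :^ 4 :* e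
      z1 = h (fromℤ (ℤ.+ 1)); z2 = h (fromℤ (ℤ.+ 2)); y1 = h (fromℤ (ℤ.- (ℤ.+ 1))); y2 = h (fromℤ (ℤ.- (ℤ.+ 2))); x0 = h (fromℤ (ℤ.+ 0))
      comb : ℤ → ℤ → ℤ → ℤ → ℤ → ℝ
      comb a b c d e = fromℤ a * H (fromℤ (ℤ.+ 0)) + fromℤ b * H (fromℤ (ℤ.+ 1)) + fromℤ c * H (fromℤ (ℤ.- (ℤ.+ 1))) + fromℤ d * H (fromℤ (ℤ.+ 2)) + fromℤ e * H (fromℤ (ℤ.- (ℤ.+ 2)))
      comb0 : ∀ a b c d e → comb a b c d e ≡ 0ℝ
      comb0 a b c d e = trans (cong₂ _+_ (cong₂ _+_ (cong₂ _+_ (cong₂ _+_ (cong (fromℤ a *_) x0) (cong (fromℤ b *_) z1)) (cong (fromℤ c *_) y1)) (cong (fromℤ d *_) z2)) (cong (fromℤ e *_) y2))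
        (solve 5 (λ a b c d e → a :* K 0 :+ b :* K 0 :+ c :* K 0 :+ d :* K 0 :+ e :* K 0 := K 0) refl (fromℤ a) (fromℤ b) (fromℤ c) (fromℤ d) (fromℤ e))
      Cb : ∀ {n} → (a b c d e : Sv.Polynomial n) → ℤ → ℤ → ℤ → ℤ → ℤ → Sv.Polynomial n
      Cb a b c d e k l m n o = con k :* Q a b c d e (ℤ.+ 0) :+ con l :* Q a b c d e (ℤ.+ 1) :+ con m :* Q a b c d e (ℤ.- (ℤ.+ 1)) :+ con n :* Q a b c d e (ℤ.+ 2) :+ con o :* Q a b c d e (ℤ.- (ℤ.+ 2))
      fin : ∀ {x} k → fromℕ (suc k) * x ≡ 0ℝ → x ≡ 0ℝ
      fin {x} k p = *-cancelˡ (fromℕ (suc k)) (0<⇒≢ (0<ℕ k)) (trans p (sym (zeroʳ _)))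
      c1 : d1 ≡ 0ℝ
      c1 = fin 11 (trans (solve 5 (λ a b c d e → K 12 :* b := Cb a b c d e (ℤ.+ 0) (ℤ.+ 8) (ℤ.- (ℤ.+ 8)) (ℤ.- (ℤ.+ 1)) (ℤ.+ 1)) refl d0 d1 d2 d3 d4) (comb0 (ℤ.+ 0) (ℤ.+ 8) (ℤ.- (ℤ.+ 8)) (ℤ.- (ℤ.+ 1)) (ℤ.+ 1)))
      c2 : d2 ≡ 0ℝ
      c2 = fin 23 (trans (solve 5 (λ a b c d e → K 24 :* c := Cb a b c d e (ℤ.- (ℤ.+ 30)) (ℤ.+ 16) (ℤ.+ 16) (ℤ.- (ℤ.+ 1)) (ℤ.- (ℤ.+ 1))) refl d0 d1 d2 d3 d4) (comb0 (ℤ.- (ℤ.+ 30)) (ℤ.+ 16) (ℤ.+ 16) (ℤ.- (ℤ.+ 1)) (ℤ.- (ℤ.+ 1))))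
      c3 : d3 ≡ 0ℝ
      c3 = fin 11 (trans (solve 5 (λ a b c d e → K 12 :* d := Cb a b c d e (ℤ.+ 0) (ℤ.- (ℤ.+ 2)) (ℤ.+ 2) (ℤ.+ 1) (ℤ.- (ℤ.+ 1))) refl d0 d1 d2 d3 d4) (comb0 (ℤ.+ 0) (ℤ.- (ℤ.+ 2)) (ℤ.+ 2) (ℤ.+ 1) (ℤ.- (ℤ.+ 1))))

  ≈v-sym : ∀ {n} {u v : Vec n} → u ≈v v → v ≈v u
  ≈v-sym p i = sym (p i)

  ≈v-trans : ∀ {n} {u v w : Vec n} → u ≈v v → v ≈v w → u ≈v w
  ≈v-trans p q i = trans (p i) (q i)

  Distinct : ∀ {n} → List (Vec n) → Set
  Distinct = AllPairs (λ u w → ¬ (u ≈v w))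

  -- Vectors are functions compared pointwise by `≈v`; only for such F does a sum depend on the
  -- vector set and not on the chosen representatives.
  Respects : ∀ {n} → (Vec n → ℝ) → Set
  Respects F = ∀ {u v} → u ≈v v → F u ≡ F v

  private
    remove : ∀ {n} {x : Vec n} (ys : List (Vec n)) → Any (x ≈v_) ys →
             ∃ λ zs → length ys ≡ suc (length zs) × (∀ {y} → ¬ (x ≈v y) → Any (y ≈v_) ys → Any (y ≈v_) zs)
               × (∀ F → Respects F → ∑ ys F ≡ F x + ∑ zs F)
    remove (y ∷ ys) (here p) = ys , refl , (λ { q (here r) → ⊥-elim (q (≈v-trans p (≈v-sym r))) ; q (there r) → r }) , λ F ext → cong (_+ ∑ ys F) (sym (ext p))
    remove {x = x} (y ∷ ys) (there p) with remove ys p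
    ... | zs , e , f , g = y ∷ zs , cong suc e , (λ { q (here r) → here r ; q (there r) → there (f q r) })
          , λ F ext → trans (cong (F y +_) (g F ext)) (solve 3 (λ a b c → a :+ (b :+ c) := b :+ (a :+ c)) refl (F y) (F x) (∑ zs F))

    shrink : ∀ {n} {x : Vec n} {ys zs : List (Vec n)} → (∀ {y} → ¬ (x ≈v y) → Any (y ≈v_) ys → Any (y ≈v_) zs) →
             ∀ xs → All (λ w → ¬ (x ≈v w)) xs → All (λ x → Any (x ≈v_) ys) xs → All (λ x → Any (x ≈v_) zs) xs
    shrink f [] [] [] = []
    shrink f (w ∷ xs) (q ∷ qs) (r ∷ rs) = f q r ∷ shrink f xs qs rs

  pigeonhole : ∀ {n} (xs ys : List (Vec n)) → Distinct xs → All (λ x → Any (x ≈v_) ys) xs → length xs ℕ.≤ length ys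
  pigeonhole [] ys _ _ = ℕ.z≤n
  pigeonhole (x ∷ xs) ys (d ∷ ds) (p ∷ ps) with remove ys p
  ... | zs , e , f , _ = subst (suc (length xs) ℕ.≤_) (sym e) (ℕ.s≤s (pigeonhole xs zs ds (shrink f xs d ps)))

  -- Distinctness and equal length make the inclusion a bijection up to `≈v`, and matched entries
  -- are removed one at a time. This carries sums along x ↦ -x between opposite shells.
  same-sum : ∀ {n} (xs ys : List (Vec n)) → Distinct xs → All (λ x → Any (x ≈v_) ys) xs → length xs ≡ length ys →
             ∀ F → Respects F → ∑ xs F ≡ ∑ ys F
  same-sum [] [] _ _ _ F ext = refl
  same-sum [] (y ∷ ys) _ _ () F ext
  same-sum (x ∷ xs) ys (d ∷ ds) (p ∷ ps) l F ext with remove ys p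
  ... | zs , e , f , g = trans (cong (F x +_) (same-sum xs zs ds (shrink f xs d ps) (ℕₚ.suc-injective (trans l e)) F ext)) (sym (g F ext))

  InLattice-neg : ∀ {n} {b : Fin n → Vec n} {v} → InLattice b v → InLattice b (𝟎 ⊖ v)
  InLattice-neg {n} {b} {v} (c , p) = (λ i → ℤ.- c i) , λ j → begin
      0ℝ - v j ≡⟨ trans (+-identityˡ _) (cong -_ (trans (p j) (Σ≡∑ n))) ⟩
      - ∑ (allFin n) (λ i → fromℤ (c i) * b i j) ≡⟨ sym (∑-neg (allFin n)) ⟩
      ∑ (allFin n) (λ i → - (fromℤ (c i) * b i j)) ≡⟨ ∑-cong (allFin n) (λ i → trans (-‿distribˡ-* _ _) (cong (_* b i j) (sym (fromℤ-neg (c i))))) ⟩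
      ∑ (allFin n) (λ i → fromℤ (ℤ.- c i) * b i j) ≡⟨ sym (Σ≡∑ n) ⟩
      Σ[ n ] (λ i → fromℤ (ℤ.- c i) * b i j) ∎
    where open ≡-Reasoning

  InLattice-+ : ∀ {n} {b : Fin n → Vec n} {u v} → InLattice b u → InLattice b v → InLattice b (u ⊕ v)
  InLattice-+ {n} {b} {u} {v} (c , p) (d , q) = (λ i → c i ℤ.+ d i) , λ j → begin
      u j + v j ≡⟨ cong₂ _+_ (trans (p j) (Σ≡∑ n)) (trans (q j) (Σ≡∑ n)) ⟩
      ∑ (allFin n) (λ i → fromℤ (c i) * b i j) + ∑ (allFin n) (λ i → fromℤ (d i) * b i j) ≡⟨ sym (∑-+ (allFin n)) ⟩
      ∑ (allFin n) (λ i → fromℤ (c i) * b i j + fromℤ (d i) * b i j) ≡⟨ ∑-cong (allFin n) (λ i → trans (sym (distribʳ _ _ _)) (cong (_* b i j) (sym (fromℤ-+ (c i) (d i))))) ⟩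
      ∑ (allFin n) (λ i → fromℤ (c i ℤ.+ d i) * b i j) ≡⟨ sym (Σ≡∑ n) ⟩
      Σ[ n ] (λ i → fromℤ (c i ℤ.+ d i) * b i j) ∎
    where open ≡-Reasoning

  neg-norm : ∀ {n} (v : Vec n) → norm (𝟎 ⊖ v) ≡ norm v
  neg-norm v = trans (⊖-· 𝟎 v (𝟎 ⊖ v)) (trans (cong₂ _-_ (𝟎-· (𝟎 ⊖ v)) (trans (·-⊖ v 𝟎 v) (cong (_- v · v) (trans (·-comm v 𝟎) (𝟎-· v))))) (solve 1 (λ a → K 0 :- (K 0 :- a) := a) refl (v · v)))

 open Lattice

 -- α is a vector of Λ* of norm m*. Its minimality enters through `r<46/5`, that of m through
 -- `minb`.
 record Setting : Set where
  field
    b : Fin 16 → Vec 16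
    m : ℝ
    m>0 : 0ℝ < m
    minb : ∀ v → InLattice b v → NonZero v → m ≤ normᵈ v
    L : List (Vec 16)
    enum : EnumMin (InLattice b) m L
    design : ∀ α → fromℕ 288 * sumList (map (λ x → (x ·ᵈ α) ^ 4) L) ≡ fromℕ (3 ℕ.* length L) * (m ^ 2) * ((α ·ᵈ α) ^ 2)
    α : Vec 16
    m* : ℝ
    m*>0 : 0ℝ < m*
    dualα : InDual b α
    normα : norm α ≡ m*
    r<46/5 : fromℕ 5 * (m * m*) < fromℕ 46

 -- Design identities of degrees 2 and 4, polarised.

 module Design (𝒮 : Setting) where
  open Setting 𝒮

  ℓ : ℝ
  ℓ = fromℕ (length L)

  ∈L : ∀ {x} → x ∈ L → InLattice b x × NonZero x × norm x ≡ m
  ∈L {x} p with Equivalence.from (proj₁ enum x) (Any.map (λ { refl i → refl }) p)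
  ... | q , nz , e = q , nz , trans (·-def x x) e

  any-L : ∀ {x} → InLattice b x → NonZero x → norm x ≡ m → Any (x ≈v_) L
  any-L {x} p q r = Equivalence.to (proj₁ enum x) (p , q , trans (sym (·-def x x)) r)

  norm-L : ∀ {x} → x ∈ L → norm x ≡ m
  norm-L p = proj₂ (proj₂ (∈L p))

  private
    sumList≡∑ : ∀ (xs : List (Vec 16)) f → sumList (map f xs) ≡ ∑ xs f
    sumList≡∑ [] f = refl
    sumList≡∑ (x ∷ xs) f = cong (f x +_) (sumList≡∑ xs f)

  -- `Dij` evaluates the sum of (x · α)^i (x · β)^j over Min(Λ). The factor 96 is 16 · 18 / 3.
  D40 : ∀ α → fromℕ 96 * ∑ L (λ x → (x · α) ^ 4) ≡ ℓ * (m * m) * ((α · α) * (α · α))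
  D40 α = *-cancelˡ (fromℕ 3) (0<⇒≢ (0<ℕ 2)) (begin
      fromℕ 3 * (fromℕ 96 * S) ≡⟨ solve 1 (λ s → K 3 :* (K 96 :* s) := K 288 :* s) refl S ⟩
      fromℕ 288 * S ≡⟨ cong (fromℕ 288 *_) (trans (∑-cong L (λ x → cong (_^ 4) (·-def x α))) (sym (sumList≡∑ L (λ x → (x ·ᵈ α) ^ 4)))) ⟩
      fromℕ 288 * sumList (map (λ x → (x ·ᵈ α) ^ 4) L) ≡⟨ design α ⟩
      fromℕ (3 ℕ.* length L) * (m ^ 2) * ((α ·ᵈ α) ^ 2) ≡⟨ cong₂ (λ t u → t * (m ^ 2) * (u ^ 2)) (fromℕ-* 3 (length L)) (sym (·-def α α)) ⟩
      fromℕ 3 * ℓ * (m ^ 2) * (A ^ 2) ≡⟨ solve 3 (λ l m a → K 3 :* l :* (m :^ 2) :* (a :^ 2) := K 3 :* (l :* (m :* m) :* (a :* a))) refl ℓ m A ⟩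
      fromℕ 3 * (ℓ * (m * m) * (A * A)) ∎)
    where
      open ≡-Reasoning
      S = ∑ L (λ x → (x · α) ^ 4)
      A = α · α

  private
    -- Both sides of `D40` at α + tβ are quartics in t. Their difference has the coefficients d0,
    -- ..., d4 and vanishes for every t; d1 and d2 yield the mixed identities.
    module Polar (α β : Vec 16) where
      A = α · α
      B = α · β
      C = β · β
      S0 = ∑ L (λ x → (x · α) ^ 4)
      S1 = ∑ L (λ x → (x · α) ^ 3 * (x · β))
      S2 = ∑ L (λ x → (x · α) ^ 2 * (x · β) ^ 2)
      S3 = ∑ L (λ x → (x · α) * (x · β) ^ 3)
      S4 = ∑ L (λ x → (x · β) ^ 4)
      lm = ℓ * (m * m)

      expand : ∀ t (xs : List (Vec 16)) → ∑ xs (λ x → (x · (α ⊕ t ⊙ β)) ^ 4) ≡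
        ∑ xs (λ x → (x · α) ^ 4) + t * (fromℕ 4 * ∑ xs (λ x → (x · α) ^ 3 * (x · β))) + t ^ 2 * (fromℕ 6 * ∑ xs (λ x → (x · α) ^ 2 * (x · β) ^ 2))
          + t ^ 3 * (fromℕ 4 * ∑ xs (λ x → (x · α) * (x · β) ^ 3)) + t ^ 4 * ∑ xs (λ x → (x · β) ^ 4)
      expand t [] = solve 1 (λ t → K 0 := K 0 :+ t :* (K 4 :* K 0) :+ t :^ 2 :* (K 6 :* K 0) :+ t :^ 3 :* (K 4 :* K 0) :+ t :^ 4 :* K 0) refl t
      expand t (x ∷ xs) = trans (cong₂ _+_ (cong (_^ 4) (trans (·-⊕ x α (t ⊙ β)) (cong (x · α +_) (·-⊙ t x β)))) (expand t xs))
        (solve 8 (λ t a c s0 s1 s2 s3 s4 → (a :+ t :* c) :^ 4 :+ (s0 :+ t :* (K 4 :* s1) :+ t :^ 2 :* (K 6 :* s2) :+ t :^ 3 :* (K 4 :* s3) :+ t :^ 4 :* s4)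
           := (a :^ 4 :+ s0) :+ t :* (K 4 :* (a :^ 3 :* c :+ s1)) :+ t :^ 2 :* (K 6 :* (a :^ 2 :* c :^ 2 :+ s2)) :+ t :^ 3 :* (K 4 :* (a :* c :^ 3 :+ s3)) :+ t :^ 4 :* (c :^ 4 :+ s4)) refl
           t (x · α) (x · β) _ _ _ _ _)

      nrm : ∀ t → (α ⊕ t ⊙ β) · (α ⊕ t ⊙ β) ≡ A + fromℕ 2 * t * B + t * t * C
      nrm t = trans (⊕-· α (t ⊙ β) _) (trans (cong₂ _+_ (trans (·-⊕ α α (t ⊙ β)) (cong (A +_) (·-⊙ t α β))) (trans (⊙-· t β _) (cong (t *_) (trans (·-⊕ β α (t ⊙ β)) (cong₂ _+_ (·-comm β α) (·-⊙ t β β))))))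
        (solve 4 (λ a b c t → a :+ t :* b :+ t :* (b :+ t :* c) := a :+ K 2 :* t :* b :+ t :* t :* c) refl A B C t))

      d0 = fromℕ 96 * S0 - lm * (A * A)
      d1 = fromℕ 384 * S1 - fromℕ 4 * lm * (A * B)
      d2 = fromℕ 576 * S2 - lm * (fromℕ 4 * (B * B) + fromℕ 2 * (A * C))
      d3 = fromℕ 384 * S3 - fromℕ 4 * lm * (B * C)
      d4 = fromℕ 96 * S4 - lm * (C * C)

      vanish : ∀ t → quartic d0 d1 d2 d3 d4 t ≡ 0ℝ
      vanish t = trans (solve 10 (λ t a b c s0 s1 s2 s3 s4 l →
            (K 96 :* s0 :- l :* (a :* a)) :+ t :* (K 384 :* s1 :- K 4 :* l :* (a :* b)) :+ t :^ 2 :* (K 576 :* s2 :- l :* (K 4 :* (b :* b) :+ K 2 :* (a :* c)))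
              :+ t :^ 3 :* (K 384 :* s3 :- K 4 :* l :* (b :* c)) :+ t :^ 4 :* (K 96 :* s4 :- l :* (c :* c))
            := K 96 :* (s0 :+ t :* (K 4 :* s1) :+ t :^ 2 :* (K 6 :* s2) :+ t :^ 3 :* (K 4 :* s3) :+ t :^ 4 :* s4)
                :- l :* ((a :+ K 2 :* t :* b :+ t :* t :* c) :* (a :+ K 2 :* t :* b :+ t :* t :* c))) refl t A B C S0 S1 S2 S3 S4 lm)
          (trans (cong₂ (λ x y → fromℕ 96 * x - lm * (y * y)) (sym (expand t L)) (sym (nrm t)))
            (trans (cong (_- lm * (v · v * (v · v))) (D40 v)) (-‿inverseʳ _)))
        where v = α ⊕ t ⊙ β

      coeffs = quartic-coeffs d0 d1 d2 d3 d4 vanish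

    x-y≡0 : ∀ {x y} → x - y ≡ 0ℝ → x ≡ y
    x-y≡0 {x} {y} p = trans (solve 2 (λ x y → x := (x :- y) :+ y) refl x y) (trans (cong (_+ y) p) (+-identityˡ y))

  D31 : ∀ α β → fromℕ 96 * ∑ L (λ x → (x · α) ^ 3 * (x · β)) ≡ ℓ * (m * m) * ((α · α) * (α · β))
  D31 α β = *-cancelˡ (fromℕ 4) (0<⇒≢ (0<ℕ 3)) (trans (solve 1 (λ s → K 4 :* (K 96 :* s) := K 384 :* s) refl S1) (trans (x-y≡0 (proj₁ coeffs)) (*-assoc _ _ _)))
    where open Polar α β

  D22 : ∀ α β → fromℕ 288 * ∑ L (λ x → (x · α) ^ 2 * (x · β) ^ 2) ≡ ℓ * (m * m) * (fromℕ 2 * ((α · β) * (α · β)) + (α · α) * (β · β))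
  D22 α β = *-cancelˡ (fromℕ 2) (0<⇒≢ (0<ℕ 1)) (trans (solve 1 (λ s → K 2 :* (K 288 :* s) := K 576 :* s) refl S2) (trans (x-y≡0 (proj₁ (proj₂ coeffs)))
      (solve 4 (λ a b c l → l :* (K 4 :* (b :* b) :+ K 2 :* (a :* c)) := K 2 :* (l :* (K 2 :* (b :* b) :+ a :* c))) refl A B C lm)))
    where open Polar α β

  -- Sum `D22` over the unit vectors β: on the left the squares (x · β)² add up to m, and on the
  -- right a factor 2 + 16 = 18 appears, with 288 = 18 · 16.
  D20 : ∀ α → fromℕ 16 * ∑ L (λ x → (x · α) ^ 2) ≡ ℓ * m * (α · α)
  D20 α = *-cancelˡ (fromℕ 18 * m) (0<⇒≢ (*-pos (0<ℕ 17) m>0)) (begin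
      fromℕ 18 * m * (fromℕ 16 * S) ≡⟨ solve 2 (λ m s → K 18 :* m :* (K 16 :* s) := K 288 :* (s :* m)) refl m S ⟩
      fromℕ 288 * (S * m) ≡⟨ cong (fromℕ 288 *_) (sym (∑-*ʳ L m)) ⟩
      fromℕ 288 * ∑ L (λ x → (x · α) ^ 2 * m) ≡⟨ cong (fromℕ 288 *_) (∑-cong∈ L (λ x p → trans (cong ((x · α) ^ 2 *_) (trans (sym (norm-L p)) (trans (dot 16) (∑-cong I (λ i → trans (solve 1 (λ a → a :* a := a :^ 2) refl (x i)) (cong (_^ 2) (sym (·-unit x i)))))))) (sym (∑-*ˡ I _)))) ⟩
      fromℕ 288 * ∑ L (λ x → ∑ I (λ i → (x · α) ^ 2 * (x · unit i) ^ 2)) ≡⟨ cong (fromℕ 288 *_) (∑-swap L I) ⟩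
      fromℕ 288 * ∑ I (λ i → ∑ L (λ x → (x · α) ^ 2 * (x · unit i) ^ 2)) ≡⟨ sym (∑-*ˡ I _) ⟩
      ∑ I (λ i → fromℕ 288 * ∑ L (λ x → (x · α) ^ 2 * (x · unit i) ^ 2)) ≡⟨ ∑-cong I (λ i → trans (D22 α (unit i)) (cong₂ (λ u v → lm * (fromℕ 2 * (u * u) + A * v)) (·-unit α i) (unit-norm i))) ⟩
      ∑ I (λ i → lm * (fromℕ 2 * (α i * α i) + A * 1ℝ)) ≡⟨ ∑-*ˡ I lm ⟩
      lm * ∑ I (λ i → fromℕ 2 * (α i * α i) + A * 1ℝ) ≡⟨ cong (lm *_) (trans (∑-+ I) (cong₂ _+_ (trans (∑-*ˡ I _) (cong (fromℕ 2 *_) (sym (dot 16)))) (∑-Fs-const 16 _))) ⟩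
      lm * (fromℕ 2 * A + fromℕ 16 * (A * 1ℝ)) ≡⟨ solve 3 (λ l m a → l :* (m :* m) :* (K 2 :* a :+ K 16 :* (a :* 𝟙)) := K 18 :* m :* (l :* m :* a)) refl ℓ m A ⟩
      fromℕ 18 * m * (ℓ * m * A) ∎)
    where
      open ≡-Reasoning
      I = Fs 16
      A = α · α
      S = ∑ L (λ x → (x · α) ^ 2)
      lm = ℓ * (m * m)

  D11 : ∀ α β → fromℕ 16 * ∑ L (λ x → (x · α) * (x · β)) ≡ ℓ * m * (α · β)
  D11 α β = *-cancelˡ (fromℕ 4) (0<⇒≢ (0<ℕ 3)) (begin
      fromℕ 4 * (fromℕ 16 * S) ≡⟨ cong (λ t → fromℕ 4 * (fromℕ 16 * t)) refl ⟩
      fromℕ 4 * (fromℕ 16 * S) ≡⟨ solve 1 (λ s → K 4 :* (K 16 :* s) := K 16 :* (K 4 :* s)) refl S ⟩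
      fromℕ 16 * (fromℕ 4 * S) ≡⟨ cong (fromℕ 16 *_) (trans (sym (∑-*ˡ L (fromℕ 4))) (trans (∑-cong L (λ x → trans (solve 2 (λ a c → K 4 :* (a :* c) := (a :+ c) :^ 2 :- (a :- c) :^ 2) refl (x · α) (x · β)) (sym (cong₂ (λ u v → u ^ 2 - v ^ 2) (·-⊕ x α β) (·-⊖ x α β))))) (∑-- L))) ⟩
      fromℕ 16 * (P - M) ≡⟨ solve 2 (λ p q → K 16 :* (p :- q) := K 16 :* p :- K 16 :* q) refl P M ⟩
      fromℕ 16 * P - fromℕ 16 * M ≡⟨ cong₂ _-_ (D20 (α ⊕ β)) (D20 (α ⊖ β)) ⟩
      ℓ * m * ((α ⊕ β) · (α ⊕ β)) - ℓ * m * ((α ⊖ β) · (α ⊖ β)) ≡⟨ cong₂ (λ u v → ℓ * m * u - ℓ * m * v) (trans (⊕-· α β _) (cong₂ _+_ (·-⊕ α α β) (trans (·-⊕ β α β) (cong (_+ C) (·-comm β α))))) (trans (⊖-· α β _) (cong₂ _-_ (·-⊖ α α β) (trans (·-⊖ β α β) (cong (_- C) (·-comm β α))))) ⟩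
      ℓ * m * (A + B + (B + C)) - ℓ * m * (A - B - (B - C)) ≡⟨ solve 4 (λ l a b c → l :* (a :+ b :+ (b :+ c)) :- l :* (a :- b :- (b :- c)) := K 4 :* (l :* b)) refl (ℓ * m) A B C ⟩
      fromℕ 4 * (ℓ * m * B) ∎)
    where
      open ≡-Reasoning
      A = α · α
      B = α · β
      C = β · β
      S = ∑ L (λ x → (x · α) * (x · β))
      P = ∑ L (λ x → (x · (α ⊕ β)) ^ 2)
      M = ∑ L (λ x → (x · (α ⊖ β)) ^ 2)

 -- Shells of constant inner product with α, and the counts A and k.

 module Shells (𝒮 : Setting) where
  open Setting 𝒮
  open Design 𝒮 public

  r : ℝ
  r = m * m*

  N : ℤ → List (Vec 16)
  N z = filter (λ x → (x · α) ≟ fromℤ z) L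

  ∈N : ∀ {z x} → x ∈ N z → x ∈ L × x · α ≡ fromℤ z
  ∈N {z} p = ∈ₚ.∈-filter⁻ (λ x → (x · α) ≟ fromℤ z) p

  N-distinct : ∀ z → Distinct (N z)
  N-distinct z = AllPairsₚ.filter⁺ (λ x → (x · α) ≟ fromℤ z) (proj₂ enum)

  n : ℤ → ℕ
  n z = length (N z)

  private
    n*n<10⇒n≤3 : ∀ k → k ℕ.* k ℕ.< 10 → k ℕ.≤ 3
    n*n<10⇒n≤3 k p with k ℕ.≤? 3
    ... | yes q = q
    ... | no q = ⊥-elim (ℕₚ.<⇒≱ p (ℕₚ.≤-trans (ℕₚ.m≤m+n 10 6) (ℕₚ.*-mono-≤ (ℕₚ.≰⇒> q) (ℕₚ.≰⇒> q))))

    r<10 : r < fromℕ 10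
    r<10 = *-cancel-<ˡ (fromℕ 5) (0<ℕ 4) (<-≤-trans r<46/5 (subst (fromℕ 46 ≤_) (fromℕ-* 5 10) (fromℕ-mono-≤ (ℕₚ.m≤m+n 46 4))))

    abs-sq : ∀ z → fromℕ (ℤ.∣ z ∣ ℕ.* ℤ.∣ z ∣) ≡ fromℤ z * fromℤ z
    abs-sq (ℤ.+ k) = fromℕ-* k k
    abs-sq -[1+ k ] = trans (fromℕ-* (suc k) (suc k)) (solve 1 (λ a → a :* a := (:- a) :* (:- a)) refl (fromℕ (suc k)))

    -- Cauchy-Schwarz gives z² ≤ m m* = r < 10.
    bounded : ∀ {x z} → x ∈ L → x · α ≡ fromℤ z → ℤ.∣ z ∣ ℕ.≤ 3
    bounded {x} {z} p e = n*n<10⇒n≤3 _ (fromℕ-cancel-< (≤-<-trans (subst₂ _≤_ (trans (cong (λ t → t * t) e) (sym (abs-sq z))) (cong₂ _*_ (norm-L p) normα) (cauchy-schwarz x α)) r<10))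

    χ : (Vec 16 → ℝ) → ℤ → Vec 16 → ℝ
    χ F z x = if does ((x · α) ≟ fromℤ z) then F x else 0ℝ

    ∑-filter : ∀ F z (xs : List (Vec 16)) → ∑ (filter (λ x → (x · α) ≟ fromℤ z) xs) F ≡ ∑ xs (χ F z)
    ∑-filter F z [] = refl
    ∑-filter F z (x ∷ xs) with (x · α) ≟ fromℤ z
    ... | yes _ = cong (F x +_) (∑-filter F z xs)
    ... | no _ = trans (∑-filter F z xs) (sym (+-identityˡ _))

    fromℤ-inj : ∀ {x y} → fromℤ x ≡ fromℤ y → x ≡ y
    fromℤ-inj {x} {y} p with x ℤ.≟ y
    ... | yes q = q
    ... | no q with ℤₚ.<-cmp x y
    ...   | tri< a _ _ = ⊥-elim (<-irrefl p (fromℤ-mono-< a))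
    ...   | tri≈ _ a _ = a
    ...   | tri> _ _ a = ⊥-elim (<-irrefl (sym p) (fromℤ-mono-< a))

    χ-eval : ∀ F z z0 x → x · α ≡ fromℤ z0 → χ F z x ≡ (if does (z ℤ.≟ z0) then F x else 0ℝ)
    χ-eval F z z0 x e with (x · α) ≟ fromℤ z | z ℤ.≟ z0
    ... | yes _ | yes _ = refl
    ... | no _ | no _ = refl
    ... | yes p | no q = ⊥-elim (q (fromℤ-inj (trans (sym p) e)))
    ... | no p | yes refl = ⊥-elim (p e)

    p1 p2 p3 m1 m2 m3 z0' : ℤ
    z0' = ℤ.+ 0
    p1 = ℤ.+ 1
    p2 = ℤ.+ 2
    p3 = ℤ.+ 3
    m1 = -[1+ 0 ]
    m2 = -[1+ 1 ]
    m3 = -[1+ 2 ]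

    total : (Vec 16 → ℝ) → Vec 16 → ℝ
    total F x = χ F z0' x + (χ F p1 x + χ F m1 x) + (χ F p2 x + χ F m2 x) + (χ F p3 x + χ F m3 x)

    δ : ℝ → ℤ → ℤ → ℝ
    δ f z z0 = if does (z ℤ.≟ z0) then f else 0ℝ

    total-δ : ∀ f z0 → ℤ.∣ z0 ∣ ℕ.≤ 3 → f ≡ δ f z0' z0 + (δ f p1 z0 + δ f m1 z0) + (δ f p2 z0 + δ f m2 z0) + (δ f p3 z0 + δ f m3 z0)
    total-δ f (ℤ.+ 0) _ = solve 1 (λ f → f := f :+ (K 0 :+ K 0) :+ (K 0 :+ K 0) :+ (K 0 :+ K 0)) refl f
    total-δ f (ℤ.+ 1) _ = solve 1 (λ f → f := K 0 :+ (f :+ K 0) :+ (K 0 :+ K 0) :+ (K 0 :+ K 0)) refl f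
    total-δ f (ℤ.+ 2) _ = solve 1 (λ f → f := K 0 :+ (K 0 :+ K 0) :+ (f :+ K 0) :+ (K 0 :+ K 0)) refl f
    total-δ f (ℤ.+ 3) _ = solve 1 (λ f → f := K 0 :+ (K 0 :+ K 0) :+ (K 0 :+ K 0) :+ (f :+ K 0)) refl f
    total-δ f (ℤ.+ (suc (suc (suc (suc k))))) (ℕ.s≤s (ℕ.s≤s (ℕ.s≤s ())))
    total-δ f -[1+ 0 ] _ = solve 1 (λ f → f := K 0 :+ (K 0 :+ f) :+ (K 0 :+ K 0) :+ (K 0 :+ K 0)) refl f
    total-δ f -[1+ 1 ] _ = solve 1 (λ f → f := K 0 :+ (K 0 :+ K 0) :+ (K 0 :+ f) :+ (K 0 :+ K 0)) refl f
    total-δ f -[1+ 2 ] _ = solve 1 (λ f → f := K 0 :+ (K 0 :+ K 0) :+ (K 0 :+ K 0) :+ (K 0 :+ f)) refl f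
    total-δ f -[1+ suc (suc (suc k)) ] (ℕ.s≤s (ℕ.s≤s (ℕ.s≤s ())))

    total-x : ∀ F {x} → x ∈ L → F x ≡ total F x
    total-x F {x} p with dualα x (proj₁ (∈L p))
    ... | z , e = trans (total-δ (F x) z (bounded {x} {z} p e')) (sym (cong₂ _+_ (cong₂ _+_ (cong₂ _+_ (ev z0') (cong₂ _+_ (ev p1) (ev m1))) (cong₂ _+_ (ev p2) (ev m2))) (cong₂ _+_ (ev p3) (ev m3))))
      where
        e' : x · α ≡ fromℤ z
        e' = trans (·-def x α) e
        ev : ∀ y → χ F y x ≡ δ (F x) y z
        ev y = χ-eval F y z x e'

    N-neg : ∀ z → All (λ x → Any (x ≈v_) (N (ℤ.- z))) (map (𝟎 ⊖_) (N z))
    N-neg z = Allₚ.map⁺ (All.tabulate go)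
      where
        go : ∀ {x} → x ∈ N z → Any ((𝟎 ⊖ x) ≈v_) (N (ℤ.- z))
        go {x} p with ∈N {z} p
        ... | pL , e with ∈L pL
        ...   | q , nz , nrm = lift (any-L (InLattice-neg {b = b} q) (λ f → nz (λ j → trans (solve 1 (λ a → a := K 0 :- (K 0 :- a)) refl (x j)) (trans (cong (λ t → 0ℝ - t) (f j)) (-‿inverseʳ 0ℝ)))) (trans (neg-norm x) nrm))
          where
            negα : (𝟎 ⊖ x) · α ≡ fromℤ (ℤ.- z)
            negα = trans (⊖-· 𝟎 x α) (trans (cong₂ _-_ (𝟎-· α) e) (trans (+-identityˡ _) (sym (fromℤ-neg z))))
            lift : Any ((𝟎 ⊖ x) ≈v_) L → Any ((𝟎 ⊖ x) ≈v_) (N (ℤ.- z))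
            lift a with find a
            ... | y , yL , eq = lose (∈ₚ.∈-filter⁺ (λ x → (x · α) ≟ fromℤ (ℤ.- z)) yL (trans (·-cong (≈v-sym eq) (λ i → refl)) negα)) eq

    neg-distinct : ∀ {xs : List (Vec 16)} → Distinct xs → Distinct (map (𝟎 ⊖_) xs)
    neg-distinct d = AllPairsₚ.map⁺ (AllPairs.map (λ {u} {w} p q → p (λ i → trans (solve 1 (λ a → a := K 0 :- (K 0 :- a)) refl (u i)) (trans (cong (λ t → 0ℝ - t) (q i)) (solve 1 (λ a → K 0 :- (K 0 :- a) := a) refl (w i))))) d)

    n-neg≤ : ∀ z → n z ℕ.≤ n (ℤ.- z)
    n-neg≤ z = subst (ℕ._≤ n (ℤ.- z)) (Listₚ.length-map _ (N z)) (pigeonhole _ _ (neg-distinct (N-distinct z)) (N-neg z))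

    n-neg : ∀ z → n z ≡ n (ℤ.- z)
    n-neg z = ℕₚ.≤-antisym (n-neg≤ z) (subst (λ t → n (ℤ.- z) ℕ.≤ n t) (ℤₚ.neg-involutive z) (n-neg≤ (ℤ.- z)))

  ∑N-neg : ∀ z F → Respects F → ∑ (N (ℤ.- z)) F ≡ ∑ (N z) (λ x → F (𝟎 ⊖ x))
  ∑N-neg z F ext = trans (sym (same-sum _ _ (neg-distinct (N-distinct z)) (N-neg z) (trans (Listₚ.length-map _ (N z)) (n-neg z)) F ext)) (∑-map _ (N z))

  -- Inner products lie between -3 and 3 by `bounded`, and negation maps each shell onto the
  -- opposite one, so opposite shells are summed together.
  ∑-shells : ∀ F → Respects F → ∑ L F ≡ ∑ (N (ℤ.+ 0)) F
     + ∑ (N (ℤ.+ 1)) (λ x → F x + F (𝟎 ⊖ x)) + ∑ (N (ℤ.+ 2)) (λ x → F x + F (𝟎 ⊖ x)) + ∑ (N (ℤ.+ 3)) (λ x → F x + F (𝟎 ⊖ x))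
  ∑-shells F ext = trans (∑-cong∈ L (λ x → total-x F)) (trans (∑-+ L) (cong₂ _+_ (trans (∑-+ L) (cong₂ _+_ (trans (∑-+ L) (cong₂ _+_ (sym (∑-filter F z0' L)) (pair p1))) (pair p2))) (pair p3)))
    where
      pair : ∀ z → ∑ L (λ x → χ F z x + χ F (ℤ.- z) x) ≡ ∑ (N z) (λ x → F x + F (𝟎 ⊖ x))
      pair z = trans (∑-+ L) (trans (cong₂ _+_ (sym (∑-filter F z L)) (trans (sym (∑-filter F (ℤ.- z) L)) (∑N-neg z F ext))) (sym (∑-+ (N z))))

  -- A and A + 12k are the sums of (x · α)² and (x · α)⁴ over one half of Min(Λ), because 1, 16, 81
  -- equal 1, 4, 9 plus 12 times 0, 1, 6.
  n₁ n₂ n₃ A k : ℕ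
  n₁ = n (ℤ.+ 1)
  n₂ = n (ℤ.+ 2)
  n₃ = n (ℤ.+ 3)
  A = n₁ ℕ.+ 4 ℕ.* n₂ ℕ.+ 9 ℕ.* n₃
  k = n₂ ℕ.+ 6 ℕ.* n₃

  neg-· : ∀ {n} (x w : Vec n) → (𝟎 ⊖ x) · w ≡ - (x · w)
  neg-· x w = trans (⊖-· 𝟎 x w) (trans (cong (_- x · w) (𝟎-· w)) (+-identityˡ _))

  private
    const-on : ∀ z (f : ℝ → ℝ) → ∑ (N z) (λ x → f (x · α) + f ((𝟎 ⊖ x) · α)) ≡ fromℕ (n z) * (f (fromℤ z) + f (- fromℤ z))
    const-on z f = trans (∑-cong∈ (N z) (λ x p → cong₂ _+_ (cong f (proj₂ (∈N {z} p))) (cong f (trans (neg-· x α) (cong -_ (proj₂ (∈N {z} p))))))) (∑-const (N z) _)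

    const-0 : ∀ (f : ℝ → ℝ) → f 0ℝ ≡ 0ℝ → ∑ (N (ℤ.+ 0)) (λ x → f (x · α)) ≡ 0ℝ
    const-0 f e = trans (∑-cong∈ (N (ℤ.+ 0)) (λ x p → trans (cong f (proj₂ (∈N {ℤ.+ 0} p))) e)) (∑-zero (N (ℤ.+ 0)))

    moment : ∀ (f : ℝ → ℝ) → f 0ℝ ≡ 0ℝ → ∑ L (λ x → f (x · α)) ≡ fromℕ n₁ * (f (fromℕ 1) + f (- fromℕ 1)) + fromℕ n₂ * (f (fromℕ 2) + f (- fromℕ 2)) + fromℕ n₃ * (f (fromℕ 3) + f (- fromℕ 3))
    moment f e = trans (∑-shells (λ x → f (x · α)) (λ p → cong f (·-cong p (λ i → refl))))
      (trans (cong₂ _+_ (cong₂ _+_ (cong₂ _+_ (const-0 f e) (const-on (ℤ.+ 1) f)) (const-on (ℤ.+ 2) f)) (const-on (ℤ.+ 3) f))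
        (solve 3 (λ a b c → K 0 :+ a :+ b :+ c := a :+ b :+ c) refl _ _ _))

    fromℕ-A : fromℕ A ≡ fromℕ n₁ + fromℕ 4 * fromℕ n₂ + fromℕ 9 * fromℕ n₃
    fromℕ-A = trans (fromℕ-+ (n₁ ℕ.+ 4 ℕ.* n₂) (9 ℕ.* n₃)) (cong₂ _+_ (trans (fromℕ-+ n₁ (4 ℕ.* n₂)) (cong (fromℕ n₁ +_) (fromℕ-* 4 n₂))) (fromℕ-* 9 n₃))

  fromℕ-k : fromℕ k ≡ fromℕ n₂ + fromℕ 6 * fromℕ n₃
  fromℕ-k = trans (fromℕ-+ n₂ (6 ℕ.* n₃)) (cong (fromℕ n₂ +_) (fromℕ-* 6 n₃))

  module _ (s : ℕ) (2s : length L ≡ 2 ℕ.* s) where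
    private
      ℓ≡ : ℓ ≡ fromℕ 2 * fromℕ s
      ℓ≡ = trans (cong fromℕ 2s) (fromℕ-* 2 s)

    rs≡16A : r * fromℕ s ≡ fromℕ 16 * fromℕ A
    rs≡16A = *-cancelˡ (fromℕ 2) (0<⇒≢ (0<ℕ 1)) (begin
        fromℕ 2 * (m * m* * fromℕ s) ≡⟨ solve 3 (λ m d s → K 2 :* (m :* d :* s) := K 2 :* s :* m :* d) refl m m* (fromℕ s) ⟩
        fromℕ 2 * fromℕ s * m * m* ≡⟨ cong₂ (λ u v → u * m * v) (sym ℓ≡) (sym normα) ⟩
        ℓ * m * (α · α) ≡⟨ sym (D20 α) ⟩
        fromℕ 16 * ∑ L (λ x → (x · α) ^ 2) ≡⟨ cong (fromℕ 16 *_) (moment (_^ 2) (zeroˡ _)) ⟩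
        _ ≡⟨ solve 3 (λ a b c → K 16 :* (a :* (K 1 :^ 2 :+ (:- K 1) :^ 2) :+ b :* (K 2 :^ 2 :+ (:- K 2) :^ 2) :+ c :* (K 3 :^ 2 :+ (:- K 3) :^ 2)) := K 2 :* (K 16 :* (a :+ K 4 :* b :+ K 9 :* c))) refl (fromℕ n₁) (fromℕ n₂) (fromℕ n₃) ⟩
        fromℕ 2 * (fromℕ 16 * (fromℕ n₁ + fromℕ 4 * fromℕ n₂ + fromℕ 9 * fromℕ n₃)) ≡⟨ cong (λ t → fromℕ 2 * (fromℕ 16 * t)) (sym fromℕ-A) ⟩
        fromℕ 2 * (fromℕ 16 * fromℕ A) ∎)
      where open ≡-Reasoning

    rrs≡96[A+12k] : r * (r * fromℕ s) ≡ fromℕ 96 * (fromℕ A + fromℕ 12 * fromℕ k)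
    rrs≡96[A+12k] = *-cancelˡ (fromℕ 2) (0<⇒≢ (0<ℕ 1)) (begin
        fromℕ 2 * (m * m* * (m * m* * fromℕ s)) ≡⟨ solve 3 (λ m d s → K 2 :* (m :* d :* (m :* d :* s)) := K 2 :* s :* (m :* m) :* (d :* d)) refl m m* (fromℕ s) ⟩
        fromℕ 2 * fromℕ s * (m * m) * (m* * m*) ≡⟨ cong₂ (λ u v → u * (m * m) * (v * v)) (sym ℓ≡) (sym normα) ⟩
        ℓ * (m * m) * ((α · α) * (α · α)) ≡⟨ sym (D40 α) ⟩
        fromℕ 96 * ∑ L (λ x → (x · α) ^ 4) ≡⟨ cong (fromℕ 96 *_) (moment (_^ 4) (zeroˡ _)) ⟩
        _ ≡⟨ solve 3 (λ a b c → K 96 :* (a :* (K 1 :^ 4 :+ (:- K 1) :^ 4) :+ b :* (K 2 :^ 4 :+ (:- K 2) :^ 4) :+ c :* (K 3 :^ 4 :+ (:- K 3) :^ 4))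
              := K 2 :* (K 96 :* (a :+ K 4 :* b :+ K 9 :* c :+ K 12 :* (b :+ K 6 :* c)))) refl (fromℕ n₁) (fromℕ n₂) (fromℕ n₃) ⟩
        fromℕ 2 * (fromℕ 96 * (fromℕ n₁ + fromℕ 4 * fromℕ n₂ + fromℕ 9 * fromℕ n₃ + fromℕ 12 * (fromℕ n₂ + fromℕ 6 * fromℕ n₃))) ≡⟨ cong₂ (λ t u → fromℕ 2 * (fromℕ 96 * (t + fromℕ 12 * u))) (sym fromℕ-A) (sym fromℕ-k) ⟩
        fromℕ 2 * (fromℕ 96 * (fromℕ A + fromℕ 12 * fromℕ k)) ∎)
      where open ≡-Reasoning

 -- Linear dependence by elimination.

 module Dependence where

  private
    find-pivot : {A : Set} (xs : List A) (f : A → ℝ) →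
      (∃ λ p → ∃ λ ys → ¬ (f p ≡ 0ℝ) × (p ∷ ys) ↭ xs) ⊎ (∀ x → x ∈ xs → f x ≡ 0ℝ)
    find-pivot [] f = inj₂ (λ x ())
    find-pivot (x ∷ xs) f with f x ≟ 0ℝ
    ... | no q = inj₁ (x , xs , q , ↭-refl)
    ... | yes q with find-pivot xs f
    ...   | inj₁ (p , ys , r , π) = inj₁ (p , x ∷ ys , r , ↭-trans (_↭_.swap p x ↭-refl) (prep x π))
    ...   | inj₂ all = inj₂ (λ { y (here refl) → q ; y (there r) → all y r })

  AllPairs-↭ : {A : Set} {Q : A → A → Set} → (∀ {x y} → Q x y → Q y x) → ∀ {xs ys} → xs ↭ ys → AllPairs Q xs → AllPairs Q ys
  AllPairs-↭ s _↭_.refl as = as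
  AllPairs-↭ s (prep x π) (a ∷ as) = ↭ₚ.All-resp-↭ π a ∷ AllPairs-↭ s π as
  AllPairs-↭ s (_↭_.swap x y π) ((q ∷ ax) ∷ ay ∷ as) = (s q ∷ ↭ₚ.All-resp-↭ π ay) ∷ ↭ₚ.All-resp-↭ π ax ∷ AllPairs-↭ s π as
  AllPairs-↭ s (_↭_.trans π π') as = AllPairs-↭ s π' (AllPairs-↭ s π as)

  -- Elimination on coordinate zero: a multiple of the pivot p is subtracted from the others, the
  -- smaller problem gives their coefficients, and `tp` is the coefficient of p that restores
  -- coordinate zero. The result is a permutation of the input because pivots move to the front.
  dependent : {A : Set} (d : ℕ) (xs : List A) (v : A → Fin d → ℝ) → d ℕ.< length xs →
    ∃ λ (zs : List (ℝ × A)) → map proj₂ zs ↭ xs × (∃ λ z → z ∈ zs × ¬ (proj₁ z ≡ 0ℝ)) × (∀ j → ∑ zs (λ z → proj₁ z * v (proj₂ z) j) ≡ 0ℝ)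
  dependent zero (x ∷ xs) v _ = map (1ℝ ,_) (x ∷ xs) , subst (_↭ (x ∷ xs)) (trans (sym (Listₚ.map-id (x ∷ xs))) (Listₚ.map-∘ (x ∷ xs))) ↭-refl , ((1ℝ , x) , here refl , λ e → 0≢1 (sym e)) , λ ()
  dependent (suc d) xs v lt with find-pivot xs (λ x → v x zero)
  ... | inj₂ all with dependent d xs (λ x j → v x (suc j)) (ℕₚ.<-trans (ℕₚ.n<1+n d) lt)
  ...   | zs , π , nz , rel = zs , π , nz , λ { zero → trans (∑-cong∈ zs (λ z p → trans (cong (proj₁ z *_) (all (proj₂ z) (↭ₚ.∈-resp-↭ π (∈ₚ.∈-map⁺ proj₂ p)))) (zeroʳ _))) (∑-zero zs) ; (suc j) → rel j }
  dependent (suc d) xs v lt | inj₁ (p , ys , c≢0 , π) with dependent d ys (λ x j → v x (suc j) - v x zero * c⁻¹ * v p (suc j)) (ℕₚ.≤-pred (subst (suc d ℕ.<_) (sym (↭ₚ.↭-length π)) lt))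
    where c⁻¹ = (v p zero) ⁻¹
  ... | zs , π' , (z , z∈ , z≢0) , rel = (tp , p) ∷ zs , ↭-trans (prep p π') π , (z , there z∈ , z≢0) , λ { zero → eq0 ; (suc j) → eqs j }
    where
      c = v p zero
      S = ∑ zs (λ z → proj₁ z * v (proj₂ z) zero)
      tp = - (S * c ⁻¹)
      eq0 : tp * c + S ≡ 0ℝ
      eq0 = trans (solve 3 (λ s i c → (:- (s :* i)) :* c :+ s := (:- s) :* (c :* i) :+ s) refl S (c ⁻¹) c) (trans (cong (λ t → - S * t + S) (*-inv c≢0)) (solve 1 (λ s → (:- s) :* 𝟙 :+ s := K 0) refl S))
      eqs : ∀ j → tp * v p (suc j) + ∑ zs (λ z → proj₁ z * v (proj₂ z) (suc j)) ≡ 0ℝ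
      eqs j = trans (trans (solve 4 (λ s i w t → (:- (s :* i)) :* w :+ t := t :- s :* (i :* w)) refl S (c ⁻¹) (v p (suc j)) _)
                (trans (cong (λ t → ∑ zs (λ z → proj₁ z * v (proj₂ z) (suc j)) - t) (sym (∑-*ʳ zs _)))
                  (trans (sym (∑-- zs)) (∑-cong zs (λ z → solve 5 (λ t a b i w → t :* a :- t :* b :* (i :* w) := t :* (a :- b :* i :* w)) refl (proj₁ z) _ _ (c ⁻¹) (v p (suc j)))))))
                (rel j)

 -- Double sums with nonpositive off-diagonal terms.

 module Codes where

  pairs∈ : {A : Set} {P Q : A → A → Set} (xs : List A) → AllPairs P xs → (∀ x y → x ∈ xs → y ∈ xs → P x y → Q x y) → AllPairs Q xs
  pairs∈ [] [] f = []
  pairs∈ {A} {P} {Q} (x ∷ xs) (p ∷ ps) f = All.tabulate (λ {y} q → f x y (here refl) (there q) (All.lookup p q)) ∷ pairs∈ xs ps (λ y z q q' → f y z (there q) (there q'))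

  -- The upper half of every linear programming bound: if the test function is nonpositive on
  -- distinct pairs, only the diagonal counts. Positive semidefiniteness supplies the matching lower
  -- half.
  offdiag : {A : Set} (xs : List A) (f : A → A → ℝ) → AllPairs (λ x y → f x y ≤ 0ℝ × f y x ≤ 0ℝ) xs → ∑ xs (λ x → ∑ xs (f x)) ≤ ∑ xs (λ x → f x x)
  offdiag [] f [] = ≤-refl
  offdiag (x ∷ xs) f (p ∷ ps) = ≤-trans (≡⇒≤ (trans (cong ((f x x + ∑ xs (f x)) +_) (∑-+ xs)) (solve 4 (λ a b c d → (a :+ b) :+ (c :+ d) := (a :+ d) :+ (b :+ c)) refl (f x x) (∑ xs (f x)) (∑ xs (λ y → f y x)) (∑ xs (λ y → ∑ xs (f y))))))
     (≤-trans (+-mono-≤ (+-mono-≤ (≤-refl {f x x}) (offdiag xs f ps)) (+-mono-≤ (neg (λ y q → proj₁ (All.lookup p q))) (neg (λ y q → proj₂ (All.lookup p q))))) (≡⇒≤ (solve 1 (λ a → a :+ (K 0 :+ K 0) := a) refl _)))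
    where
      neg : ∀ {g} → (∀ y → y ∈ xs → g y ≤ 0ℝ) → ∑ xs g ≤ 0ℝ
      neg {g} h = subst (∑ xs g ≤_) (∑-zero xs) (∑-mono∈ xs h)

 -- Orthogonal projection onto the complement of α.

 module Projection (α : Vec 16) (m* : ℝ) (m*>0 : 0ℝ < m*) (normα : norm α ≡ m*) where

  ρ : ℝ
  ρ = m* ⁻¹

  ρ>0 : 0ℝ < ρ
  ρ>0 = inv-pos m*>0

  m*ρ : m* * ρ ≡ 1ℝ
  m*ρ = *-inv⁺ m*>0

  P : Vec 16 → Vec 16
  P x = x ⊖ ((x · α) * ρ) ⊙ α

  P-· : ∀ x y → P x · y ≡ x · y - (x · α) * (y · α) * ρ
  P-· x y = trans (⊖-· x _ y) (cong (x · y +_) (cong -_ (trans (⊙-· _ α y) (trans (cong ((x · α) * ρ *_) (·-comm α y)) (solve 3 (λ a b c → a :* c :* b := a :* b :* c) refl (x · α) (y · α) ρ)))))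

  P-⊥ : ∀ x → P x · α ≡ 0ℝ
  P-⊥ x = trans (P-· x α) (trans (cong (λ t → x · α - (x · α) * t * ρ) normα) (trans (cong (x · α +_) (cong -_ (trans (*-assoc _ _ _) (trans (cong ((x · α) *_) m*ρ) (*-identityʳ _))))) (-‿inverseʳ _)))

  P-P : ∀ x y → P x · P y ≡ P x · y
  P-P x y = trans (·-⊖ (P x) y _) (trans (cong (P x · y +_) (cong -_ (trans (·-⊙ _ (P x) α) (trans (cong ((y · α) * ρ *_) (P-⊥ x)) (zeroʳ _))))) (trans (cong (P x · y +_) -0#≈0#) (+-identityʳ _)))

  P·P : ∀ x y → P x · P y ≡ x · y - (x · α) * (y · α) * ρ
  P·P x y = trans (P-P x y) (P-· x y)

  -- The complement of α has dimension 15, and a code of constant norm has at least the second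
  -- moment of a tight frame. This is Cauchy-Schwarz for the kernel (u · v)² between the code and
  -- the projected unit vectors, whose own second moment is the trace 15 of the projection.
  frame : ∀ {A : Set} (xs : List A) (v : A → Vec 16) (c : ℝ) → (∀ x → x ∈ xs → norm (P (v x)) ≡ c) →
    (fromℕ (length xs) * c) * (fromℕ (length xs) * c) ≤ fromℕ 15 * ∑ xs (λ x → ∑ xs (λ y → (P (v x) · P (v y)) ^ 2))
  frame xs v c h = 0≤⇒≤ (0≤-cancelˡ (fromℕ 15) (0<ℕ 14) (subst (0ℝ ≤_) eq (0≤* {fromℕ 15 * fromℕ 15} (0≤* (0≤ℕ 15) (0≤ℕ 15)) two)))
    where
      I = Fs 16
      nc = fromℕ (length xs) * c
      -- The minimiser XY / YY of the quadratic in `psd-two`.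
      l = nc * (fromℕ 15) ⁻¹
      K2 = ∑ xs (λ x → ∑ xs (λ y → (1ℝ * 1ℝ) * (P (v x) · P (v y)) ^ 2))
      K2' = ∑ xs (λ x → ∑ xs (λ y → (P (v x) · P (v y)) ^ 2))
      XY = ∑ xs (λ x → ∑ I (λ i → (1ℝ * 1ℝ) * (P (v x) · P (unit i)) ^ 2))
      YY = ∑ I (λ i → ∑ I (λ j → (1ℝ * 1ℝ) * (P (unit i) · P (unit j)) ^ 2))
      two : 0ℝ ≤ K2 - (l + l) * XY + l * l * YY
      two = psd-two (λ u w → (u · w) ^ 2) (psd-pow 2) (λ u w → cong (_^ 2) (·-comm u w)) xs (λ _ → 1ℝ) (P ∘ v) I (λ _ → 1ℝ) (P ∘ unit) l
      inner : ∀ u → ∑ I (λ i → (1ℝ * 1ℝ) * (P u · P (unit i)) ^ 2) ≡ norm (P u)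
      inner u = trans (∑-cong I (λ i → trans (cong (λ t → (1ℝ * 1ℝ) * t ^ 2) (trans (P-P u (unit i)) (·-unit (P u) i))) (solve 1 (λ a → 𝟙 :* 𝟙 :* a :^ 2 := a :* a) refl (P u i)))) (sym (dot 16))
      K2≡ : K2 ≡ K2'
      K2≡ = ∑-cong xs (λ x → ∑-cong xs (λ y → solve 1 (λ a → 𝟙 :* 𝟙 :* a := a) refl ((P (v x) · P (v y)) ^ 2)))
      XY≡ : XY ≡ nc
      XY≡ = trans (∑-cong∈ xs (λ x p → trans (inner (v x)) (h x p))) (∑-const xs c)
      YY≡ : YY ≡ fromℕ 15
      YY≡ = trans (∑-cong I (λ i → trans (inner (unit i)) (trans (P·P (unit i) (unit i)) (cong₂ (λ s t → s - t * t * ρ) (unit-norm i) (unit-· i α)))))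
        (trans (∑-- I) (trans (cong₂ _-_ (∑-Fs-const 16 1ℝ) (trans (∑-*ʳ I ρ) (trans (cong (_* ρ) (trans (sym (dot 16)) normα)) m*ρ))) (solve 0 (K 16 :* 𝟙 :- 𝟙 := K 15) refl)))
      15≢0 = 0<⇒≢ (0<ℕ 14)
      eq : (fromℕ 15 * fromℕ 15) * (K2 - (l + l) * XY + l * l * YY) ≡ fromℕ 15 * (fromℕ 15 * K2' - nc * nc)
      eq = trans (cong₂ (λ s t → (fromℕ 15 * fromℕ 15) * (s - (l + l) * XY + l * l * t)) K2≡ YY≡)
        (trans (cong (λ t → (fromℕ 15 * fromℕ 15) * (K2' - (l + l) * t + l * l * fromℕ 15)) XY≡)
         (trans (solve 3 (λ k n i → K 15 :* K 15 :* (k :- (n :* i :+ n :* i) :* n :+ n :* i :* (n :* i) :* K 15) := K 15 :* (K 15 :* k :- K 2 :* (n :* n :* (K 15 :* i)) :+ n :* n :* ((K 15 :* i) :* (K 15 :* i)))) refl K2' nc ((fromℕ 15) ⁻¹))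
          (trans (cong (λ t → fromℕ 15 * (fromℕ 15 * K2' - fromℕ 2 * (nc * nc * t) + nc * nc * (t * t))) (*-inv 15≢0))
            (solve 2 (λ k n → K 15 :* (K 15 :* k :- K 2 :* (n :* n :* 𝟙) :+ n :* n :* (𝟙 :* 𝟙)) := K 15 :* (K 15 :* k :- n :* n)) refl K2' nc))))

 -- Spherical code bounds for the shells 2 and 3.

 module Bounds (𝒮 : Setting) where
  open Setting 𝒮
  open Shells 𝒮 public
  open Projection α m* m*>0 normα public
  open Codes public
  open Dependence

  -- x - y is a nonzero lattice vector of norm 2m - 2 x · y, which is at least m.
  half : ∀ x y → x ∈ L → y ∈ L → ¬ (x ≈v y) → fromℕ 2 * (x · y) ≤ m
  half x y p q ne with ∈L p | ∈L q
  ... | ix , _ , nx | iy , _ , ny = 0≤⇒≤ (subst (0ℝ ≤_) eq (≤⇒0≤ (minb w (InLattice-+ {b = b} ix (InLattice-neg {b = b} iy)) nz)))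
    where
      w = x ⊕ (𝟎 ⊖ y)
      nz : NonZero w
      nz h = ne (λ j → trans (solve 2 (λ a b → a := (a :+ (K 0 :- b)) :+ b) refl (x j) (y j)) (trans (cong (_+ y j) (h j)) (+-identityˡ _)))
      eq : normᵈ w - m ≡ m - fromℕ 2 * (x · y)
      eq = trans (cong (_- m) (trans (sym (·-def w w)) (trans (⊕-· x (𝟎 ⊖ y) w) (cong₂ _+_ (trans (·-⊕ x x _) (cong₂ _+_ nx (trans (·-comm x _) (trans (neg-· y x) (cong -_ (·-comm y x)))))) (trans (neg-· y w) (cong -_ (trans (·-⊕ y x _) (cong₂ _+_ (·-comm y x) (trans (·-comm y _) (trans (neg-· y y) (cong -_ ny)))))))))))
        (solve 2 (λ m c → ((m :+ (:- c)) :+ (:- (c :+ (:- m)))) :- m := m :- K 2 :* c) refl m (x · y))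

  -- The hypothesis on α makes x + y nonzero, so its norm 2m + 2 x · y is at least m.
  half⁻ : ∀ x y → x ∈ L → y ∈ L → ¬ ((x · α) + (y · α) ≡ 0ℝ) → - m ≤ fromℕ 2 * (x · y)
  half⁻ x y p q ne with ∈L p | ∈L q
  ... | ix , _ , nx | iy , _ , ny = 0≤⇒≤ (subst (0ℝ ≤_) eq (≤⇒0≤ (minb w (InLattice-+ {b = b} ix iy) nz)))
    where
      w = x ⊕ y
      nz : NonZero w
      nz h = ne (trans (sym (⊕-· x y α)) (trans (·-cong h (λ i → refl)) (𝟎-· α)))
      eq : normᵈ w - m ≡ fromℕ 2 * (x · y) - (- m)
      eq = trans (cong (_- m) (trans (sym (·-def w w)) (trans (⊕-· x y w) (cong₂ _+_ (trans (·-⊕ x x y) (cong (_+ x · y) nx)) (trans (·-⊕ y x y) (cong₂ _+_ (·-comm y x) ny))))))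
        (solve 2 (λ m c → ((m :+ c) :+ (c :+ m)) :- m := K 2 :* c :- (:- m)) refl m (x · y))

  r≥0 : 0ℝ ≤ r
  r≥0 = <⇒≤ (*-pos m>0 m*>0)

  mm*ρ : ∀ a c → (a * m - c * ρ) * m* ≡ a * r - c
  mm*ρ a c = trans (solve 5 (λ a m c i d → (a :* m :- c :* i) :* d := a :* (m :* d) :- c :* (d :* i)) refl a m c ρ m*) (trans (cong (λ t → a * r - c * t) m*ρ) (cong (λ t → a * r - t) (*-identityʳ c)))

  -- The projected shell: ν is the common norm of its vectors, κ their inner product, and `KK e` the
  -- moment of degree e.
  module Shell (z : ℕ) where
    xs = N (ℤ.+ z)
    N# = fromℕ (n (ℤ.+ z))
    zz = fromℕ z * fromℕ z
    ν = m - zz * ρ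

    κ : Vec 16 → Vec 16 → ℝ
    κ x y = P x · P y

    κ≡ : ∀ x y → x ∈ xs → y ∈ xs → κ x y ≡ x · y - zz * ρ
    κ≡ x y p q = trans (P·P x y) (cong₂ (λ s t → x · y - s * t * ρ) (proj₂ (∈N {ℤ.+ z} p)) (proj₂ (∈N {ℤ.+ z} q)))

    κν : ∀ x → x ∈ xs → κ x x ≡ ν
    κν x p = trans (κ≡ x x p p) (cong (_- zz * ρ) (norm-L (proj₁ (∈N {ℤ.+ z} p))))

    κ≤ : ∀ x y → x ∈ xs → y ∈ xs → ¬ (x ≈v y) → fromℕ 2 * κ x y ≤ m - fromℕ 2 * zz * ρ
    κ≤ x y p q ne = ≤-trans (≡⇒≤ (trans (cong (fromℕ 2 *_) (κ≡ x y p q)) (solve 3 (λ a b c → K 2 :* (a :- b :* c) := K 2 :* a :- K 2 :* b :* c) refl (x · y) zz ρ)))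
                      (+-mono-≤ʳ _ (half x y (proj₁ (∈N {ℤ.+ z} p)) (proj₁ (∈N {ℤ.+ z} q)) ne))

    KK : ℕ → ℝ
    KK e = ∑ xs (λ x → ∑ xs (λ y → κ x y ^ e))

    0≤KK : ∀ e → 0ℝ ≤ KK e
    0≤KK e = subst (0ℝ ≤_) (∑-cong xs (λ x → ∑-cong xs (λ y → solve 1 (λ a → 𝟙 :* 𝟙 :* a := a) refl (κ x y ^ e)))) (psd-pow e xs (λ _ → 1ℝ) P)

    KK0 : KK 0 ≡ N# * N#
    KK0 = trans (∑-cong xs (λ x → trans (∑-const xs 1ℝ) (*-identityʳ _))) (∑-const xs N#)

    poly : ∀ a₃ a₂ a₁ a₀ → ∑ xs (λ x → ∑ xs (λ y → a₃ * κ x y ^ 3 + a₂ * κ x y ^ 2 + a₁ * κ x y ^ 1 + a₀ * κ x y ^ 0))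
             ≡ a₃ * KK 3 + a₂ * KK 2 + a₁ * KK 1 + a₀ * KK 0
    poly a₃ a₂ a₁ a₀ = trans (∑-cong xs (λ x → trans (∑-+ xs) (cong₂ _+_ (trans (∑-+ xs) (cong₂ _+_ (trans (∑-+ xs) (cong₂ _+_ (∑-*ˡ xs a₃) (∑-*ˡ xs a₂))) (∑-*ˡ xs a₁))) (∑-*ˡ xs a₀))))
      (trans (∑-+ xs) (cong₂ _+_ (trans (∑-+ xs) (cong₂ _+_ (trans (∑-+ xs) (cong₂ _+_ (∑-*ˡ xs a₃) (∑-*ˡ xs a₂))) (∑-*ˡ xs a₁))) (∑-*ˡ xs a₀)))

    diagonal : ∀ (F : ℝ → ℝ) → (∀ x y → x ∈ xs → y ∈ xs → ¬ (x ≈v y) → F (κ x y) ≤ 0ℝ) → ∑ xs (λ x → ∑ xs (λ y → F (κ x y))) ≤ N# * F ν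
    diagonal F h = ≤-trans (offdiag xs (λ x y → F (κ x y)) (pairs∈ xs (N-distinct (ℤ.+ z)) (λ x y p q ne → h x y p q ne , h y x q p (λ e → ne (≈v-sym e)))))
      (≡⇒≤ (trans (∑-cong∈ xs (λ x p → cong F (κν x p))) (∑-const xs (F ν))))

  0≤*≤0 : ∀ {x y} → 0ℝ ≤ x → y ≤ 0ℝ → x * y ≤ 0ℝ
  0≤*≤0 {x} {y} p q = subst (x * y ≤_) (zeroʳ x) (*-mono-≤ˡ x p q)

  -- Two distinct vectors x, y of shell 3 would give 0 ≤ norm (Px + Py) ≤ 3m - 36ρ, hence r ≥ 12.
  n₃≤1 : n₃ ℕ.≤ 1
  n₃≤1 = go (N (ℤ.+ 3)) refl (N-distinct (ℤ.+ 3))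
    where
      open Shell 3
      go : ∀ ys → ys ≡ N (ℤ.+ 3) → Distinct ys → length ys ℕ.≤ 1
      go [] e d = ℕ.z≤n
      go (x ∷ []) e d = ℕ.s≤s ℕ.z≤n
      go (x ∷ y ∷ ys) e ((d ∷ _) ∷ _) = ⊥-elim (contra lower)
        where
          px : x ∈ xs
          px = subst (x ∈_) e (here refl)
          py : y ∈ xs
          py = subst (y ∈_) e (there (here refl))
          w = P x ⊕ P y
          nw : norm w ≡ fromℕ 2 * ν + fromℕ 2 * κ x y
          nw = trans (⊕-· (P x) (P y) w) (trans (cong₂ _+_ (trans (·-⊕ (P x) (P x) (P y)) (cong (_+ κ x y) (κν x px))) (trans (·-⊕ (P y) (P x) (P y)) (cong₂ _+_ (·-comm (P y) (P x)) (κν y py))))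
                 (solve 2 (λ v k → v :+ k :+ (k :+ v) := K 2 :* v :+ K 2 :* k) refl ν (κ x y)))
          lower : 0ℝ ≤ fromℕ 2 * ν + (m - fromℕ 2 * zz * ρ)
          lower = ≤-trans (subst (0ℝ ≤_) nw (0≤norm w)) (+-mono-≤ (≤-refl {fromℕ 2 * ν}) (κ≤ x y px py d))
          contra : ¬ (0ℝ ≤ fromℕ 2 * ν + (m - fromℕ 2 * zz * ρ))
          contra h = <-asym r<46/5 (<-≤-trans (subst (fromℕ 46 <_) (fromℕ-* 5 12) (fromℕ-mono-< (ℕₚ.m≤m+n 47 13))) (*-mono-≤ˡ (fromℕ 5) (0≤ℕ 5)
             (*-cancel-≤ˡ (fromℕ 3) (0<ℕ 2) (0≤⇒≤ (subst (0ℝ ≤_) (trans (cong (_* m*) (solve 2 (λ m i → K 2 :* (m :- K 3 :* K 3 :* i) :+ (m :- K 2 :* (K 3 :* K 3) :* i) := K 3 :* m :- K 36 :* i) refl m ρ)) (trans (mm*ρ (fromℕ 3) (fromℕ 36)) (cong (λ t → fromℕ 3 * r - t) (fromℕ-* 3 12)))) (0≤* h (<⇒≤ m*>0)))))))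

  -- For x in shell 3 the norm m - 9ρ of Px is nonnegative, hence r ≥ 9.
  n₃≡0 : r < fromℕ 9 → n₃ ≡ 0
  n₃≡0 r<9 = go (N (ℤ.+ 3)) refl
    where
      open Shell 3
      go : ∀ ys → ys ≡ N (ℤ.+ 3) → length ys ≡ 0
      go [] e = refl
      go (x ∷ ys) e = ⊥-elim (0≤⇒≤ (subst (0ℝ ≤_) (trans (cong (_* m*) (solve 2 (λ m i → m :- K 3 :* K 3 :* i := 𝟙 :* m :- K 9 :* i) refl m ρ)) (trans (mm*ρ 1ℝ (fromℕ 9)) (cong (_- fromℕ 9) (*-identityˡ r))))
        (0≤* (subst (0ℝ ≤_) (κν x (subst (x ∈_) e (here refl))) (0≤norm (P x))) (<⇒≤ m*>0))) r<9)

  module _ where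
    open Shell 2
    private
      c₂ = m - fromℕ 8 * ρ
      κ≤c₂ : ∀ x y → x ∈ xs → y ∈ xs → ¬ (x ≈v y) → fromℕ 2 * κ x y ≤ c₂
      κ≤c₂ x y p q ne = ≤-trans (κ≤ x y p q ne) (≡⇒≤ (solve 2 (λ m i → m :- K 2 :* (K 2 :* K 2) :* i := m :- K 8 :* i) refl m ρ))
      c₂m* : c₂ * m* ≡ r - fromℕ 8
      c₂m* = trans (cong (_* m*) (solve 2 (λ m i → m :- K 8 :* i := 𝟙 :* m :- K 8 :* i) refl m ρ)) (trans (mm*ρ 1ℝ (fromℕ 8)) (cong (_- fromℕ 8) (*-identityˡ r)))
      νm* : ν * m* ≡ r - fromℕ 4
      νm* = trans (cong (_* m*) (solve 2 (λ m i → m :- K 2 :* K 2 :* i := 𝟙 :* m :- K 4 :* i) refl m ρ)) (trans (mm*ρ 1ℝ (fromℕ 4)) (cong (_- fromℕ 4) (*-identityˡ r)))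
      2ν-c₂ : fromℕ 2 * ν - c₂ ≡ m
      2ν-c₂ = solve 2 (λ m i → K 2 :* (m :- K 2 :* K 2 :* i) :- (m :- K 8 :* i) := m) refl m ρ

    -- Delsarte bound for the polynomial (u + p/q)² (u - c) in dimension 15
    codeBound : ∀ p q → 2 ℕ.* q ℕ.≤ 5 ℕ.* p → fromℕ 8 ≤ r →
      fromℕ n₂ * (fromℕ 4 * fromℕ p * fromℕ q * (r - fromℕ 4) - (fromℕ q * fromℕ q + fromℕ 15 * (fromℕ p * fromℕ p)) * (r - fromℕ 8))
        ≤ fromℕ 15 * ((fromℕ p + fromℕ q) * (fromℕ p + fromℕ q)) * r
    codeBound p' q' 2q≤5p 8≤r = go (n (ℤ.+ 2)) refl
      where
        p = fromℕ p'
        q = fromℕ q'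
        p≥0 = 0≤ℕ p'
        q≥0 = 0≤ℕ q'
        r-4>0 : 0ℝ < r - fromℕ 4
        r-4>0 = <⇒0< (<-≤-trans (fromℕ-mono-< (ℕₚ.m≤m+n 5 3)) 8≤r)
        ν>0 : 0ℝ < ν
        ν>0 = *-cancel-<ˡ m* m*>0 (subst₂ _<_ (sym (zeroʳ m*)) (trans (sym νm*) (*-comm ν m*)) r-4>0)
        -- The sign condition that makes `a₂` and `a₁` nonnegative. Here 2q ≤ 5p and r < 46/5 are
        -- consumed.
        gap : 0ℝ ≤ p * (r - fromℕ 4) - q * (r - fromℕ 8)
        gap = 0≤-cancelˡ (fromℕ 25) (0<ℕ 24) (subst (0ℝ ≤_) (solve 3 (λ p q r → K 5 :* ((K 5 :* p :- K 2 :* q) :* (r :- K 4)) :+ q :* (K 3 :* (K 46 :- K 5 :* r) :+ K 22) := K 25 :* (p :* (r :- K 4) :- q :* (r :- K 8))) refl p q r)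
                (0≤+ (0≤* (0≤ℕ 5) (0≤* (≤⇒0≤ (subst₂ _≤_ (fromℕ-* 2 q') (fromℕ-* 5 p') (fromℕ-mono-≤ 2q≤5p))) (<⇒≤ r-4>0))) (0≤* q≥0 (0≤+ (0≤* (0≤ℕ 3) (≤⇒0≤ (<⇒≤ r<46/5))) (0≤ℕ 22)))))
        pν-qc₂ : 0ℝ ≤ p * ν - q * c₂
        pν-qc₂ = 0≤-cancelˡ m* m*>0 (subst (0ℝ ≤_) (trans (cong₂ (λ s t → p * s - q * t) (sym νm*) (sym c₂m*)) (solve 5 (λ p v q c d → p :* (v :* d) :- q :* (c :* d) := d :* (p :* v :- q :* c)) refl p ν q c₂ m*)) gap)
        a₂ = fromℕ 4 * p * q * ν - q * q * c₂
        a₁ = fromℕ 2 * p * ν * (p * ν - q * c₂)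
        F : ℝ → ℝ
        F t = (q * t + p * ν) * (q * t + p * ν) * (fromℕ 2 * t - c₂)
        a₂≥0 : 0ℝ ≤ a₂
        a₂≥0 = subst (0ℝ ≤_) (solve 4 (λ p q v c → q :* (K 3 :* p :* v :+ (p :* v :- q :* c)) := K 4 :* p :* q :* v :- q :* q :* c) refl p q ν c₂) (0≤* q≥0 (0≤+ (0≤* (0≤* (0≤ℕ 3) p≥0) (<⇒≤ ν>0)) pν-qc₂))
        a₁≥0 : 0ℝ ≤ a₁
        a₁≥0 = 0≤* (0≤* (0≤* (0≤ℕ 2) p≥0) (<⇒≤ ν>0)) pν-qc₂
        S = ∑ xs (λ x → ∑ xs (λ y → F (κ x y)))
        S≡ : S ≡ fromℕ 2 * (q * q) * KK 3 + a₂ * KK 2 + a₁ * KK 1 + (- (p * p * (ν * ν) * c₂)) * (N# * N#)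
        S≡ = trans (∑-cong xs (λ x → ∑-cong xs (λ y → solve 5 (λ p q v c t → (q :* t :+ p :* v) :* (q :* t :+ p :* v) :* (K 2 :* t :- c)
                 := K 2 :* (q :* q) :* t :^ 3 :+ (K 4 :* p :* q :* v :- q :* q :* c) :* t :^ 2 :+ K 2 :* p :* v :* (p :* v :- q :* c) :* t :^ 1 :+ (:- (p :* p :* (v :* v) :* c)) :* t :^ 0) refl p q ν c₂ (κ x y))))
               (trans (poly (fromℕ 2 * (q * q)) a₂ a₁ (- (p * p * (ν * ν) * c₂))) (cong (λ t → fromℕ 2 * (q * q) * KK 3 + a₂ * KK 2 + a₁ * KK 1 + (- (p * p * (ν * ν) * c₂)) * t) KK0))
        upper : S ≤ N# * ((p + q) * (p + q) * (ν * ν) * m)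
        upper = ≤-trans (diagonal F (λ x y px py ne → 0≤*≤0 (0≤sq (q * κ x y + p * ν)) (subst (fromℕ 2 * κ x y - c₂ ≤_) (-‿inverseʳ c₂) (+-mono-≤ʳ (- c₂) (κ≤c₂ x y px py ne)))))
                  (≡⇒≤ (cong (N# *_) (trans (cong ((q * ν + p * ν) * (q * ν + p * ν) *_) 2ν-c₂) (solve 4 (λ p q v m → (q :* v :+ p :* v) :* (q :* v :+ p :* v) :* m := (p :+ q) :* (p :+ q) :* (v :* v) :* m) refl p q ν m))))
        -- The moments of degree 3 and 1 are dropped as nonnegative, the one of degree 2 is bounded
        -- by `frame`, and degree 0 is exact.
        lower : a₂ * (N# * ν * (N# * ν)) + fromℕ 15 * ((- (p * p * (ν * ν) * c₂)) * (N# * N#)) ≤ fromℕ 15 * S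
        lower = ≤-trans (+-mono-≤ (*-mono-≤ˡ a₂ a₂≥0 (frame xs id ν (λ x → κν x))) ≤-refl)
                 (≤-by (fromℕ 15 * (fromℕ 2 * (q * q) * KK 3 + a₁ * KK 1)) (0≤* (0≤ℕ 15) (0≤+ (0≤* (0≤* (0≤ℕ 2) (0≤sq q)) (0≤KK 3)) (0≤* a₁≥0 (0≤KK 1))))
                  (trans (cong (fromℕ 15 *_) S≡) (solve 7 (λ x a k d e l o → K 15 :* (x :* l :+ a :* k :+ d :* e :+ o) := (a :* (K 15 :* k) :+ K 15 :* o) :+ K 15 :* (x :* l :+ d :* e)) refl (fromℕ 2 * (q * q)) a₂ (KK 2) a₁ (KK 1) (KK 3) ((- (p * p * (ν * ν) * c₂)) * (N# * N#)))))
        go : ∀ k → n (ℤ.+ 2) ≡ k → fromℕ n₂ * (fromℕ 4 * p * q * (r - fromℕ 4) - (q * q + fromℕ 15 * (p * p)) * (r - fromℕ 8)) ≤ fromℕ 15 * ((p + q) * (p + q)) * r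
        go zero e = subst (_≤ fromℕ 15 * ((p + q) * (p + q)) * r) (sym (trans (cong (λ k → fromℕ k * Z) e) (zeroˡ _))) (0≤* (0≤* (0≤ℕ 15) (0≤sq (p + q))) r≥0)
          where Z = fromℕ 4 * p * q * (r - fromℕ 4) - (q * q + fromℕ 15 * (p * p)) * (r - fromℕ 8)
        go (suc k) e = subst₂ _≤_
            (trans (solve 6 (λ n p q v c d → n :* (K 4 :* p :* q :* v :- q :* q :* c :- K 15 :* (p :* p) :* c) :* d := n :* (K 4 :* p :* q :* (v :* d) :- (q :* q :+ K 15 :* (p :* p)) :* (c :* d))) refl N# p q ν c₂ m*)
              (cong₂ (λ s t → N# * (fromℕ 4 * p * q * s - (q * q + fromℕ 15 * (p * p)) * t)) νm* c₂m*))
            (solve 4 (λ p q m d → K 15 :* ((p :+ q) :* (p :+ q)) :* m :* d := K 15 :* ((p :+ q) :* (p :+ q)) :* (m :* d)) refl p q m m*)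
            (*-mono-≤ʳ m* (<⇒≤ m*>0) (*-cancel-≤ˡ (N# * (ν * ν)) (*-pos N>0 (*-pos ν>0 ν>0)) (≤-trans (≡⇒≤ (solve 5 (λ n p q v c → n :* (v :* v) :* (n :* (K 4 :* p :* q :* v :- q :* q :* c :- K 15 :* (p :* p) :* c)) := (K 4 :* p :* q :* v :- q :* q :* c) :* (n :* v :* (n :* v)) :+ K 15 :* ((:- (p :* p :* (v :* v) :* c)) :* (n :* n))) refl N# p q ν c₂))
               (≤-trans (≤-trans lower (*-mono-≤ˡ (fromℕ 15) (0≤ℕ 15) upper)) (≡⇒≤ (solve 5 (λ n p q v m → K 15 :* (n :* ((p :+ q) :* (p :+ q) :* (v :* v) :* m)) := n :* (v :* v) :* (K 15 :* ((p :+ q) :* (p :+ q)) :* m)) refl N# p q ν m))))))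
          where
            N>0 : 0ℝ < N#
            N>0 = subst (λ k → 0ℝ < fromℕ k) (sym e) (0<ℕ k)

    -- The simplex bound: the sum of all projected vectors has nonnegative norm, while distinct ones
    -- satisfy 2κ ≤ m - 8ρ, which is negative for r < 8.
    n₂[8-r]≤r : fromℕ n₂ * (fromℕ 8 - r) ≤ r
    n₂[8-r]≤r = go (n (ℤ.+ 2)) refl
      where
        up : ∑ xs (λ x → ∑ xs (λ y → fromℕ 2 * κ x y - c₂)) ≤ N# * m
        up = ≤-trans (diagonal (λ t → fromℕ 2 * t - c₂) (λ x y px py ne → subst (fromℕ 2 * κ x y - c₂ ≤_) (-‿inverseʳ c₂) (+-mono-≤ʳ (- c₂) (κ≤c₂ x y px py ne)))) (≡⇒≤ (cong (N# *_) 2ν-c₂))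
        eq : ∑ xs (λ x → ∑ xs (λ y → fromℕ 2 * κ x y - c₂)) ≡ fromℕ 2 * KK 1 - c₂ * (N# * N#)
        eq = trans (∑-cong xs (λ x → ∑-cong xs (λ y → solve 2 (λ t c → K 2 :* t :- c := K 0 :* t :^ 3 :+ K 0 :* t :^ 2 :+ K 2 :* t :^ 1 :+ (:- c) :* t :^ 0) refl (κ x y) c₂)))
              (trans (poly (fromℕ 0) (fromℕ 0) (fromℕ 2) (- c₂)) (trans (cong (λ t → fromℕ 0 * KK 3 + fromℕ 0 * KK 2 + fromℕ 2 * KK 1 + (- c₂) * t) KK0) (solve 5 (λ a b d c n → K 0 :* a :+ K 0 :* b :+ K 2 :* d :+ (:- c) :* n := K 2 :* d :- c :* n) refl (KK 3) (KK 2) (KK 1) c₂ (N# * N#))))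
        go : ∀ k → n (ℤ.+ 2) ≡ k → fromℕ n₂ * (fromℕ 8 - r) ≤ r
        go zero e = subst (_≤ r) (sym (trans (cong (λ k → fromℕ k * (fromℕ 8 - r)) e) (zeroˡ _))) r≥0
        go (suc k) e = ≤-trans (≡⇒≤ (trans (cong (N# *_) (trans (solve 1 (λ r → K 8 :- r := :- (r :- K 8)) refl r) (cong -_ (sym c₂m*)))) (solve 3 (λ n c d → n :* (:- (c :* d)) := n :* (:- c) :* d) refl N# c₂ m*)))
           (*-mono-≤ʳ m* (<⇒≤ m*>0) (*-cancel-≤ˡ N# (subst (λ k → 0ℝ < fromℕ k) (sym e) (0<ℕ k))
             (≤-trans (≤-by (fromℕ 2 * KK 1) (0≤* (0≤ℕ 2) (0≤KK 1)) (trans eq (solve 3 (λ k c n → K 2 :* k :- c :* (n :* n) := n :* (n :* (:- c)) :+ K 2 :* k) refl (KK 1) c₂ N#))) up)))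

    private
      pos : ℝ → ℝ
      pos t with 0ℝ ≤? t
      ... | inj₁ _ = t
      ... | inj₂ _ = 0ℝ

      0≤pos : ∀ t → 0ℝ ≤ pos t
      0≤pos t with 0ℝ ≤? t
      ... | inj₁ p = p
      ... | inj₂ _ = ≤-refl

      pos-split : ∀ t → t ≡ pos t - pos (- t) × pos t * pos (- t) ≡ 0ℝ
      pos-split t with 0ℝ ≤? t | 0ℝ ≤? (- t)
      ... | inj₁ p | inj₁ q = trans t≡0 (sym (trans (cong (λ s → s - (- s)) t≡0) (solve 0 (K 0 :- (:- K 0) := K 0) refl))) , trans (cong (_* (- t)) t≡0) (zeroˡ _)
        where
          t≡0 : t ≡ 0ℝ
          t≡0 = ≤-antisym (subst₂ _≤_ (-‿involutive t) -0#≈0# (neg-mono-≤ q)) p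
      ... | inj₁ p | inj₂ q = solve 1 (λ t → t := t :- K 0) refl t , zeroʳ t
      ... | inj₂ p | inj₁ q = solve 1 (λ t → t := K 0 :- (:- t)) refl t , zeroˡ _
      ... | inj₂ p | inj₂ q = ⊥-elim (<-asym p (subst₂ _<_ (solve 1 (λ t → :- t :+ t := K 0) refl t) (+-identityˡ t) (+-mono-< t q)))

    -- For r < 8 distinct projected vectors have negative inner products, and dimension 15 admits at
    -- most 16 such vectors. A linear relation among more, split by sign into two equal combinations
    -- V⁺ and V⁻ with the same total weight T, gives 0 ≤ 2 V⁺ · V⁻ ≤ c₂ T² with c₂ < 0. So T = 0 and
    -- every coefficient vanishes.
    n₂≤16 : r < fromℕ 8 → n₂ ℕ.≤ 16
    n₂≤16 r<8 with n₂ ℕ.≤? 16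
    ... | yes p = p
    ... | no p with dependent 16 xs id (ℕₚ.≰⇒> p)
    ...   | zs , π , ((t₀ , x₀) , z∈ , t≢0) , rel = ⊥-elim (t≢0 (trans (proj₁ (pos-split t₀)) (trans (cong₂ _-_ (all0 pos (λ t → 0≤pos t) T≡0 z∈) (all0 (pos ∘ -_) (λ t → 0≤pos (- t)) T'≡0 z∈)) (-‿inverseʳ 0ℝ))))
      where
        mem : ∀ {z} → z ∈ zs → proj₂ z ∈ xs
        mem q = ↭ₚ.∈-resp-↭ π (∈ₚ.∈-map⁺ proj₂ q)
        distinct : AllPairs (λ z w → ¬ (proj₂ z ≈v proj₂ w)) zs
        distinct = AllPairsₚ.map⁻ (AllPairs-↭ (λ ne e → ne (≈v-sym e)) (↭-sym π) (N-distinct (ℤ.+ 2)))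
        P₂ : ℝ × Vec 16 → Vec 16
        P₂ z = P (proj₂ z)
        V⁺ V⁻ : Vec 16
        V⁺ = lincomb zs (pos ∘ proj₁) P₂
        V⁻ = lincomb zs (pos ∘ -_ ∘ proj₁) P₂
        T T' : ℝ
        T = ∑ zs (pos ∘ proj₁)
        T' = ∑ zs (pos ∘ -_ ∘ proj₁)
        relα : ∀ w → ∑ zs (λ z → proj₁ z * (proj₂ z · w)) ≡ 0ℝ
        relα w = trans (sym (lincomb-· zs proj₁ proj₂ w)) (trans (·-cong rel (λ i → refl)) (𝟎-· w))
        T≡T' : T ≡ T'
        T≡T' = trans (solve 2 (λ a b → a := (a :- b) :+ b) refl T T') (trans (cong (_+ T') (trans (sym (∑-- zs)) (trans (∑-cong zs (λ z → sym (proj₁ (pos-split (proj₁ z))))) sum0))) (+-identityˡ T'))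
          where
            -- The relation is paired with α, with which every vector of shell 2 has inner product
            -- 2.
            sum0 : ∑ zs proj₁ ≡ 0ℝ
            sum0 = *-cancelˡ (fromℕ 2) (0<⇒≢ (0<ℕ 1)) (trans (trans (sym (∑-*ˡ zs (fromℕ 2))) (∑-cong∈ zs (λ z q → trans (*-comm _ _) (cong (proj₁ z *_) (sym (proj₂ (∈N {ℤ.+ 2} (mem q)))))))) (trans (relα α) (sym (zeroʳ _))))
        V⁺V⁻ : V⁺ · V⁺ ≡ V⁻ · V⁺
        V⁺V⁻ = trans (solve 2 (λ a b → a := (a :- b) :+ b) refl (V⁺ · V⁺) (V⁻ · V⁺)) (trans (cong (_+ V⁻ · V⁺) diff) (+-identityˡ _))
          where
            diff : V⁺ · V⁺ - V⁻ · V⁺ ≡ 0ℝ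
            diff = trans (cong₂ _-_ (lincomb-· zs (pos ∘ proj₁) P₂ V⁺) (lincomb-· zs (pos ∘ -_ ∘ proj₁) P₂ V⁺)) (trans (sym (∑-- zs)) (trans (∑-cong zs (λ z →
                trans (solve 3 (λ a b c → a :* c :- b :* c := (a :- b) :* c) refl _ _ _) (trans (cong₂ _*_ (sym (proj₁ (pos-split (proj₁ z)))) (P-· (proj₂ z) V⁺))
                  (solve 5 (λ t a b c d → t :* (a :- b :* c :* d) := t :* a :- t :* b :* (c :* d)) refl (proj₁ z) _ _ _ ρ))))
                (trans (∑-- zs) (trans (cong₂ _-_ (relα V⁺) (trans (∑-*ʳ zs _) (trans (cong (_* (V⁺ · α * ρ)) (relα α)) (zeroˡ _)))) (-‿inverseʳ 0ℝ)))))
        G = ∑ zs (λ z → ∑ zs (λ w → pos (proj₁ z) * pos (- proj₁ w) * (fromℕ 2 * κ (proj₂ z) (proj₂ w) - c₂)))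
        -- The diagonal contributes nothing, as no coefficient has both a positive and a negative
        -- part.
        G≤0 : G ≤ 0ℝ
        G≤0 = ≤-trans (offdiag zs _ (pairs∈ zs distinct (λ z w pz pw ne → sgn z w pz pw ne , sgn w z pw pz (λ e → ne (≈v-sym e)))))
                (≡⇒≤ (trans (∑-cong zs (λ z → trans (cong (_* (fromℕ 2 * κ (proj₂ z) (proj₂ z) - c₂)) (proj₂ (pos-split (proj₁ z)))) (zeroˡ _))) (∑-zero zs)))
          where
            sgn : ∀ z w → z ∈ zs → w ∈ zs → ¬ (proj₂ z ≈v proj₂ w) → pos (proj₁ z) * pos (- proj₁ w) * (fromℕ 2 * κ (proj₂ z) (proj₂ w) - c₂) ≤ 0ℝ
            sgn z w pz pw ne = 0≤*≤0 (0≤* (0≤pos _) (0≤pos _)) (subst (fromℕ 2 * κ (proj₂ z) (proj₂ w) - c₂ ≤_) (-‿inverseʳ c₂) (+-mono-≤ʳ (- c₂) (κ≤c₂ _ _ (mem pz) (mem pw) ne)))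
        G≡ : G ≡ fromℕ 2 * (V⁺ · V⁺) + (- c₂) * (T * T)
        G≡ = trans (∑-cong zs (λ z → trans (∑-cong zs (λ w → solve 4 (λ a b k c → a :* b :* (K 2 :* k :- c) := K 2 :* (a :* (b :* k)) :+ (:- c) :* (a :* b)) refl (pos (proj₁ z)) (pos (- proj₁ w)) (κ (proj₂ z) (proj₂ w)) c₂)) (trans (∑-+ zs) (cong₂ _+_ (∑-*ˡ zs (fromℕ 2)) (∑-*ˡ zs (- c₂))))))
              (trans (∑-+ zs) (cong₂ _+_ (trans (∑-*ˡ zs (fromℕ 2)) (cong (fromℕ 2 *_) (trans (trans (∑-cong zs (λ z → trans (∑-*ˡ zs (pos (proj₁ z))) (cong (pos (proj₁ z) *_) (trans (∑-cong zs (λ w → cong (pos (- proj₁ w) *_) (·-comm (P₂ z) (P₂ w)))) (trans (sym (lincomb-· zs (pos ∘ -_ ∘ proj₁) P₂ (P₂ z))) (·-comm V⁻ (P₂ z))))))) (sym (lincomb-· zs (pos ∘ proj₁) P₂ V⁻))) (trans (·-comm V⁺ V⁻) (sym V⁺V⁻)))))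
                (trans (∑-*ˡ zs (- c₂)) (cong ((- c₂) *_) (trans (sym (∑-prod zs zs)) (cong (T *_) (sym T≡T')))))))
        c₂<0 : 0ℝ < - c₂
        c₂<0 = *-cancel-<ˡ m* m*>0 (subst₂ _<_ (sym (zeroʳ m*)) (trans (solve 1 (λ r → K 8 :- r := :- (r :- K 8)) refl r) (trans (cong -_ (sym c₂m*)) (solve 2 (λ c d → :- (c :* d) := d :* (:- c)) refl c₂ m*))) (<⇒0< r<8))
        TT≤0 : T * T ≤ 0ℝ
        TT≤0 = *-cancel-≤ˡ (- c₂) c₂<0 (≤-trans (≤-by (fromℕ 2 * (V⁺ · V⁺)) (0≤* (0≤ℕ 2) (0≤norm V⁺)) (+-comm _ _)) (≤-trans (≡⇒≤ (sym G≡)) (subst (G ≤_) (sym (zeroʳ _)) G≤0)))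
        T≡0 : T ≡ 0ℝ
        T≡0 = ≤-antisym (sq-cancel-≤ ≤-refl (subst (T * T ≤_) (sym (zeroʳ 0ℝ)) TT≤0)) (0≤∑ zs (λ z → 0≤pos (proj₁ z)))
        T'≡0 = trans (sym T≡T') T≡0
        all0 : ∀ (f : ℝ → ℝ) → (∀ t → 0ℝ ≤ f t) → ∑ zs (f ∘ proj₁) ≡ 0ℝ → ∀ {z} → z ∈ zs → f (proj₁ z) ≡ 0ℝ
        all0 f h e {z} q = ≤-antisym (subst (f (proj₁ z) ≤_) e (term≤∑ zs (λ w _ → h (proj₁ w)) q)) (h (proj₁ z))

 -- A weighted cubature formula of degree 6 in dimension 16.

 module Cubature where

  discriminant : ∀ {x y z} → (∀ l → 0ℝ ≤ x - (l + l) * y + l * l * z) → 0ℝ < z → y * y ≤ x * z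
  discriminant {x} {y} {z} h p = 0≤⇒≤ (subst (0ℝ ≤_) eq (0≤* (<⇒≤ p) (h l)))
    where
      l = y * z ⁻¹
      eq : z * (x - (l + l) * y + l * l * z) ≡ x * z - y * y
      eq = trans (solve 4 (λ x y z i → z :* (x :- (y :* i :+ y :* i) :* y :+ y :* i :* (y :* i) :* z) := x :* z :- K 2 :* (y :* y :* (z :* i)) :+ y :* y :* ((z :* i) :* (z :* i))) refl x y z (z ⁻¹))
        (trans (cong (λ t → x * z - fromℕ 2 * (y * y * t) + y * y * (t * t)) (*-inv⁺ p)) (solve 3 (λ x y z → x :* z :- K 2 :* (y :* y :* 𝟙) :+ y :* y :* (𝟙 :* 𝟙) := x :* z :- y :* y) refl x y z))

  -- The seven-point central difference for the second derivative, with weights -490, 270, -27, 2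
  -- over 360.
  sextic-coeff : ∀ d0 d1 d2 d3 d4 d5 d6 → (∀ t → d0 + t * d1 + t ^ 2 * d2 + t ^ 3 * d3 + t ^ 4 * d4 + t ^ 5 * d5 + t ^ 6 * d6 ≡ 0ℝ) → d2 ≡ 0ℝ
  sextic-coeff d0 d1 d2 d3 d4 d5 d6 h = *-cancelˡ (fromℕ 360) (0<⇒≢ (0<ℕ 359)) (trans eq (sym (zeroʳ _)))
    where
      H : ℤ → ℝ
      H k = d0 + fromℤ k * d1 + fromℤ k ^ 2 * d2 + fromℤ k ^ 3 * d3 + fromℤ k ^ 4 * d4 + fromℤ k ^ 5 * d5 + fromℤ k ^ 6 * d6
      eq : fromℕ 360 * d2 ≡ 0ℝ
      eq = trans (solve 7 (λ a b c d e f g → let Q = λ k → a :+ con k :* b :+ con k :^ 2 :* c :+ con k :^ 3 :* d :+ con k :^ 4 :* e :+ con k :^ 5 :* f :+ con k :^ 6 :* g in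
             K 360 :* c := K 270 :* (Q (ℤ.+ 1) :+ Q (ℤ.- (ℤ.+ 1))) :+ (:- K 27) :* (Q (ℤ.+ 2) :+ Q (ℤ.- (ℤ.+ 2))) :+ K 2 :* (Q (ℤ.+ 3) :+ Q (ℤ.- (ℤ.+ 3))) :+ (:- K 490) :* Q (ℤ.+ 0)) refl d0 d1 d2 d3 d4 d5 d6)
           (trans (cong₂ _+_ (cong₂ _+_ (cong₂ _+_ (cong₂ (λ s t → fromℕ 270 * (s + t)) (h (fromℤ (ℤ.+ 1))) (h (fromℤ (ℤ.- (ℤ.+ 1))))) (cong₂ (λ s t → (- fromℕ 27) * (s + t)) (h (fromℤ (ℤ.+ 2))) (h (fromℤ (ℤ.- (ℤ.+ 2)))))) (cong₂ (λ s t → fromℕ 2 * (s + t)) (h (fromℤ (ℤ.+ 3))) (h (fromℤ (ℤ.- (ℤ.+ 3)))))) (cong ((- fromℕ 490) *_) (h (fromℤ (ℤ.+ 0)))))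
            (solve 0 (K 270 :* (K 0 :+ K 0) :+ (:- K 27) :* (K 0 :+ K 0) :+ K 2 :* (K 0 :+ K 0) :+ (:- K 490) :* K 0 := K 0) refl))

  private
    I = Fs 16

    even6 : ∀ (x : Vec 16) a₀ a₂ a₄ a₆ → ∑ I (λ i → a₀ + a₂ * x i ^ 2 + a₄ * x i ^ 4 + a₆ * x i ^ 6)
              ≡ fromℕ 16 * a₀ + a₂ * ∑ I (λ i → x i ^ 2) + a₄ * ∑ I (λ i → x i ^ 4) + a₆ * ∑ I (λ i → x i ^ 6)
    even6 x a₀ a₂ a₄ a₆ = trans (∑-+ I) (cong₂ _+_ (trans (∑-+ I) (cong₂ _+_ (trans (∑-+ I) (cong₂ _+_ (∑-Fs-const 16 a₀) (∑-*ˡ I a₂))) (∑-*ˡ I a₄))) (∑-*ˡ I a₆))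

  -- (Σ xᵢ²)³ as a combination of sixth powers of xᵢ, xᵢ ± xⱼ, xᵢ ± xⱼ ± xₖ (indices may coincide)
  nodes : List (ℝ × Vec 16)
  nodes = map (λ i → fromℕ 3072 , unit i) I
       ++ concatMap (λ i → concatMap (λ j → (- fromℕ 96 , unit i ⊕ unit j) ∷ (- fromℕ 96 , unit i ⊖ unit j) ∷ []) I) I
       ++ concatMap (λ i → concatMap (λ j → concatMap (λ k →
            (1ℝ , unit i ⊕ unit j ⊕ unit k) ∷ (1ℝ , unit i ⊕ unit j ⊖ unit k) ∷ (1ℝ , unit i ⊖ unit j ⊕ unit k) ∷ (1ℝ , unit i ⊖ unit j ⊖ unit k) ∷ []) I) I) I

  wt : ℝ × Vec 16 → ℝ
  wt = proj₁

  nd : ℝ × Vec 16 → Vec 16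
  nd = proj₂

  sixth : ∀ x → ∑ nodes (λ v → wt v * (nd v · x) ^ 6) ≡ fromℕ 360 * (x · x) ^ 3
  sixth x = begin
      ∑ nodes f ≡⟨ trans (∑-++ (map (λ i → fromℕ 3072 , unit i) I) _) (cong₂ _+_ (∑-map _ I) (trans (∑-++ (concatMap (λ i → concatMap (λ j → (- fromℕ 96 , unit i ⊕ unit j) ∷ (- fromℕ 96 , unit i ⊖ unit j) ∷ []) I) I) _)
                     (cong₂ _+_ (trans (∑-concatMap _ I) (∑-cong I (λ i → ∑-concatMap _ I))) (trans (∑-concatMap _ I) (∑-cong I (λ i → trans (∑-concatMap _ I) (∑-cong I (λ j → ∑-concatMap _ I)))))))) ⟩
      ∑ I (λ i → fromℕ 3072 * (unit i · x) ^ 6) + (∑ I (λ i → ∑ I (λ j → two i j)) + ∑ I (λ i → ∑ I (λ j → ∑ I (λ k → three i j k)))) ≡⟨ cong₂ _+_ (trans (∑-*ˡ I (fromℕ 3072)) (cong (fromℕ 3072 *_) (∑-cong I (λ i → cong (_^ 6) (unit-· i x))))) (cong₂ _+_ twos threes) ⟩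
      -- The weights 3072, -96, 1 are chosen so that the multiples of S6 (3072 - 96 · 64 + 3072) and
      -- of S4 · S2 (5760 - 96 · 60) cancel.
      fromℕ 3072 * S6 + ((- fromℕ 96) * (fromℕ 64 * S6 + fromℕ 60 * (S4 * S2)) + (fromℕ 3072 * S6 + fromℕ 5760 * (S4 * S2) + fromℕ 360 * S2 ^ 3)) ≡⟨ solve 3 (λ a b c → K 3072 :* c :+ ((:- K 96) :* (K 64 :* c :+ K 60 :* (b :* a)) :+ (K 3072 :* c :+ K 5760 :* (b :* a) :+ K 360 :* a :^ 3)) := K 360 :* a :^ 3) refl S2 S4 S6 ⟩
      fromℕ 360 * S2 ^ 3 ≡⟨ cong (λ t → fromℕ 360 * t ^ 3) (sym (trans (dot 16) (∑-cong I (λ i → solve 1 (λ a → a :* a := a :^ 2) refl (x i))))) ⟩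
      fromℕ 360 * (x · x) ^ 3 ∎
    where
      open ≡-Reasoning
      f : ℝ × Vec 16 → ℝ
      f v = wt v * (nd v · x) ^ 6
      S2 = ∑ I (λ i → x i ^ 2)
      S4 = ∑ I (λ i → x i ^ 4)
      S6 = ∑ I (λ i → x i ^ 6)
      two : Fin 16 → Fin 16 → ℝ
      two i j = (- fromℕ 96) * ((unit i ⊕ unit j) · x) ^ 6 + ((- fromℕ 96) * ((unit i ⊖ unit j) · x) ^ 6 + 0ℝ)
      three : Fin 16 → Fin 16 → Fin 16 → ℝ
      three i j k = 1ℝ * ((unit i ⊕ unit j ⊕ unit k) · x) ^ 6 + (1ℝ * ((unit i ⊕ unit j ⊖ unit k) · x) ^ 6 + (1ℝ * ((unit i ⊖ unit j ⊕ unit k) · x) ^ 6 + (1ℝ * ((unit i ⊖ unit j ⊖ unit k) · x) ^ 6 + 0ℝ)))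
      pl : ∀ u w → (u ⊕ w) · x ≡ u · x + w · x
      pl u w = ⊕-· u w x
      mi : ∀ u w → (u ⊖ w) · x ≡ u · x - w · x
      mi u w = ⊖-· u w x
      two≡ : ∀ i j → two i j ≡ (- fromℕ 96) * (fromℕ 2 * x i ^ 6) + (- fromℕ 96) * (fromℕ 30 * x i ^ 4) * x j ^ 2 + (- fromℕ 96) * (fromℕ 30 * x i ^ 2) * x j ^ 4 + (- fromℕ 96) * fromℕ 2 * x j ^ 6
      two≡ i j = trans (cong₂ (λ s t → (- fromℕ 96) * s ^ 6 + ((- fromℕ 96) * t ^ 6 + 0ℝ)) (trans (pl _ _) (cong₂ _+_ (unit-· i x) (unit-· j x))) (trans (mi _ _) (cong₂ _-_ (unit-· i x) (unit-· j x))))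
        (solve 2 (λ a b → (:- K 96) :* (a :+ b) :^ 6 :+ ((:- K 96) :* (a :- b) :^ 6 :+ K 0) := (:- K 96) :* (K 2 :* a :^ 6) :+ (:- K 96) :* (K 30 :* a :^ 4) :* b :^ 2 :+ (:- K 96) :* (K 30 :* a :^ 2) :* b :^ 4 :+ (:- K 96) :* K 2 :* b :^ 6) refl (x i) (x j))
      twos : ∑ I (λ i → ∑ I (two i)) ≡ (- fromℕ 96) * (fromℕ 64 * S6 + fromℕ 60 * (S4 * S2))
      twos = trans (∑-cong I (λ i → trans (∑-cong I (two≡ i)) (trans (even6 x _ _ _ _)
               (solve 4 (λ a s t u → K 16 :* ((:- K 96) :* (K 2 :* a :^ 6)) :+ (:- K 96) :* (K 30 :* a :^ 4) :* s :+ (:- K 96) :* (K 30 :* a :^ 2) :* t :+ (:- K 96) :* K 2 :* u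
                  := (:- K 96) :* (K 2 :* u) :+ (:- K 96) :* (K 30 :* t) :* a :^ 2 :+ (:- K 96) :* (K 30 :* s) :* a :^ 4 :+ (:- K 96) :* K 32 :* a :^ 6) refl (x i) S2 S4 S6))))
             (trans (even6 x _ _ _ _) (solve 3 (λ s t u → K 16 :* ((:- K 96) :* (K 2 :* u)) :+ (:- K 96) :* (K 30 :* t) :* s :+ (:- K 96) :* (K 30 :* s) :* t :+ (:- K 96) :* K 32 :* u := (:- K 96) :* (K 64 :* u :+ K 60 :* (t :* s))) refl S2 S4 S6))
      three≡ : ∀ i j k → three i j k ≡ (fromℕ 4 * (x i ^ 6 + x j ^ 6) + fromℕ 60 * (x i ^ 4 * x j ^ 2 + x i ^ 2 * x j ^ 4))
                   + (fromℕ 60 * (x i ^ 4 + x j ^ 4) + fromℕ 360 * (x i ^ 2 * x j ^ 2)) * x k ^ 2 + fromℕ 60 * (x i ^ 2 + x j ^ 2) * x k ^ 4 + fromℕ 4 * x k ^ 6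
      three≡ i j k = trans (cong₂ _+_ (ev _ (trans (pl _ _) (cong₂ _+_ (trans (pl _ _) ui+j) uk))) (cong₂ _+_ (ev _ (trans (mi _ _) (cong₂ _-_ (trans (pl _ _) ui+j) uk)))
            (cong₂ _+_ (ev _ (trans (pl _ _) (cong₂ _+_ (trans (mi _ _) ui-j) uk))) (cong (_+ 0ℝ) (ev _ (trans (mi _ _) (cong₂ _-_ (trans (mi _ _) ui-j) uk)))))))
         (solve 3 (λ a b c → 𝟙 :* (a :+ b :+ c) :^ 6 :+ (𝟙 :* (a :+ b :- c) :^ 6 :+ (𝟙 :* (a :- b :+ c) :^ 6 :+ (𝟙 :* (a :- b :- c) :^ 6 :+ K 0)))
            := (K 4 :* (a :^ 6 :+ b :^ 6) :+ K 60 :* (a :^ 4 :* b :^ 2 :+ a :^ 2 :* b :^ 4)) :+ (K 60 :* (a :^ 4 :+ b :^ 4) :+ K 360 :* (a :^ 2 :* b :^ 2)) :* c :^ 2 :+ K 60 :* (a :^ 2 :+ b :^ 2) :* c :^ 4 :+ K 4 :* c :^ 6) refl (x i) (x j) (x k))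
        where
          uk = unit-· k x
          ui+j = cong₂ _+_ (unit-· i x) (unit-· j x)
          ui-j = cong₂ _-_ (unit-· i x) (unit-· j x)
          ev : ∀ s {t} → s ≡ t → 1ℝ * s ^ 6 ≡ 1ℝ * t ^ 6
          ev s refl = refl
      threes : ∑ I (λ i → ∑ I (λ j → ∑ I (three i j))) ≡ fromℕ 3072 * S6 + fromℕ 5760 * (S4 * S2) + fromℕ 360 * S2 ^ 3
      threes = trans (∑-cong I (λ i → trans (∑-cong I (λ j → trans (∑-cong I (three≡ i j)) (trans (even6 x _ _ _ _)
             (solve 5 (λ a b s t u → K 16 :* (K 4 :* (a :^ 6 :+ b :^ 6) :+ K 60 :* (a :^ 4 :* b :^ 2 :+ a :^ 2 :* b :^ 4)) :+ (K 60 :* (a :^ 4 :+ b :^ 4) :+ K 360 :* (a :^ 2 :* b :^ 2)) :* s :+ K 60 :* (a :^ 2 :+ b :^ 2) :* t :+ K 4 :* u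
                := (K 64 :* a :^ 6 :+ K 60 :* a :^ 4 :* s :+ K 60 :* a :^ 2 :* t :+ K 4 :* u) :+ (K 960 :* a :^ 4 :+ K 360 :* a :^ 2 :* s :+ K 60 :* t) :* b :^ 2 :+ (K 960 :* a :^ 2 :+ K 60 :* s) :* b :^ 4 :+ K 64 :* b :^ 6) refl (x i) (x j) S2 S4 S6))))
             (trans (even6 x _ _ _ _)
               (solve 4 (λ a s t u → K 16 :* (K 64 :* a :^ 6 :+ K 60 :* a :^ 4 :* s :+ K 60 :* a :^ 2 :* t :+ K 4 :* u) :+ (K 960 :* a :^ 4 :+ K 360 :* a :^ 2 :* s :+ K 60 :* t) :* s :+ (K 960 :* a :^ 2 :+ K 60 :* s) :* t :+ K 64 :* u
                 := (K 128 :* u :+ K 120 :* t :* s) :+ (K 1920 :* t :+ K 360 :* s :* s) :* a :^ 2 :+ K 1920 :* s :* a :^ 4 :+ K 1024 :* a :^ 6) refl (x i) S2 S4 S6))))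
             (trans (even6 x _ _ _ _) (solve 3 (λ s t u → K 16 :* (K 128 :* u :+ K 120 :* t :* s) :+ (K 1920 :* t :+ K 360 :* s :* s) :* s :+ K 1920 :* s :* t :+ K 1024 :* u := K 3072 :* u :+ K 5760 :* (t :* s) :+ K 360 :* s :^ 3) refl S2 S4 S6))

  -- Lower moments follow by applying the Laplacian to the previous identity.

  private
    line : ∀ (x y : Vec 16) t → (x ⊕ t ⊙ y) · (x ⊕ t ⊙ y) ≡ x · x + fromℕ 2 * t * (x · y) + t * t * (y · y)
    line x y t = trans (⊕-· x (t ⊙ y) _) (trans (cong₂ _+_ (trans (·-⊕ x x (t ⊙ y)) (cong (x · x +_) (·-⊙ t x y))) (trans (⊙-· t y _) (cong (t *_) (trans (·-⊕ y x (t ⊙ y)) (cong₂ _+_ (·-comm y x) (·-⊙ t y y))))))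
        (solve 4 (λ a b c t → a :+ t :* b :+ t :* (b :+ t :* c) := a :+ K 2 :* t :* b :+ t :* t :* c) refl (x · x) (x · y) (y · y) t))

    norm² : ∀ (v : Vec 16) → norm v ≡ ∑ I (λ i → (v · unit i) ^ 2)
    norm² v = trans (dot 16) (∑-cong I (λ i → trans (solve 1 (λ a → a :* a := a :^ 2) refl (v i)) (cong (_^ 2) (sym (·-unit v i)))))

    x-y≡0 : ∀ {x y} → x - y ≡ 0ℝ → x ≡ y
    x-y≡0 {x} {y} p = trans (solve 2 (λ x y → x := (x :- y) :+ y) refl x y) (trans (cong (_+ y) p) (+-identityˡ y))

    -- Summing the coefficient of t² over all unit directions turns the squares (v · unit i)² into
    -- the norm of v; this is the Laplacian without derivatives.
    trace : ∀ {A : Set} (vs : List A) (g : A → ℝ) (p : A → Vec 16) c →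
      (∀ i → ∑ vs (λ v → g v * (p v · unit i) ^ 2) ≡ c i) → ∑ vs (λ v → g v * norm (p v)) ≡ ∑ I c
    trace vs g p c h = trans (∑-cong vs (λ v → trans (cong (g v *_) (norm² (p v))) (sym (∑-*ˡ I (g v))))) (trans (∑-swap vs I) (∑-cong I h))

  fourth : ∀ x → ∑ nodes (λ v → wt v * (nd v · x) ^ 4 * norm (nd v)) ≡ fromℕ 1440 * (x · x) ^ 2
  fourth x = trans (trace nodes (λ v → wt v * (nd v · x) ^ 4) nd _ coeff) (trans (∑-*ˡ I (fromℕ 24)) (trans (cong (fromℕ 24 *_) (trans (∑-+ I) (cong₂ _+_ (∑-Fs-const 16 _) (trans (∑-*ˡ I _) (cong (fromℕ 12 * (x · x) *_) (sym (dot 16)))))))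
       (solve 1 (λ a → K 24 :* (K 16 :* (K 3 :* (a :* a)) :+ K 12 :* a :* a) := K 1440 :* a :^ 2) refl (x · x))))
    where
      coeff : ∀ i → ∑ nodes (λ v → wt v * (nd v · x) ^ 4 * (nd v · unit i) ^ 2) ≡ fromℕ 24 * (fromℕ 3 * ((x · x) * (x · x)) + fromℕ 12 * (x · x) * (x i * x i))
      coeff i = *-cancelˡ (fromℕ 15) (0<⇒≢ (0<ℕ 14)) (trans (x-y≡0 (sextic-coeff _ _ _ _ _ _ _ vanish))
          (trans (cong₂ (λ b c → fromℕ 360 * (fromℕ 3 * (a * a * c) + fromℕ 12 * (a * (b * b)))) (·-unit x i) (unit-norm i)) (solve 2 (λ a b → K 360 :* (K 3 :* (a :* a :* 𝟙) :+ K 12 :* (a :* (b :* b))) := K 15 :* (K 24 :* (K 3 :* (a :* a) :+ K 12 :* a :* (b :* b)))) refl a (x i))))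
        where
          a = x · x
          B = x · unit i
          C = unit i · unit i
          s : ℕ → ℕ → ℝ
          s p q = ∑ nodes (λ v → wt v * (nd v · x) ^ p * (nd v · unit i) ^ q)
          expand : ∀ t (vs : List (ℝ × Vec 16)) → ∑ vs (λ v → wt v * (nd v · (x ⊕ t ⊙ unit i)) ^ 6) ≡
             let s' = λ p q → ∑ vs (λ v → wt v * (nd v · x) ^ p * (nd v · unit i) ^ q) in
             s' 6 0 + t * (fromℕ 6 * s' 5 1) + t ^ 2 * (fromℕ 15 * s' 4 2) + t ^ 3 * (fromℕ 20 * s' 3 3) + t ^ 4 * (fromℕ 15 * s' 2 4) + t ^ 5 * (fromℕ 6 * s' 1 5) + t ^ 6 * s' 0 6
          expand t [] = solve 1 (λ t → K 0 := K 0 :+ t :* (K 6 :* K 0) :+ t :^ 2 :* (K 15 :* K 0) :+ t :^ 3 :* (K 20 :* K 0) :+ t :^ 4 :* (K 15 :* K 0) :+ t :^ 5 :* (K 6 :* K 0) :+ t :^ 6 :* K 0) refl t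
          expand t (v ∷ vs) = trans (cong₂ _+_ (cong (λ z → wt v * z ^ 6) (trans (·-⊕ (nd v) x _) (cong (nd v · x +_) (·-⊙ t (nd v) (unit i))))) (expand t vs))
            (solve 11 (λ t w a c s0 s1 s2 s3 s4 s5 s6 → w :* (a :+ t :* c) :^ 6 :+ (s0 :+ t :* (K 6 :* s1) :+ t :^ 2 :* (K 15 :* s2) :+ t :^ 3 :* (K 20 :* s3) :+ t :^ 4 :* (K 15 :* s4) :+ t :^ 5 :* (K 6 :* s5) :+ t :^ 6 :* s6)
              := (w :* a :^ 6 :* c :^ 0 :+ s0) :+ t :* (K 6 :* (w :* a :^ 5 :* c :^ 1 :+ s1)) :+ t :^ 2 :* (K 15 :* (w :* a :^ 4 :* c :^ 2 :+ s2)) :+ t :^ 3 :* (K 20 :* (w :* a :^ 3 :* c :^ 3 :+ s3)) :+ t :^ 4 :* (K 15 :* (w :* a :^ 2 :* c :^ 4 :+ s4)) :+ t :^ 5 :* (K 6 :* (w :* a :^ 1 :* c :^ 5 :+ s5)) :+ t :^ 6 :* (w :* a :^ 0 :* c :^ 6 :+ s6)) refl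
              t (wt v) (nd v · x) (nd v · unit i) _ _ _ _ _ _ _)
          vanish : ∀ t → (s 6 0 - fromℕ 360 * (a * a * a)) + t * (fromℕ 6 * s 5 1 - fromℕ 360 * (fromℕ 6 * (a * a * B))) + t ^ 2 * (fromℕ 15 * s 4 2 - fromℕ 360 * (fromℕ 3 * (a * a * C) + fromℕ 12 * (a * (B * B))))
                + t ^ 3 * (fromℕ 20 * s 3 3 - fromℕ 360 * (fromℕ 12 * (a * B * C) + fromℕ 8 * (B * B * B))) + t ^ 4 * (fromℕ 15 * s 2 4 - fromℕ 360 * (fromℕ 3 * (a * C * C) + fromℕ 12 * (B * B * C))) + t ^ 5 * (fromℕ 6 * s 1 5 - fromℕ 360 * (fromℕ 6 * (B * C * C))) + t ^ 6 * (s 0 6 - fromℕ 360 * (C * C * C)) ≡ 0ℝ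
          vanish t = trans (solve 11 (λ t a b c s0 s1 s2 s3 s4 s5 s6 →
               (s0 :- K 360 :* (a :* a :* a)) :+ t :* (K 6 :* s1 :- K 360 :* (K 6 :* (a :* a :* b))) :+ t :^ 2 :* (K 15 :* s2 :- K 360 :* (K 3 :* (a :* a :* c) :+ K 12 :* (a :* (b :* b)))) :+ t :^ 3 :* (K 20 :* s3 :- K 360 :* (K 12 :* (a :* b :* c) :+ K 8 :* (b :* b :* b))) :+ t :^ 4 :* (K 15 :* s4 :- K 360 :* (K 3 :* (a :* c :* c) :+ K 12 :* (b :* b :* c))) :+ t :^ 5 :* (K 6 :* s5 :- K 360 :* (K 6 :* (b :* c :* c))) :+ t :^ 6 :* (s6 :- K 360 :* (c :* c :* c))
                := (s0 :+ t :* (K 6 :* s1) :+ t :^ 2 :* (K 15 :* s2) :+ t :^ 3 :* (K 20 :* s3) :+ t :^ 4 :* (K 15 :* s4) :+ t :^ 5 :* (K 6 :* s5) :+ t :^ 6 :* s6) :- K 360 :* (a :+ K 2 :* t :* b :+ t :* t :* c) :^ 3) refl t a B C (s 6 0) (s 5 1) (s 4 2) (s 3 3) (s 2 4) (s 1 5) (s 0 6))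
             (trans (cong₂ (λ u w → u - fromℕ 360 * w ^ 3) (sym (expand t nodes)) (sym (line x (unit i) t))) (trans (cong (_- fromℕ 360 * (v · v) ^ 3) (sixth v)) (-‿inverseʳ _)))
            where v = x ⊕ t ⊙ unit i

  second : ∀ x → ∑ nodes (λ v → wt v * (nd v · x) ^ 2 * norm (nd v) * norm (nd v)) ≡ fromℕ 8640 * (x · x)
  second x = trans (trans (∑-cong nodes (λ v → solve 3 (λ w a n → w :* a :^ 2 :* n :* n := w :* n :* a :^ 2 :* n) refl (wt v) (nd v · x) (norm (nd v)))) (trace nodes (λ v → wt v * norm (nd v) * (nd v · x) ^ 2) nd _ coeff)) (trans (∑-*ˡ I (fromℕ 240)) (trans (cong (fromℕ 240 *_) (trans (∑-+ I) (cong₂ _+_ (∑-Fs-const 16 _) (trans (∑-*ˡ I _) (cong (fromℕ 4 *_) (sym (dot 16)))))))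
       (solve 1 (λ a → K 240 :* (K 16 :* (K 2 :* a) :+ K 4 :* a) := K 8640 :* a) refl (x · x))))
    where
      coeff : ∀ i → ∑ nodes (λ v → wt v * norm (nd v) * (nd v · x) ^ 2 * (nd v · unit i) ^ 2) ≡ fromℕ 240 * (fromℕ 2 * (x · x) + fromℕ 4 * (x i * x i))
      coeff i = *-cancelˡ (fromℕ 6) (0<⇒≢ (0<ℕ 5)) (trans (x-y≡0 (proj₁ (proj₂ (quartic-coeffs _ _ _ _ _ vanish))))
          (trans (cong₂ (λ b c → fromℕ 1440 * (fromℕ 2 * (a * c) + fromℕ 4 * (b * b))) (·-unit x i) (unit-norm i)) (solve 2 (λ a b → K 1440 :* (K 2 :* (a :* 𝟙) :+ K 4 :* (b :* b)) := K 6 :* (K 240 :* (K 2 :* a :+ K 4 :* (b :* b)))) refl a (x i))))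
        where
          a = x · x
          B = x · unit i
          C = unit i · unit i
          s : ℕ → ℕ → ℝ
          s p q = ∑ nodes (λ v → wt v * norm (nd v) * (nd v · x) ^ p * (nd v · unit i) ^ q)
          expand : ∀ t (vs : List (ℝ × Vec 16)) → ∑ vs (λ v → wt v * (nd v · (x ⊕ t ⊙ unit i)) ^ 4 * norm (nd v)) ≡
             let s' = λ p q → ∑ vs (λ v → wt v * norm (nd v) * (nd v · x) ^ p * (nd v · unit i) ^ q) in
             s' 4 0 + t * (fromℕ 4 * s' 3 1) + t ^ 2 * (fromℕ 6 * s' 2 2) + t ^ 3 * (fromℕ 4 * s' 1 3) + t ^ 4 * s' 0 4
          expand t [] = solve 1 (λ t → K 0 := K 0 :+ t :* (K 4 :* K 0) :+ t :^ 2 :* (K 6 :* K 0) :+ t :^ 3 :* (K 4 :* K 0) :+ t :^ 4 :* K 0) refl t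
          expand t (v ∷ vs) = trans (cong₂ _+_ (cong (λ z → wt v * z ^ 4 * norm (nd v)) (trans (·-⊕ (nd v) x _) (cong (nd v · x +_) (·-⊙ t (nd v) (unit i))))) (expand t vs))
            (solve 10 (λ t w n a c s0 s1 s2 s3 s4 → w :* (a :+ t :* c) :^ 4 :* n :+ (s0 :+ t :* (K 4 :* s1) :+ t :^ 2 :* (K 6 :* s2) :+ t :^ 3 :* (K 4 :* s3) :+ t :^ 4 :* s4)
              := (w :* n :* a :^ 4 :* c :^ 0 :+ s0) :+ t :* (K 4 :* (w :* n :* a :^ 3 :* c :^ 1 :+ s1)) :+ t :^ 2 :* (K 6 :* (w :* n :* a :^ 2 :* c :^ 2 :+ s2)) :+ t :^ 3 :* (K 4 :* (w :* n :* a :^ 1 :* c :^ 3 :+ s3)) :+ t :^ 4 :* (w :* n :* a :^ 0 :* c :^ 4 :+ s4)) refl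
              t (wt v) (norm (nd v)) (nd v · x) (nd v · unit i) _ _ _ _ _)
          vanish : ∀ t → quartic (s 4 0 - fromℕ 1440 * (a * a)) (fromℕ 4 * s 3 1 - fromℕ 1440 * (fromℕ 4 * (a * B))) (fromℕ 6 * s 2 2 - fromℕ 1440 * (fromℕ 2 * (a * C) + fromℕ 4 * (B * B))) (fromℕ 4 * s 1 3 - fromℕ 1440 * (fromℕ 4 * (B * C))) (s 0 4 - fromℕ 1440 * (C * C)) t ≡ 0ℝ
          vanish t = trans (solve 9 (λ t a b c s0 s1 s2 s3 s4 →
               (s0 :- K 1440 :* (a :* a)) :+ t :* (K 4 :* s1 :- K 1440 :* (K 4 :* (a :* b))) :+ t :^ 2 :* (K 6 :* s2 :- K 1440 :* (K 2 :* (a :* c) :+ K 4 :* (b :* b))) :+ t :^ 3 :* (K 4 :* s3 :- K 1440 :* (K 4 :* (b :* c))) :+ t :^ 4 :* (s4 :- K 1440 :* (c :* c))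
                := (s0 :+ t :* (K 4 :* s1) :+ t :^ 2 :* (K 6 :* s2) :+ t :^ 3 :* (K 4 :* s3) :+ t :^ 4 :* s4) :- K 1440 :* (a :+ K 2 :* t :* b :+ t :* t :* c) :^ 2) refl t a B C (s 4 0) (s 3 1) (s 2 2) (s 1 3) (s 0 4))
             (trans (cong₂ (λ u w → u - fromℕ 1440 * w ^ 2) (sym (expand t nodes)) (sym (line x (unit i) t))) (trans (cong (_- fromℕ 1440 * (v · v) ^ 2) (fourth v)) (-‿inverseʳ _)))
            where v = x ⊕ t ⊙ unit i

  mass : ∑ nodes (λ v → wt v * norm (nd v) * norm (nd v) * norm (nd v)) ≡ fromℕ 138240
  mass = trans (trace nodes (λ v → wt v * norm (nd v) * norm (nd v)) nd (λ _ → fromℕ 8640) (λ i → trans (∑-cong nodes (λ v → solve 3 (λ w a n → w :* n :* n :* a :^ 2 := w :* a :^ 2 :* n :* n) refl (wt v) (nd v · unit i) (norm (nd v)))) (trans (second (unit i)) (trans (cong (fromℕ 8640 *_) (unit-norm i)) (*-identityʳ _)))))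
          (trans (∑-Fs-const 16 _) (sym (fromℕ-* 16 8640)))

 -- Exceptional cases: a single vector in shell 2, the size of Min(Λ), and shell 1 for r near 6.

 module Special (𝒮 : Setting) where
  open Setting 𝒮
  open Bounds 𝒮 public
  open Cubature

  private
    F-ext : ∀ (β : Vec 16) (f : ℝ → ℝ → ℝ) → Respects (λ y → f (y · α) (y · β))
    F-ext β f p = cong₂ f (·-cong p (λ i → refl)) (·-cong p (λ i → refl))

    shells : ∀ (β : Vec 16) (f : ℝ → ℝ → ℝ) → ∑ L (λ y → f (y · α) (y · β)) ≡ ∑ (N (ℤ.+ 0)) (λ y → f 0ℝ (y · β))
       + ∑ (N (ℤ.+ 1)) (λ y → f (fromℕ 1) (y · β) + f (- fromℕ 1) (- (y · β))) + ∑ (N (ℤ.+ 2)) (λ y → f (fromℕ 2) (y · β) + f (- fromℕ 2) (- (y · β)))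
       + ∑ (N (ℤ.+ 3)) (λ y → f (fromℕ 3) (y · β) + f (- fromℕ 3) (- (y · β)))
    shells β f = trans (∑-shells _ (F-ext β f)) (cong₂ _+_ (cong₂ _+_ (cong₂ _+_ (∑-cong∈ (N (ℤ.+ 0)) (λ y p → cong (λ t → f t (y · β)) (proj₂ (∈N {ℤ.+ 0} p)))) (pr (ℤ.+ 1))) (pr (ℤ.+ 2))) (pr (ℤ.+ 3)))
      where
        pr : ∀ z → ∑ (N z) (λ y → f (y · α) (y · β) + f ((𝟎 ⊖ y) · α) ((𝟎 ⊖ y) · β)) ≡ ∑ (N z) (λ y → f (fromℤ z) (y · β) + f (- fromℤ z) (- (y · β)))
        pr z = ∑-cong∈ (N z) (λ y p → cong₂ _+_ (cong (λ t → f t (y · β)) (proj₂ (∈N {z} p))) (cong₂ f (trans (neg-· y α) (cong -_ (proj₂ (∈N {z} p)))) (neg-· y β)))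

    empty : ∀ (xs : List (Vec 16)) {f} → length xs ≡ 0 → ∑ xs f ≡ 0ℝ
    empty [] e = refl

    -- The design values of these mixed moments all carry the factor α · β.
    ⊥-moments : ∀ β → α · β ≡ 0ℝ → ∑ L (λ y → (y · α) ^ 3 * (y · β)) ≡ 0ℝ × ∑ L (λ y → (y · α) * (y · β)) ≡ 0ℝ × ∑ L (λ y → (y · β) ^ 3 * (y · α)) ≡ 0ℝ
    ⊥-moments β e = *-cancelˡ (fromℕ 96) (0<⇒≢ (0<ℕ 95)) (trans (D31 α β) (trans (cong (λ t → ℓ * (m * m) * ((α · α) * t)) e) (solve 2 (λ l a → l :* (a :* K 0) := K 96 :* K 0) refl (ℓ * (m * m)) (α · α))))
                  , *-cancelˡ (fromℕ 16) (0<⇒≢ (0<ℕ 15)) (trans (D11 α β) (trans (cong (ℓ * m *_) e) (solve 1 (λ l → l :* K 0 := K 16 :* K 0) refl (ℓ * m))))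
                  , *-cancelˡ (fromℕ 96) (0<⇒≢ (0<ℕ 95)) (trans (D31 β α) (trans (cong (λ t → ℓ * (m * m) * ((β · β) * t)) (trans (·-comm β α) e)) (solve 2 (λ l a → l :* (a :* K 0) := K 96 :* K 0) refl (ℓ * (m * m)) (β · β))))

    α⊥P : ∀ x → α · P x ≡ 0ℝ
    α⊥P x = trans (·-comm α (P x)) (P-⊥ x)

  -- The third moments give Σ_{N 2} x ∈ ℝα, so a single vector in N 2 would be parallel to α.
  single⇒r≡4 : n₂ ≡ 1 → n₃ ≡ 0 → r ≡ fromℕ 4
  single⇒r≡4 e₂ e₃ = go (N (ℤ.+ 2)) refl
    where
      open Shell 2
      -- t³ - t kills the shells 0 and ±1 and equals 6 at 2. With shell 3 empty, the vanishing
      -- moments of degrees 3 and 1 speak about shell 2 alone.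
      weighted : ∀ β → α · β ≡ 0ℝ → ∑ xs (λ y → y · β) ≡ 0ℝ
      weighted β e = *-cancelˡ (fromℕ 12) (0<⇒≢ (0<ℕ 11)) (begin
          fromℕ 12 * ∑ xs (λ y → y · β) ≡⟨ solve 1 (λ a → a := K 0 :+ K 0 :+ a :+ K 0) refl _ ⟩
          0ℝ + 0ℝ + fromℕ 12 * ∑ xs (λ y → y · β) + 0ℝ ≡⟨ sym (cong₂ _+_ (cong₂ _+_ (cong₂ _+_ (trans (∑-cong (N (ℤ.+ 0)) (λ y → solve 1 (λ t → (K 0 :^ 3 :- K 0) :* t := K 0) refl (y · β))) (∑-zero (N (ℤ.+ 0))))
                   (trans (∑-cong (N (ℤ.+ 1)) (λ y → solve 1 (λ t → (K 1 :^ 3 :- K 1) :* t :+ ((:- K 1) :^ 3 :- (:- K 1)) :* (:- t) := K 0) refl (y · β))) (∑-zero (N (ℤ.+ 1)))))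
                   (trans (∑-cong xs (λ y → solve 1 (λ t → (K 2 :^ 3 :- K 2) :* t :+ ((:- K 2) :^ 3 :- (:- K 2)) :* (:- t) := K 12 :* t) refl (y · β))) (∑-*ˡ xs (fromℕ 12)))) (empty (N (ℤ.+ 3)) e₃)) ⟩
          _ ≡⟨ sym (shells β (λ a c → (a ^ 3 - a) * c)) ⟩
          ∑ L (λ y → ((y · α) ^ 3 - (y · α)) * (y · β)) ≡⟨ ∑-cong L (λ y → solve 2 (λ a c → (a :^ 3 :- a) :* c := a :^ 3 :* c :- a :* c) refl (y · α) (y · β)) ⟩
          ∑ L (λ y → (y · α) ^ 3 * (y · β) - (y · α) * (y · β)) ≡⟨ ∑-- L ⟩
          ∑ L (λ y → (y · α) ^ 3 * (y · β)) - ∑ L (λ y → (y · α) * (y · β)) ≡⟨ cong₂ _-_ (proj₁ (⊥-moments β e)) (proj₁ (proj₂ (⊥-moments β e))) ⟩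
          0ℝ - 0ℝ ≡⟨ solve 0 (K 0 :- K 0 := K 12 :* K 0) refl ⟩
          fromℕ 12 * 0ℝ ∎)
        where open ≡-Reasoning
      go : ∀ ys → ys ≡ xs → r ≡ fromℕ 4
      go [] e = ⊥-elim (absurd (trans (cong length e) e₂))
        where
          absurd : ¬ (0 ≡ 1)
          absurd ()
      go (x ∷ []) e = trans (solve 1 (λ r → r := (r :- K 4) :+ K 4) refl r) (trans (cong (_+ fromℕ 4) (trans (sym (trans (cong (_* m*) (solve 2 (λ m i → m :- K 2 :* K 2 :* i := 𝟙 :* m :- K 4 :* i) refl m ρ)) (trans (mm*ρ 1ℝ (fromℕ 4)) (cong (_- fromℕ 4) (*-identityˡ r))))) (trans (cong (_* m*) ν≡0) (zeroˡ m*)))) (+-identityˡ _))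
        where
          ν≡0 : ν ≡ 0ℝ
          ν≡0 = trans (sym (κν x (subst (x ∈_) e (here refl)))) (trans (trans (P-P x x) (·-comm (P x) x)) (trans (solve 1 (λ a → a := a :+ K 0) refl (x · P x)) (trans (cong (λ l → ∑ l (λ y → y · P x)) e) (weighted (P x) (α⊥P x)))))
      go (x ∷ y ∷ ys) e = ⊥-elim (absurd (trans (cong length e) e₂))
        where
          absurd : ∀ {k} → ¬ (suc (suc k) ≡ 1)
          absurd ()

  private
    two-terms : ∀ (xs : List (Vec 16)) {f} → (∀ x → 0ℝ ≤ f x) → ∀ {x y} → x ∈ xs → y ∈ xs → ¬ (x ≡ y) → f x + f y ≤ ∑ xs f
    two-terms (z ∷ xs) h (here refl) (here refl) ne = ⊥-elim (ne refl)
    two-terms (z ∷ xs) {f} h (here refl) (there q) ne = +-mono-≤ (≤-refl {f z}) (term≤∑ xs (λ y _ → h y) q)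
    two-terms (z ∷ xs) {f} h {x} (there p) (here refl) ne = ≤-trans (≡⇒≤ (+-comm (f x) (f z))) (+-mono-≤ (≤-refl {f z}) (term≤∑ xs (λ y _ → h y) p))
    two-terms (z ∷ xs) {f} h (there p) (there q) ne = ≤-trans (two-terms xs h p q ne) (≤-by (f z) (h z) (+-comm _ _))

  -- Lower bound for antipodal 4-designs, from the polynomial (u² - 1/18)² at a single point.
  272≤length : ∀ x → x ∈ L → 272 ℕ.≤ length L
  272≤length x p = fromℕ-cancel-≤ (*-cancel-≤ˡ (fromℕ 17 * (m * m * (m * m))) (*-pos (0<ℕ 16) m⁴>0) (≤-trans (≡⇒≤ (solve 1 (λ m → K 17 :* (m :* m :* (m :* m)) :* K 272 := K 8 :* ((K 18 :* m :^ 2 :- m :* m) :^ 2 :+ (K 18 :* m :^ 2 :- m :* m) :^ 2)) refl m))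
      (≤-trans (*-mono-≤ˡ (fromℕ 8) (0≤ℕ 8) terms) (≡⇒≤ total))))
    where
      m⁴>0 = *-pos (*-pos m>0 m>0) (*-pos m>0 m>0)
      f : Vec 16 → ℝ
      f y = (fromℕ 18 * (y · x) ^ 2 - m * m) ^ 2
      f≥0 : ∀ y → 0ℝ ≤ f y
      f≥0 y = subst (0ℝ ≤_) (solve 1 (λ a → a :* a := a :^ 2) refl w) (0≤sq w)
        where w = fromℕ 18 * (y · x) ^ 2 - m * m
      ix = proj₁ (∈L p)
      nx = norm-L p
      opp : ∃ λ y → y ∈ L × (𝟎 ⊖ x) ≈v y
      opp = find (any-L (InLattice-neg {b = b} ix) (⊙-NonZero (subst (0ℝ <_) (sym (trans (neg-norm x) nx)) m>0)) (trans (neg-norm x) nx))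
      y = proj₁ opp
      yx : y · x ≡ - m
      yx = trans (·-cong (≈v-sym (proj₂ (proj₂ opp))) (λ i → refl)) (trans (neg-· x x) (cong -_ nx))
      x≢y : ¬ (x ≡ y)
      x≢y e = <-irrefl (sym 2m≡0) (0<+ m>0 (<⇒≤ m>0))
        where
          2m≡0 : m + m ≡ 0ℝ
          2m≡0 = trans (cong (_+ m) (trans (sym nx) (trans (cong (_· x) e) yx))) (-‿inverseˡ m)
      -- The points x and -x contribute (17 m²)² each, and the other terms are squares. With the
      -- total 17 m⁴ ℓ / 8 this yields ℓ ≥ 16 · 17.
      terms : (fromℕ 18 * m ^ 2 - m * m) ^ 2 + (fromℕ 18 * m ^ 2 - m * m) ^ 2 ≤ ∑ L f
      terms = ≤-trans (≡⇒≤ (sym (cong₂ _+_ (cong (λ t → (fromℕ 18 * t ^ 2 - m * m) ^ 2) nx) (trans (cong (λ t → (fromℕ 18 * t ^ 2 - m * m) ^ 2) yx) (solve 1 (λ m → (K 18 :* (:- m) :^ 2 :- m :* m) :^ 2 := (K 18 :* m :^ 2 :- m :* m) :^ 2) refl m)))))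
                (two-terms L {f} f≥0 p (proj₁ (proj₂ opp)) x≢y)
      T4 = ∑ L (λ y → (y · x) ^ 4)
      T2 = ∑ L (λ y → (y · x) ^ 2)
      total : fromℕ 8 * ∑ L f ≡ fromℕ 17 * (m * m * (m * m)) * ℓ
      total = begin
        fromℕ 8 * ∑ L f ≡⟨ cong (fromℕ 8 *_) (trans (∑-cong L (λ y → solve 2 (λ a m → (K 18 :* a :^ 2 :- m :* m) :^ 2 := K 324 :* a :^ 4 :+ (:- (K 36 :* (m :* m))) :* a :^ 2 :+ m :* m :* (m :* m)) refl (y · x) m))
               (trans (∑-+ L) (cong₂ _+_ (trans (∑-+ L) (cong₂ _+_ (∑-*ˡ L _) (∑-*ˡ L _))) (∑-const L _)))) ⟩
        fromℕ 8 * (fromℕ 324 * T4 + (- (fromℕ 36 * (m * m))) * T2 + ℓ * (m * m * (m * m))) ≡⟨ solve 4 (λ s t m l → K 8 :* (K 324 :* s :+ (:- (K 36 :* (m :* m))) :* t :+ l :* (m :* m :* (m :* m))) := K 27 :* (K 96 :* s) :- K 18 :* (m :* m) :* (K 16 :* t) :+ K 8 :* (l :* (m :* m :* (m :* m)))) refl T4 T2 m ℓ ⟩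
        fromℕ 27 * (fromℕ 96 * T4) - fromℕ 18 * (m * m) * (fromℕ 16 * T2) + fromℕ 8 * (ℓ * (m * m * (m * m))) ≡⟨ cong₂ (λ u v → fromℕ 27 * u - fromℕ 18 * (m * m) * v + fromℕ 8 * (ℓ * (m * m * (m * m)))) (trans (D40 x) (cong (λ t → ℓ * (m * m) * (t * t)) nx)) (trans (D20 x) (cong (ℓ * m *_) nx)) ⟩
        fromℕ 27 * (ℓ * (m * m) * (m * m)) - fromℕ 18 * (m * m) * (ℓ * m * m) + fromℕ 8 * (ℓ * (m * m * (m * m))) ≡⟨ solve 2 (λ m l → K 27 :* (l :* (m :* m) :* (m :* m)) :- K 18 :* (m :* m) :* (l :* m :* m) :+ K 8 :* (l :* (m :* m :* (m :* m))) := K 17 :* (m :* m :* (m :* m)) :* l) refl m ℓ ⟩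
        fromℕ 17 * (m * m * (m * m)) * ℓ ∎
        where open ≡-Reasoning

  -- Linear programming bound for N 1, which is nearly a 3-design in dimension 15,
  -- with the polynomial u² (8u + 3)² (400u - 161) (5u + 4).
  module FirstShell (s : ℕ) (2s : length L ≡ 2 ℕ.* s) (6≤r : fromℕ 6 ≤ r) (39r≤239 : fromℕ 39 * r ≤ fromℕ 239)
    (n₃0 : n₃ ≡ 0) (n₂≤3 : n₂ ℕ.≤ 3) (ℓ>0 : 0ℝ < ℓ) where
    open Shell 1
    private
      module S₂ = Shell 2
      ν₂ = S₂.ν
      N₂ = fromℕ n₂

      by-m* : ∀ {x} → 0ℝ ≤ x * m* → 0ℝ ≤ x
      by-m* {x} p = 0≤-cancelˡ m* m*>0 (subst (0ℝ ≤_) (*-comm x m*) p)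

      m≤6/5ν : fromℕ 5 * m ≤ fromℕ 6 * ν
      m≤6/5ν = 0≤⇒≤ (by-m* (subst (0ℝ ≤_) (trans (solve 1 (λ r → r :- K 6 := K 1 :* r :- K 6) refl r) (trans (sym (mm*ρ (fromℕ 1) (fromℕ 6))) (cong (_* m*) (solve 2 (λ m i → K 1 :* m :- K 6 :* i := K 6 :* (m :- K 1 :* K 1 :* i) :- K 5 :* m) refl m ρ)))) (≤⇒0≤ 6≤r)))

      ν>0 : 0ℝ < ν
      ν>0 = *-cancel-<ˡ (fromℕ 6) (0<ℕ 5) (subst (_< fromℕ 6 * ν) (sym (zeroʳ _)) (<-≤-trans (*-pos (0<ℕ 4) m>0) m≤6/5ν))

      ν≥0 = <⇒≤ ν>0

      -- 2κ ≤ m - 2ρ, and 200 (r - 2) ≤ 161 (r - 1) is the same as 39 r ≤ 239. The root 161/400 of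
      -- the polynomial comes from here.
      κ-upper : ∀ x y → x ∈ xs → y ∈ xs → ¬ (x ≈v y) → fromℕ 400 * κ x y - fromℕ 161 * ν ≤ 0ℝ
      κ-upper x y p q ne = subst (fromℕ 400 * κ x y - fromℕ 161 * ν ≤_) (-‿inverseʳ (fromℕ 161 * ν)) (+-mono-≤ʳ _ (≤-trans (≡⇒≤ (solve 1 (λ k → K 400 :* k := K 200 :* (K 2 :* k)) refl (κ x y))) (≤-trans (*-mono-≤ˡ (fromℕ 200) (0≤ℕ 200) (κ≤ x y p q ne))
         (0≤⇒≤ (by-m* (subst (0ℝ ≤_) (trans (solve 1 (λ r → K 239 :- K 39 :* r := :- (K 39 :* r :- K 239)) refl r) (trans (cong -_ (sym (mm*ρ (fromℕ 39) (fromℕ 239)))) (solve 3 (λ m i d → :- ((K 39 :* m :- K 239 :* i) :* d) := (K 161 :* (m :- K 1 :* K 1 :* i) :- K 200 :* (m :- K 2 :* (K 1 :* K 1) :* i)) :* d) refl m ρ m*))) (≤⇒0≤ 39r≤239)))))))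

      -- Two vectors of shell 1 are never opposite, since x + y has inner product 2 with α; so
      -- `half⁻` applies.
      κ-lower : ∀ x y → x ∈ xs → y ∈ xs → 0ℝ ≤ fromℕ 5 * κ x y + fromℕ 4 * ν
      κ-lower x y p q = 0≤-cancelˡ (fromℕ 2) (0<ℕ 1) (subst (0ℝ ≤_) eq (0≤+ (0≤* (0≤ℕ 5) (≤⇒0≤ lower)) (0≤* (0≤ℕ 3) m-6ρ)))
        where
          lower : - m ≤ fromℕ 2 * (x · y)
          lower = half⁻ x y (proj₁ (∈N {ℤ.+ 1} p)) (proj₁ (∈N {ℤ.+ 1} q)) (λ e → <-irrefl (sym (trans (sym (cong₂ _+_ (proj₂ (∈N {ℤ.+ 1} p)) (proj₂ (∈N {ℤ.+ 1} q)))) e)) (0<+ (0<ℕ 0) (0≤ℕ 1)))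
          m-6ρ : 0ℝ ≤ m - fromℕ 6 * ρ
          m-6ρ = by-m* (subst (0ℝ ≤_) (trans (solve 1 (λ r → r :- K 6 := 𝟙 :* r :- K 6) refl r) (trans (sym (mm*ρ 1ℝ (fromℕ 6))) (cong (_* m*) (solve 2 (λ m i → 𝟙 :* m :- K 6 :* i := m :- K 6 :* i) refl m ρ)))) (≤⇒0≤ 6≤r))
          eq : fromℕ 5 * (fromℕ 2 * (x · y) - (- m)) + fromℕ 3 * (m - fromℕ 6 * ρ) ≡ fromℕ 2 * (fromℕ 5 * κ x y + fromℕ 4 * ν)
          eq = trans (solve 3 (λ c m i → K 5 :* (K 2 :* c :- (:- m)) :+ K 3 :* (m :- K 6 :* i) := K 2 :* (K 5 :* (c :- K 1 :* K 1 :* i) :+ K 4 :* (m :- K 1 :* K 1 :* i))) refl (x · y) m ρ) (cong (λ t → fromℕ 2 * (fromℕ 5 * t + fromℕ 4 * ν)) (sym (κ≡ x y p q)))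

      -- 85 = 15 · 17 / 3 is the value for a 4-design in dimension 15. It is Cauchy-Schwarz for the
      -- kernel (u · v)⁴ against the projection of all of Min(Λ), whose moments the design
      -- identities determine.
      4th : N# * N# * ν ^ 4 ≤ fromℕ 85 * KK 4
      4th = *-cancel-≤ˡ (E * E) (*-pos E>0 E>0) (≤-trans (≡⇒≤ (sym lhs)) (≤-trans (*-mono-≤ˡ (fromℕ 96 * fromℕ 96) (0≤* (0≤ℕ 96) (0≤ℕ 96)) disc) (≡⇒≤ rhs)))
        where
          E = ℓ * (m * m)
          E>0 : 0ℝ < E
          E>0 = *-pos ℓ>0 (*-pos m>0 m>0)
          XX = ∑ xs (λ x → ∑ xs (λ y → (1ℝ * 1ℝ) * (P x · P y) ^ 4))
          XY = ∑ xs (λ x → ∑ L (λ y → (1ℝ * 1ℝ) * (P x · P y) ^ 4))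
          YY = ∑ L (λ x → ∑ L (λ y → (1ℝ * 1ℝ) * (P x · P y) ^ 4))
          XX≡ : XX ≡ KK 4
          XX≡ = ∑-cong xs (λ x → ∑-cong xs (λ y → solve 1 (λ a → 𝟙 :* 𝟙 :* a := a) refl (κ x y ^ 4)))
          inner : ∀ x → fromℕ 96 * ∑ L (λ y → (1ℝ * 1ℝ) * (P x · P y) ^ 4) ≡ E * (norm (P x) * norm (P x))
          inner x = trans (cong (fromℕ 96 *_) (∑-cong L (λ y → trans (cong (λ t → (1ℝ * 1ℝ) * t ^ 4) (trans (P-P x y) (·-comm (P x) y))) (solve 1 (λ a → 𝟙 :* 𝟙 :* a := a) refl ((y · P x) ^ 4))))) (D40 (P x))
          XY≡ : fromℕ 96 * XY ≡ N# * (E * (ν * ν))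
          XY≡ = trans (sym (∑-*ˡ xs (fromℕ 96))) (trans (∑-cong∈ xs (λ x p → trans (inner x) (cong (λ t → E * (t * t)) (κν x p)))) (∑-const xs _))
          sq : ∀ y → y ∈ L → norm (P y) * norm (P y) ≡ m * m + (- (fromℕ 2 * m * ρ)) * (y · α) ^ 2 + ρ * ρ * (y · α) ^ 4
          sq y p = trans (cong (λ t → t * t) (trans (P·P y y) (cong (_- (y · α) * (y · α) * ρ) (norm-L p)))) (solve 3 (λ m a i → (m :- a :* a :* i) :* (m :- a :* a :* i) := m :* m :+ (:- (K 2 :* m :* i)) :* a :^ 2 :+ i :* i :* a :^ 4) refl m (y · α) ρ)
          YY≡ : fromℕ 96 * (fromℕ 96 * YY) ≡ fromℕ 85 * (E * E)
          YY≡ = begin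
            fromℕ 96 * (fromℕ 96 * YY) ≡⟨ cong (fromℕ 96 *_) (trans (sym (∑-*ˡ L (fromℕ 96))) (trans (∑-cong∈ L (λ y p → trans (inner y) (cong (E *_) (sq y p)))) (∑-*ˡ L E))) ⟩
            fromℕ 96 * (E * ∑ L (λ y → m * m + (- (fromℕ 2 * m * ρ)) * (y · α) ^ 2 + ρ * ρ * (y · α) ^ 4)) ≡⟨ cong (λ t → fromℕ 96 * (E * t)) (trans (∑-+ L) (cong₂ _+_ (trans (∑-+ L) (cong₂ _+_ (∑-const L _) (∑-*ˡ L _))) (∑-*ˡ L _))) ⟩
            fromℕ 96 * (E * (ℓ * (m * m) + (- (fromℕ 2 * m * ρ)) * T2 + ρ * ρ * T4)) ≡⟨ solve 6 (λ e l m i s t → K 96 :* (e :* (l :* (m :* m) :+ (:- (K 2 :* m :* i)) :* s :+ i :* i :* t)) := e :* (K 96 :* (l :* (m :* m)) :- K 12 :* m :* i :* (K 16 :* s) :+ i :* i :* (K 96 :* t))) refl E ℓ m ρ T2 T4 ⟩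
            E * (fromℕ 96 * E - fromℕ 12 * m * ρ * (fromℕ 16 * T2) + ρ * ρ * (fromℕ 96 * T4)) ≡⟨ cong₂ (λ u v → E * (fromℕ 96 * E - fromℕ 12 * m * ρ * u + ρ * ρ * v)) (trans (D20 α) (cong (ℓ * m *_) normα)) (trans (D40 α) (cong (λ t → E * (t * t)) normα)) ⟩
            E * (fromℕ 96 * E - fromℕ 12 * m * ρ * (ℓ * m * m*) + ρ * ρ * (E * (m* * m*))) ≡⟨ solve 5 (λ e l m i d → e :* (K 96 :* (l :* (m :* m)) :- K 12 :* m :* i :* (l :* m :* d) :+ i :* i :* (l :* (m :* m) :* (d :* d))) := e :* (l :* (m :* m) :* (K 96 :- K 12 :* (d :* i) :+ (d :* i) :* (d :* i)))) refl E ℓ m ρ m* ⟩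
            E * (E * (fromℕ 96 - fromℕ 12 * (m* * ρ) + (m* * ρ) * (m* * ρ))) ≡⟨ cong (λ t → E * (E * (fromℕ 96 - fromℕ 12 * t + t * t))) m*ρ ⟩
            E * (E * (fromℕ 96 - fromℕ 12 * 1ℝ + 1ℝ * 1ℝ)) ≡⟨ solve 1 (λ e → e :* (e :* (K 96 :- K 12 :* 𝟙 :+ 𝟙 :* 𝟙)) := K 85 :* (e :* e)) refl E ⟩
            fromℕ 85 * (E * E) ∎
            where
              open ≡-Reasoning
              T2 = ∑ L (λ y → (y · α) ^ 2)
              T4 = ∑ L (λ y → (y · α) ^ 4)
          YY>0 : 0ℝ < YY
          YY>0 = *-cancel-<ˡ (fromℕ 96) (0<ℕ 95) (*-cancel-<ˡ (fromℕ 96) (0<ℕ 95) (subst₂ _<_ (solve 0 (K 0 := K 96 :* (K 96 :* K 0)) refl) (sym YY≡) (*-pos (0<ℕ 84) (*-pos E>0 E>0))))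
          disc : XY * XY ≤ XX * YY
          disc = discriminant (λ l → psd-two (λ u w → (u · w) ^ 4) (psd-pow 4) (λ u w → cong (_^ 4) (·-comm u w)) xs (λ _ → 1ℝ) P L (λ _ → 1ℝ) P l) YY>0
          lhs : fromℕ 96 * fromℕ 96 * (XY * XY) ≡ E * E * (N# * N# * ν ^ 4)
          lhs = trans (solve 1 (λ x → K 96 :* K 96 :* (x :* x) := (K 96 :* x) :* (K 96 :* x)) refl XY) (trans (cong (λ t → t * t) XY≡) (solve 3 (λ n e v → n :* (e :* (v :* v)) :* (n :* (e :* (v :* v))) := e :* e :* (n :* n :* v :^ 4)) refl N# E ν))
          rhs : fromℕ 96 * fromℕ 96 * (XX * YY) ≡ E * E * (fromℕ 85 * KK 4)
          rhs = trans (solve 2 (λ x y → K 96 :* K 96 :* (x :* y) := x :* (K 96 :* (K 96 :* y))) refl XX YY) (trans (cong₂ _*_ XX≡ YY≡) (solve 2 (λ k e → k :* (K 85 :* (e :* e)) := e :* e :* (K 85 :* k)) refl (KK 4) E))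

      -- 323 = 17 · 19 is the value for a 6-design in dimension 15. The design identities stop at
      -- degree 4, so the comparison family is the projected set `nodes`; its weights may be
      -- negative in Cauchy-Schwarz.
      6th : N# * N# * ν ^ 6 ≤ fromℕ 323 * KK 6
      6th = *-cancel-≤ˡ (fromℕ 360 * fromℕ 360) (*-pos (0<ℕ 359) (0<ℕ 359)) (≤-trans (≡⇒≤ (trans (solve 2 (λ n v → K 360 :* K 360 :* (n :* n :* v :^ 6) := n :* (K 360 :* v :^ 3) :* (n :* (K 360 :* v :^ 3))) refl N# ν) (sym (cong (λ t → t * t) XY≡))))
               (≤-trans disc (≡⇒≤ (trans (cong₂ _*_ XX≡ YY≡) (solve 1 (λ k → k :* (K 360 :* K 116280) := K 360 :* K 360 :* (K 323 :* k)) refl (KK 6))))))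
        where
          XX = ∑ xs (λ x → ∑ xs (λ y → (1ℝ * 1ℝ) * (P x · P y) ^ 6))
          XY = ∑ xs (λ x → ∑ nodes (λ v → (1ℝ * wt v) * (P x · P (nd v)) ^ 6))
          YY = ∑ nodes (λ u → ∑ nodes (λ v → (wt u * wt v) * (P (nd u) · P (nd v)) ^ 6))
          XX≡ : XX ≡ KK 6
          XX≡ = ∑-cong xs (λ x → ∑-cong xs (λ y → solve 1 (λ a → 𝟙 :* 𝟙 :* a := a) refl (κ x y ^ 6)))
          inner : ∀ c x → ∑ nodes (λ v → (c * wt v) * (P x · P (nd v)) ^ 6) ≡ c * (fromℕ 360 * norm (P x) ^ 3)
          inner c x = trans (∑-cong nodes (λ v → trans (cong (λ t → (c * wt v) * t ^ 6) (trans (P-P x (nd v)) (·-comm (P x) (nd v)))) (*-assoc c (wt v) _))) (trans (∑-*ˡ nodes c) (cong (c *_) (sixth (P x))))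
          XY≡ : XY ≡ N# * (fromℕ 360 * ν ^ 3)
          XY≡ = trans (∑-cong∈ xs (λ x p → trans (inner 1ℝ x) (trans (*-identityˡ _) (cong (λ t → fromℕ 360 * t ^ 3) (κν x p))))) (∑-const xs _)
          cube : ∀ v → wt v * (fromℕ 360 * norm (P (nd v)) ^ 3) ≡ fromℕ 360 * (wt v * norm (nd v) * norm (nd v) * norm (nd v)
                    + (- (fromℕ 3 * ρ)) * (wt v * (nd v · α) ^ 2 * norm (nd v) * norm (nd v)) + fromℕ 3 * (ρ * ρ) * (wt v * (nd v · α) ^ 4 * norm (nd v)) + (- (ρ * ρ * ρ)) * (wt v * (nd v · α) ^ 6))
          cube v = trans (cong (λ t → wt v * (fromℕ 360 * t ^ 3)) (P·P (nd v) (nd v))) (solve 4 (λ w n a i → w :* (K 360 :* (n :- a :* a :* i) :^ 3)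
                    := K 360 :* (w :* n :* n :* n :+ (:- (K 3 :* i)) :* (w :* a :^ 2 :* n :* n) :+ K 3 :* (i :* i) :* (w :* a :^ 4 :* n) :+ (:- (i :* i :* i)) :* (w :* a :^ 6))) refl (wt v) (norm (nd v)) (nd v · α) ρ)
          YY≡ : YY ≡ fromℕ 360 * fromℕ 116280
          YY≡ = trans (∑-cong nodes (λ u → trans (inner (wt u) (nd u)) (cube u))) (trans (∑-*ˡ nodes (fromℕ 360)) (cong (fromℕ 360 *_)
            (trans (trans (∑-+ nodes) (cong₂ _+_ (trans (∑-+ nodes) (cong₂ _+_ (trans (∑-+ nodes) (cong₂ _+_ mass (trans (∑-*ˡ nodes _) (cong ((- (fromℕ 3 * ρ)) *_) (trans (second α) (cong (fromℕ 8640 *_) normα))))))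
                (trans (∑-*ˡ nodes _) (cong (fromℕ 3 * (ρ * ρ) *_) (trans (fourth α) (cong (λ t → fromℕ 1440 * t ^ 2) normα)))))) (trans (∑-*ˡ nodes _) (cong ((- (ρ * ρ * ρ)) *_) (trans (sixth α) (cong (λ t → fromℕ 360 * t ^ 3) normα))))))
              (trans (solve 2 (λ i d → K 138240 :+ (:- (K 3 :* i)) :* (K 8640 :* d) :+ K 3 :* (i :* i) :* (K 1440 :* d :^ 2) :+ (:- (i :* i :* i)) :* (K 360 :* d :^ 3)
                    := K 138240 :- K 25920 :* (d :* i) :+ K 4320 :* (d :* i) :^ 2 :- K 360 :* (d :* i) :^ 3) refl ρ m*)
                (trans (cong (λ t → fromℕ 138240 - fromℕ 25920 * t + fromℕ 4320 * t ^ 2 - fromℕ 360 * t ^ 3) m*ρ) (solve 0 (K 138240 :- K 25920 :* 𝟙 :+ K 4320 :* 𝟙 :^ 2 :- K 360 :* 𝟙 :^ 3 := K 116280) refl))))))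
          disc : XY * XY ≤ XX * YY
          disc = discriminant (λ l → psd-two (λ u w → (u · w) ^ 6) (psd-pow 6) (λ u w → cong (_^ 6) (·-comm u w)) xs (λ _ → 1ℝ) P nodes wt (P ∘ nd) l) (subst (0ℝ <_) (sym YY≡) (*-pos (0<ℕ 359) (0<ℕ 116279)))

      empty₃ : ∀ {f} → ∑ (N (ℤ.+ 3)) f ≡ 0ℝ
      empty₃ = empty (N (ℤ.+ 3)) n₃0

      -- An upper bound, because this moment enters with a negative coefficient. `D22` bounds each
      -- row once the squares coming from shell 2 are discarded.
      2nd : fromℕ 15 * KK 2 ≤ N# * fromℕ A * (ν * ν)
      2nd = *-cancel-≤ˡ (fromℕ 576 * fromℕ 6) (*-pos (0<ℕ 575) (0<ℕ 5)) (≤-trans (≡⇒≤ (solve 1 (λ k → K 576 :* K 6 :* (K 15 :* k) := K 90 :* (K 576 :* k)) refl (KK 2))) (≤-trans (*-mono-≤ˡ (fromℕ 90) (0≤ℕ 90) bound)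
               (≤-trans (≡⇒≤ (trans (cong (λ t → fromℕ 90 * (N# * (t * ν))) Em*) (solve 4 (λ n a v m → K 90 :* (n :* (K 32 :* m :* a :* v)) := n :* a :* v :* K 576 :* (K 5 :* m)) refl N# (fromℕ A) ν m)))
                 (≤-trans (*-mono-≤ˡ (N# * fromℕ A * ν * fromℕ 576) (0≤* (0≤* (0≤* (0≤ℕ n₁) (0≤ℕ A)) ν≥0) (0≤ℕ 576)) m≤6/5ν) (≡⇒≤ (solve 3 (λ n a v → n :* a :* v :* K 576 :* (K 6 :* v) := K 576 :* K 6 :* (n :* a :* (v :* v))) refl N# (fromℕ A) ν))))))
        where
          Em* : ℓ * (m * m) * m* ≡ fromℕ 32 * m * fromℕ A
          Em* = trans (cong (λ t → t * (m * m) * m*) (trans (cong fromℕ 2s) (fromℕ-* 2 s))) (trans (solve 3 (λ s m d → K 2 :* s :* (m :* m) :* d := K 2 :* m :* (m :* d :* s)) refl (fromℕ s) m m*) (trans (cong (fromℕ 2 * m *_) (rs≡16A s 2s)) (solve 2 (λ m a → K 2 :* m :* (K 16 :* a) := K 32 :* m :* a) refl m (fromℕ A))))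
          row : ∀ y → y ∈ xs → fromℕ 576 * ∑ xs (λ x → κ y x ^ 2) ≤ ℓ * (m * m) * m* * ν
          row y p = ≤-trans (≤-by (fromℕ 288 * ∑ (N (ℤ.+ 2)) (λ x → fromℕ 8 * ((x · P y) * (x · P y)))) (0≤* (0≤ℕ 288) (0≤∑ (N (ℤ.+ 2)) (λ x → 0≤* (0≤ℕ 8) (0≤sq _))))
               (trans (cong (fromℕ 288 *_) (trans (shells (P y) (λ a c → a ^ 2 * c ^ 2)) (cong₂ _+_ (cong₂ _+_ (cong₂ _+_ (trans (∑-cong (N (ℤ.+ 0)) (λ x → solve 1 (λ c → K 0 :^ 2 :* c :^ 2 := K 0) refl (x · P y))) (∑-zero (N (ℤ.+ 0))))
                    (trans (∑-cong xs (λ x → trans (solve 1 (λ c → K 1 :^ 2 :* c :^ 2 :+ (:- K 1) :^ 2 :* (:- c) :^ 2 := K 2 :* c :^ 2) refl (x · P y)) (cong (λ t → fromℕ 2 * t ^ 2) (trans (·-comm x (P y)) (sym (P-P y x)))))) (∑-*ˡ xs (fromℕ 2))))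
                    (∑-cong (N (ℤ.+ 2)) (λ x → solve 1 (λ c → K 2 :^ 2 :* c :^ 2 :+ (:- K 2) :^ 2 :* (:- c) :^ 2 := K 8 :* (c :* c)) refl (x · P y)))) empty₃)))
                 (solve 2 (λ k t → K 288 :* (K 0 :+ K 2 :* k :+ t :+ K 0) := K 576 :* k :+ K 288 :* t) refl (∑ xs (λ x → κ y x ^ 2)) _)))
               (≡⇒≤ (trans (D22 α (P y)) (trans (cong₂ (λ t u → ℓ * (m * m) * (fromℕ 2 * (t * t) + u)) (α⊥P y) (cong₂ _*_ normα (κν y p))) (solve 3 (λ e d v → e :* (K 2 :* (K 0 :* K 0) :+ d :* v) := e :* d :* v) refl (ℓ * (m * m)) m* ν))))
          bound : fromℕ 576 * KK 2 ≤ N# * (ℓ * (m * m) * m* * ν)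
          bound = ≤-trans (≡⇒≤ (sym (∑-*ˡ xs (fromℕ 576)))) (≤-trans (∑-mono∈ xs row) (≡⇒≤ (∑-const xs _)))

      -- The moment of (x · Py)³ (x · α) vanishes, and shell 2 enters it with twice the weight of
      -- shell 1.
      odd-row : ∀ y → ∑ xs (λ x → (x · P y) ^ 3) ≡ - (fromℕ 2 * ∑ (N (ℤ.+ 2)) (λ x → (x · P y) ^ 3))
      odd-row y = *-cancelˡ (fromℕ 2) (0<⇒≢ (0<ℕ 1)) (trans (solve 2 (λ a b → K 2 :* a := (K 0 :+ K 2 :* a :+ K 4 :* b :+ K 0) :- K 4 :* b) refl (∑ xs (λ x → (x · P y) ^ 3)) Q) (trans (cong (_- fromℕ 4 * Q) zero-sum) (solve 1 (λ b → K 0 :- K 4 :* b := K 2 :* (:- (K 2 :* b))) refl Q)))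
        where
          Q = ∑ (N (ℤ.+ 2)) (λ x → (x · P y) ^ 3)
          zero-sum : 0ℝ + fromℕ 2 * ∑ xs (λ x → (x · P y) ^ 3) + fromℕ 4 * Q + 0ℝ ≡ 0ℝ
          zero-sum = trans (sym (trans (shells (P y) (λ a c → c ^ 3 * a)) (cong₂ _+_ (cong₂ _+_ (cong₂ _+_ (trans (∑-cong (N (ℤ.+ 0)) (λ x → zeroʳ _)) (∑-zero (N (ℤ.+ 0))))
               (trans (∑-cong xs (λ x → solve 1 (λ c → c :^ 3 :* K 1 :+ (:- c) :^ 3 :* (:- K 1) := K 2 :* c :^ 3) refl (x · P y))) (∑-*ˡ xs (fromℕ 2))))
               (trans (∑-cong (N (ℤ.+ 2)) (λ x → solve 1 (λ c → c :^ 3 :* K 2 :+ (:- c) :^ 3 :* (:- K 2) := K 4 :* c :^ 3) refl (x · P y))) (∑-*ˡ (N (ℤ.+ 2)) (fromℕ 4)))) empty₃)))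
             (proj₂ (proj₂ (⊥-moments (P y) (α⊥P y))))

      ν₂≤ν : ν₂ ≤ ν
      ν₂≤ν = ≤-by (fromℕ 3 * ρ) (0≤* (0≤ℕ 3) (<⇒≤ ρ>0)) (solve 2 (λ m i → m :- K 1 :* K 1 :* i := (m :- K 2 :* K 2 :* i) :+ K 3 :* i) refl m ρ)

      cube≤ : ∀ t c → 0ℝ ≤ c → t ≤ c → t ^ 3 ≤ c ^ 3
      cube≤ t c p q with ≤-total 0ℝ t
      ... | inj₁ h = ^-mono-≤ 3 h q
      ... | inj₂ h = ≤-trans (subst (_≤ 0ℝ) (solve 1 (λ t → t :* t :* t := t :^ 3) refl t) (0≤*≤0 (0≤sq t) h)) (0≤^ 3 p)

      -- `odd-row` in both variables moves the cubic moment to shell 2, which has at most 3 vectors: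
      -- 4 · 3 · 3 = 36.
      3rd : KK 3 ≤ fromℕ 36 * ν ^ 3
      3rd = ≤-trans (≡⇒≤ eq) (≤-trans (*-mono-≤ˡ (fromℕ 4) (0≤ℕ 4) (≤-trans (∑-mono∈ S₂.xs (λ x p → ∑-mono∈ S₂.xs (λ y q → cube≤ _ _ ν≥0 (≤-trans (κ₂≤ x y p q) ν₂≤ν)))) (≡⇒≤ (trans (∑-cong S₂.xs (λ x → ∑-const S₂.xs (ν ^ 3))) (∑-const S₂.xs _)))))
              (≤-trans (*-mono-≤ˡ (fromℕ 4) (0≤ℕ 4) (*-mono-≤ (0≤ℕ n₂) (0≤* (0≤ℕ 3) (0≤^ 3 ν≥0)) (fromℕ-mono-≤ n₂≤3) (*-mono-≤ʳ (ν ^ 3) (0≤^ 3 ν≥0) (fromℕ-mono-≤ n₂≤3)))) (≡⇒≤ (solve 1 (λ v → K 4 :* (K 3 :* (K 3 :* v)) := K 36 :* v) refl (ν ^ 3)))))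
        where
          κ₂≤ : ∀ x y → x ∈ S₂.xs → y ∈ S₂.xs → κ x y ≤ ν₂
          κ₂≤ x y p q = *-cancel-≤ˡ (fromℕ 2) (0<ℕ 1) (0≤⇒≤ (subst (0ℝ ≤_) nrm (0≤norm w)))
            where
              w = P x ⊖ P y
              nrm : norm w ≡ fromℕ 2 * ν₂ - fromℕ 2 * κ x y
              nrm = trans (⊖-· (P x) (P y) w) (trans (cong₂ _-_ (trans (·-⊖ (P x) (P x) (P y)) (cong (_- κ x y) (S₂.κν x p))) (trans (·-⊖ (P y) (P x) (P y)) (cong₂ _-_ (·-comm (P y) (P x)) (S₂.κν y q)))) (solve 2 (λ v k → (v :- k) :- (k :- v) := K 2 :* v :- K 2 :* k) refl ν₂ (κ x y)))
          eq : KK 3 ≡ fromℕ 4 * ∑ S₂.xs (λ x → ∑ S₂.xs (λ y → κ x y ^ 3))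
          eq = trans (∑-cong xs (λ x → trans (∑-cong xs (λ y → cong (_^ 3) (trans (P-P x y) (·-comm (P x) y)))) (trans (odd-row x) (trans (-‿distribˡ-* (fromℕ 2) _) (trans (sym (∑-*ˡ S₂.xs (- fromℕ 2))) (∑-cong S₂.xs (λ y → cong (λ t → (- fromℕ 2) * t ^ 3) (trans (·-comm y (P x)) (trans (sym (P-P x y)) (trans (·-comm (P x) (P y)) (trans (P-P y x) (·-comm (P y) x))))))))))))
               (trans (∑-swap xs S₂.xs) (trans (∑-cong S₂.xs (λ y → trans (∑-*ˡ xs (- fromℕ 2)) (cong ((- fromℕ 2) *_) (odd-row y)))) (trans (∑-cong S₂.xs (λ y → trans (solve 1 (λ t → (:- K 2) :* (:- (K 2 :* t)) := K 4 :* t) refl _) (cong (fromℕ 4 *_) (∑-cong S₂.xs (λ x → cong (_^ 3) (trans (·-comm x (P y)) (sym (P-P y x)))))))) (∑-*ˡ S₂.xs (fromℕ 4)))))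

      H : ℝ → ℝ
      H t = (t * t) * ((fromℕ 8 * t + fromℕ 3 * ν) * (fromℕ 8 * t + fromℕ 3 * ν)) * (fromℕ 5 * t + fromℕ 4 * ν) * (fromℕ 400 * t - fromℕ 161 * ν)

      -- 260271 = 11² · 9 · 239 is the value of the polynomial at u = 1.
      upper : ∑ xs (λ x → ∑ xs (λ y → H (κ x y))) ≤ N# * (fromℕ 260271 * ν ^ 6)
      upper = ≤-trans (diagonal H (λ x y p q ne → 0≤*≤0 (0≤* (0≤* (0≤sq (κ x y)) (0≤sq _)) (κ-lower x y p q)) (κ-upper x y p q ne)))
                (≡⇒≤ (cong (N# *_) (solve 1 (λ v → (v :* v) :* ((K 8 :* v :+ K 3 :* v) :* (K 8 :* v :+ K 3 :* v)) :* (K 5 :* v :+ K 4 :* v) :* (K 400 :* v :- K 161 :* v) := K 260271 :* v :^ 6) refl ν)))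

      H-expand : ∀ t → H t ≡ fromℕ 128000 * t ^ 6 + fromℕ 146880 * (ν * t ^ 5) + fromℕ 14944 * (ν ^ 2 * t ^ 4) + (- fromℕ 23757) * (ν ^ 3 * t ^ 3) + (- fromℕ 5796) * (ν ^ 4 * t ^ 2)
      H-expand t = solve 2 (λ t v → (t :* t) :* ((K 8 :* t :+ K 3 :* v) :* (K 8 :* t :+ K 3 :* v)) :* (K 5 :* t :+ K 4 :* v) :* (K 400 :* t :- K 161 :* v)
           := K 128000 :* t :^ 6 :+ K 146880 :* (v :* t :^ 5) :+ K 14944 :* (v :^ 2 :* t :^ 4) :+ (:- K 23757) :* (v :^ 3 :* t :^ 3) :+ (:- K 5796) :* (v :^ 4 :* t :^ 2)) refl t ν

      pairs : (Vec 16 → Vec 16 → ℝ) → ℝ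
      pairs f = ∑ xs (λ x → ∑ xs (f x))

      pairs-+ : ∀ (f g : Vec 16 → Vec 16 → ℝ) → pairs (λ x y → f x y + g x y) ≡ pairs f + pairs g
      pairs-+ f g = trans (∑-cong xs (λ x → ∑-+ xs)) (∑-+ xs)

      pairs-* : ∀ c (f : Vec 16 → Vec 16 → ℝ) → pairs (λ x y → c * f x y) ≡ c * pairs f
      pairs-* c f = trans (∑-cong xs (λ x → ∑-*ˡ xs c)) (∑-*ˡ xs c)

      scaled : ∀ c v j → pairs (λ x y → c * (v * κ x y ^ j)) ≡ c * (v * KK j)
      scaled c v j = trans (pairs-* c (λ x y → v * κ x y ^ j)) (cong (c *_) (pairs-* v (λ x y → κ x y ^ j)))

      expand : pairs (λ x y → H (κ x y)) ≡ fromℕ 128000 * KK 6 + fromℕ 146880 * (ν * KK 5) + fromℕ 14944 * (ν ^ 2 * KK 4) + (- fromℕ 23757) * (ν ^ 3 * KK 3) + (- fromℕ 5796) * (ν ^ 4 * KK 2)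
      expand = trans (∑-cong xs (λ x → ∑-cong xs (λ y → H-expand (κ x y))))
        (trans (pairs-+ (λ x y → t₆ x y + t₅ x y + t₄ x y + t₃ x y) t₂) (cong₂ _+_ (trans (pairs-+ (λ x y → t₆ x y + t₅ x y + t₄ x y) t₃) (cong₂ _+_ (trans (pairs-+ (λ x y → t₆ x y + t₅ x y) t₄) (cong₂ _+_ (trans (pairs-+ t₆ t₅)
           (cong₂ _+_ (pairs-* (fromℕ 128000) (λ x y → κ x y ^ 6)) (scaled (fromℕ 146880) ν 5))) (scaled (fromℕ 14944) (ν ^ 2) 4))) (scaled (- fromℕ 23757) (ν ^ 3) 3))) (scaled (- fromℕ 5796) (ν ^ 4) 2)))
        where
          t₆ t₅ t₄ t₃ t₂ : Vec 16 → Vec 16 → ℝ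
          t₆ x y = fromℕ 128000 * κ x y ^ 6
          t₅ x y = fromℕ 146880 * (ν * κ x y ^ 5)
          t₄ x y = fromℕ 14944 * (ν ^ 2 * κ x y ^ 4)
          t₃ x y = (- fromℕ 23757) * (ν ^ 3 * κ x y ^ 3)
          t₂ x y = (- fromℕ 5796) * (ν ^ 4 * κ x y ^ 2)

      w = N# * N# * ν ^ 6
      u = N# * fromℕ A * ν ^ 6

      4th′ : w ≤ fromℕ 85 * (ν ^ 2 * KK 4)
      4th′ = ≤-trans (≡⇒≤ (solve 2 (λ n v → n :* n :* v :^ 6 := v :^ 2 :* (n :* n :* v :^ 4)) refl N# ν)) (≤-trans (*-mono-≤ˡ (ν ^ 2) (0≤^ 2 ν≥0) 4th) (≡⇒≤ (solve 2 (λ v k → v :* (K 85 :* k) := K 85 :* (v :* k)) refl (ν ^ 2) (KK 4))))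

      3rd′ : ν ^ 3 * KK 3 ≤ fromℕ 36 * ν ^ 6
      3rd′ = ≤-trans (*-mono-≤ˡ (ν ^ 3) (0≤^ 3 ν≥0) 3rd) (≡⇒≤ (solve 1 (λ v → v :^ 3 :* (K 36 :* v :^ 3) := K 36 :* v :^ 6) refl ν))

      2nd′ : fromℕ 15 * (ν ^ 4 * KK 2) ≤ u
      2nd′ = ≤-trans (≡⇒≤ (solve 2 (λ v k → K 15 :* (v :* k) := v :* (K 15 :* k)) refl (ν ^ 4) (KK 2))) (≤-trans (*-mono-≤ˡ (ν ^ 4) (0≤^ 4 ν≥0) 2nd) (≡⇒≤ (solve 3 (λ n a v → v :^ 4 :* (n :* a :* (v :* v)) := n :* a :* v :^ 6) refl N# (fromℕ A) ν)))

      -- the linear combination of the moment inequalities that eliminates all moments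
      eliminate : ∀ {w k₆ x₅ x₄ x₃ x₂ z u t} → w ≤ fromℕ 323 * k₆ → 0ℝ ≤ x₅ → w ≤ fromℕ 85 * x₄ → x₃ ≤ fromℕ 36 * z → fromℕ 15 * x₂ ≤ u →
        fromℕ 128000 * k₆ + fromℕ 146880 * x₅ + fromℕ 14944 * x₄ + (- fromℕ 23757) * x₃ + (- fromℕ 5796) * x₂ ≤ t →
        fromℕ 5 * (fromℕ 15706912 * w) ≤ fromℕ 27455 * (fromℕ 5 * t + fromℕ 5 * (fromℕ 855252 * z) + fromℕ 1932 * u)
      eliminate {w} {k₆} {x₅} {x₄} {x₃} {x₂} {z} {u} {t} h₆ h₅ h₄ h₃ h₂ h = ≤-by slack slack≥0
          (solve 9 (λ w k₆ x₅ x₄ x₃ x₂ z u t → K 27455 :* (K 5 :* t :+ K 5 :* (K 855252 :* z) :+ K 1932 :* u) := K 5 :* (K 15706912 :* w) :+ (K 137275 :* (t :- (K 128000 :* k₆ :+ K 146880 :* x₅ :+ K 14944 :* x₄ :+ (:- K 23757) :* x₃ :+ (:- K 5796) :* x₂)) :+ K 54400000 :* (K 323 :* k₆ :- w) :+ K 24134560 :* (K 85 :* x₄ :- w) :+ K 137275 :* K 146880 :* x₅ :+ K 137275 :* K 23757 :* (K 36 :* z :- x₃) :+ K 53043060 :* (u :- K 15 :* x₂))) refl w k₆ x₅ x₄ x₃ x₂ z u t)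
        where
          e = fromℕ 128000 * k₆ + fromℕ 146880 * x₅ + fromℕ 14944 * x₄ + (- fromℕ 23757) * x₃ + (- fromℕ 5796) * x₂
          slack = fromℕ 137275 * (t - e) + fromℕ 54400000 * (fromℕ 323 * k₆ - w) + fromℕ 24134560 * (fromℕ 85 * x₄ - w) + fromℕ 137275 * fromℕ 146880 * x₅ + fromℕ 137275 * fromℕ 23757 * (fromℕ 36 * z - x₃) + fromℕ 53043060 * (u - fromℕ 15 * x₂)
          slack≥0 : 0ℝ ≤ slack
          slack≥0 = 0≤+ (0≤+ (0≤+ (0≤+ (0≤+ (0≤* (0≤ℕ 137275) (≤⇒0≤ h)) (0≤* (0≤ℕ 54400000) (≤⇒0≤ h₆))) (0≤* (0≤ℕ 24134560) (≤⇒0≤ h₄))) (0≤* (0≤* (0≤ℕ 137275) (0≤ℕ 146880)) h₅)) (0≤* (0≤* (0≤ℕ 137275) (0≤ℕ 23757)) (≤⇒0≤ h₃))) (0≤* (0≤ℕ 53043060) (≤⇒0≤ h₂))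

      combined : fromℕ 5 * (fromℕ 15706912 * (N# * N#)) ≤ fromℕ 27455 * (fromℕ 5 * (fromℕ 260271 * N#) + fromℕ 5 * fromℕ 855252 + fromℕ 1932 * (N# * fromℕ A))
      combined = *-cancel-≤ˡ (ν ^ 6) (0<^ 6 ν>0) (≤-trans (≡⇒≤ (left (fromℕ 5) (fromℕ 15706912) N# (ν ^ 6))) (≤-trans (eliminate 6th (0≤* ν≥0 (0≤KK 5)) 4th′ 3rd′ 2nd′ (≤-trans (≡⇒≤ (sym expand)) upper)) (≡⇒≤ (right (fromℕ 27455) (fromℕ 5) (fromℕ 260271) (fromℕ 855252) (fromℕ 1932) N# (fromℕ A) (ν ^ 6)))))
        where
          left : ∀ a b n v → v * (a * (b * (n * n))) ≡ a * (b * (n * n * v))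
          left = solve 4 (λ a b n v → v :* (a :* (b :* (n :* n))) := a :* (b :* (n :* n :* v))) refl
          right : ∀ a b c d e n A v → a * (b * (n * (c * v)) + b * (d * v) + e * (n * A * v)) ≡ v * (a * (b * (c * n) + b * d + e * (n * A)))
          right = solve 8 (λ a b c d e n A v → a :* (b :* (n :* (c :* v)) :+ b :* (d :* v) :+ e :* (n :* A :* v)) := v :* (a :* (b :* (c :* n) :+ b :* d :+ e :* (n :* A)))) refl

    n₁≤1500 : n₁ ℕ.≤ 1500
    n₁≤1500 with n₁ ℕ.≤? 1500
    ... | yes p = p
    ... | no p = ⊥-elim (combined (≤-<-trans (*-mono-≤ˡ (fromℕ 27455) (0≤ℕ 27455) (+-mono-≤ (≤-refl {fromℕ 5 * (fromℕ 260271 * N#) + fromℕ 5 * fromℕ 855252}) (*-mono-≤ˡ (fromℕ 1932) (0≤ℕ 1932) (*-mono-≤ˡ N# (0≤ℕ n₁) A≤)))) (<-by d d>0 eq)))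
      where
        t = N# - fromℕ 1501
        t≥0 : 0ℝ ≤ t
        t≥0 = ≤⇒0≤ (fromℕ-mono-≤ (ℕₚ.≰⇒> p))
        A≤ : fromℕ A ≤ N# + fromℕ 12
        A≤ = ≤-trans (fromℕ-mono-≤ (ℕₚ.≤-trans (ℕₚ.≤-reflexive (trans (cong (λ j → n₁ ℕ.+ 4 ℕ.* n₂ ℕ.+ 9 ℕ.* j) n₃0) (ℕₚ.+-identityʳ _))) (ℕₚ.+-monoʳ-≤ n₁ (ℕₚ.*-monoʳ-≤ 4 n₂≤3)))) (≡⇒≤ (fromℕ-+ n₁ 12))
        -- The difference of the two sides of `combined`, expanded about n₁ = 1501.
        d = fromℕ 25491500 * (t * t) + fromℕ 40160264755 * t + fromℕ 2730777687455
        d>0 : 0ℝ < d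
        d>0 = subst (0ℝ <_) (+-comm _ _) (0<+ (0<ℕ 2730777687454) (0≤+ (0≤* (0≤ℕ 25491500) (0≤sq t)) (0≤* (0≤ℕ 40160264755) t≥0)))
        eq : fromℕ 5 * (fromℕ 15706912 * (N# * N#)) ≡ fromℕ 27455 * (fromℕ 5 * (fromℕ 260271 * N#) + fromℕ 5 * fromℕ 855252 + fromℕ 1932 * (N# * (N# + fromℕ 12))) + d
        eq = solve 1 (λ n → K 5 :* (K 15706912 :* (n :* n)) := K 27455 :* (K 5 :* (K 260271 :* n) :+ K 5 :* K 855252 :+ K 1932 :* (n :* (n :+ K 12))) :+ (K 25491500 :* ((n :- K 1501) :* (n :- K 1501)) :+ K 40160264755 :* (n :- K 1501) :+ K 2730777687455)) refl N#

 -- The function exp(-x) for x ≥ 0.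

 module Exponential where
  open Field
  open Sums

  <-stable : ∀ {x y} → ¬ ¬ (x < y) → x < y
  <-stable {x} {y} p with compare x y
  ... | tri< a _ _ = a
  ... | tri≈ q _ _ = ⊥-elim (p q)
  ... | tri> q _ _ = ⊥-elim (p q)

  -- If y < x, the Archimedean property for z / (x - y) provides an n with z / (n + 1) < x - y.
  -- Limits are therefore tracked with errors of order 1/n.
  ≤-limit : ∀ {x y} z → (∀ n → x ≤ y + z * (fromℕ (suc n)) ⁻¹) → x ≤ y
  ≤-limit {x} {y} z h with x ≤? y
  ... | inj₁ p = p
  ... | inj₂ q = ≤-stable (λ k → archimedes (z * d ⁻¹) (λ { (n , zd<n) → k (⊥-elim (h n (lem n zd<n))) }))
    where
      d = x - y
      d>0 : 0ℝ < d
      d>0 = <⇒0< q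
      lem : ∀ n → z * d ⁻¹ < fromℕ n → y + z * (fromℕ (suc n)) ⁻¹ < x
      lem n p = 0<⇒< (subst (0ℝ <_) eq (*-pos (inv-pos (0<ℕ n)) (<⇒0< zN)))
        where
          N = fromℕ (suc n)
          zN : z < d * N
          zN = subst₂ _<_ (trans (solve 3 (λ d z i → d :* (z :* i) := z :* (d :* i)) refl d z (d ⁻¹)) (trans (cong (z *_) (*-inv⁺ d>0)) (*-identityʳ z))) refl (*-mono-<ˡ d d>0 (<-≤-trans p (fromℕ-mono-≤ (ℕₚ.n≤1+n n))))
          eq : N ⁻¹ * (d * N - z) ≡ x - (y + z * N ⁻¹)
          eq = trans (solve 4 (λ i d n z → i :* (d :* n :- z) := d :* (n :* i) :- z :* i) refl (N ⁻¹) d N z) (trans (cong (λ t → d * t - z * N ⁻¹) (*-inv⁺ (0<ℕ n))) (solve 4 (λ x y z i → (x :- y) :* 𝟙 :- z :* i := x :- (y :+ z :* i)) refl x y z (N ⁻¹)))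

  pow2 : ℕ → ℕ
  pow2 zero = 1
  pow2 (suc n) = pow2 n ℕ.+ pow2 n

  n<pow2 : ∀ n → n ℕ.< pow2 n
  n<pow2 zero = ℕ.s≤s ℕ.z≤n
  n<pow2 (suc n) = ℕₚ.≤-trans (ℕ.s≤s (n<pow2 n)) (ℕₚ.≤-trans (ℕₚ.≤-reflexive (ℕₚ.+-comm 1 (pow2 n))) (ℕₚ.+-monoʳ-≤ (pow2 n) (ℕₚ.≤-trans (ℕ.s≤s ℕ.z≤n) (n<pow2 n))))

  ½^ : ℕ → ℝ
  ½^ zero = 1ℝ
  ½^ (suc n) = ½^ n * (fromℕ 2) ⁻¹

  private
    2>0 : 0ℝ < fromℕ 2
    2>0 = 0<ℕ 1

    h : ℝ
    h = (fromℕ 2) ⁻¹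

    2h : fromℕ 2 * h ≡ 1ℝ
    2h = *-inv⁺ 2>0

  0<½^ : ∀ n → 0ℝ < ½^ n
  0<½^ zero = 0<1
  0<½^ (suc n) = *-pos (0<½^ n) (inv-pos 2>0)

  pow2*½^ : ∀ n → fromℕ (pow2 n) * ½^ n ≡ 1ℝ
  pow2*½^ zero = trans (*-identityʳ _) (+-identityʳ 1ℝ)
  pow2*½^ (suc n) = trans (cong (_* (½^ n * h)) (fromℕ-+ (pow2 n) (pow2 n))) (trans (solve 3 (λ p a h → (p :+ p) :* (a :* h) := (p :* a) :* (K 2 :* h)) refl (fromℕ (pow2 n)) (½^ n) h) (trans (cong₂ _*_ (pow2*½^ n) 2h) (*-identityˡ 1ℝ)))

  ½^≤1/ : ∀ n → ½^ n ≤ (fromℕ (suc n)) ⁻¹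
  ½^≤1/ n = *-cancel-≤ˡ (fromℕ (suc n)) (0<ℕ n) (subst (fromℕ (suc n) * ½^ n ≤_) (trans (pow2*½^ n) (sym (*-inv⁺ (0<ℕ n)))) (*-mono-≤ʳ (½^ n) (<⇒≤ (0<½^ n)) (fromℕ-mono-≤ (n<pow2 n))))

  -- u to the power 2ⁿ. As iterated squaring it is monotone and multiplicative by induction.
  sqn : ℕ → ℝ → ℝ
  sqn zero u = u
  sqn (suc n) u = sqn n (u * u)

  sqn-* : ∀ n u v → sqn n (u * v) ≡ sqn n u * sqn n v
  sqn-* zero u v = refl
  sqn-* (suc n) u v = trans (cong (sqn n) (solve 2 (λ u v → u :* v :* (u :* v) := u :* u :* (v :* v)) refl u v)) (sqn-* n (u * u) (v * v))

  sqn-mono : ∀ n {u v} → 0ℝ ≤ u → u ≤ v → sqn n u ≤ sqn n v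
  sqn-mono zero p q = q
  sqn-mono (suc n) {u} {v} p q = sqn-mono n (0≤sq u) (*-mono-≤ p (≤-trans p q) q q)

  0≤sqn : ∀ n {u} → 0ℝ ≤ u → 0ℝ ≤ sqn n u
  0≤sqn zero p = p
  0≤sqn (suc n) {u} p = 0≤sqn n (0≤sq u)

  0<sqn : ∀ n {u} → 0ℝ < u → 0ℝ < sqn n u
  0<sqn zero p = p
  0<sqn (suc n) p = 0<sqn n (*-pos p p)

  sqn-1 : ∀ n → sqn n 1ℝ ≡ 1ℝ
  sqn-1 zero = refl
  sqn-1 (suc n) = trans (cong (sqn n) (*-identityˡ 1ℝ)) (sqn-1 n)

  module _ (x : ℝ) where
    den : ℕ → ℝ
    den n = 1ℝ + x * ½^ n

    approx : ℕ → ℝ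
    approx n = sqn n (den n ⁻¹)

  den>0 : ∀ {x} → 0ℝ ≤ x → ∀ n → 0ℝ < den x n
  den>0 p n = 0<+ 0<1 (0≤* p (<⇒≤ (0<½^ n)))

  inv-mono : ∀ {x y} → 0ℝ < x → x ≤ y → y ⁻¹ ≤ x ⁻¹
  inv-mono {x} {y} p q = *-cancel-≤ˡ y y>0 (subst (_≤ y * x ⁻¹) (sym (*-inv⁺ y>0)) (subst (_≤ y * x ⁻¹) (*-inv⁺ p) (*-mono-≤ʳ (x ⁻¹) (<⇒≤ (inv-pos p)) q)))
    where y>0 = <-≤-trans p q

  inv-* : ∀ {x y} → 0ℝ < x → 0ℝ < y → (x * y) ⁻¹ ≡ x ⁻¹ * y ⁻¹
  inv-* {x} {y} p q = sym (inv-uniq (*-pos p q) (trans (solve 4 (λ x y i j → x :* y :* (i :* j) := (x :* i) :* (y :* j)) refl x y (x ⁻¹) (y ⁻¹)) (trans (cong₂ _*_ (*-inv⁺ p) (*-inv⁺ q)) (*-identityˡ 1ℝ))))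

  approx>0 : ∀ {x} → 0ℝ ≤ x → ∀ n → 0ℝ < approx x n
  approx>0 p n = 0<sqn n (inv-pos (den>0 p n))

  approx-step : ∀ {x} → 0ℝ ≤ x → ∀ n → approx x (suc n) ≤ approx x n
  approx-step {x} p n = sqn-mono n (0≤sq _) (subst (_≤ den x n ⁻¹) (inv-* d d) (inv-mono (den>0 p n) (≤-by ((x * (½^ n * h)) * (x * (½^ n * h))) (0≤sq _)
      (trans (solve 3 (λ x a h → (𝟙 :+ x :* (a :* h)) :* (𝟙 :+ x :* (a :* h)) := (𝟙 :+ x :* a :* (K 2 :* h)) :+ (x :* (a :* h)) :* (x :* (a :* h))) refl x (½^ n) h) (cong (λ t → (1ℝ + t) + (x * (½^ n * h)) * (x * (½^ n * h))) (trans (cong (x * ½^ n *_) 2h) (*-identityʳ _)))))))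
    where d = den>0 p (suc n)

  approx-mono : ∀ {x} → 0ℝ ≤ x → ∀ {m n} → m ℕ.≤ n → approx x n ≤ approx x m
  approx-mono {x} p {m} {n} q = subst (λ k → approx x k ≤ approx x m) (ℕₚ.m+[n∸m]≡n q) (go (n ℕ.∸ m))
    where
      go : ∀ k → approx x (m ℕ.+ k) ≤ approx x m
      go zero = ≡⇒≤ (cong (approx x) (ℕₚ.+-identityʳ m))
      go (suc k) = ≤-trans (subst (λ j → approx x j ≤ approx x (m ℕ.+ k)) (sym (ℕₚ.+-suc m k)) (approx-step p (m ℕ.+ k))) (go k)

  approx≤1 : ∀ {x} → 0ℝ ≤ x → ∀ n → approx x n ≤ 1ℝ
  approx≤1 {x} p n = subst (approx x n ≤_) (sqn-1 n) (sqn-mono n (<⇒≤ (inv-pos (den>0 p n))) (*-cancel-≤ˡ (den x n) (den>0 p n) (subst₂ _≤_ (sym (*-inv⁺ (den>0 p n))) (sym (*-identityʳ _)) (≤-by (x * ½^ n) (0≤* p (<⇒≤ (0<½^ n))) refl))))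

  -- E x = e^{-x} for 0 ≤ x, the infimum of (1 + x/2ⁿ)^(-2ⁿ)
  private
    max0 : ℝ → ℝ
    max0 x with 0ℝ ≤? x
    ... | inj₁ _ = x
    ... | inj₂ _ = 0ℝ

    0≤max0 : ∀ x → 0ℝ ≤ max0 x
    0≤max0 x with 0ℝ ≤? x
    ... | inj₁ p = p
    ... | inj₂ _ = ≤-refl

    max0≡ : ∀ {x} → 0ℝ ≤ x → max0 x ≡ x
    max0≡ {x} p with 0ℝ ≤? x
    ... | inj₁ _ = refl
    ... | inj₂ q = ⊥-elim (p q)

    -- An infimum is obtained as the supremum of the lower bounds. Clamping x at 0 makes this set
    -- inhabited and bounded for every x.
    Low : ℝ → ℝ → Set
    Low x y = ∀ n → y ≤ approx (max0 x) n

    inf : ∀ x → ∃ λ u → (∀ y → Low x y → y ≤ u) × (∀ b → (∀ y → Low x y → ¬ (b < y)) → ¬ (b < u))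
    inf x = lub (Low x) (0ℝ , λ n → <⇒≤ (approx>0 (0≤max0 x) n)) (1ℝ , λ y l → ≤-trans (l 0) (approx≤1 (0≤max0 x) 0))

  abstract
    E : ℝ → ℝ
    E x = proj₁ (inf x)

    E≤approx : ∀ {x} → 0ℝ ≤ x → ∀ n → E x ≤ approx x n
    E≤approx {x} p n = proj₂ (proj₂ (inf x)) (approx x n) (λ y l → subst (λ t → y ≤ approx t n) (max0≡ p) (l n))

    ≤E : ∀ {x y} → 0ℝ ≤ x → (∀ n → y ≤ approx x n) → y ≤ E x
    ≤E {x} {y} p q = proj₁ (proj₂ (inf x)) y (λ n → subst (λ t → y ≤ approx t n) (sym (max0≡ p)) (q n))

  0≤E : ∀ {x} → 0ℝ ≤ x → 0ℝ ≤ E x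
  0≤E p = ≤E p (λ n → <⇒≤ (approx>0 p n))

  E≤1 : ∀ {x} → 0ℝ ≤ x → E x ≤ 1ℝ
  E≤1 p = ≤-trans (E≤approx p 0) (approx≤1 p 0)

  ½^≤1 : ∀ n → ½^ n ≤ 1ℝ
  ½^≤1 zero = ≤-refl
  ½^≤1 (suc n) = ≤-trans (≤-by (½^ n * h) (<⇒≤ (0<½^ (suc n))) (trans (solve 2 (λ a h → a := a :* 𝟙) refl (½^ n) h) (trans (cong (½^ n *_) (sym 2h)) (solve 2 (λ a h → a :* (K 2 :* h) := a :* h :+ a :* h) refl (½^ n) h)))) (½^≤1 n)

  -- Bernoulli
  1-x≤sqn : ∀ n {u} → 0ℝ ≤ u → u * ½^ n ≤ 1ℝ → 1ℝ - u ≤ sqn n (1ℝ - u * ½^ n)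
  1-x≤sqn zero {u} p q = ≡⇒≤ (solve 1 (λ u → 𝟙 :- u := 𝟙 :- u :* 𝟙) refl u)
  1-x≤sqn (suc n) {u} p q with (u * ½^ n) ≤? 1ℝ
  ... | inj₁ r = ≤-trans (1-x≤sqn n p r) (sqn-mono n (≤⇒0≤ r) (≤-by ((u * (½^ n * h)) * (u * (½^ n * h))) (0≤sq _)
      (trans (solve 3 (λ x a h → (𝟙 :- x :* (a :* h)) :* (𝟙 :- x :* (a :* h)) := (𝟙 :- x :* a :* (K 2 :* h)) :+ (x :* (a :* h)) :* (x :* (a :* h))) refl u (½^ n) h) (cong (λ t → (1ℝ - t) + (u * (½^ n * h)) * (u * (½^ n * h))) (trans (cong (u * ½^ n *_) 2h) (*-identityʳ _))))))
  ... | inj₂ r = ≤-trans (neg≤0) (0≤sqn n (0≤sq _))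
    where
      neg≤0 : 1ℝ - u ≤ 0ℝ
      neg≤0 = subst (1ℝ - u ≤_) (-‿inverseʳ u) (+-mono-≤ʳ (- u) (≤-trans (<⇒≤ r) (subst (u * ½^ n ≤_) (*-identityʳ u) (*-mono-≤ˡ u p (½^≤1 n)))))

  1-x≤E : ∀ {x} → 0ℝ ≤ x → 1ℝ - x ≤ E x
  1-x≤E {x} p = ≤E p lem
    where
      lem : ∀ n → 1ℝ - x ≤ approx x n
      lem n with (x * ½^ n) ≤? 1ℝ
      ... | inj₁ r = ≤-trans (1-x≤sqn n p r) (sqn-mono n (≤⇒0≤ r) (*-cancel-≤ˡ (den x n) (den>0 p n) (subst (den x n * (1ℝ - x * ½^ n) ≤_) (sym (*-inv⁺ (den>0 p n)))
            (≤-by ((x * ½^ n) * (x * ½^ n)) (0≤sq _) (solve 1 (λ y → 𝟙 := (𝟙 :+ y) :* (𝟙 :- y) :+ y :* y) refl (x * ½^ n))))))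
      ... | inj₂ r = ≤-trans (subst (1ℝ - x ≤_) (-‿inverseʳ x) (+-mono-≤ʳ (- x) (≤-trans (<⇒≤ r) (subst (x * ½^ n ≤_) (*-identityʳ x) (*-mono-≤ˡ x p (≤-trans (½^≤1/ n) (1/≤1 n))))))) (<⇒≤ (approx>0 p n))
        where
          1/≤1 : ∀ n → (fromℕ (suc n)) ⁻¹ ≤ 1ℝ
          1/≤1 n = *-cancel-≤ˡ (fromℕ (suc n)) (0<ℕ n) (subst₂ _≤_ (sym (*-inv⁺ (0<ℕ n))) (sym (*-identityʳ _)) (≤-by (fromℕ n) (0≤ℕ n) refl))

  E0 : E 0ℝ ≡ 1ℝ
  E0 = ≤-antisym (E≤1 ≤-refl) (subst (_≤ E 0ℝ) (solve 0 (𝟙 :- K 0 := 𝟙) refl) (1-x≤E ≤-refl))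

  -- From (1 + xδ)(1 + yδ) ≥ 1 + (x + y)δ one inequality follows at once. Conversely the product
  -- exceeds the right side by xyδ² only, and Bernoulli bounds the accumulated relative error by xy
  -- / 2ⁿ.
  E-+ : ∀ {x y} → 0ℝ ≤ x → 0ℝ ≤ y → E (x + y) ≡ E x * E y
  E-+ {x} {y} p q = ≤-antisym ge le
    where
      p+q = 0≤+ p q
      z = x * y
      z≥0 = 0≤* p q
      le : E x * E y ≤ E (x + y)
      le = ≤E p+q (λ n → ≤-trans (*-mono-≤ (0≤E p) (<⇒≤ (approx>0 q n)) (E≤approx p n) (E≤approx q n)) (≤-trans (≡⇒≤ (trans (sym (sqn-* n (den x n ⁻¹) (den y n ⁻¹))) (cong (sqn n) (sym (inv-* (den>0 p n) (den>0 q n))))))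
             (sqn-mono n (<⇒≤ (inv-pos (*-pos (den>0 p n) (den>0 q n)))) (inv-mono (den>0 p+q n) (≤-by (z * (½^ n * ½^ n)) (0≤* z≥0 (0≤sq _)) (solve 3 (λ x y a → (𝟙 :+ x :* a) :* (𝟙 :+ y :* a) := (𝟙 :+ (x :+ y) :* a) :+ x :* y :* (a :* a)) refl x y (½^ n)))))))
      -- (1 + xδ)(1 + yδ)(1 - xyδ²) ≤ 1 + (x+y)δ
      key : ∀ n → (z * ½^ n) * ½^ n ≤ 1ℝ → approx (x + y) n * (1ℝ - z * ½^ n) ≤ approx x n * approx y n
      key n r = ≤-trans (*-mono-≤ˡ _ (<⇒≤ (approx>0 p+q n)) (1-x≤sqn n (0≤* z≥0 (<⇒≤ (0<½^ n))) r)) (≤-trans (≡⇒≤ (sym (sqn-* n (den (x + y) n ⁻¹) (1ℝ - (z * ½^ n) * ½^ n)))) (≤-trans (sqn-mono n (0≤* (<⇒≤ (inv-pos (den>0 p+q n))) (≤⇒0≤ r)) step) (≡⇒≤ (sqn-* n (den x n ⁻¹) (den y n ⁻¹)))))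
        where
          A = den x n
          B = den y n
          C = den (x + y) n
          A>0 = den>0 p n
          B>0 = den>0 q n
          C>0 = den>0 p+q n
          w = 1ℝ - (z * ½^ n) * ½^ n
          step : C ⁻¹ * w ≤ A ⁻¹ * B ⁻¹
          step = *-cancel-≤ˡ (C * (A * B)) (*-pos C>0 (*-pos A>0 B>0)) (subst₂ _≤_ (sym lhs) (sym rhs) (≤-by ((x + y) * z * (½^ n * ½^ n * ½^ n) + z * z * (½^ n * ½^ n * ½^ n * ½^ n))
                  (0≤+ (0≤* (0≤* p+q z≥0) (0≤* (0≤sq _) (<⇒≤ (0<½^ n)))) (0≤* (0≤sq z) (0≤* (0≤* (0≤sq _) (<⇒≤ (0<½^ n))) (<⇒≤ (0<½^ n)))))
                  (solve 3 (λ x y a → 𝟙 :+ (x :+ y) :* a := (𝟙 :+ x :* a) :* (𝟙 :+ y :* a) :* (𝟙 :- x :* y :* a :* a) :+ ((x :+ y) :* (x :* y) :* (a :* a :* a) :+ x :* y :* (x :* y) :* (a :* a :* a :* a))) refl x y (½^ n))))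
            where
              lhs : C * (A * B) * (C ⁻¹ * w) ≡ A * B * w
              lhs = trans (solve 5 (λ c a b i w → c :* (a :* b) :* (i :* w) := (c :* i) :* (a :* b :* w)) refl C A B (C ⁻¹) w) (trans (cong (_* (A * B * w)) (*-inv⁺ C>0)) (*-identityˡ _))
              rhs : C * (A * B) * (A ⁻¹ * B ⁻¹) ≡ C
              rhs = trans (solve 5 (λ c a b i j → c :* (a :* b) :* (i :* j) := c :* ((a :* i) :* (b :* j))) refl C A B (A ⁻¹) (B ⁻¹)) (trans (cong₂ (λ s t → C * (s * t)) (*-inv⁺ A>0) (*-inv⁺ B>0)) (solve 1 (λ c → c :* (𝟙 :* 𝟙) := c) refl C))
      both : ∀ n k → E (x + y) ≤ approx x n * approx y k
      both n k = ≤-limit z (λ j → ≤-stable (λ c → archimedes z (λ { (M , z<M) → c (go j (n ℕ.+ k ℕ.+ M ℕ.+ j) (ℕₚ.≤-trans (ℕₚ.m≤m+n n k) (ℕₚ.≤-trans (ℕₚ.m≤m+n (n ℕ.+ k) M) (ℕₚ.m≤m+n _ j))) (ℕₚ.≤-trans (ℕₚ.m≤n+m k n) (ℕₚ.≤-trans (ℕₚ.m≤m+n (n ℕ.+ k) M) (ℕₚ.m≤m+n _ j))) (ℕₚ.≤-trans (ℕₚ.m≤n+m M (n ℕ.+ k)) (ℕₚ.m≤m+n _ j)) (ℕₚ.m≤n+m j (n ℕ.+ k ℕ.+ M)) z<M) })))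
        where
          go : ∀ {M} j N → n ℕ.≤ N → k ℕ.≤ N → M ℕ.≤ N → j ℕ.≤ N → z < fromℕ M → E (x + y) ≤ approx x n * approx y k + z * (fromℕ (suc j)) ⁻¹
          go {M} j N n≤ k≤ M≤ j≤ z<M = ≤-trans (≤-trans (≡⇒≤ (solve 2 (λ e t → e := e :* (𝟙 :- t) :+ e :* t) refl (E (x + y)) (z * ½^ N)))
               (+-mono-≤ (≤-trans (*-mono-≤ʳ _ (≤⇒0≤ small) (E≤approx p+q N)) (≤-trans (key N small2) (*-mono-≤ (<⇒≤ (approx>0 p N)) (<⇒≤ (approx>0 q k)) (approx-mono p n≤) (approx-mono q k≤))))
                 (≤-trans (*-mono-≤ʳ (z * ½^ N) (0≤* z≥0 (<⇒≤ (0<½^ N))) (E≤1 p+q)) (≡⇒≤ (*-identityˡ _)))))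
               (+-mono-≤ (≤-refl {approx x n * approx y k}) (*-mono-≤ˡ z z≥0 (≤-trans (½^≤1/ N) (inv-mono (0<ℕ j) (fromℕ-mono-≤ (ℕ.s≤s j≤))))))
            where
              small : z * ½^ N ≤ 1ℝ
              small = ≤-trans (*-mono-≤ʳ (½^ N) (<⇒≤ (0<½^ N)) (≤-trans (<⇒≤ z<M) (fromℕ-mono-≤ (ℕₚ.≤-trans M≤ (ℕₚ.<⇒≤ (n<pow2 N)))))) (≡⇒≤ (pow2*½^ N))
              small2 : (z * ½^ N) * ½^ N ≤ 1ℝ
              small2 = subst ((z * ½^ N) * ½^ N ≤_) (*-identityˡ 1ℝ) (*-mono-≤ (0≤* z≥0 (<⇒≤ (0<½^ N))) 0≤1 small (½^≤1 N))
      div : ∀ {a b c} → 0ℝ < b → a ≤ c * b → a * b ⁻¹ ≤ c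
      div {a} {b} {c} b>0 r = *-cancel-≤ʳ b b>0 (subst (_≤ c * b) (sym (trans (*-assoc a (b ⁻¹) b) (trans (cong (a *_) (trans (*-comm _ _) (*-inv⁺ b>0))) (*-identityʳ a)))) r)
      undiv : ∀ {a b c} → 0ℝ < b → a * b ⁻¹ ≤ c → a ≤ c * b
      undiv {a} {b} {c} b>0 r = subst (_≤ c * b) (trans (*-assoc a (b ⁻¹) b) (trans (cong (a *_) (trans (*-comm _ _) (*-inv⁺ b>0))) (*-identityʳ a))) (*-mono-≤ʳ b (<⇒≤ b>0) r)
      half : ∀ k → E (x + y) ≤ E x * approx y k
      half k = undiv (approx>0 q k) (≤E p (λ n → div (approx>0 q k) (both n k)))
      -- Positivity of E is deduced from this lemma later, so the case E x = 0 is treated here.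
      E>0 : 0ℝ < E x ⊎ E x ≡ 0ℝ
      E>0 with ≤-split (0≤E p)
      ... | inj₁ a = inj₁ a
      ... | inj₂ a = inj₂ (sym a)
      ge : E (x + y) ≤ E x * E y
      ge with E>0
      ... | inj₁ e = subst (E (x + y) ≤_) (*-comm (E y) (E x)) (undiv e (≤E q (λ k → div e (subst (E (x + y) ≤_) (*-comm (E x) (approx y k)) (half k)))))
      ... | inj₂ e = subst (E (x + y) ≤_) (trans (trans (cong (_* approx y 0) e) (zeroˡ _)) (sym (trans (cong (_* E y) e) (zeroˡ _)))) (half 0)

  E-mono : ∀ {x y} → 0ℝ ≤ x → x ≤ y → E y ≤ E x
  E-mono {x} {y} p q = subst (_≤ E x) (trans (sym (E-+ p (≤⇒0≤ q))) (cong E (solve 2 (λ x y → x :+ (y :- x) := y) refl x y))) (subst (E x * E (y - x) ≤_) (*-identityʳ _) (*-mono-≤ˡ (E x) (0≤E p) (E≤1 (≤⇒0≤ q))))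

  E-× : ∀ k {x} → 0ℝ ≤ x → E (fromℕ k * x) ≡ E x ^ k
  E-× zero {x} p = trans (cong E (zeroˡ x)) E0
  E-× (suc k) {x} p = trans (cong E (solve 2 (λ k x → (𝟙 :+ k) :* x := x :+ k :* x) refl (fromℕ k) x)) (trans (E-+ p (0≤* (0≤ℕ k) p)) (cong (E x *_) (E-× k p)))

  -- E x is the (n + 1)-st power of E (x / (n + 1)) ≥ 1 - x / (n + 1), which is positive once n > x.
  E-pos : ∀ {x} → 0ℝ ≤ x → 0ℝ < E x
  E-pos {x} p = <-stable (λ c → archimedes x (λ { (n , x<n) → c (go n x<n) }))
    where
      go : ∀ n → x < fromℕ n → 0ℝ < E x
      go n x<n = subst (0ℝ <_) (trans (sym (E-× (suc n) y≥0)) (cong E (trans (solve 3 (λ n x i → n :* (x :* i) := x :* (n :* i)) refl N x (N ⁻¹)) (trans (cong (x *_) (*-inv⁺ (0<ℕ n))) (*-identityʳ x))))) (0<^ (suc n) (<-≤-trans (<⇒0< y<1) (1-x≤E y≥0)))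
        where
          N = fromℕ (suc n)
          y = x * N ⁻¹
          y≥0 = 0≤* p (<⇒≤ (inv-pos (0<ℕ n)))
          y<1 : y < 1ℝ
          y<1 = *-cancel-<ˡ N (0<ℕ n) (subst₂ _<_ (sym (trans (solve 3 (λ n x i → n :* (x :* i) := x :* (n :* i)) refl N x (N ⁻¹)) (trans (cong (x *_) (*-inv⁺ (0<ℕ n))) (*-identityʳ x)))) (sym (*-identityʳ N)) (<-≤-trans x<n (fromℕ-mono-≤ (ℕₚ.n≤1+n n))))

  E≤inv : ∀ {x} → 0ℝ ≤ x → E x * (1ℝ + x) ≤ 1ℝ
  E≤inv {x} p = ≤-trans (*-mono-≤ʳ (1ℝ + x) (0≤+ 0≤1 p) (E≤approx p 0)) (≡⇒≤ (trans (cong (λ t → (1ℝ + t) ⁻¹ * (1ℝ + x)) (*-identityʳ x)) (trans (*-comm _ _) (*-inv⁺ (0<+ 0<1 p)))))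

 -- The integers from -s to s' - 1.
 win : ℕ → ℕ → List ℤ
 win s s' = map ℤ.+_ (range s') ++ map -[1+_] (range s)

 -- Riemann sums of the Gaussian on a half line and on integer windows.

 module GaussSum where
  open Field
  open Sums
  open Exponential

  ∑-range-split : ∀ m n (f : ℕ → ℝ) → ∑ (range (m ℕ.+ n)) f ≡ ∑ (range n) f + ∑ (range m) (λ i → f (n ℕ.+ i))
  ∑-range-split zero n f = sym (+-identityʳ _)
  ∑-range-split (suc m) n f = trans (cong₂ _+_ (cong f (ℕₚ.+-comm m n)) (∑-range-split m n f)) (solve 3 (λ a b c → a :+ (b :+ c) := b :+ (a :+ c)) refl (f (n ℕ.+ m)) _ _)

  ∑-range-shift : ∀ n (f : ℕ → ℝ) → ∑ (range (suc n)) f ≡ f 0 + ∑ (range n) (f ∘ suc)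
  ∑-range-shift zero f = refl
  ∑-range-shift (suc n) f = trans (cong (f (suc n) +_) (∑-range-shift n f)) (solve 3 (λ a b c → a :+ (b :+ c) := b :+ (a :+ c)) refl (f (suc n)) (f 0) _)

  ∑-blocks : ∀ K M (f : ℕ → ℝ) → ∑ (range (K ℕ.* M)) f ≡ ∑ (range K) (λ j → ∑ (range M) (λ i → f (j ℕ.* M ℕ.+ i)))
  ∑-blocks zero M f = refl
  ∑-blocks (suc K) M f = trans (∑-range-split M (K ℕ.* M) f) (trans (+-comm _ _) (cong (∑ (range M) (λ i → f (K ℕ.* M ℕ.+ i)) +_) (∑-blocks K M f)))

  ∑-range-mono : ∀ {m n} (f : ℕ → ℝ) → (∀ k → 0ℝ ≤ f k) → m ℕ.≤ n → ∑ (range m) f ≤ ∑ (range n) f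
  ∑-range-mono {m} {n} f p q = ≤-by (∑ (range (n ℕ.∸ m)) (λ i → f (m ℕ.+ i))) (0≤∑ (range (n ℕ.∸ m)) (λ i → p _)) (trans (cong (λ k → ∑ (range k) f) (sym (ℕₚ.m∸n+n≡m q))) (∑-range-split (n ℕ.∸ m) m f))

  ∑-range-const : ∀ n c → ∑ (range n) (λ _ → c) ≡ fromℕ n * c
  ∑-range-const zero c = sym (zeroˡ c)
  ∑-range-const (suc n) c = trans (cong (c +_) (∑-range-const n c)) (solve 2 (λ n c → c :+ n :* c := (𝟙 :+ n) :* c) refl (fromℕ n) c)

  ∑-win : ∀ s s' (f : ℤ → ℝ) → ∑ (win s s') f ≡ ∑ (range s') (λ k → f (ℤ.+ k)) + ∑ (range s) (λ k → f -[1+ k ])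
  ∑-win s s' f = trans (∑-++ (map ℤ.+_ (range s')) _) (cong₂ _+_ (∑-map ℤ.+_ (range s')) (∑-map -[1+_] (range s)))

  private
    ∑-win-step : ∀ s s' (f : ℤ → ℝ) → ∑ (win s (suc s')) (λ z → f (z ℤ.- ℤ.+ 1)) ≡ ∑ (win (suc s) s') f
    ∑-win-step s s' f = trans (∑-win s (suc s') _) (trans (cong₂ _+_ (∑-range-shift s' _) (∑-cong (range s) (λ k → cong f (cong -[1+_] (cong suc (ℕₚ.+-identityʳ k)))))) (trans (solve 3 (λ a b c → a :+ b :+ c := b :+ (a :+ c)) refl _ _ _) (trans (cong (∑ (range s') (λ k → f (ℤ.+ k)) +_) (sym (∑-range-shift s (f ∘ -[1+_])))) (sym (∑-win (suc s) s' f)))))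

  -- Translation by h moves h places from one end of the window to the other. It recentres Riemann
  -- sums at an arbitrary point.
  ∑-win-shift : ∀ h s s' (f : ℤ → ℝ) → ∑ (win s (h ℕ.+ s')) (λ z → f (z ℤ.- ℤ.+ h)) ≡ ∑ (win (h ℕ.+ s) s') f
  ∑-win-shift zero s s' f = ∑-cong (win s s') (λ z → cong f (ℤₚ.+-identityʳ z))
  ∑-win-shift (suc h) s s' f = trans (∑-cong (win s (suc (h ℕ.+ s'))) (λ z → cong f (sub z))) (trans (∑-win-step s (h ℕ.+ s') (λ z → f (z ℤ.- ℤ.+ h)))
       (trans (∑-win-shift h (suc s) s' f) (cong (λ k → ∑ (win k s') f) (ℕₚ.+-suc h s))))
    where
      sub : ∀ z → z ℤ.- ℤ.+ suc h ≡ z ℤ.- ℤ.+ 1 ℤ.- ℤ.+ h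
      sub z = trans (cong (λ t → z ℤ.- t) (ℤₚ.pos-+ 1 h)) (trans (cong (λ t → z ℤ.+ t) (ℤₚ.neg-distrib-+ (ℤ.+ 1) (ℤ.+ h))) (sym (ℤₚ.+-assoc z (ℤ.- ℤ.+ 1) (ℤ.- ℤ.+ h))))

  ∑-win-shift⁻ : ∀ h s s' (f : ℤ → ℝ) → ∑ (win (h ℕ.+ s) s') (λ z → f (z ℤ.+ ℤ.+ h)) ≡ ∑ (win s (h ℕ.+ s')) f
  ∑-win-shift⁻ h s s' f = trans (sym (∑-win-shift h s s' (λ z → f (z ℤ.+ ℤ.+ h)))) (∑-cong (win s (h ℕ.+ s')) (λ z → cong f (trans (ℤₚ.+-assoc z (ℤ.- ℤ.+ h) (ℤ.+ h)) (trans (cong (λ t → z ℤ.+ t) (ℤₚ.+-inverseˡ (ℤ.+ h))) (ℤₚ.+-identityʳ z)))))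

  module _ (a : ℝ) (a>0 : 0ℝ < a) where

    gauss : ℝ → ℝ
    gauss x = E (a * (x * x))

    0≤ax² : ∀ x → 0ℝ ≤ a * (x * x)
    0≤ax² x = 0≤* (<⇒≤ a>0) (0≤sq x)

    gauss-anti : ∀ {x y} → x * x ≤ y * y → gauss y ≤ gauss x
    gauss-anti {x} {y} p = E-mono (0≤ax² x) (*-mono-≤ˡ a (<⇒≤ a>0) p)

    0≤gauss : ∀ x → 0ℝ ≤ gauss x
    0≤gauss x = 0≤E (0≤ax² x)

    gauss≤1 : ∀ x → gauss x ≤ 1ℝ
    gauss≤1 x = E≤1 (0≤ax² x)

    ν : ℕ → ℝ
    ν N = (fromℕ (suc N)) ⁻¹

    ν>0 : ∀ N → 0ℝ < ν N
    ν>0 N = inv-pos (0<ℕ N)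

    g : ℕ → ℕ → ℝ
    g N k = gauss (fromℕ k * ν N)

    -- Right and left Riemann sums with step 1/(N + 1) over K cells of the half line; by
    -- monotonicity they bound the integral over these cells from below and above.
    lower upper : ℕ → ℕ → ℝ
    lower N K = ν N * ∑ (range K) (λ k → g N (suc k))
    upper N K = ν N * ∑ (range K) (g N)

    private
      frac≤ : ∀ {j k} N N' → j ℕ.* suc N' ℕ.≤ k ℕ.* suc N → fromℕ j * ν N ≤ fromℕ k * ν N'
      frac≤ {j} {k} N N' p = *-cancel-≤ˡ (n * n') (*-pos (0<ℕ N) (0<ℕ N')) (subst₂ _≤_ (sym (lhs)) (sym rhs) (subst₂ _≤_ (fromℕ-* j (suc N')) (fromℕ-* k (suc N)) (fromℕ-mono-≤ p)))
        where
          n = fromℕ (suc N)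
          n' = fromℕ (suc N')
          lhs : n * n' * (fromℕ j * ν N) ≡ fromℕ j * n'
          lhs = trans (solve 4 (λ a b c i → a :* b :* (c :* i) := c :* b :* (a :* i)) refl n n' (fromℕ j) (ν N)) (trans (cong (fromℕ j * n' *_) (*-inv⁺ (0<ℕ N))) (*-identityʳ _))
          rhs : n * n' * (fromℕ k * ν N') ≡ fromℕ k * n
          rhs = trans (solve 4 (λ a b c i → a :* b :* (c :* i) := c :* a :* (b :* i)) refl n n' (fromℕ k) (ν N')) (trans (cong (fromℕ k * n *_) (*-inv⁺ (0<ℕ N'))) (*-identityʳ _))

      0≤kν : ∀ k N → 0ℝ ≤ fromℕ k * ν N
      0≤kν k N = 0≤* (0≤ℕ k) (<⇒≤ (ν>0 N))

      g≤g : ∀ {j k} N N' → j ℕ.* suc N' ℕ.≤ k ℕ.* suc N → g N' k ≤ g N j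
      g≤g {j} {k} N N' p = gauss-anti (*-mono-≤ (0≤kν j N) (0≤kν k N') (frac≤ {j} {k} N N' p) (frac≤ {j} {k} N N' p))

      0≤g : ∀ N k → 0ℝ ≤ g N k
      0≤g N k = 0≤gauss _

      g-anti : ∀ N k → g N (suc k) ≤ g N k
      g-anti N k = g≤g {k} {suc k} N N (ℕₚ.*-monoˡ-≤ (suc N) (ℕₚ.n≤1+n k))

    lower≤upper : ∀ N K → lower N K ≤ upper N K
    lower≤upper N K = *-mono-≤ˡ (ν N) (<⇒≤ (ν>0 N)) (∑-mono (range K) (g-anti N))

    upper≤lower+ν : ∀ N K → upper N K ≤ lower N K + ν N
    upper≤lower+ν N K = ≤-trans (*-mono-≤ˡ (ν N) (<⇒≤ (ν>0 N)) (≤-trans (≤-by (g N K) (0≤g N K) (trans (sym (∑-range-shift K (g N))) (+-comm _ _))) (+-mono-≤ (gauss≤1 _) (≤-refl {∑ (range K) (λ k → g N (suc k))}))))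
         (≡⇒≤ (solve 2 (λ v s → v :* (𝟙 :+ s) := v :* s :+ v) refl (ν N) _))

    -- suc (N ⊗ M) = suc N * suc M
    _⊗_ : ℕ → ℕ → ℕ
    N ⊗ M = M ℕ.+ N ℕ.* suc M

    ν-⊗ : ∀ N M → fromℕ (suc M) * ν (N ⊗ M) ≡ ν N
    ν-⊗ N M = inv-uniq (0<ℕ N) (trans (sym (*-assoc _ _ _)) (trans (cong (_* ν (N ⊗ M)) (sym (fromℕ-* (suc N) (suc M)))) (*-inv⁺ (0<ℕ (N ⊗ M)))))

    refine-lower : ∀ N K M → lower N K ≤ lower (N ⊗ M) (K ℕ.* suc M)
    refine-lower N K M = ≤-trans (≡⇒≤ (trans (cong (_* ∑ (range K) (λ k → g N (suc k))) (sym (ν-⊗ N M))) (solve 3 (λ m v s → m :* v :* s := v :* (m :* s)) refl (fromℕ (suc M)) (ν (N ⊗ M)) _)))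
         (*-mono-≤ˡ (ν (N ⊗ M)) (<⇒≤ (ν>0 (N ⊗ M))) (≤-trans (≡⇒≤ (sym (∑-*ˡ (range K) _))) (≤-trans (∑-mono (range K) blk) (≡⇒≤ (sym (∑-blocks K (suc M) (λ k → g (N ⊗ M) (suc k))))))))
      where
        blk : ∀ j → fromℕ (suc M) * g N (suc j) ≤ ∑ (range (suc M)) (λ i → g (N ⊗ M) (suc (j ℕ.* suc M ℕ.+ i)))
        blk j = ≤-trans (≡⇒≤ (sym (∑-range-const (suc M) _))) (∑-mono∈ (range (suc M)) (λ i p → g≤g {suc (j ℕ.* suc M ℕ.+ i)} {suc j} (N ⊗ M) N
                 (ℕₚ.≤-trans (ℕₚ.*-monoˡ-≤ (suc N) (ℕₚ.≤-trans (ℕₚ.≤-reflexive (sym (ℕₚ.+-suc (j ℕ.* suc M) i))) (ℕₚ.≤-trans (ℕₚ.+-monoʳ-≤ (j ℕ.* suc M) (range-< (suc M) p)) (ℕₚ.≤-reflexive (ℕₚ.+-comm (j ℕ.* suc M) (suc M))))))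
                   (ℕₚ.≤-reflexive (trans (ℕₚ.*-assoc (suc j) (suc M) (suc N)) (cong (suc j ℕ.*_) (ℕₚ.*-comm (suc M) (suc N))))))))

    refine-upper : ∀ N K M → upper (N ⊗ M) (K ℕ.* suc M) ≤ upper N K
    refine-upper N K M = ≤-trans (*-mono-≤ˡ (ν (N ⊗ M)) (<⇒≤ (ν>0 (N ⊗ M))) (≤-trans (≡⇒≤ (∑-blocks K (suc M) (g (N ⊗ M)))) (≤-trans (∑-mono (range K) blk) (≡⇒≤ (∑-*ˡ (range K) _)))))
         (≡⇒≤ (trans (solve 3 (λ m v s → v :* (m :* s) := m :* v :* s) refl (fromℕ (suc M)) (ν (N ⊗ M)) _) (cong (_* ∑ (range K) (g N)) (ν-⊗ N M))))
      where
        blk : ∀ j → ∑ (range (suc M)) (λ i → g (N ⊗ M) (j ℕ.* suc M ℕ.+ i)) ≤ fromℕ (suc M) * g N j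
        blk j = ≤-trans (∑-mono (range (suc M)) (λ i → g≤g {j} {j ℕ.* suc M ℕ.+ i} N (N ⊗ M)
                 (ℕₚ.≤-trans (ℕₚ.≤-reflexive (trans (cong (j ℕ.*_) (ℕₚ.*-comm (suc N) (suc M))) (sym (ℕₚ.*-assoc j (suc M) (suc N))))) (ℕₚ.*-monoˡ-≤ (suc N) (ℕₚ.m≤m+n (j ℕ.* suc M) i)))))
                 (≡⇒≤ (∑-range-const (suc M) _))

    upper-mono : ∀ N {K K'} → K ℕ.≤ K' → upper N K ≤ upper N K'
    upper-mono N p = *-mono-≤ˡ (ν N) (<⇒≤ (ν>0 N)) (∑-range-mono (g N) (0≤g N) p)

    -- Both sums are compared on the common refinement with step 1/((N + 1)(N' + 1)).
    lower≤upper′ : ∀ N' K' N → lower N' K' ≤ upper N (K' ℕ.* suc N)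
    lower≤upper′ N' K' N = ≤-trans (refine-lower N' K' N) (≤-trans (lower≤upper (N' ⊗ N) (K' ℕ.* suc N)) (≤-trans (≤-trans (upper-mono (N' ⊗ N) (ℕₚ.m≤m*n (K' ℕ.* suc N) (suc N'))) (≡⇒≤ (cong (λ t → upper t (K' ℕ.* suc N ℕ.* suc N')) sw))) (refine-upper N (K' ℕ.* suc N) N')))
      where
        sw : N' ⊗ N ≡ N ⊗ N'
        sw = ℕₚ.suc-injective (ℕₚ.*-comm (suc N') (suc N))

    private
      -- Since exp(-t) ≤ 1/(1 + t) ≤ 1/t, the terms are of order 1/k², and 1/(k + 1)² ≤ 1/k - 1/(k +
      -- 1) telescopes.
      tail-bound : ∀ N K T → ∑ (range T) (λ i → g N (suc (suc K) ℕ.+ i)) ≤ fromℕ (suc N) * fromℕ (suc N) * a ⁻¹ * ((fromℕ (suc K)) ⁻¹ - (fromℕ (suc K ℕ.+ T)) ⁻¹)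
      tail-bound N K zero = ≡⇒≤ (sym (trans (cong (λ t → c * ((fromℕ (suc K)) ⁻¹ - (fromℕ t) ⁻¹)) (ℕₚ.+-identityʳ (suc K))) (solve 2 (λ c i → c :* (i :- i) := K' 0) refl c ((fromℕ (suc K)) ⁻¹))))
        where
          c = fromℕ (suc N) * fromℕ (suc N) * a ⁻¹
          K' : ∀ {n} → ℕ → Sv.Polynomial n
          K' = Field.K
      tail-bound N K (suc T) = ≤-trans (+-mono-≤ one (tail-bound N K T)) (≡⇒≤ (trans (solve 4 (λ c i j l → c :* (j :- l) :+ c :* (i :- j) := c :* (i :- l)) refl c ((fromℕ (suc K)) ⁻¹) (fromℕ k ⁻¹) (fromℕ (suc k) ⁻¹)) (cong (λ t → c * ((fromℕ (suc K)) ⁻¹ - (fromℕ t) ⁻¹)) (sym (ℕₚ.+-suc (suc K) T)))))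
        where
          c = fromℕ (suc N) * fromℕ (suc N) * a ⁻¹
          k = suc K ℕ.+ T
          n = fromℕ (suc N)
          p = fromℕ k
          q = fromℕ (suc k)
          p>0 : 0ℝ < p
          p>0 = 0<ℕ (K ℕ.+ T)
          q>0 : 0ℝ < q
          q>0 = 0<ℕ k
          y = a * ((q * ν N) * (q * ν N))
          raw : a * (q * q) * g N (suc k) ≤ n * n
          raw = ≤-trans (≡⇒≤ (trans (solve 2 (λ x e → x :* e := x :* e :* (𝟙 :* 𝟙)) refl (a * (q * q)) (g N (suc k))) (trans (cong (λ t → a * (q * q) * g N (suc k) * (t * t)) (sym (*-inv⁺ (0<ℕ N))))
                   (solve 5 (λ a q e n v → a :* (q :* q) :* e :* (n :* v :* (n :* v)) := n :* n :* (e :* (a :* (q :* v :* (q :* v))))) refl a q (g N (suc k)) n (ν N)))))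
                 (≤-trans (*-mono-≤ˡ (n * n) (0≤sq n) (≤-trans (*-mono-≤ˡ (g N (suc k)) (0≤g N (suc k)) (≤-by 1ℝ 0≤1 (+-comm 1ℝ y))) (E≤inv (0≤ax² (q * ν N))))) (≡⇒≤ (*-identityʳ _)))
          one : g N (suc (suc K) ℕ.+ T) ≤ c * (p ⁻¹ - q ⁻¹)
          one = *-cancel-≤ˡ (a * (q * q)) (*-pos a>0 (*-pos q>0 q>0)) (≤-trans raw (≤-trans (≤-by (n * n * p ⁻¹) (0≤* (0≤sq n) (<⇒≤ (inv-pos p>0))) refl) (≡⇒≤ (sym rhs))))
            where
              diff : p ⁻¹ - q ⁻¹ ≡ p ⁻¹ * q ⁻¹
              diff = begin
                p ⁻¹ - q ⁻¹ ≡⟨ solve 2 (λ i j → i :- j := i :* 𝟙 :- j :* 𝟙) refl (p ⁻¹) (q ⁻¹) ⟩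
                p ⁻¹ * 1ℝ - q ⁻¹ * 1ℝ ≡⟨ cong₂ (λ s t → p ⁻¹ * s - q ⁻¹ * t) (sym (*-inv⁺ q>0)) (sym (*-inv⁺ p>0)) ⟩
                p ⁻¹ * ((1ℝ + p) * q ⁻¹) - q ⁻¹ * (p * p ⁻¹) ≡⟨ solve 3 (λ p i j → i :* ((𝟙 :+ p) :* j) :- j :* (p :* i) := i :* j) refl p (p ⁻¹) (q ⁻¹) ⟩
                p ⁻¹ * q ⁻¹ ∎ where open ≡-Reasoning
              rhs : a * (q * q) * (c * (p ⁻¹ - q ⁻¹)) ≡ n * n + n * n * p ⁻¹
              rhs = begin
                a * (q * q) * (n * n * a ⁻¹ * (p ⁻¹ - q ⁻¹)) ≡⟨ cong (λ t → a * (q * q) * (n * n * a ⁻¹ * t)) diff ⟩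
                a * (q * q) * (n * n * a ⁻¹ * (p ⁻¹ * q ⁻¹)) ≡⟨ solve 6 (λ a q n b i j → a :* (q :* q) :* (n :* n :* b :* (i :* j)) := (a :* b) :* (q :* j) :* (n :* n :* (i :* q))) refl a q n (a ⁻¹) (p ⁻¹) (q ⁻¹) ⟩
                (a * a ⁻¹) * (q * q ⁻¹) * (n * n * (p ⁻¹ * (1ℝ + p))) ≡⟨ cong₂ (λ s t → s * t * (n * n * (p ⁻¹ * (1ℝ + p)))) (*-inv⁺ a>0) (*-inv⁺ q>0) ⟩
                1ℝ * 1ℝ * (n * n * (p ⁻¹ * (1ℝ + p))) ≡⟨ solve 3 (λ n p i → 𝟙 :* 𝟙 :* (n :* n :* (i :* (𝟙 :+ p))) := n :* n :* (p :* i) :+ n :* n :* i) refl n p (p ⁻¹) ⟩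
                n * n * (p * p ⁻¹) + n * n * p ⁻¹ ≡⟨ cong (λ t → n * n * t + n * n * p ⁻¹) (*-inv⁺ p>0) ⟩
                n * n * 1ℝ + n * n * p ⁻¹ ≡⟨ cong (_+ n * n * p ⁻¹) (*-identityʳ _) ⟩
                n * n + n * n * p ⁻¹ ∎ where open ≡-Reasoning

    tail : ℕ → ℕ → ℝ
    tail N K = fromℕ (suc N) * a ⁻¹ * (fromℕ (suc K)) ⁻¹

    upper-tail : ∀ N K K' → upper N K' ≤ upper N (suc (suc K)) + tail N K
    upper-tail N K K' = ≤-trans (upper-mono N (ℕₚ.m≤m+n K' (suc (suc K)))) (≤-trans (*-mono-≤ˡ (ν N) (<⇒≤ (ν>0 N)) (≤-trans (≡⇒≤ (∑-range-split K' (suc (suc K)) (g N))) (+-mono-≤ (≤-refl {∑ (range (suc (suc K))) (g N)}) (≤-trans (tail-bound N K K') (*-mono-≤ˡ c c≥0 (≤-by ((fromℕ (suc K ℕ.+ K')) ⁻¹) (<⇒≤ (inv-pos (0<ℕ (K ℕ.+ K')))) (solve 2 (λ i j → i := i :- j :+ j) refl _ _)))))))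
        (≡⇒≤ (trans (distribˡ _ _ _) (cong (upper N (suc (suc K)) +_) (trans (solve 4 (λ v n b i → v :* (n :* n :* b :* i) := (n :* v) :* (n :* b :* i)) refl (ν N) (fromℕ (suc N)) (a ⁻¹) _) (trans (cong (_* tail N K) (*-inv⁺ (0<ℕ N))) (*-identityˡ _)))))) )
      where
        c = fromℕ (suc N) * fromℕ (suc N) * a ⁻¹
        c≥0 = 0≤* (0≤sq (fromℕ (suc N))) (<⇒≤ (inv-pos a>0))

    private
      Sup : ℝ → Set
      Sup y = ∃ λ N → ∃ λ K → y ≡ lower N K

      bounded : ∀ N K → lower N K ≤ upper 0 2 + tail 0 0
      bounded N K = ≤-trans (lower≤upper′ N K 0) (upper-tail 0 0 (K ℕ.* 1))

      sup = lub Sup (lower 0 0 , 0 , 0 , refl) (upper 0 2 + tail 0 0 , λ { y (N , K , refl) → bounded N K })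

    -- the half Gaussian integral
    abstract
      J : ℝ
      J = proj₁ sup

      lower≤J : ∀ N K → lower N K ≤ J
      lower≤J N K = proj₁ (proj₂ sup) (lower N K) (N , K , refl)

      J≤ : ∀ b → (∀ N K → lower N K ≤ b) → J ≤ b
      J≤ b h = proj₂ (proj₂ sup) b (λ { y (N , K , refl) → h N K })

    J≤upper : ∀ N K → J ≤ upper N (suc (suc K)) + tail N K
    J≤upper N K = J≤ _ (λ N' K' → ≤-trans (lower≤upper′ N' K' N) (upper-tail N K (K' ℕ.* suc N)))

    0<J : 0ℝ < J
    0<J = <-≤-trans (*-pos (ν>0 0) (0<+ (E-pos (0≤ax² _)) ≤-refl)) (lower≤J 0 1)

    InCells : ℕ → (ℤ → ℝ) → Set
    InCells N y = ∀ z → fromℤ z * ν N ≤ y z × y z ≤ (fromℤ z + 1ℝ) * ν N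

    private
      pos-cell : ∀ N y → InCells N y → ∀ k → g N (suc k) ≤ gauss (y (ℤ.+ k)) × gauss (y (ℤ.+ k)) ≤ g N k
      pos-cell N y c k = gauss-anti (*-mono-≤ (≤-trans (0≤kν k N) lo) (0≤kν (suc k) N) hi' hi') , gauss-anti (*-mono-≤ (0≤kν k N) (≤-trans (0≤kν k N) lo) lo lo)
        where
          lo = proj₁ (c (ℤ.+ k))
          hi' : y (ℤ.+ k) ≤ fromℕ (suc k) * ν N
          hi' = ≤-trans (proj₂ (c (ℤ.+ k))) (≡⇒≤ (cong (_* ν N) (+-comm (fromℕ k) 1ℝ)))

      neg-cell : ∀ N y → InCells N y → ∀ k → g N (suc k) ≤ gauss (y -[1+ k ]) × gauss (y -[1+ k ]) ≤ g N k
      neg-cell N y c k = gauss-anti (≤-trans (≡⇒≤ (sq t)) (*-mono-≤ (≤-trans (0≤kν k N) lo) (0≤kν (suc k) N) hi hi)) , gauss-anti (≤-trans (*-mono-≤ (0≤kν k N) (≤-trans (0≤kν k N) lo) lo lo) (≡⇒≤ (sym (sq t))))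
        where
          t = y -[1+ k ]
          sq : ∀ t → t * t ≡ (- t) * (- t)
          sq t = solve 1 (λ t → t :* t := (:- t) :* (:- t)) refl t
          hi : - t ≤ fromℕ (suc k) * ν N
          hi = ≤-trans (neg-mono-≤ (proj₁ (c -[1+ k ]))) (≡⇒≤ (solve 2 (λ k v → :- ((:- k) :* v) := k :* v) refl (fromℕ (suc k)) (ν N)))
          lo : fromℕ k * ν N ≤ - t
          lo = ≤-trans (≡⇒≤ (solve 2 (λ k v → k :* v := :- ((:- (𝟙 :+ k) :+ 𝟙) :* v)) refl (fromℕ k) (ν N))) (neg-mono-≤ (proj₂ (c -[1+ k ])))

    -- Both halves of the window reach beyond N²+1, so the truncation error is O(1/N).
    riemann : ∀ N s s' y → InCells N y → suc N ℕ.* suc N ℕ.< s → suc N ℕ.* suc N ℕ.< s' →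
      let S = ν N * ∑ (win s s') (λ z → gauss (y z)) ; C = fromℕ 2 * (1ℝ + a ⁻¹) in
      S ≤ fromℕ 2 * J + C * ν N × fromℕ 2 * J ≤ S + C * ν N
    riemann N s s' y c p p' = up , down
      where
        S = ν N * ∑ (win s s') (λ z → gauss (y z))
        v≥0 = <⇒≤ (ν>0 N)
        split : S ≡ ν N * ∑ (range s') (λ k → gauss (y (ℤ.+ k))) + ν N * ∑ (range s) (λ k → gauss (y -[1+ k ]))
        split = trans (cong (ν N *_) (∑-win s s' _)) (distribˡ _ _ _)
        half-up : ∀ K → upper N K ≤ J + ν N
        half-up K = ≤-trans (upper≤lower+ν N K) (+-mono-≤ʳ (ν N) (lower≤J N K))
        up : S ≤ fromℕ 2 * J + fromℕ 2 * (1ℝ + a ⁻¹) * ν N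
        up = ≤-trans (≤-trans (≡⇒≤ split) (+-mono-≤ (≤-trans (*-mono-≤ˡ (ν N) v≥0 (∑-mono (range s') (λ k → proj₂ (pos-cell N y c k)))) (half-up s')) (≤-trans (*-mono-≤ˡ (ν N) v≥0 (∑-mono (range s) (λ k → proj₂ (neg-cell N y c k)))) (half-up s))))
               (≤-by (fromℕ 2 * a ⁻¹ * ν N) (0≤* (0≤* (0≤ℕ 2) (<⇒≤ (inv-pos a>0))) v≥0) (solve 3 (λ j v b → K 2 :* j :+ K 2 :* (𝟙 :+ b) :* v := (j :+ v :+ (j :+ v)) :+ K 2 :* b :* v) refl J (ν N) (a ⁻¹)))
        tail≤ : tail N (ℕ.pred (suc N ℕ.* suc N)) ≤ a ⁻¹ * ν N
        tail≤ = ≡⇒≤ (trans (cong (λ t → fromℕ (suc N) * a ⁻¹ * t) (trans (cong _⁻¹ (fromℕ-* (suc N) (suc N))) (inv-* (0<ℕ N) (0<ℕ N)))) (trans (solve 3 (λ n b v → n :* b :* (v :* v) := (n :* v) :* (b :* v)) refl (fromℕ (suc N)) (a ⁻¹) (ν N)) (trans (cong (_* (a ⁻¹ * ν N)) (*-inv⁺ (0<ℕ N))) (*-identityˡ _))))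
        half-down : ∀ K → suc N ℕ.* suc N ℕ.< K → J ≤ lower N K + (1ℝ + a ⁻¹) * ν N
        half-down K q = ≤-trans (J≤upper N (ℕ.pred (suc N ℕ.* suc N))) (≤-trans (+-mono-≤ (≤-trans (upper-mono N q) (upper≤lower+ν N K)) tail≤) (≡⇒≤ (solve 3 (λ l v b → l :+ v :+ b :* v := l :+ (𝟙 :+ b) :* v) refl (lower N K) (ν N) (a ⁻¹))))
        down : fromℕ 2 * J ≤ S + fromℕ 2 * (1ℝ + a ⁻¹) * ν N
        down = ≤-trans (≡⇒≤ (solve 1 (λ j → K 2 :* j := j :+ j) refl J)) (≤-trans (+-mono-≤ (half-down s' p') (half-down s p)) (≤-trans (≡⇒≤ (solve 3 (λ x y e → x :+ e :+ (y :+ e) := x :+ y :+ K 2 :* e) refl (lower N s') (lower N s) ((1ℝ + a ⁻¹) * ν N)))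
               (+-mono-≤ (≤-trans (+-mono-≤ (*-mono-≤ˡ (ν N) v≥0 (∑-mono (range s') (λ k → proj₁ (pos-cell N y c k)))) (*-mono-≤ˡ (ν N) v≥0 (∑-mono (range s) (λ k → proj₁ (neg-cell N y c k))))) (≡⇒≤ (sym split))) (≡⇒≤ (sym (*-assoc (fromℕ 2) _ _))))))

 -- The Gaussian integral as a function of its parameter, and limits with rate 1/N.

 module GaussIntegral where
  open Field
  open Sums
  open Exponential
  open GaussSum

  -- ∫ e^{-ax²} over the whole line for 0 < a, and 0 otherwise
  G : ℝ → ℝ
  G a with compare 0ℝ a
  ... | tri< p _ _ = fromℕ 2 * J a p
  ... | tri≈ _ _ _ = 0ℝ
  ... | tri> _ _ _ = 0ℝ

  ν′ : ℕ → ℝ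
  ν′ N = (fromℕ (suc N)) ⁻¹

  G-pos : ∀ {a} → 0ℝ < a → 0ℝ < G a
  G-pos {a} p with compare 0ℝ a
  ... | tri< q _ _ = *-pos (0<ℕ 1) (0<J a q)
  ... | tri≈ _ e _ = ⊥-elim (<-irrefl e p)
  ... | tri> _ _ q = ⊥-elim (<-asym p q)

  G-lower : ∀ {a} (p : 0ℝ < a) N K → fromℕ 2 * lower a p N K ≤ G a
  G-lower {a} p N K with compare 0ℝ a
  ... | tri< q _ _ = *-mono-≤ˡ (fromℕ 2) (0≤ℕ 2) (lower≤J a q N K)
  ... | tri≈ _ e _ = ⊥-elim (<-irrefl e p)
  ... | tri> _ _ q = ⊥-elim (<-asym p q)

  G≤ : ∀ {a} (p : 0ℝ < a) b → (∀ N K → fromℕ 2 * lower a p N K ≤ b) → G a ≤ b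
  G≤ {a} p b h with compare 0ℝ a
  ... | tri< q _ _ = ≤-trans (*-mono-≤ˡ (fromℕ 2) (0≤ℕ 2) (J≤ a q (b * (fromℕ 2) ⁻¹) (λ N K → *-cancel-≤ˡ (fromℕ 2) (0<ℕ 1) (≤-trans (h N K) (≡⇒≤ (sym dbl)))))) (≡⇒≤ dbl)
    where
      dbl : fromℕ 2 * (b * (fromℕ 2) ⁻¹) ≡ b
      dbl = trans (solve 3 (λ t b i → t :* (b :* i) := b :* (t :* i)) refl (fromℕ 2) b _) (trans (cong (b *_) (*-inv⁺ (0<ℕ 1))) (*-identityʳ b))
  ... | tri≈ _ e _ = ⊥-elim (<-irrefl e p)
  ... | tri> _ _ q = ⊥-elim (<-asym p q)

  -- convergence with rate O(1/N)
  infix 4 _⟶_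
  _⟶_ : (ℕ → ℝ) → ℝ → Set
  s ⟶ l = ∃ λ C → 0ℝ ≤ C × (∀ N → s N ≤ l + C * ν′ N × l ≤ s N + C * ν′ N)

  0<ν′ : ∀ N → 0ℝ < ν′ N
  0<ν′ N = inv-pos (0<ℕ N)

  ν′≤1 : ∀ N → ν′ N ≤ 1ℝ
  ν′≤1 N = *-cancel-≤ˡ (fromℕ (suc N)) (0<ℕ N) (subst₂ _≤_ (sym (*-inv⁺ (0<ℕ N))) (sym (*-identityʳ _)) (≤-by (fromℕ N) (0≤ℕ N) refl))

  G-riemann : ∀ {a} → 0ℝ < a → (S : ℕ → ℝ) →
    (∀ (p : 0ℝ < a) N → ∃ λ s → ∃ λ s' → ∃ λ y → InCells a p N y × suc N ℕ.* suc N ℕ.< s × suc N ℕ.* suc N ℕ.< s' × S N ≡ ν′ N * ∑ (win s s') (λ z → E (a * (y z * y z)))) → S ⟶ G a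
  G-riemann {a} p S h with compare 0ℝ a
  ... | tri≈ _ e _ = ⊥-elim (<-irrefl e p)
  ... | tri> _ _ q = ⊥-elim (<-asym p q)
  ... | tri< q _ _ = C , 0≤* (0≤ℕ 2) (0≤+ 0≤1 (<⇒≤ (inv-pos q))) , λ N → go N (h q N)
    where
      C = fromℕ 2 * (1ℝ + a ⁻¹)
      go : ∀ N → (∃ λ s → ∃ λ s' → ∃ λ y → InCells a q N y × suc N ℕ.* suc N ℕ.< s × suc N ℕ.* suc N ℕ.< s' × S N ≡ ν′ N * ∑ (win s s') (λ z → E (a * (y z * y z)))) →
           S N ≤ fromℕ 2 * J a q + C * ν′ N × fromℕ 2 * J a q ≤ S N + C * ν′ N
      go N (s , s' , y , c , u , u' , e) = subst (λ t → t ≤ fromℕ 2 * J a q + C * ν′ N × fromℕ 2 * J a q ≤ t + C * ν′ N) (sym e) (riemann a q N s s' y c u u')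

  ⟶-≤ : ∀ {s t l k} → s ⟶ l → t ⟶ k → (∀ N → s N ≤ t N) → l ≤ k
  ⟶-≤ {s} {t} {l} {k} (C , _ , p) (D , _ , q) h = ≤-limit (C + D) (λ N → ≤-trans (proj₂ (p N)) (≤-trans (+-mono-≤ʳ _ (≤-trans (h N) (proj₁ (q N)))) (≡⇒≤ (solve 4 (λ k d v c → k :+ d :* v :+ c :* v := k :+ (c :+ d) :* v) refl k D (ν′ N) C))))

  ⟶-const : ∀ c → (λ _ → c) ⟶ c
  ⟶-const c = 0ℝ , ≤-refl , λ N → ≡⇒≤ (e N) , ≡⇒≤ (e N)
    where e : ∀ N → c ≡ c + 0ℝ * ν′ N
          e N = solve 2 (λ c v → c := c :+ K 0 :* v) refl c (ν′ N)

  ⟶-cong : ∀ {s t l} → (∀ N → s N ≡ t N) → s ⟶ l → t ⟶ l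
  ⟶-cong {s} {t} {l} h (C , p , q) = C , p , λ N → subst (λ x → x ≤ l + C * ν′ N × l ≤ x + C * ν′ N) (h N) (q N)

  ⟶-+ : ∀ {s t l k} → s ⟶ l → t ⟶ k → (λ N → s N + t N) ⟶ l + k
  ⟶-+ {s} {t} {l} {k} (C , p , f) (D , q , g) = C + D , 0≤+ p q , λ N →
      ≤-trans (+-mono-≤ (proj₁ (f N)) (proj₁ (g N))) (≡⇒≤ (sh l k N)) , ≤-trans (+-mono-≤ (proj₂ (f N)) (proj₂ (g N))) (≡⇒≤ (sh (s N) (t N) N))
    where
      sh : ∀ x y N → x + C * ν′ N + (y + D * ν′ N) ≡ x + y + (C + D) * ν′ N
      sh x y N = solve 5 (λ x y c d v → x :+ c :* v :+ (y :+ d :* v) := x :+ y :+ (c :+ d) :* v) refl x y C D (ν′ N)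

  private
    -- c² + 1 stands in for the absolute value of c.
    scale≤ : ∀ c {x y e} → 0ℝ ≤ e → x ≤ y + e → y ≤ x + e → c * x ≤ c * y + (c * c + 1ℝ) * e
    scale≤ c {x} {y} {e} e≥0 p q with ≤-total 0ℝ c
    ... | inj₁ h = ≤-trans (*-mono-≤ˡ c h p) (≤-trans (≡⇒≤ (distribˡ c y e)) (+-mono-≤ (≤-refl {c * y}) (*-mono-≤ʳ e e≥0 c≤)))
      where
        c≤ : c ≤ c * c + 1ℝ
        c≤ with c ≤? 1ℝ
        ... | inj₁ r = ≤-trans r (≤-by (c * c) (0≤sq c) (+-comm _ _))
        ... | inj₂ r = ≤-trans (≤-trans (≡⇒≤ (sym (*-identityʳ c))) (*-mono-≤ˡ c h (<⇒≤ r))) (≤-by 1ℝ 0≤1 refl)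
    ... | inj₂ h = ≤-trans (≡⇒≤ (solve 2 (λ c x → c :* x := (:- c) :* (:- x)) refl c x)) (≤-trans (*-mono-≤ˡ (- c) h' (subst (- x ≤_) (solve 2 (λ y e → :- (y :- e) := :- y :+ e) refl y e) (neg-mono-≤ (0≤⇒≤ (subst (0ℝ ≤_) (solve 3 (λ x y e → x :+ e :- y := x :- (y :- e)) refl x y e) (≤⇒0≤ q))))))
             (≤-trans (≡⇒≤ (solve 3 (λ c y e → (:- c) :* (:- y :+ e) := c :* y :+ (:- c) :* e) refl c y e)) (+-mono-≤ (≤-refl {c * y}) (*-mono-≤ʳ e e≥0 c≤))))
      where
        h' : 0ℝ ≤ - c
        h' = subst (_≤ - c) -0#≈0# (neg-mono-≤ h)
        c≤ : - c ≤ c * c + 1ℝ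
        c≤ with (- c) ≤? 1ℝ
        ... | inj₁ r = ≤-trans r (≤-by (c * c) (0≤sq c) (+-comm _ _))
        ... | inj₂ r = ≤-trans (≤-trans (≡⇒≤ (sym (*-identityʳ (- c)))) (*-mono-≤ˡ (- c) h' (<⇒≤ r))) (≤-by 1ℝ 0≤1 (solve 1 (λ c → c :* c :+ 𝟙 := (:- c) :* (:- c) :+ 𝟙) refl c))

  ⟶-*ˡ : ∀ c {s l} → s ⟶ l → (λ N → c * s N) ⟶ c * l
  ⟶-*ˡ c {s} {l} (C , p , f) = (c * c + 1ℝ) * C , 0≤* (0≤+ (0≤sq c) 0≤1) p , λ N →
      ≤-trans (scale≤ c (e≥0 N) (proj₁ (f N)) (proj₂ (f N))) (≡⇒≤ (cong (c * l +_) (sym (*-assoc _ _ _)))) , ≤-trans (scale≤ c (e≥0 N) (proj₂ (f N)) (proj₁ (f N))) (≡⇒≤ (cong (c * s N +_) (sym (*-assoc _ _ _))))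
    where
      e≥0 : ∀ N → 0ℝ ≤ C * ν′ N
      e≥0 N = 0≤* p (<⇒≤ (0<ν′ N))

  ⟶-* : ∀ {s t l k} → (∀ N → 0ℝ ≤ s N) → (∀ N → 0ℝ ≤ t N) → 0ℝ ≤ l → 0ℝ ≤ k → s ⟶ l → t ⟶ k → (λ N → s N * t N) ⟶ l * k
  ⟶-* {s} {t} {l} {k} s≥0 t≥0 l≥0 k≥0 (C , p , f) (D , q , g) = B , B≥0 , λ N → up N , down N
    where
      B = (l + C) * D + (k + D) * C + C * D
      B≥0 = 0≤+ (0≤+ (0≤* (0≤+ l≥0 p) q) (0≤* (0≤+ k≥0 q) p)) (0≤* p q)
      shrink : ∀ c N → 0ℝ ≤ c → c * ν′ N ≤ c
      shrink c N h = subst (c * ν′ N ≤_) (*-identityʳ c) (*-mono-≤ˡ c h (ν′≤1 N))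
      general : ∀ x y N → 0ℝ ≤ x → 0ℝ ≤ y → x ≤ l + C → y ≤ k + D → (x + C * ν′ N) * (y + D * ν′ N) ≤ x * y + B * ν′ N
      general x y N x0 y0 xl yk = ≤-trans (≡⇒≤ (solve 5 (λ x y c d v → (x :+ c :* v) :* (y :+ d :* v) := x :* y :+ (x :* d :+ y :* c :+ c :* d :* v) :* v) refl x y C D (ν′ N)))
         (+-mono-≤ (≤-refl {x * y}) (*-mono-≤ʳ (ν′ N) (<⇒≤ (0<ν′ N)) (+-mono-≤ (+-mono-≤ (*-mono-≤ʳ D q xl) (*-mono-≤ʳ C p yk)) (shrink (C * D) N (0≤* p q)))))
      bound : ∀ N → s N ≤ l + C
      bound N = ≤-trans (proj₁ (f N)) (+-mono-≤ (≤-refl {l}) (shrink C N p))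
      bound' : ∀ N → t N ≤ k + D
      bound' N = ≤-trans (proj₁ (g N)) (+-mono-≤ (≤-refl {k}) (shrink D N q))
      v≥0 : ∀ N → 0ℝ ≤ ν′ N
      v≥0 N = <⇒≤ (0<ν′ N)
      up : ∀ N → s N * t N ≤ l * k + B * ν′ N
      up N = ≤-trans (*-mono-≤ (s≥0 N) (0≤+ k≥0 (0≤* q (v≥0 N))) (proj₁ (f N)) (proj₁ (g N))) (general l k N l≥0 k≥0 (≤-by C p refl) (≤-by D q refl))
      down : ∀ N → l * k ≤ s N * t N + B * ν′ N
      down N = ≤-trans (*-mono-≤ l≥0 (0≤+ (t≥0 N) (0≤* q (v≥0 N))) (proj₂ (f N)) (proj₂ (g N))) (general (s N) (t N) N (s≥0 N) (t≥0 N) (bound N) (bound' N))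

  ⟶-Π : ∀ n {s : Fin n → ℕ → ℝ} {l : Fin n → ℝ} → (∀ i N → 0ℝ ≤ s i N) → (∀ i → 0ℝ ≤ l i) → (∀ i → s i ⟶ l i) → (λ N → Π n (λ i → s i N)) ⟶ Π n l
  ⟶-Π zero _ _ _ = ⟶-const 1ℝ
  ⟶-Π (suc n) p q h = ⟶-* (p zero) (λ N → 0≤Π n (λ i → p (suc i) N)) (q zero) (0≤Π n (q ∘ suc)) (h zero) (⟶-Π n (p ∘ suc) (q ∘ suc) (h ∘ suc))

  G-anti : ∀ {a b} → 0ℝ < a → a ≤ b → G b ≤ G a
  G-anti {a} {b} p q = G≤ p' (G a) (λ N K → ≤-trans (*-mono-≤ˡ (fromℕ 2) (0≤ℕ 2) (*-mono-≤ˡ (ν′ N) (<⇒≤ (0<ν′ N)) (∑-mono (range K) (λ k → E-mono (0≤* (<⇒≤ p) (0≤sq _)) (*-mono-≤ʳ _ (0≤sq _) q))))) (G-lower p N K))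
    where p' = <-≤-trans p q

  private
    dilate : ∀ {a} (p : 0ℝ < a) k (p' : 0ℝ < fromℕ (suc k) * fromℕ (suc k) * a) N K → fromℕ (suc k) * lower (fromℕ (suc k) * fromℕ (suc k) * a) p' (_⊗_ a p N k) K ≡ lower a p N K
    dilate {a} p k p' N K = trans (sym (*-assoc _ _ _)) (trans (cong (_* ∑ (range K) (λ j → g (fromℕ (suc k) * fromℕ (suc k) * a) p' (_⊗_ a p N k) (suc j))) (ν-⊗ a p N k))
        (cong (ν′ N *_) (∑-cong (range K) (λ j → cong E (trans (solve 4 (λ k a j v → k :* k :* a :* (j :* v :* (j :* v)) := a :* (j :* (k :* v) :* (j :* (k :* v)))) refl (fromℕ (suc k)) a (fromℕ (suc j)) (ν′ (_⊗_ a p N k))) (cong (λ t → a * (fromℕ (suc j) * t * (fromℕ (suc j) * t))) (ν-⊗ a p N k)))))))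

  -- The substitution x ↦ (k + 1) x, exact on Riemann sums once the step is refined by k + 1.
  G-square : ∀ {a} → 0ℝ < a → ∀ k → fromℕ (suc k) * G (fromℕ (suc k) * fromℕ (suc k) * a) ≡ G a
  G-square {a} p k = ≤-antisym le ge
    where
      q = fromℕ (suc k)
      q>0 = 0<ℕ k
      p' = *-pos (*-pos q>0 q>0) p
      ge : G a ≤ q * G (q * q * a)
      ge = G≤ p _ (λ N K → ≤-trans (≡⇒≤ (trans (cong (fromℕ 2 *_) (sym (dilate p k p' N K))) (solve 2 (λ q l → K' 2 :* (q :* l) := q :* (K' 2 :* l)) refl q _))) (*-mono-≤ˡ q (<⇒≤ q>0) (G-lower p' (_⊗_ a p N k) K)))
        where
          K' : ∀ {n} → ℕ → Sv.Polynomial n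
          K' = Field.K
      le : q * G (q * q * a) ≤ G a
      le = ≤-trans (*-mono-≤ˡ q (<⇒≤ q>0) (G≤ p' (q ⁻¹ * G a) (λ N K → *-cancel-≤ˡ q q>0 (≤-trans (*-mono-≤ˡ q (<⇒≤ q>0) (*-mono-≤ˡ (fromℕ 2) (0≤ℕ 2) (refine-lower _ p' N K k)))
             (≤-trans (≡⇒≤ (trans (solve 3 (λ q t l → q :* (t :* l) := t :* (q :* l)) refl q (fromℕ 2) _) (cong (fromℕ 2 *_) (dilate p k p' N (K ℕ.* suc k))))) (≤-trans (G-lower p N (K ℕ.* suc k)) (≡⇒≤ (sym (trans (sym (*-assoc _ _ _)) (trans (cong (_* G a) (*-inv⁺ q>0)) (*-identityˡ _)))))))))))
             (≡⇒≤ (trans (sym (*-assoc _ _ _)) (trans (cong (_* G a) (*-inv⁺ q>0)) (*-identityˡ _))))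

  private
    least : (P : ℕ → Set) → (∀ n → P n ⊎ ¬ P n) → ¬ P 0 → ∀ M → P M → ∃ λ q → P (suc q) × ¬ P q
    least P dec n0 zero p = ⊥-elim (n0 p)
    least P dec n0 (suc M) p with dec M
    ... | inj₁ r = least P dec n0 M r
    ... | inj₂ r = M , p , r

    -- `G-square` settles ratios that are squares of rationals. In general q + 1 is where a p² ≤ b
    -- (q + 1)² first holds; monotonicity of G then compares the two values with an error of order
    -- 1/p.
    G-scale≤ : ∀ {a b} → 0ℝ < a → 0ℝ < b → b * (G b * G b) ≤ a * (G a * G a)
    G-scale≤ {a} {b} a>0 b>0 = ≤-limit (fromℕ 3 * (a + b) * (G a * G a)) (λ n → ≤-stable (λ c → archimedes (a * (fromℕ (suc n) * fromℕ (suc n)) * b ⁻¹) (λ { (M , lt) → c (go n M lt) })))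
      where
        go : ∀ n M → a * (fromℕ (suc n) * fromℕ (suc n)) * b ⁻¹ < fromℕ M → b * (G b * G b) ≤ a * (G a * G a) + fromℕ 3 * (a + b) * (G a * G a) * (fromℕ (suc n)) ⁻¹
        go n M lt = fin (least P dec n0 (suc M) PM)
          where
            p = fromℕ (suc n)
            p>0 = 0<ℕ n
            P : ℕ → Set
            P q = a * (p * p) ≤ b * (fromℕ q * fromℕ q)
            dec : ∀ q → P q ⊎ ¬ P q
            dec q with (a * (p * p)) ≤? (b * (fromℕ q * fromℕ q))
            ... | inj₁ r = inj₁ r
            ... | inj₂ r = inj₂ (λ s → s r)
            n0 : ¬ P 0
            n0 h = h (subst (_< a * (p * p)) (solve 1 (λ b → K 0 := b :* (K 0 :* K 0)) refl b) (*-pos a>0 (*-pos p>0 p>0)))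
            PM : P (suc M)
            PM = ≤-trans (≡⇒≤ (trans (sym (*-identityʳ _)) (trans (cong (a * (p * p) *_) (sym (*-inv⁺ b>0))) (solve 3 (λ x b i → x :* (b :* i) := b :* (x :* i)) refl (a * (p * p)) b (b ⁻¹)))))
                  (*-mono-≤ˡ b (<⇒≤ b>0) (≤-trans (<⇒≤ lt) (≤-trans (≤-by (1ℝ + fromℕ M + fromℕ M * fromℕ M) (0≤+ (0≤+ 0≤1 (0≤ℕ M)) (0≤sq (fromℕ M))) (solve 1 (λ m → (𝟙 :+ m) :* (𝟙 :+ m) := m :+ (𝟙 :+ m :+ m :* m)) refl (fromℕ M))) ≤-refl)))
            fin : (∃ λ q → P (suc q) × ¬ P q) → b * (G b * G b) ≤ a * (G a * G a) + fromℕ 3 * (a + b) * (G a * G a) * p ⁻¹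
            fin (q , Pq , nPq) = *-cancel-≤ˡ (p * p) (*-pos p>0 p>0) (≤-trans chain (≡⇒≤ (sym last)))
              where
                x = fromℕ q
                x≥0 = 0≤ℕ q
                Q = fromℕ (suc q)
                ga = G a
                gb = G b
                small : b * (x * x) ≤ a * (p * p)
                small with (a * (p * p)) ≤? (b * (x * x))
                ... | inj₁ r = ⊥-elim (nPq r)
                ... | inj₂ r = <⇒≤ r
                bx : b * x ≤ (a + b) * p
                bx = sq-cancel-≤ (0≤* (0≤+ (<⇒≤ a>0) (<⇒≤ b>0)) (<⇒≤ p>0)) (≤-trans (≡⇒≤ (solve 2 (λ b x → b :* x :* (b :* x) := b :* (b :* (x :* x))) refl b x)) (≤-trans (*-mono-≤ˡ b (<⇒≤ b>0) small) (≤-by ((a * a + a * b + b * b) * (p * p)) (0≤* (0≤+ (0≤+ (0≤sq a) (0≤* (<⇒≤ a>0) (<⇒≤ b>0))) (0≤sq b)) (0≤sq p)) (solve 3 (λ a b p → (a :+ b) :* p :* ((a :+ b) :* p) := b :* (a :* (p :* p)) :+ (a :* a :+ a :* b :+ b :* b) :* (p :* p)) refl a b p))))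
                bQ² : b * (Q * Q) ≤ a * (p * p) + fromℕ 3 * (a + b) * p
                bQ² = ≤-trans (≡⇒≤ (solve 2 (λ b x → b :* ((𝟙 :+ x) :* (𝟙 :+ x)) := b :* (x :* x) :+ K 2 :* (b :* x) :+ b) refl b x)) (≤-trans (+-mono-≤ (+-mono-≤ small (*-mono-≤ˡ (fromℕ 2) (0≤ℕ 2) bx)) b≤) (≡⇒≤ (solve 3 (λ a b p → a :* (p :* p) :+ K 2 :* ((a :+ b) :* p) :+ (a :+ b) :* p := a :* (p :* p) :+ K 3 :* (a :+ b) :* p) refl a b p)))
                  where
                    b≤ : b ≤ (a + b) * p
                    b≤ = ≤-by (a * p + b * fromℕ n) (0≤+ (0≤* (<⇒≤ a>0) (<⇒≤ p>0)) (0≤* (<⇒≤ b>0) (0≤ℕ n))) (solve 3 (λ a b n → (a :+ b) :* (𝟙 :+ n) := b :+ (a :* (𝟙 :+ n) :+ b :* n)) refl a b (fromℕ n))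
                gb≤ : p * gb ≤ Q * ga
                gb≤ = ≤-trans (≡⇒≤ (cong (p *_) (sym (G-square b>0 q)))) (≤-trans (*-mono-≤ˡ p (<⇒≤ p>0) (*-mono-≤ˡ Q (0≤ℕ (suc q)) (G-anti (*-pos (*-pos p>0 p>0) a>0) (subst₂ _≤_ (*-comm a (p * p)) (*-comm b (Q * Q)) Pq))))
                        (≡⇒≤ (trans (solve 3 (λ p q g → p :* (q :* g) := q :* (p :* g)) refl p Q _) (cong (Q *_) (G-square a>0 n)))))
                chain : p * p * (b * (gb * gb)) ≤ (a * (p * p) + fromℕ 3 * (a + b) * p) * (ga * ga)
                chain = ≤-trans (≡⇒≤ (solve 3 (λ p b g → p :* p :* (b :* (g :* g)) := b :* (p :* g :* (p :* g))) refl p b gb)) (≤-trans (*-mono-≤ˡ b (<⇒≤ b>0) (*-mono-≤ (0≤* (<⇒≤ p>0) (<⇒≤ (G-pos b>0))) (0≤* (0≤ℕ (suc q)) (<⇒≤ (G-pos a>0))) gb≤ gb≤))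
                        (≤-trans (≡⇒≤ (solve 3 (λ q b g → b :* (q :* g :* (q :* g)) := b :* (q :* q) :* (g :* g)) refl Q b ga)) (*-mono-≤ʳ (ga * ga) (0≤sq ga) bQ²)))
                last : p * p * (a * (ga * ga) + fromℕ 3 * (a + b) * (ga * ga) * p ⁻¹) ≡ (a * (p * p) + fromℕ 3 * (a + b) * p) * (ga * ga)
                last = trans (solve 5 (λ p a b g i → p :* p :* (a :* (g :* g) :+ K 3 :* (a :+ b) :* (g :* g) :* i) := a :* (p :* p) :* (g :* g) :+ K 3 :* (a :+ b) :* p :* (g :* g) :* (p :* i)) refl p a b ga (p ⁻¹))
                        (trans (cong (λ t → a * (p * p) * (ga * ga) + fromℕ 3 * (a + b) * p * (ga * ga) * t) (*-inv⁺ p>0)) (solve 4 (λ p a b g → a :* (p :* p) :* (g :* g) :+ K 3 :* (a :+ b) :* p :* (g :* g) :* 𝟙 := (a :* (p :* p) :+ K 3 :* (a :+ b) :* p) :* (g :* g)) refl p a b ga))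

  -- The invariant a G(a)² is π. Its value is not computed here; a lower bound for `G 1ℝ` is
  -- supplied later.
  G-scale : ∀ {a b} → 0ℝ < a → 0ℝ < b → a * (G a * G a) ≡ b * (G b * G b)
  G-scale p q = ≤-antisym (G-scale≤ q p) (G-scale≤ p q)

 -- Gaussian kernels of varying width and their positive semidefiniteness.

 module HeatKernel where
  open Field
  open Sums
  open Exponential
  open GaussSum
  open GaussIntegral

  ⟶-∑∈ : {A : Set} (xs : List A) {s : A → ℕ → ℝ} {l : A → ℝ} → (∀ x → x ∈ xs → s x ⟶ l x) → (λ N → ∑ xs (λ x → s x N)) ⟶ ∑ xs l
  ⟶-∑∈ [] h = ⟶-const 0ℝ
  ⟶-∑∈ (x ∷ xs) h = ⟶-+ (h x (here refl)) (⟶-∑∈ xs (λ y p → h y (there p)))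

  private
    search : (P : ℕ → Set) → (∀ n → P n ⊎ ¬ P n) → ¬ P 0 → ∀ M → P M → ∃ λ q → q ℕ.< M × P (suc q) × ¬ P q
    search P dec n0 zero p = ⊥-elim (n0 p)
    search P dec n0 (suc M) p with dec M
    ... | inj₁ r = let q , lt , rest = search P dec n0 M r in q , ℕₚ.m≤n⇒m≤1+n lt , rest
    ... | inj₂ r = M , ℕₚ.≤-refl , p , r

  -- The a priori bound B makes this a finite search, so the integer is found without double
  -- negation. The last component tells how far a window has to be shifted.
  ceiling : ∀ u B → - fromℕ B ≤ u → u ≤ fromℕ B → ∃ λ h → u ≤ fromℤ h × fromℤ h ≤ u + 1ℝ × ((∃ λ k → h ≡ ℤ.+ k × k ℕ.≤ B) ⊎ (∃ λ k → h ≡ ℤ.- (ℤ.+ k) × k ℕ.≤ B))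
  ceiling u B lo hi with (u + fromℕ B) ≤? fromℕ 0
  ... | inj₁ p = ℤ.- (ℤ.+ B) , ≤-trans u≤ (≡⇒≤ (sym (fromℤ-neg (ℤ.+ B)))) , ≤-trans (≡⇒≤ (fromℤ-neg (ℤ.+ B))) (≤-trans lo (≤-by 1ℝ 0≤1 refl)) , inj₂ (B , refl , ℕₚ.≤-refl)
    where
      u≤ : u ≤ - fromℕ B
      u≤ = 0≤⇒≤ (subst (0ℝ ≤_) (solve 2 (λ u b → K 0 :- (u :+ b) := (:- b) :- u) refl u (fromℕ B)) (≤⇒0≤ p))
  ... | inj₂ p with search P dec (λ h → h p) (B ℕ.+ B) (subst (u + fromℕ B ≤_) (sym (fromℕ-+ B B)) (+-mono-≤ʳ (fromℕ B) hi))
    where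
      P : ℕ → Set
      P k = u + fromℕ B ≤ fromℕ k
      dec : ∀ k → P k ⊎ ¬ P k
      dec k with (u + fromℕ B) ≤? fromℕ k
      ... | inj₁ r = inj₁ r
      ... | inj₂ r = inj₂ (λ s → s r)
  ...   | q , lt , up , nlow = h , ≤-trans ub (≡⇒≤ (sym hval)) , ≤-trans (≡⇒≤ hval) lb , side
    where
      h = ℤ.+ suc q ℤ.- ℤ.+ B
      hval : fromℤ h ≡ fromℕ (suc q) - fromℕ B
      hval = trans (fromℤ-+ (ℤ.+ suc q) (ℤ.- ℤ.+ B)) (cong (fromℕ (suc q) +_) (fromℤ-neg (ℤ.+ B)))
      ub : u ≤ fromℕ (suc q) - fromℕ B
      ub = 0≤⇒≤ (subst (0ℝ ≤_) (solve 3 (λ u b q → q :- (u :+ b) := q :- b :- u) refl u (fromℕ B) (fromℕ (suc q))) (≤⇒0≤ up))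
      low : fromℕ q ≤ u + fromℕ B
      low with (u + fromℕ B) ≤? fromℕ q
      ... | inj₁ r = ⊥-elim (nlow r)
      ... | inj₂ r = <⇒≤ r
      lb : fromℕ (suc q) - fromℕ B ≤ u + 1ℝ
      lb = 0≤⇒≤ (subst (0ℝ ≤_) (solve 3 (λ u b q → (u :+ b) :- q := (u :+ 𝟙) :- (𝟙 :+ q :- b)) refl u (fromℕ B) (fromℕ q)) (≤⇒0≤ low))
      side : (∃ λ k → h ≡ ℤ.+ k × k ℕ.≤ B) ⊎ (∃ λ k → h ≡ ℤ.- (ℤ.+ k) × k ℕ.≤ B)
      side with ℕₚ.≤-total B (suc q)
      ... | inj₁ r = inj₁ (suc q ℕ.∸ B , trans (ℤₚ.m-n≡m⊖n (suc q) B) (ℤₚ.⊖-≥ r) , ℕₚ.≤-trans (ℕₚ.∸-monoˡ-≤ B lt) (ℕₚ.≤-reflexive (ℕₚ.m+n∸n≡m B B)))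
      ... | inj₂ r = inj₂ (B ℕ.∸ suc q , trans (ℤₚ.m-n≡m⊖n (suc q) B) (ℤₚ.⊖-≤ r) , ℕₚ.m∸n≤m B (suc q))

  -- Large enough to keep more than (N + 1)² cells on either side after a shift to a centre of size
  -- at most H.
  window : ℕ → ℕ → ℕ
  window H N = suc (suc N ℕ.* suc N ℕ.+ suc H ℕ.* suc N)

  -- With h the ceiling of c (N + 1), the index shift z ↦ z + h puts the point (z + h)/(N + 1) - c
  -- into the cell of z that `G-riemann` expects.
  centred : ∀ {a} → 0ℝ < a → ∀ c H → - fromℕ H ≤ c → c ≤ fromℕ H →
    (λ N → ν′ N * ∑ (win (window H N) (window H N)) (λ z → E (a * ((fromℤ z * ν′ N - c) * (fromℤ z * ν′ N - c))))) ⟶ G a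
  centred {a} a>0 c H lo hi = G-riemann a>0 _ (λ p N → build p N)
    where
      build : ∀ (p : 0ℝ < a) N → ∃ λ s → ∃ λ s' → ∃ λ y → InCells a p N y × suc N ℕ.* suc N ℕ.< s × suc N ℕ.* suc N ℕ.< s' ×
                ν′ N * ∑ (win (window H N) (window H N)) (λ z → E (a * ((fromℤ z * ν′ N - c) * (fromℤ z * ν′ N - c)))) ≡ ν′ N * ∑ (win s s') (λ z → E (a * (y z * y z)))
      build p N = go (ceiling u B loB hiB)
        where
          n = fromℕ (suc N)
          v = ν′ N
          u = c * n
          B = H ℕ.* suc N
          W = window H N
          nv : n * v ≡ 1ℝ
          nv = *-inv⁺ (0<ℕ N)
          loB : - fromℕ B ≤ u
          loB = ≤-trans (≡⇒≤ (trans (cong -_ (fromℕ-* H (suc N))) (-‿distribˡ-* _ _))) (*-mono-≤ʳ n (0≤ℕ (suc N)) lo)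
          hiB : u ≤ fromℕ B
          hiB = ≤-trans (*-mono-≤ʳ n (0≤ℕ (suc N)) hi) (≡⇒≤ (sym (fromℕ-* H (suc N))))
          F : ℤ → ℝ
          F z = E (a * ((fromℤ z * v - c) * (fromℤ z * v - c)))
          big : ∀ k → k ℕ.≤ B → suc N ℕ.* suc N ℕ.< W ℕ.∸ k
          big k q = ℕₚ.≤-trans (ℕ.s≤s (ℕₚ.m≤m+n (suc N ℕ.* suc N) (suc N))) (ℕₚ.≤-trans (ℕₚ.≤-reflexive (sym (trans (cong (ℕ._∸ B) eqW) (ℕₚ.m+n∸n≡m _ B)))) (ℕₚ.∸-monoʳ-≤ W q))
            where
              eqW : W ≡ suc (suc N ℕ.* suc N ℕ.+ suc N) ℕ.+ B
              eqW = cong suc (sym (ℕₚ.+-assoc (suc N ℕ.* suc N) (suc N) B))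
          k≤W : ∀ k → k ℕ.≤ B → k ℕ.≤ W
          k≤W k q = ℕₚ.≤-trans q (ℕₚ.≤-trans (ℕₚ.m≤n+m B (suc N)) (ℕₚ.m≤n⇒m≤1+n (ℕₚ.m≤n+m (suc H ℕ.* suc N) (suc N ℕ.* suc N))))
          bigW : ∀ k → suc N ℕ.* suc N ℕ.< k ℕ.+ W
          bigW k = ℕₚ.≤-trans (ℕ.s≤s (ℕₚ.m≤m+n (suc N ℕ.* suc N) _)) (ℕₚ.m≤n+m W k)
          go : (∃ λ h → u ≤ fromℤ h × fromℤ h ≤ u + 1ℝ × ((∃ λ k → h ≡ ℤ.+ k × k ℕ.≤ B) ⊎ (∃ λ k → h ≡ ℤ.- (ℤ.+ k) × k ℕ.≤ B))) → _
          go (h , up , low , side) = wrap side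
            where
              y : ℤ → ℝ
              y z = fromℤ (z ℤ.+ h) * v - c
              cells : InCells a p N y
              cells z = ≤-by ((fromℤ h - u) * v) (0≤* (≤⇒0≤ up) (<⇒≤ (0<ν′ N))) (trans (cong (λ t → t * v - c) (fromℤ-+ z h)) (trans (solve 5 (λ z h v c n → (z :+ h) :* v :- c := z :* v :+ (h :* v :- c :* 𝟙)) refl (fromℤ z) (fromℤ h) v c n) (trans (cong (λ t → fromℤ z * v + (fromℤ h * v - c * t)) (sym nv)) (solve 5 (λ z h v c n → z :* v :+ (h :* v :- c :* (n :* v)) := z :* v :+ (h :- c :* n) :* v) refl (fromℤ z) (fromℤ h) v c n))))
                      , ≤-by ((u + 1ℝ - fromℤ h) * v) (0≤* (≤⇒0≤ low) (<⇒≤ (0<ν′ N))) (sym (trans (cong (λ t → t * v - c + (u + 1ℝ - fromℤ h) * v) (fromℤ-+ z h)) (trans (solve 5 (λ z h v c n → (z :+ h) :* v :- c :+ (c :* n :+ 𝟙 :- h) :* v := (z :+ 𝟙) :* v :+ c :* (n :* v :- 𝟙)) refl (fromℤ z) (fromℤ h) v c n) (trans (cong (λ t → (fromℤ z + 1ℝ) * v + c * (t - 1ℝ)) nv) (solve 3 (λ z v c → (z :+ 𝟙) :* v :+ c :* (𝟙 :- 𝟙) := (z :+ 𝟙) :* v) refl (fromℤ z) v c)))))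
              wrap : (∃ λ k → h ≡ ℤ.+ k × k ℕ.≤ B) ⊎ (∃ λ k → h ≡ ℤ.- (ℤ.+ k) × k ℕ.≤ B) → _
              wrap (inj₁ (k , refl , q)) = k ℕ.+ W , W ℕ.∸ k , y , cells , bigW k , big k q , cong (v *_) (trans (cong (λ t → ∑ (win W t) F) (sym (ℕₚ.m+[n∸m]≡n (k≤W k q)))) (trans (∑-cong (win W (k ℕ.+ (W ℕ.∸ k))) (λ z → cong F (back z))) (∑-win-shift k W (W ℕ.∸ k) (λ z → F (z ℤ.+ ℤ.+ k)))))
                where
                  back : ∀ z → z ≡ z ℤ.- ℤ.+ k ℤ.+ ℤ.+ k
                  back z = sym (trans (ℤₚ.+-assoc z (ℤ.- ℤ.+ k) (ℤ.+ k)) (trans (cong (λ t → z ℤ.+ t) (ℤₚ.+-inverseˡ (ℤ.+ k))) (ℤₚ.+-identityʳ z)))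
              wrap (inj₂ (k , refl , q)) = W ℕ.∸ k , k ℕ.+ W , y , cells , big k q , bigW k , cong (v *_) (trans (cong (λ t → ∑ (win t W) F) (sym (ℕₚ.m+[n∸m]≡n (k≤W k q)))) (trans (∑-cong (win (k ℕ.+ (W ℕ.∸ k)) W) (λ z → cong F (back z))) (∑-win-shift⁻ k (W ℕ.∸ k) W (λ z → F (z ℤ.- ℤ.+ k)))))
                where
                  back : ∀ z → z ≡ z ℤ.+ ℤ.+ k ℤ.- ℤ.+ k
                  back z = sym (trans (ℤₚ.+-assoc z (ℤ.+ k) (ℤ.- ℤ.+ k)) (trans (cong (λ t → z ℤ.+ t) (ℤₚ.+-inverseʳ (ℤ.+ k))) (ℤₚ.+-identityʳ z)))

  -- Distances are taken in a diagonal quadratic form d, the shape that the lattice norm has in a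
  -- Gram-Schmidt frame. Writing n = 2h keeps powers with exponent n/2 integral.
  module Kernel (n h : ℕ) (n≡h+h : n ≡ h ℕ.+ h) (d : Fin n → ℝ) (d>0 : ∀ i → 0ℝ < d i) where

    abstract
      dist : (Fin n → ℝ) → (Fin n → ℝ) → ℝ
      dist x y = Σ[ n ] (λ i → d i * ((x i - y i) * (x i - y i)))

      0≤dist : ∀ x y → 0ℝ ≤ dist x y
      0≤dist x y = subst (0ℝ ≤_) (sym (Σ≡∑ n)) (0≤∑ (allFin n) (λ i → 0≤* (<⇒≤ (d>0 i)) (0≤sq _)))

      dist-Σ : ∀ x y → dist x y ≡ Σ[ n ] (λ i → d i * ((x i - y i) * (x i - y i)))
      dist-Σ x y = refl

      E-dist : ∀ x y {t} → 0ℝ ≤ t → E (dist x y * t) ≡ Π n (λ i → E (d i * ((x i - y i) * (x i - y i)) * t))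
      E-dist x y {t} p = go n (λ i → d i * ((x i - y i) * (x i - y i))) (λ i → 0≤* (<⇒≤ (d>0 i)) (0≤sq _))
        where
          0≤Σ : ∀ n (f : Fin n → ℝ) → (∀ i → 0ℝ ≤ f i) → 0ℝ ≤ Σ[ n ] f
          0≤Σ zero f q = ≤-refl
          0≤Σ (suc n) f q = 0≤+ (q zero) (0≤Σ n (f ∘ suc) (q ∘ suc))
          go : ∀ n (f : Fin n → ℝ) → (∀ i → 0ℝ ≤ f i) → E (Σ[ n ] f * t) ≡ Π n (λ i → E (f i * t))
          go zero f q = trans (cong E (zeroˡ t)) E0
          go (suc n) f q = trans (cong E (distribʳ t _ _)) (trans (E-+ (0≤* (q zero) p) (0≤* (0≤Σ n (f ∘ suc) (q ∘ suc)) p)) (cong (E (f zero * t) *_) (go n (f ∘ suc) (q ∘ suc))))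

    dist-sym : ∀ x y → dist x y ≡ dist y x
    dist-sym x y = trans (dist-Σ x y) (trans (Σ≡∑ n) (trans (∑-cong (allFin n) (λ i → cong (d i *_) (solve 2 (λ a b → (a :- b) :* (a :- b) := (b :- a) :* (b :- a)) refl (x i) (y i)))) (sym (trans (dist-Σ y x) (Σ≡∑ n)))))

    dist-0 : ∀ x → dist x x ≡ 0ℝ
    dist-0 x = trans (dist-Σ x x) (trans (Σ≡∑ n) (trans (∑-cong (allFin n) (λ i → solve 2 (λ d x → d :* ((x :- x) :* (x :- x)) := K 0) refl (d i) (x i))) (∑-zero (allFin n))))

    𝒢 : ℝ
    𝒢 = Π n (λ i → G (d i))

    𝒢>0 : 0ℝ < 𝒢
    𝒢>0 = 0<Π n (λ i → G-pos (d>0 i))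

    -- Squares are compared because `G-scale` relates values of G only through G².
    𝒢-scale : ∀ {β} → 0ℝ < β → Π n (λ i → G (d i * β)) * β ^ h ≡ 𝒢
    𝒢-scale {β} β>0 = ≤-antisym (sq-cancel-≤ (<⇒≤ 𝒢>0) (≡⇒≤ eq)) (sq-cancel-≤ (<⇒≤ (*-pos P>0 (0<^ h β>0))) (≡⇒≤ (sym eq)))
      where
        P = Π n (λ i → G (d i * β))
        P>0 = 0<Π n (λ i → G-pos (*-pos (d>0 i) β>0))
        term : ∀ i → G (d i * β) * G (d i * β) * β ≡ G (d i) * G (d i)
        term i = *-cancelˡ (d i) (0<⇒≢ (d>0 i)) (trans (solve 3 (λ d b g → d :* (g :* g :* b) := d :* b :* (g :* g)) refl (d i) β (G (d i * β))) (G-scale (*-pos (d>0 i) β>0) (d>0 i)))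
        eq : P * β ^ h * (P * β ^ h) ≡ 𝒢 * 𝒢
        eq = trans (solve 2 (λ p b → p :* b :* (p :* b) := p :* p :* (b :* b)) refl P (β ^ h)) (trans (cong (P * P *_) (trans (sym (^-+ β h h)) (trans (cong (β ^_) (sym n≡h+h)) (sym (Π-const n β)))))
              (trans (cong (_* Π n (λ _ → β)) (sym (Π-* n))) (trans (sym (Π-* n)) (trans (Π-cong n term) (Π-* n)))))

    Point : Set
    Point = ℕ × (Fin n → ℝ)

    τ : ℕ → ℕ → ℝ
    τ e e' = (fromℕ (suc e ℕ.+ suc e')) ⁻¹

    0<τ : ∀ e e' → 0ℝ < τ e e'
    0<τ e e' = inv-pos (0<ℕ (e ℕ.+ suc e'))

    -- The width a is stored as its predecessor e, so that positivity is automatic.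
    Φ : Point → Point → ℝ
    Φ (e , x) (e' , x') = τ e e' ^ h * E (dist x x' * τ e e')

    Φ-sym : ∀ u v → Φ u v ≡ Φ v u
    Φ-sym (e , x) (e' , x') = cong₂ (λ t s → t ^ h * E (s * t)) (cong (λ k → (fromℕ k) ⁻¹) (ℕₚ.+-comm (suc e) (suc e'))) (dist-sym x x')

    private
      α : ℕ → ℝ
      α e = (fromℕ (suc e)) ⁻¹

      α>0 : ∀ e → 0ℝ < α e
      α>0 e = inv-pos (0<ℕ e)

      module Pair (e e' : ℕ) where
        a = fromℕ (suc e)
        a' = fromℕ (suc e')
        β = α e + α e'
        β>0 : 0ℝ < β
        β>0 = 0<+ (α>0 e) (<⇒≤ (α>0 e'))
        t = τ e e'
        aα : a * α e ≡ 1ℝ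
        aα = *-inv⁺ (0<ℕ e)
        aα' : a' * α e' ≡ 1ℝ
        aα' = *-inv⁺ (0<ℕ e')
        tsum : (a + a') * t ≡ 1ℝ
        tsum = trans (cong (_* t) (sym (fromℕ-+ (suc e) (suc e')))) (*-inv⁺ (0<ℕ (e ℕ.+ suc e')))
        αα : α e * α e' ≡ β * t
        αα = trans (solve 2 (λ i j → i :* j := i :* j :* 𝟙) refl (α e) (α e')) (trans (cong (α e * α e' *_) (sym tsum)) (trans (solve 5 (λ i j a b t → i :* j :* ((a :+ b) :* t) := ((a :* i) :* j :+ (b :* j) :* i) :* t) refl (α e) (α e') a a' t) (trans (cong₂ (λ u v → (u * α e' + v * α e) * t) aα aα') (solve 3 (λ i j t → (𝟙 :* j :+ 𝟙 :* i) :* t := (i :+ j) :* t) refl (α e) (α e') t))))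

        centre : ℝ → ℝ → ℝ
        centre x x' = (α e * x + α e' * x') * β ⁻¹

        -- Completing the square: the product of two Gaussians is a Gaussian about the weighted
        -- `centre`, times a factor that depends on x - x' only.
        complete : ∀ s x x' → α e * ((s - x) * (s - x)) + α e' * ((s - x') * (s - x')) ≡ β * ((s - centre x x') * (s - centre x x')) + (x - x') * (x - x') * t
        complete s x x' = *-cancelˡ β (0<⇒≢ β>0) (trans (solve 5 (λ i j s x y → (i :+ j) :* (i :* ((s :- x) :* (s :- x)) :+ j :* ((s :- y) :* (s :- y))) := ((i :+ j) :* s :- (i :* x :+ j :* y)) :* ((i :+ j) :* s :- (i :* x :+ j :* y)) :+ (x :- y) :* (x :- y) :* (i :* j)) refl (α e) (α e') s x x')
            (trans (cong₂ (λ u v → (β * s - u) * (β * s - u) + (x - x') * (x - x') * v) (trans (sym (*-identityʳ w)) (trans (cong (w *_) (sym (*-inv⁺ β>0))) (solve 3 (λ w b i → w :* (b :* i) := b :* (w :* i)) refl w β (β ⁻¹)))) αα)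
              (solve 5 (λ b s c q t → (b :* s :- b :* c) :* (b :* s :- b :* c) :+ q :* (b :* t) := b :* (b :* ((s :- c) :* (s :- c)) :+ q :* t)) refl β s (centre x x') ((x - x') * (x - x')) t)))
          where w = α e * x + α e' * x'

        centre≤ : ∀ {x x' b} → x ≤ b → x' ≤ b → centre x x' ≤ b
        centre≤ {x} {x'} {b} p q = *-cancel-≤ʳ β β>0 (≤-trans (≡⇒≤ (trans (*-assoc _ _ _) (trans (cong ((α e * x + α e' * x') *_) (trans (*-comm _ _) (*-inv⁺ β>0))) (*-identityʳ _)))) (≤-trans (+-mono-≤ (*-mono-≤ˡ (α e) (<⇒≤ (α>0 e)) p) (*-mono-≤ˡ (α e') (<⇒≤ (α>0 e')) q)) (≡⇒≤ (solve 3 (λ i j b → i :* b :+ j :* b := b :* (i :+ j)) refl (α e) (α e') b))))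

        ≤centre : ∀ {x x' b} → b ≤ x → b ≤ x' → b ≤ centre x x'
        ≤centre {x} {x'} {b} p q = *-cancel-≤ʳ β β>0 (≤-trans (≤-trans (≡⇒≤ (solve 3 (λ i j b → b :* (i :+ j) := i :* b :+ j :* b) refl (α e) (α e') b)) (+-mono-≤ (*-mono-≤ˡ (α e) (<⇒≤ (α>0 e)) p) (*-mono-≤ˡ (α e') (<⇒≤ (α>0 e')) q))) (≡⇒≤ (sym (trans (*-assoc _ _ _) (trans (cong ((α e * x + α e' * x') *_) (trans (*-comm _ _) (*-inv⁺ β>0))) (*-identityʳ _))))))

      bump : Point → ℝ → Fin n → ℝ
      bump (e , x) s i = E (d i * ((s - x i) * (s - x i)) * α e)

      Bounded : ℕ → Point → Set
      Bounded H (e , x) = ∀ i → - fromℕ H ≤ x i × x i ≤ fromℕ H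

      grid-sum : ℕ → Point → Point → ℕ → ℝ
      grid-sum H u v N = Π n (λ i → ν′ N * ∑ (win (window H N) (window H N)) (λ z → bump u (fromℤ z * ν′ N) i * bump v (fromℤ z * ν′ N) i))

      grid-limit : ∀ H u v → Bounded H u → Bounded H v → grid-sum H u v ⟶ E (dist (proj₂ u) (proj₂ v) * τ (proj₁ u) (proj₁ v)) * Π n (λ i → G (d i * (α (proj₁ u) + α (proj₁ v))))
      grid-limit H (e , x) (e' , x') bu bv = subst (grid-sum H (e , x) (e' , x') ⟶_) (trans (Π-* n) (cong (_* Π n (λ i → G (d i * β))) (sym (E-dist x x' (<⇒≤ (0<τ e e'))))))
          (⟶-Π n (λ i N → 0≤* (<⇒≤ (0<ν′ N)) (0≤∑ (win (window H N) (window H N)) (λ z → 0≤* (0≤E (0≤* (0≤* (<⇒≤ (d>0 i)) (0≤sq _)) (<⇒≤ (α>0 e)))) (0≤E (0≤* (0≤* (<⇒≤ (d>0 i)) (0≤sq _)) (<⇒≤ (α>0 e')))))))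
              (λ i → 0≤* (0≤E (0≤* (0≤* (<⇒≤ (d>0 i)) (0≤sq _)) (<⇒≤ (0<τ e e')))) (<⇒≤ (G-pos (*-pos (d>0 i) β>0)))) axis)
        where
          open Pair e e'
          axis : ∀ i → (λ N → ν′ N * ∑ (win (window H N) (window H N)) (λ z → bump (e , x) (fromℤ z * ν′ N) i * bump (e' , x') (fromℤ z * ν′ N) i)) ⟶ E (d i * ((x i - x' i) * (x i - x' i)) * t) * G (d i * β)
          axis i = ⟶-cong (λ N → sym (trans (cong (ν′ N *_) (trans (∑-cong (win (window H N) (window H N)) (λ z → prod (fromℤ z * ν′ N))) (∑-*ˡ (win (window H N) (window H N)) κ))) (solve 3 (λ v k s → v :* (k :* s) := k :* (v :* s)) refl (ν′ N) κ _)))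
                    (⟶-*ˡ κ (centred (*-pos (d>0 i) β>0) c H (≤centre (proj₁ (bu i)) (proj₁ (bv i))) (centre≤ (proj₂ (bu i)) (proj₂ (bv i)))))
            where
              κ = E (d i * ((x i - x' i) * (x i - x' i)) * t)
              c = centre (x i) (x' i)
              prod : ∀ s → bump (e , x) s i * bump (e' , x') s i ≡ κ * E (d i * β * ((s - c) * (s - c)))
              prod s = trans (sym (E-+ (0≤* (0≤* (<⇒≤ (d>0 i)) (0≤sq _)) (<⇒≤ (α>0 e))) (0≤* (0≤* (<⇒≤ (d>0 i)) (0≤sq _)) (<⇒≤ (α>0 e')))))
                (trans (cong E (trans (solve 5 (λ d p q i j → d :* p :* i :+ d :* q :* j := d :* (i :* p :+ j :* q)) refl (d i) ((s - x i) * (s - x i)) ((s - x' i) * (s - x' i)) (α e) (α e')) (trans (cong (d i *_) (complete s (x i) (x' i)))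
                    (solve 5 (λ d b p q t → d :* (b :* p :+ q :* t) := d :* q :* t :+ d :* b :* p) refl (d i) β ((s - c) * (s - c)) ((x i - x' i) * (x i - x' i)) t))))
                  (E-+ (0≤* (0≤* (<⇒≤ (d>0 i)) (0≤sq _)) (<⇒≤ (0<τ e e'))) (0≤* (0≤* (<⇒≤ (d>0 i)) (<⇒≤ β>0)) (0≤sq _))))

      bounding : {A : Set} (zs : List A) (p : A → Point) → ¬ ¬ (∃ λ H → ∀ z → z ∈ zs → Bounded H (p z))
      bounding [] p k = k (0 , λ z ())
      bounding (z ∷ zs) p = bounding zs p >>= λ { (H , b) → coords n (proj₂ (p z)) >>= λ { (H' , b') → pure (H ℕ.+ H' ,
            λ { w (here refl) i → widen (ℕₚ.m≤n+m H' H) (b' i) ; w (there q) i → widen (ℕₚ.m≤m+n H H') (b w q i) }) } }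
        where
          widen : ∀ {H H' t} → H ℕ.≤ H' → - fromℕ H ≤ t × t ≤ fromℕ H → - fromℕ H' ≤ t × t ≤ fromℕ H'
          widen q (l , u) = ≤-trans (neg-mono-≤ (fromℕ-mono-≤ q)) l , ≤-trans u (fromℕ-mono-≤ q)
          coords : ∀ n (x : Fin n → ℝ) → ¬ ¬ (∃ λ H → ∀ i → - fromℕ H ≤ x i × x i ≤ fromℕ H)
          coords zero x k = k (0 , λ ())
          coords (suc n) x = coords n (x ∘ suc) >>= λ { (H , b) → archimedes (x zero) >>= λ { (H₁ , u) → archimedes (- x zero) >>= λ { (H₂ , l) → pure (H ℕ.+ (H₁ ℕ.+ H₂) ,
             λ { zero → ≤-trans (neg-mono-≤ (≤-trans (<⇒≤ l) (fromℕ-mono-≤ (ℕₚ.≤-trans (ℕₚ.m≤n+m H₂ H₁) (ℕₚ.m≤n+m _ H))))) (≡⇒≤ (-‿involutive (x zero))) , ≤-trans (<⇒≤ u) (fromℕ-mono-≤ (ℕₚ.≤-trans (ℕₚ.m≤m+n H₁ H₂) (ℕₚ.m≤n+m _ H)))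
               ; (suc i) → widen (ℕₚ.m≤m+n H _) (b i) }) } } }

    -- Φ is the limit of Gram matrices of Gaussian bumps sampled on ever finer grids.
    Φ-psd : PSD Φ
    Φ-psd {A} zs w p = ≤-stable (bounding zs p >>= λ { (H , b) → pure (0≤-cancelˡ 𝒢 𝒢>0 (subst (0ℝ ≤_) (value H) (⟶-≤ (⟶-const 0ℝ) (limit H b) (λ N → gram H N)))) })
      where
        e : A → ℕ
        e z = proj₁ (p z)
        -- The grid limit is 𝒢 / β^h times an exponential. Since `αα` says that the product of both
        -- α is βτ, these factors turn it into 𝒢 τ^h, the normalisation of Φ.
        v : A → ℝ
        v z = w z * α (e z) ^ h
        limit : ∀ H → (∀ z → z ∈ zs → Bounded H (p z)) → (λ N → ∑ zs (λ i → ∑ zs (λ j → (v i * v j) * grid-sum H (p i) (p j) N))) ⟶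
            ∑ zs (λ i → ∑ zs (λ j → (v i * v j) * (E (dist (proj₂ (p i)) (proj₂ (p j)) * τ (e i) (e j)) * Π n (λ c → G (d c * (α (e i) + α (e j)))))))
        limit H b = ⟶-∑∈ zs (λ i qi → ⟶-∑∈ zs (λ j qj → ⟶-*ˡ (v i * v j) (grid-limit H (p i) (p j) (b i qi) (b j qj))))
        gram : ∀ H N → 0ℝ ≤ ∑ zs (λ i → ∑ zs (λ j → (v i * v j) * grid-sum H (p i) (p j) N))
        gram H N = subst (0ℝ ≤_) (sym eq) (0≤* (0≤Π n (λ _ → <⇒≤ (0<ν′ N))) (0≤∑ (box n Z) (λ k → 0≤sq (∑ zs (λ i → v i * B i k)))))
          where
            Z = win (window H N) (window H N)
            B : A → (Fin n → ℤ) → ℝ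
            B i k = Π n (λ c → bump (p i) (fromℤ (k c) * ν′ N) c)
            c₀ = Π n (λ _ → ν′ N)
            entry : ∀ i j → grid-sum H (p i) (p j) N ≡ c₀ * ∑ (box n Z) (λ k → B i k * B j k)
            entry i j = trans (Π-* n) (cong (c₀ *_) (trans (sym (∑-box n Z (λ c z → bump (p i) (fromℤ z * ν′ N) c * bump (p j) (fromℤ z * ν′ N) c))) (∑-cong (box n Z) (λ k → Π-* n))))
            eq : ∑ zs (λ i → ∑ zs (λ j → (v i * v j) * grid-sum H (p i) (p j) N)) ≡ c₀ * ∑ (box n Z) (λ k → ∑ zs (λ i → v i * B i k) * ∑ zs (λ i → v i * B i k))
            eq = trans (∑-cong zs (λ i → trans (∑-cong zs (λ j → trans (cong ((v i * v j) *_) (entry i j)) (trans (solve 3 (λ a c s → a :* (c :* s) := c :* (a :* s)) refl (v i * v j) c₀ _) (cong (c₀ *_) (sym (∑-*ˡ (box n Z) (v i * v j))))))) (trans (∑-*ˡ zs c₀) (cong (c₀ *_) (∑-swap zs (box n Z))))))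
                  (trans (∑-*ˡ zs c₀) (cong (c₀ *_) (trans (∑-swap zs (box n Z)) (∑-cong (box n Z) (λ k → sym (trans (∑-prod zs zs) (∑-cong zs (λ i → ∑-cong zs (λ j → solve 4 (λ a b c d → a :* b :* (c :* d) := a :* c :* (b :* d)) refl (v i) (B i k) (v j) (B j k))))))))))
        value : ∀ H → ∑ zs (λ i → ∑ zs (λ j → (v i * v j) * (E (dist (proj₂ (p i)) (proj₂ (p j)) * τ (e i) (e j)) * Π n (λ c → G (d c * (α (e i) + α (e j)))))))
             ≡ 𝒢 * ∑ zs (λ i → ∑ zs (λ j → (w i * w j) * Φ (p i) (p j)))
        value H = trans (∑-cong zs (λ i → trans (∑-cong zs (λ j → one i j)) (∑-*ˡ zs 𝒢))) (∑-*ˡ zs 𝒢)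
          where
            one : ∀ i j → (v i * v j) * (E (dist (proj₂ (p i)) (proj₂ (p j)) * τ (e i) (e j)) * Π n (λ c → G (d c * (α (e i) + α (e j))))) ≡ 𝒢 * ((w i * w j) * Φ (p i) (p j))
            one i j = trans (solve 6 (λ w w' a a' x g → w :* a :* (w' :* a') :* (x :* g) := w :* w' :* x :* (g :* (a :* a'))) refl (w i) (w j) (α (e i) ^ h) (α (e j) ^ h) X P)
                (trans (cong (w i * w j * X *_) (trans (cong (P *_) (trans (sym (*-^ (α (e i)) (α (e j)) h)) (trans (cong (_^ h) αα) (*-^ β t h)))) (trans (sym (*-assoc P (β ^ h) (t ^ h))) (cong (_* t ^ h) (𝒢-scale β>0)))))
                  (solve 5 (λ w w' x g t → w :* w' :* x :* (g :* t) := g :* (w :* w' :* (t :* x))) refl (w i) (w j) X 𝒢 (t ^ h)))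
              where
                open Pair (e i) (e j)
                X = E (dist (proj₂ (p i)) (proj₂ (p j)) * τ (e i) (e j))
                P = Π n (λ c → G (d c * (α (e i) + α (e j))))

 -- Integer polynomial arithmetic and the certificate checker.

 module IntegerPolynomials where

  infixl 6 _⊞_
  infixl 7 _⊛_

  _⊞_ : List ℤ → List ℤ → List ℤ
  [] ⊞ q = q
  (a ∷ p) ⊞ [] = a ∷ p
  (a ∷ p) ⊞ (b ∷ q) = (a ℤ.+ b) ∷ (p ⊞ q)

  scale : ℤ → List ℤ → List ℤ
  scale a = map (λ b → a ℤ.* b)

  _⊛_ : List ℤ → List ℤ → List ℤ
  [] ⊛ q = []
  (a ∷ p) ⊛ q = scale a q ⊞ (ℤ.+ 0 ∷ (p ⊛ q))

  monomial : ℕ → ℤ → List ℤ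
  monomial k a = replicate k (ℤ.+ 0) ++ a ∷ []

  -- (X + Y) p + a X^(length p), for forms listed by decreasing powers of X
  homogenise-step : ℤ → List ℤ → List ℤ
  homogenise-step a [] = a ∷ []
  homogenise-step a (b ∷ p) = (a ℤ.+ b) ∷ homogenise-step b p

  homogenise : List ℤ → List ℤ → List ℤ
  homogenise acc [] = acc
  homogenise acc (a ∷ p) = homogenise (homogenise-step a acc) p

  -- coefficients of p in the (unnormalised) Bernstein basis x^k (1 - x)^(deg p - k)
  bernstein : List ℤ → List ℤ
  bernstein = homogenise []

  nonneg : ℤ → Bool
  nonneg (ℤ.+ _) = true
  nonneg -[1+ _ ] = false

  all-nonneg : List ℤ → Bool
  all-nonneg [] = true
  all-nonneg (a ∷ p) = nonneg a ∧ all-nonneg p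

  private
    _÷_ : ℤ → ℕ → ℤ
    a ÷ zero = ℤ.+ 0
    a ÷ suc d = a ℤ./ℕ suc d

    subtract : ℤ → List ℤ → List ℤ → List ℤ
    subtract q [] p = p
    subtract q (g ∷ gs) [] = []
    subtract q (g ∷ gs) (a ∷ p) = (a ℤ.- q ℤ.* g) ∷ subtract q gs p

    divide : ℕ → ℕ → List ℤ → List ℤ → List ℤ → List ℤ
    divide zero d gs p quo = quo
    divide (suc n) d gs [] quo = quo
    divide (suc n) d gs (a ∷ p) quo = let q = a ÷ d in divide n d gs (subtract q gs p) (q ∷ quo)

  -- approximate quotient of p by g (integer parts of the coefficients)
  quotient : List ℤ → List ℤ → List ℤ
  quotient p g with reverse g
  ... | [] = []
  ... | d ∷ gs = divide (length p ℕ.∸ length gs) ℤ.∣ d ∣ gs (reverse p) []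

  infix 7 _≤head_
  _≤head_ : ℤ → List ℤ → Bool
  κ ≤head [] = false
  κ ≤head (b ∷ _) = nonneg (b ℤ.- κ)

  -- Defined by subtraction, which makes c p = g² q + remainder true for every list that `quotient`
  -- may return.
  remainder : ℤ → List ℤ → List ℤ → List ℤ
  remainder c p g = scale c p ⊞ scale (ℤ.- ℤ.+ 1) (quotient (scale c p) (g ⊛ g) ⊛ (g ⊛ g))

  -- c p = g² q + e with q and e nonnegative in the Bernstein basis, and q(1) ≥ κ
  certify : ℤ → List ℤ → List ℤ → ℤ → Bool
  certify c p g κ = all-nonneg (bernstein q) ∧ (κ ≤head bernstein q ∧ all-nonneg (bernstein (remainder c p g)))
    where q = quotient (scale c p) (g ⊛ g)

 -- Bernstein positivity for functionals given by completely monotone sequences.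

 module CompleteMonotonicity where
  open Field
  open Sums
  open IntegerPolynomials

  ∧-split : ∀ {x y} → x ∧ y ≡ true → x ≡ true × y ≡ true
  ∧-split {true} {true} refl = refl , refl

  nonneg-sound : ∀ a → nonneg a ≡ true → 0ℝ ≤ fromℤ a
  nonneg-sound (ℤ.+ n) refl = 0≤ℕ n

  -- the linear functional sending U^i to s i, applied to U^k p
  ⟪_⟫ : (ℕ → ℝ) → List ℤ → ℕ → ℝ
  ⟪ s ⟫ [] k = 0ℝ
  ⟪ s ⟫ (a ∷ p) k = fromℤ a * s k + ⟪ s ⟫ p (suc k)

  ⟪⟫-cong : ∀ {s t : ℕ → ℝ} → (∀ k → s k ≡ t k) → ∀ p k → ⟪ s ⟫ p k ≡ ⟪ t ⟫ p k
  ⟪⟫-cong e [] k = refl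
  ⟪⟫-cong e (a ∷ p) k = cong₂ _+_ (cong (fromℤ a *_) (e k)) (⟪⟫-cong e p (suc k))

  ⟪⟫-⊞ : ∀ s p q k → ⟪ s ⟫ (p ⊞ q) k ≡ ⟪ s ⟫ p k + ⟪ s ⟫ q k
  ⟪⟫-⊞ s [] q k = sym (+-identityˡ _)
  ⟪⟫-⊞ s (a ∷ p) [] k = sym (+-identityʳ _)
  ⟪⟫-⊞ s (a ∷ p) (b ∷ q) k = trans (cong₂ (λ u v → u * s k + v) (fromℤ-+ a b) (⟪⟫-⊞ s p q (suc k)))
    (solve 5 (λ a b s x y → (a :+ b) :* s :+ (x :+ y) := a :* s :+ x :+ (b :* s :+ y)) refl (fromℤ a) (fromℤ b) (s k) _ _)

  ⟪⟫-scale : ∀ s c p k → ⟪ s ⟫ (scale c p) k ≡ fromℤ c * ⟪ s ⟫ p k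
  ⟪⟫-scale s c [] k = sym (zeroʳ _)
  ⟪⟫-scale s c (a ∷ p) k = trans (cong₂ (λ u v → u * s k + v) (fromℤ-* c a) (⟪⟫-scale s c p (suc k)))
    (solve 4 (λ c a s x → c :* a :* s :+ c :* x := c :* (a :* s :+ x)) refl (fromℤ c) (fromℤ a) (s k) _)

  -- The values k ↦ ⟪ s ⟫ q k form a sequence again, so multiplication of polynomials becomes
  -- iteration of functionals.
  ⟪⟫-⊛ : ∀ s p q k → ⟪ s ⟫ (p ⊛ q) k ≡ ⟪ ⟪ s ⟫ q ⟫ p k
  ⟪⟫-⊛ s [] q k = refl
  ⟪⟫-⊛ s (a ∷ p) q k = trans (⟪⟫-⊞ s (scale a q) (ℤ.+ 0 ∷ (p ⊛ q)) k) (cong₂ _+_ (⟪⟫-scale s a q k)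
    (trans (cong₂ _+_ (zeroˡ (s k)) (⟪⟫-⊛ s p q (suc k))) (+-identityˡ _)))

  ⟪⟫-monomial : ∀ s k a j → ⟪ s ⟫ (monomial k a) j ≡ fromℤ a * s (k ℕ.+ j)
  ⟪⟫-monomial s zero a j = +-identityʳ _
  ⟪⟫-monomial s (suc k) a j = trans (cong₂ _+_ (zeroˡ (s j)) (⟪⟫-monomial s k a (suc j))) (trans (+-identityˡ _) (cong (λ i → fromℤ a * s i) (ℕₚ.+-suc k j)))

  ⟪⟫-*ˡ : ∀ c s p k → ⟪ (λ i → c * s i) ⟫ p k ≡ c * ⟪ s ⟫ p k
  ⟪⟫-*ˡ c s [] k = sym (zeroʳ c)
  ⟪⟫-*ˡ c s (a ∷ p) k = trans (cong (fromℤ a * (c * s k) +_) (⟪⟫-*ˡ c s p (suc k))) (solve 4 (λ a c s x → a :* (c :* s) :+ c :* x := c :* (a :* s :+ x)) refl (fromℤ a) c (s k) _)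

  ⟪⟫-+ : ∀ s t p k → ⟪ (λ i → s i + t i) ⟫ p k ≡ ⟪ s ⟫ p k + ⟪ t ⟫ p k
  ⟪⟫-+ s t [] k = sym (+-identityˡ 0ℝ)
  ⟪⟫-+ s t (a ∷ p) k = trans (cong (fromℤ a * (s k + t k) +_) (⟪⟫-+ s t p (suc k))) (solve 5 (λ a s t x y → a :* (s :+ t) :+ (x :+ y) := a :* s :+ x :+ (a :* t :+ y)) refl (fromℤ a) (s k) (t k) _ _)

  ⟪⟫-∑ : {A : Set} (xs : List A) (s : A → ℕ → ℝ) → ∀ p k → ⟪ (λ i → ∑ xs (λ x → s x i)) ⟫ p k ≡ ∑ xs (λ x → ⟪ s x ⟫ p k)
  ⟪⟫-∑ [] s p k = go p k
    where
      go : ∀ p k → ⟪ (λ _ → 0ℝ) ⟫ p k ≡ 0ℝ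
      go [] k = refl
      go (a ∷ p) k = trans (cong₂ _+_ (zeroʳ _) (go p (suc k))) (+-identityˡ 0ℝ)
  ⟪⟫-∑ (x ∷ xs) s p k = trans (⟪⟫-+ (s x) (λ i → ∑ xs (λ x → s x i)) p k) (cong (⟪ s x ⟫ p k +_) (⟪⟫-∑ xs s p k))

  Δ : (ℕ → ℝ) → ℕ → ℝ
  Δ s k = s k - s (suc k)

  -- `diff l s k` is the functional of s at U^k (1 - U)^l; nonnegativity of all these numbers is
  -- Hausdorff's moment condition.
  diff : ℕ → (ℕ → ℝ) → ℕ → ℝ
  diff zero s = s
  diff (suc l) s = diff l (Δ s)

  diff-cong : ∀ l {s t : ℕ → ℝ} → (∀ k → s k ≡ t k) → ∀ k → diff l s k ≡ diff l t k
  diff-cong zero e k = e k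
  diff-cong (suc l) e k = diff-cong l (λ k → cong₂ _-_ (e k) (e (suc k))) k

  diff-suc : ∀ l s k → diff (suc l) s k ≡ diff l s k - diff l s (suc k)
  diff-suc zero s k = refl
  diff-suc (suc l) s k = diff-suc l (Δ s) k

  CompletelyMonotone : (ℕ → ℝ) → Set
  CompletelyMonotone s = ∀ l k → 0ℝ ≤ diff l s k

  private
    module _ (s : ℕ → ℝ) where
      -- The functional of s at the polynomial with Bernstein coefficient list p, multiplied by (1 -
      -- U)^l.
      form : List ℤ → ℕ → ℝ
      form [] l = 0ℝ
      form (b ∷ p) l = fromℤ b * diff l s (length p) + form p (suc l)

      length-step : ∀ a p → length (homogenise-step a p) ≡ suc (length p)
      length-step a [] = refl
      length-step a (b ∷ p) = cong suc (length-step b p)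

      -- U^k (1 - U)^l = U^(k+1) (1 - U)^l + U^k (1 - U)^(l+1)
      pascal : ∀ l k → diff l s k ≡ diff l s (suc k) + diff (suc l) s k
      pascal l k = trans (solve 2 (λ x y → x := y :+ (x :- y)) refl (diff l s k) (diff l s (suc k))) (cong (diff l s (suc k) +_) (sym (diff-suc l s k)))

      form-step : ∀ a p l → form (homogenise-step a p) l ≡ fromℤ a * diff l s (length p) + form p l
      form-step a [] l = refl
      form-step a (b ∷ p) l = begin
        fromℤ (a ℤ.+ b) * diff l s (length (homogenise-step b p)) + form (homogenise-step b p) (suc l)
          ≡⟨ cong₂ (λ u v → fromℤ (a ℤ.+ b) * diff l s u + v) (length-step b p) (form-step b p (suc l)) ⟩
        fromℤ (a ℤ.+ b) * diff l s n + (fromℤ b * diff (suc l) s (length p) + F)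
          ≡⟨ cong (λ t → t * diff l s n + (fromℤ b * diff (suc l) s (length p) + F)) (fromℤ-+ a b) ⟩
        (fromℤ a + fromℤ b) * diff l s n + (fromℤ b * diff (suc l) s (length p) + F)
          ≡⟨ solve 5 (λ a b x y f → (a :+ b) :* x :+ (b :* y :+ f) := a :* x :+ (b :* (x :+ y) :+ f)) refl (fromℤ a) (fromℤ b) (diff l s n) (diff (suc l) s (length p)) F ⟩
        fromℤ a * diff l s n + (fromℤ b * (diff l s n + diff (suc l) s (length p)) + F)
          ≡⟨ cong (λ t → fromℤ a * diff l s n + (fromℤ b * t + F)) (sym (pascal l (length p))) ⟩
        fromℤ a * diff l s n + (fromℤ b * diff l s (length p) + F) ∎
        where
          open ≡-Reasoning
          n = suc (length p)
          F = form p (suc l)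

      form-homogenise : ∀ acc p → form (homogenise acc p) 0 ≡ form acc 0 + ⟪ s ⟫ p (length acc)
      form-homogenise acc [] = sym (+-identityʳ _)
      form-homogenise acc (a ∷ p) = trans (form-homogenise (homogenise-step a acc) p)
        (trans (cong₂ _+_ (form-step a acc 0) (cong (⟪ s ⟫ p) (length-step a acc))) (solve 3 (λ x y z → x :+ y :+ z := y :+ (x :+ z)) refl (fromℤ a * s (length acc)) (form acc 0) _))

      length-homogenise : ∀ acc p → length (homogenise acc p) ≡ length acc ℕ.+ length p
      length-homogenise acc [] = sym (ℕₚ.+-identityʳ _)
      length-homogenise acc (a ∷ p) = trans (length-homogenise (homogenise-step a acc) p) (trans (cong (ℕ._+ length p) (length-step a acc)) (sym (ℕₚ.+-suc (length acc) (length p))))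

      form-nonneg : CompletelyMonotone s → ∀ p l → all-nonneg p ≡ true → 0ℝ ≤ form p l
      form-nonneg cm [] l e = ≤-refl
      form-nonneg cm (a ∷ p) l e = let u , v = ∧-split e in 0≤+ (0≤* (nonneg-sound a u) (cm l (length p))) (form-nonneg cm p (suc l) v)

  bernstein-nonneg : ∀ {s} → CompletelyMonotone s → ∀ p → all-nonneg (bernstein p) ≡ true → 0ℝ ≤ ⟪ s ⟫ p 0
  bernstein-nonneg {s} cm p e = subst (0ℝ ≤_) (trans (form-homogenise s [] p) (+-identityˡ _)) (form-nonneg s cm (bernstein p) 0 e)

  -- The head coefficient belongs to the pure power U^(deg p) and equals p(1); the other terms are
  -- nonnegative and are dropped.
  bernstein-head : ∀ {s} → CompletelyMonotone s → ∀ p κ → all-nonneg (bernstein p) ≡ true → (κ ≤head bernstein p) ≡ true → fromℤ κ * s (length p ℕ.∸ 1) ≤ ⟪ s ⟫ p 0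
  bernstein-head {s} cm p κ e f = go (bernstein p) (length-homogenise s [] p) (trans (form-homogenise s [] p) (+-identityˡ _)) e f
    where
      go : ∀ b → length b ≡ length p → form s b 0 ≡ ⟪ s ⟫ p 0 → all-nonneg b ≡ true → (κ ≤head b) ≡ true → fromℤ κ * s (length p ℕ.∸ 1) ≤ ⟪ s ⟫ p 0
      go (b ∷ bs) len eq e f = subst (fromℤ κ * s (length p ℕ.∸ 1) ≤_) eq (≤-trans (≤-trans (*-mono-≤ʳ _ (cm 0 _) κ≤b) (≡⇒≤ (cong (λ k → fromℤ b * s (k ℕ.∸ 1)) (sym len))))
                  (≤-by (form s bs 1) (form-nonneg s cm bs 1 (proj₂ (∧-split e))) refl))
        where
          κ≤b : fromℤ κ ≤ fromℤ b
          κ≤b = 0≤⇒≤ (subst (0ℝ ≤_) (trans (fromℤ-+ b (ℤ.- κ)) (cong (fromℤ b +_) (fromℤ-neg κ))) (nonneg-sound (b ℤ.- κ) f))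

  -- On g² q the functional of s is the functional of ⟪ ⟪ s ⟫ g ⟫ g on q, so q and the remainder are
  -- tested against two different sequences.
  certify-sound : ∀ {s} c p g κ → certify c p g κ ≡ true → CompletelyMonotone s → CompletelyMonotone (⟪ ⟪ s ⟫ g ⟫ g) →
    fromℤ κ * ⟪ ⟪ s ⟫ g ⟫ g (length (quotient (scale c p) (g ⊛ g)) ℕ.∸ 1) ≤ fromℤ c * ⟪ s ⟫ p 0
  certify-sound {s} c p g κ ok cm cmg with ∧-split ok
  ... | q≥0 , rest with ∧-split rest
  ... | κ≤ , e≥0 = ≤-trans (bernstein-head cmg q κ q≥0 κ≤) (≤-by (⟪ s ⟫ (remainder c p g) 0) (bernstein-nonneg cm (remainder c p g) e≥0) eq)
    where
      q = quotient (scale c p) (g ⊛ g)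
      eq : fromℤ c * ⟪ s ⟫ p 0 ≡ ⟪ ⟪ ⟪ s ⟫ g ⟫ g ⟫ q 0 + ⟪ s ⟫ (remainder c p g) 0
      eq = sym (trans (cong₂ _+_ (trans (⟪⟫-cong (λ k → sym (⟪⟫-⊛ s g g k)) q 0) (sym (⟪⟫-⊛ s q (g ⊛ g) 0)))
             (trans (⟪⟫-⊞ s (scale c p) (scale (ℤ.- ℤ.+ 1) (q ⊛ (g ⊛ g))) 0) (cong₂ _+_ (⟪⟫-scale s c p 0) (⟪⟫-scale s (ℤ.- ℤ.+ 1) (q ⊛ (g ⊛ g)) 0))))
             (solve 2 (λ x y → x :+ (y :+ (:- (𝟙 :+ K 0)) :* x) := y) refl (⟪ s ⟫ (q ⊛ (g ⊛ g)) 0) (fromℤ c * ⟪ s ⟫ p 0)))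

  -- A single increase by δ would by convexity be repeated at every later step, and the sequence
  -- would outgrow its bound b.
  convex⇒nonincreasing : ∀ (s : ℕ → ℝ) b → (∀ k → s k ≤ b) → (∀ k → 0ℝ ≤ diff 2 s k) → ∀ k → 0ℝ ≤ Δ s k
  convex⇒nonincreasing s b bd cv k lt = archimedes ((b - s k) * δ ⁻¹) (λ { (M , big) → bd (k ℕ.+ M) (<-≤-trans (0<⇒< (subst (0ℝ <_) (solve 4 (λ m d b s → d :* m :- (b :- s) := (s :+ d :* m) :- b) refl (fromℕ M) δ b (s k)) (<⇒0< (≤-<-trans (≡⇒≤ (unfold M)) (*-mono-<ˡ δ δ>0 big))))) (grow M)) })
    where
      δ = - Δ s k
      δ>0 : 0ℝ < δ
      δ>0 = 0<⇒< (subst (0ℝ <_) (solve 1 (λ x → K 0 :- x := :- x :- K 0) refl (Δ s k)) (<⇒0< lt))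
      unfold : ∀ M → b - s k ≡ δ * ((b - s k) * δ ⁻¹)
      unfold M = sym (trans (solve 3 (λ d x i → d :* (x :* i) := (d :* i) :* x) refl δ (b - s k) (δ ⁻¹)) (trans (cong (_* (b - s k)) (*-inv⁺ δ>0)) (*-identityˡ _)))
      drop : ∀ M → Δ s (k ℕ.+ M) ≤ Δ s k
      drop zero = ≡⇒≤ (cong (Δ s) (ℕₚ.+-identityʳ k))
      drop (suc M) = ≤-trans (≤-trans (≡⇒≤ (cong (Δ s) (ℕₚ.+-suc k M))) (0≤⇒≤ (cv (k ℕ.+ M)))) (drop M)
      grow : ∀ M → s k + δ * fromℕ M ≤ s (k ℕ.+ M)
      grow zero = ≡⇒≤ (trans (solve 2 (λ s d → s :+ d :* K 0 := s) refl (s k) δ) (cong s (sym (ℕₚ.+-identityʳ k))))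
      grow (suc M) = ≤-trans (≡⇒≤ (solve 3 (λ s d m → s :+ d :* (𝟙 :+ m) := s :+ d :* m :+ d) refl (s k) δ (fromℕ M))) (≤-trans (+-mono-≤ (grow M) (neg-mono-≤ (drop M)))
        (≡⇒≤ (trans (solve 2 (λ x y → x :+ (:- (x :- y)) := y) refl (s (k ℕ.+ M)) (s (suc (k ℕ.+ M)))) (cong s (sym (ℕₚ.+-suc k M))))))

  geometric-cm : ∀ {t c} → 0ℝ ≤ c → 0ℝ ≤ t → t ≤ 1ℝ → CompletelyMonotone (λ k → c * t ^ k)
  geometric-cm {t} {c} c≥0 t≥0 t≤1 zero k = 0≤* c≥0 (0≤^ k t≥0)
  geometric-cm {t} {c} c≥0 t≥0 t≤1 (suc l) k = subst (0ℝ ≤_) (diff-cong l (λ j → solve 3 (λ c t p → c :* (𝟙 :- t) :* p := c :* p :- c :* (t :* p)) refl c t (t ^ j)) k) (geometric-cm (0≤* c≥0 (≤⇒0≤ t≤1)) t≥0 t≤1 l k)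

  ⟪⟫-geometric : ∀ t p k → ⟪ (λ i → t ^ i) ⟫ p k ≡ ⟪ (λ i → t ^ i) ⟫ p 0 * t ^ k
  ⟪⟫-geometric t [] k = sym (zeroˡ _)
  ⟪⟫-geometric t (a ∷ p) k = trans (cong (fromℤ a * t ^ k +_) (trans (⟪⟫-geometric t p (suc k)) refl))
    (trans (solve 4 (λ a x t y → a :* x :+ y :* (t :* x) := (a :* 𝟙 :+ y :* (t :* 𝟙)) :* x) refl (fromℤ a) (t ^ k) t _) (cong (λ u → (fromℤ a * 1ℝ + u) * t ^ k) (sym (⟪⟫-geometric t p 1))))

  certify-unit-interval : ∀ c p g → certify c p g (ℤ.+ 0) ≡ true → ∀ {t} → 0ℝ ≤ t → t ≤ 1ℝ → 0ℝ ≤ fromℤ c * ⟪ (λ i → t ^ i) ⟫ p 0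
  certify-unit-interval c p g ok {t} t≥0 t≤1 = subst (_≤ fromℤ c * ⟪ (λ i → t ^ i) ⟫ p 0) (zeroˡ _)
     (certify-sound c p g (ℤ.+ 0) ok (λ l k → subst (0ℝ ≤_) (diff-cong l (λ k → *-identityˡ (t ^ k)) k) (geometric-cm 0≤1 t≥0 t≤1 l k))
       (λ l k → subst (0ℝ ≤_) (diff-cong l sq k) (geometric-cm (0≤sq γ) t≥0 t≤1 l k)))
    where
      -- The functional is evaluation at t, so g acts as the scalar γ and acting twice multiplies by
      -- γ² ≥ 0.
      γ = ⟪ (λ i → t ^ i) ⟫ g 0
      sq : ∀ k → γ * γ * t ^ k ≡ ⟪ ⟪ (λ i → t ^ i) ⟫ g ⟫ g k
      sq k = sym (trans (⟪⟫-cong (λ j → ⟪⟫-geometric t g j) g k) (trans (⟪⟫-*ˡ γ (λ i → t ^ i) g k) (trans (cong (γ *_) (⟪⟫-geometric t g k)) (sym (*-assoc _ _ _)))))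

 -- Complete monotonicity of heat-kernel energies.

 module HeatMoments where
  open Field
  open Sums
  open Exponential
  open GaussIntegral using (ν′≤1)
  open HeatKernel
  open CompleteMonotonicity
  open IntegerPolynomials

  psd-cauchy-schwarz : {C : Set} (k : C → C → ℝ) → PSD k → (∀ u v → k u v ≡ k v u) → {A : Set} (xs : List A) (w : A → ℝ) (p : A → C) (q : C) → 0ℝ < k q q →
    ∑ xs (λ i → w i * k (p i) q) * ∑ xs (λ i → w i * k (p i) q) ≤ ∑ xs (λ i → ∑ xs (λ j → (w i * w j) * k (p i) (p j))) * k q q
  psd-cauchy-schwarz k psd ksym {A} xs w p q kqq>0 = 0≤⇒≤ (subst (0ℝ ≤_) eq (0≤* (<⇒≤ kqq>0) (psd-two k psd ksym xs w p (q ∷ []) (λ _ → 1ℝ) id l)))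
    where
      XX = ∑ xs (λ i → ∑ xs (λ j → (w i * w j) * k (p i) (p j)))
      XY = ∑ xs (λ i → w i * k (p i) q)
      Y = k q q
      l = XY * Y ⁻¹
      yl : Y * l ≡ XY
      yl = trans (solve 3 (λ y x i → y :* (x :* i) := x :* (y :* i)) refl Y XY (Y ⁻¹)) (trans (cong (XY *_) (*-inv⁺ kqq>0)) (*-identityʳ XY))
      eq : Y * (XX - (l + l) * ∑ xs (λ i → ∑ (q ∷ []) (λ j → (w i * 1ℝ) * k (p i) j)) + l * l * ∑ (q ∷ []) (λ i → ∑ (q ∷ []) (λ j → (1ℝ * 1ℝ) * k i j))) ≡ XX * Y - XY * XY
      eq = trans (cong₂ (λ u v → Y * (XX - (l + l) * u + l * l * v)) (∑-cong xs (λ i → solve 2 (λ w k → (w :* 𝟙) :* k :+ K 0 := w :* k) refl (w i) (k (p i) q))) (solve 1 (λ y → (𝟙 :* 𝟙) :* y :+ K 0 :+ K 0 := y) refl Y))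
           (trans (solve 4 (λ y x l z → y :* (x :- (l :+ l) :* z :+ l :* l :* y) := x :* y :- (y :* l :+ y :* l) :* z :+ (y :* l) :* (y :* l)) refl Y XX l XY)
             (trans (cong (λ t → XX * Y - (t + t) * XY + t * t) yl) (solve 3 (λ x y z → x :* y :- (z :+ z) :* z :+ z :* z := x :* y :- z :* z) refl XX Y XY)))

  module Moments (n h : ℕ) (n≡h+h : n ≡ h ℕ.+ h) (d : Fin n → ℝ) (d>0 : ∀ i → 0ℝ < d i) where
    open Kernel n h n≡h+h d d>0

    Family : Set
    Family = List (ℝ × Point)

    lift : ℕ → Point → Point
    lift k (e , x) = k ℕ.+ e , x

    energy : Family → ℕ → ℝ
    energy F k = ∑ F (λ u → ∑ F (λ v → (proj₁ u * proj₁ v) * Φ (lift k (proj₂ u)) (lift k (proj₂ v))))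

    0≤Φ : ∀ u v → 0ℝ ≤ Φ u v
    0≤Φ (e , x) (e' , x') = 0≤* (0≤^ h (<⇒≤ (0<τ e e'))) (0≤E (0≤* (0≤dist x x') (<⇒≤ (0<τ e e'))))

    Φ≤1 : ∀ u v → Φ u v ≤ 1ℝ
    Φ≤1 (e , x) (e' , x') = ≤-trans (*-mono-≤ (0≤^ h (<⇒≤ (0<τ e e'))) 0≤1 (^≤1 h (<⇒≤ (0<τ e e')) (ν′≤1 (e ℕ.+ suc e'))) (E≤1 (0≤* (0≤dist x x') (<⇒≤ (0<τ e e'))))) (≡⇒≤ (*-identityʳ 1ℝ))

    Φ-cong : ∀ {e₁ e₂ e₁′ e₂′} x y → suc e₁ ℕ.+ suc e₂ ≡ suc e₁′ ℕ.+ suc e₂′ → Φ (e₁ , x) (e₂ , y) ≡ Φ (e₁′ , x) (e₂′ , y)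
    Φ-cong x y p = cong (λ m → ((fromℕ m) ⁻¹) ^ h * E (dist x y * (fromℕ m) ⁻¹)) p

    private
      step : ℝ × Point → ℝ × Point
      step (w , e , x) = - w , suc (suc e) , x

      -- the family of (1 - U) F
      F⁺ : Family → Family
      F⁺ F = F ++ map step F

      -- For fixed centres Φ sees two widths only through their sum, so widening one Gaussian of a
      -- pair by 2 equals widening both by 1. The cross terms are therefore energies at k + 1, and a
      -- second difference appears.
      energy-F⁺ : ∀ F k → energy (F⁺ F) k ≡ Δ (Δ (energy F)) k
      energy-F⁺ F k = begin
        energy (F⁺ F) k ≡⟨ split _ ⟩
        ∑ F (λ u → ∑ (F⁺ F) (t k u)) + ∑ F (λ u → ∑ (F⁺ F) (t k (step u)))
          ≡⟨ cong₂ _+_ (∑-cong F (λ u → trans (split _) (cong (∑ F (t k u) +_) (trans (∑-cong F (mixed u)) (∑-neg F)))))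
                       (∑-cong F (λ u → trans (split _) (cong₂ _+_ (trans (∑-cong F (mixed′ u)) (∑-neg F)) (∑-cong F (both u))))) ⟩
        ∑ F (λ u → ∑ F (t k u) - ∑ F (t (suc k) u)) + ∑ F (λ u → - ∑ F (t (suc k) u) + ∑ F (t (suc (suc k)) u))
          ≡⟨ cong₂ _+_ (∑-- F) (trans (∑-+ F) (cong (_+ energy F (suc (suc k))) (∑-neg F))) ⟩
        energy F k - energy F (suc k) + (- energy F (suc k) + energy F (suc (suc k)))
          ≡⟨ solve 3 (λ a b c → a :- b :+ (:- b :+ c) := a :- b :- (b :- c)) refl (energy F k) (energy F (suc k)) (energy F (suc (suc k))) ⟩
        Δ (Δ (energy F)) k ∎
        where
          open ≡-Reasoning
          t : ℕ → ℝ × Point → ℝ × Point → ℝ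
          t k u v = (proj₁ u * proj₁ v) * Φ (lift k (proj₂ u)) (lift k (proj₂ v))
          split : ∀ f → ∑ (F⁺ F) f ≡ ∑ F f + ∑ F (f ∘ step)
          split f = trans (∑-++ F (map step F)) (cong (∑ F f +_) (∑-map step F))
          two : ∀ e → k ℕ.+ suc (suc e) ≡ suc (suc (k ℕ.+ e))
          two e = trans (ℕₚ.+-suc k (suc e)) (cong suc (ℕₚ.+-suc k e))
          mixed : ∀ u v → t k u (step v) ≡ - t (suc k) u v
          mixed (w , e , x) (w' , e' , x') = trans (cong ((w * (- w')) *_) (Φ-cong {k ℕ.+ e} {k ℕ.+ suc (suc e')} {suc k ℕ.+ e} {suc k ℕ.+ e'} x x' (trans (cong (λ j → suc (k ℕ.+ e) ℕ.+ suc j) (two e')) (ℕₚ.+-suc (suc (k ℕ.+ e)) (suc (suc (k ℕ.+ e')))))))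
             (solve 3 (λ w v p → (w :* (:- v)) :* p := :- (w :* v :* p)) refl w w' _)
          mixed′ : ∀ u v → t k (step u) v ≡ - t (suc k) u v
          mixed′ (w , e , x) (w' , e' , x') = trans (cong (((- w) * w') *_) (Φ-cong {k ℕ.+ suc (suc e)} {k ℕ.+ e'} {suc k ℕ.+ e} {suc k ℕ.+ e'} x x' (trans (cong (λ j → suc j ℕ.+ suc (k ℕ.+ e')) (two e)) (sym (ℕₚ.+-suc (suc (suc (k ℕ.+ e))) (suc (k ℕ.+ e')))))))
             (solve 3 (λ w v p → ((:- w) :* v) :* p := :- (w :* v :* p)) refl w w' _)
          both : ∀ u v → t k (step u) (step v) ≡ t (suc (suc k)) u v
          both (w , e , x) (w' , e' , x') = trans (cong (((- w) * (- w')) *_) (cong₂ (λ i j → Φ (i , x) (j , x')) (two e) (two e')))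
             (solve 3 (λ w v p → ((:- w) :* (:- v)) :* p := w :* v :* p) refl w w' _)

      bound : ∀ F → ∃ λ b → ∀ k → energy F k ≤ b
      bound F = ∑ F (λ u → ∑ F (λ v → proj₁ u * proj₁ v * (proj₁ u * proj₁ v) + 1ℝ)) , λ k → ∑-mono F (λ u → ∑-mono F (λ v → term (proj₁ u * proj₁ v) (0≤Φ (lift k (proj₂ u)) (lift k (proj₂ v))) (Φ≤1 (lift k (proj₂ u)) (lift k (proj₂ v)))))
        where
          term : ∀ x {p} → 0ℝ ≤ p → p ≤ 1ℝ → x * p ≤ x * x + 1ℝ
          term x {p} p≥0 p≤1 = ≤-trans (≤-trans (*-mono-≤ʳ p p≥0 x≤) (*-mono-≤ˡ _ (0≤+ (0≤sq x) 0≤1) p≤1)) (≡⇒≤ (*-identityʳ _))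
            where
              x≤ : x ≤ x * x + 1ℝ
              x≤ with x ≤? 1ℝ
              ... | inj₁ r = ≤-trans r (≤-by (x * x) (0≤sq x) (+-comm _ _))
              ... | inj₂ r = ≤-trans (≤-trans (≡⇒≤ (sym (*-identityʳ x))) (*-mono-≤ˡ x (<⇒≤ (<-trans 0<1 r)) (<⇒≤ r))) (≤-by 1ℝ 0≤1 refl)

    -- Positive semidefiniteness gives order 0, and passing to `F⁺` raises the order by two. Order 1
    -- comes from convexity and boundedness, so every order is reached.
    energy-cm : ∀ F → CompletelyMonotone (energy F)
    energy-cm F zero k = Φ-psd F proj₁ (lift k ∘ proj₂)
    energy-cm F (suc zero) k = convex⇒nonincreasing (energy F) (proj₁ (bound F)) (proj₂ (bound F)) (λ j → subst (0ℝ ≤_) (energy-F⁺ F j) (Φ-psd (F⁺ F) proj₁ (lift j ∘ proj₂))) k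
    energy-cm F (suc (suc l)) k = subst (0ℝ ≤_) (diff-cong l (energy-F⁺ F) k) (energy-cm (F⁺ F) l k)

    module Weighted {A : Set} (b : ℕ) (zs : List A) (ω : A → ℝ) (y : A → Fin n → ℝ) where

      θ : ℕ → ℝ
      θ i = ∑ zs (λ z → ∑ zs (λ z' → (ω z * ω z') * Φ (b ℕ.+ i , y z) (b ℕ.+ i , y z')))

      -- Term i is widened by 2i, so that the terms i and j together contribute θ (i + j): the
      -- energy of the family is the functional of θ at g².
      family : List ℤ → ℕ → Family
      family [] i = []
      family (a ∷ g) i = map (λ z → fromℤ a * ω z , b ℕ.+ (i ℕ.+ i) , y z) zs ++ family g (suc i)

      ∑-family : ∀ g i (ψ : Point → ℝ) → ∑ (family g i) (λ u → proj₁ u * ψ (proj₂ u)) ≡ ⟪ (λ j → ∑ zs (λ z → ω z * ψ (b ℕ.+ (j ℕ.+ j) , y z))) ⟫ g i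
      ∑-family [] i ψ = refl
      ∑-family (a ∷ g) i ψ = trans (∑-++ (map _ zs) (family g (suc i))) (cong₂ _+_ (trans (∑-map _ zs) (trans (∑-cong zs (λ z → *-assoc _ _ _)) (∑-*ˡ zs (fromℤ a)))) (∑-family g (suc i) ψ))

      private
        offset : ∀ (s : ℕ → ℝ) m g i → ⟪ (λ j → s (j ℕ.+ m)) ⟫ g i ≡ ⟪ s ⟫ g (i ℕ.+ m)
        offset s m [] i = refl
        offset s m (a ∷ g) i = cong (fromℤ a * s (i ℕ.+ m) +_) (offset s m g (suc i))

        exponents : ∀ k i j → suc (k ℕ.+ (b ℕ.+ (i ℕ.+ i))) ℕ.+ suc (k ℕ.+ (b ℕ.+ (j ℕ.+ j))) ≡ suc (b ℕ.+ (j ℕ.+ (i ℕ.+ k))) ℕ.+ suc (b ℕ.+ (j ℕ.+ (i ℕ.+ k)))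
        exponents k i j = S.solve 4 (λ b k i j → (S.con 1 S.:+ (k S.:+ (b S.:+ (i S.:+ i)))) S.:+ (S.con 1 S.:+ (k S.:+ (b S.:+ (j S.:+ j)))) S.:= (S.con 1 S.:+ (b S.:+ (j S.:+ (i S.:+ k)))) S.:+ (S.con 1 S.:+ (b S.:+ (j S.:+ (i S.:+ k))))) refl b k i j
          where module S = Data.Nat.Solver.+-*-Solver

      energy-family : ∀ g k → energy (family g 0) k ≡ ⟪ ⟪ θ ⟫ g ⟫ g k
      energy-family g k = begin
        energy F k ≡⟨ ∑-cong F (λ u → trans (∑-cong F (λ v → *-assoc (proj₁ u) (proj₁ v) _)) (∑-*ˡ F (proj₁ u))) ⟩
        ∑ F (λ u → proj₁ u * ∑ F (λ v → proj₁ v * Φ (lift k (proj₂ u)) (lift k (proj₂ v)))) ≡⟨ ∑-family g 0 (λ p → ∑ F (λ v → proj₁ v * Φ (lift k p) (lift k (proj₂ v)))) ⟩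
        ⟪ (λ i → ∑ zs (λ z → ω z * ∑ F (λ v → proj₁ v * Φ (lift k (b ℕ.+ (i ℕ.+ i) , y z)) (lift k (proj₂ v))))) ⟫ g 0 ≡⟨ ⟪⟫-cong inner g 0 ⟩
        ⟪ (λ i → ⟪ θ ⟫ g (i ℕ.+ k)) ⟫ g 0 ≡⟨ offset (⟪ θ ⟫ g) k g 0 ⟩
        ⟪ ⟪ θ ⟫ g ⟫ g k ∎
        where
          open ≡-Reasoning
          F = family g 0
          inner : ∀ i → ∑ zs (λ z → ω z * ∑ F (λ v → proj₁ v * Φ (lift k (b ℕ.+ (i ℕ.+ i) , y z)) (lift k (proj₂ v)))) ≡ ⟪ θ ⟫ g (i ℕ.+ k)
          inner i = trans (∑-cong zs (λ z → trans (cong (ω z *_) (∑-family g 0 (λ p → Φ (lift k (b ℕ.+ (i ℕ.+ i) , y z)) (lift k p)))) (sym (⟪⟫-*ˡ (ω z) _ g 0))))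
                    (trans (sym (⟪⟫-∑ zs _ g 0)) (trans (⟪⟫-cong (λ j → ∑-cong zs (λ z → trans (sym (∑-*ˡ zs (ω z))) (∑-cong zs (λ z' → trans (sym (*-assoc _ _ _)) (cong ((ω z * ω z') *_) (Φ-cong {k ℕ.+ (b ℕ.+ (i ℕ.+ i))} {k ℕ.+ (b ℕ.+ (j ℕ.+ j))} {b ℕ.+ (j ℕ.+ (i ℕ.+ k))} {b ℕ.+ (j ℕ.+ (i ℕ.+ k))} (y z) (y z') (exponents k i j))))))) g 0) (offset θ (i ℕ.+ k) g 0)))

      θ-cm : CompletelyMonotone θ
      θ-cm l k = subst (0ℝ ≤_) (diff-cong l (λ k → trans (energy-family (ℤ.+ 1 ∷ []) k) (solve 1 (λ t → (𝟙 :+ K 0) :* ((𝟙 :+ K 0) :* t :+ K 0) :+ K 0 := t) refl (θ k))) k) (energy-cm (family (ℤ.+ 1 ∷ []) 0) l k)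

      -- The surplus κ of the quotient at U = 1 multiplies the energy of the family of g widened by
      -- D. Cauchy-Schwarz for Φ bounds that energy below by its correlation H with an arbitrary
      -- Gaussian w.
      energy-bound : ∀ c p g κ → certify c p g κ ≡ true → 0ℝ ≤ fromℤ κ → ∀ w →
        let D = length (quotient (scale c p) (g ⊛ g)) ℕ.∸ 1
            H = ⟪ (λ i → ∑ zs (λ z → ω z * Φ (lift D (b ℕ.+ (i ℕ.+ i) , y z)) w)) ⟫ g 0 in
        fromℤ κ * (H * H) ≤ fromℤ c * ⟪ θ ⟫ p 0 * Φ w w
      energy-bound c p g κ ok κ≥0 w = ≤-trans (*-mono-≤ˡ (fromℤ κ) κ≥0 (≤-trans (≡⇒≤ (cong (λ t → t * t) (sym (∑-family g 0 (λ u → Φ (lift D u) w))))) (psd-cauchy-schwarz Φ Φ-psd Φ-sym (family g 0) proj₁ (lift D ∘ proj₂) w (Φ-diag w))))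
          (≤-trans (≡⇒≤ (sym (*-assoc _ _ _))) (*-mono-≤ʳ (Φ w w) (0≤Φ w w) (≤-trans (≡⇒≤ (cong (fromℤ κ *_) (energy-family g D))) (certify-sound c p g κ ok θ-cm (λ l k → subst (0ℝ ≤_) (diff-cong l (energy-family g) k) (energy-cm (family g 0) l k))))))
        where
          D = length (quotient (scale c p) (g ⊛ g)) ℕ.∸ 1
          Φ-diag : ∀ w → 0ℝ < Φ w w
          Φ-diag (e , x) = *-pos (0<^ h (0<τ e e)) (E-pos (0≤* (0≤dist x x) (<⇒≤ (0<τ e e))))

 -- A combination f(y) = Σ a exp(-y/2e) of Gaussians, e = b + 1 + i, as a list of (i , k , a):
 -- with V = exp(-y/m) one has exp(-y/2e) = V^(v+k), and V = (p/q) t on the range of interest.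
 module Combination (b v deg m p q h : ℕ) where
  open IntegerPolynomials

  Terms : Set
  Terms = List (ℕ × ℕ × ℤ)

  double : ℕ → ℕ
  double i = suc (b ℕ.+ i) ℕ.+ suc (b ℕ.+ i)

  -- A polynomial in the moment variable U. The factor (2e)^h undoes the normalisation of Φ at equal
  -- widths.
  fourier : Terms → List ℤ
  fourier [] = []
  fourier ((i , k , a) ∷ ts) = monomial i (a ℤ.* ℤ.+ (double i ℕ.^ h)) ⊞ fourier ts

  -- The polynomial in t of -f / V^v, with denominators cleared by q^deg.
  direct : Terms → List ℤ
  direct [] = []
  direct ((i , k , a) ∷ ts) = monomial k (ℤ.- (a ℤ.* ℤ.+ (p ℕ.^ k ℕ.* q ℕ.^ (deg ℕ.∸ k)))) ⊞ direct ts

  total : Terms → ℤ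
  total [] = ℤ.+ 0
  total ((i , k , a) ∷ ts) = a ℤ.+ total ts

  wellformed : Terms → Bool
  wellformed [] = true
  wellformed ((i , k , a) ∷ ts) = (double i ℕ.* (v ℕ.+ k) ℕ.≡ᵇ m) ∧ ((k ℕ.≤ᵇ deg) ∧ wellformed ts)

 -- The sign of the auxiliary function and the resulting bound on energies.

 module CombinationBounds (b v deg m p q h : ℕ) (0<m : 0 ℕ.< m) (0<p : 0 ℕ.< p) (0<q : 0 ℕ.< q) where
  open Field
  open Sums
  open Exponential
  open Combination b v deg m p q h
  open IntegerPolynomials
  open CompleteMonotonicity
  open HeatKernel
  open HeatMoments
  open Codes

  private
    0<fromℕ : ∀ {k} → 0 ℕ.< k → 0ℝ < fromℕ k
    0<fromℕ {suc k} _ = 0<ℕ k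

    fromℕ-^ : ∀ a k → fromℕ (a ℕ.^ k) ≡ fromℕ a ^ k
    fromℕ-^ a zero = +-identityʳ 1ℝ
    fromℕ-^ a (suc k) = trans (fromℕ-* a (a ℕ.^ k)) (cong (fromℕ a *_) (fromℕ-^ a k))

  eval : Terms → ℝ → ℝ
  eval [] y = 0ℝ
  eval ((i , k , a) ∷ ts) y = fromℤ a * E (y * (fromℕ (double i)) ⁻¹) + eval ts y

  eval-0 : ∀ ts → eval ts 0ℝ ≡ fromℤ (total ts)
  eval-0 [] = refl
  eval-0 ((i , k , a) ∷ ts) = trans (cong₂ _+_ (trans (cong (λ t → fromℤ a * E t) (zeroˡ _)) (trans (cong (fromℤ a *_) E0) (*-identityʳ _))) (eval-0 ts)) (sym (fromℤ-+ a (total ts)))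

  -- This is V ≤ p/q, or t ≤ 1, so the sign condition on f becomes a polynomial inequality on the
  -- unit interval.
  Far : ℝ → Set
  Far y = fromℕ q * E (y * (fromℕ m) ⁻¹) ≤ fromℕ p

  private
    wf : ∀ i k a ts → wellformed ((i , k , a) ∷ ts) ≡ true → double i ℕ.* (v ℕ.+ k) ≡ m × k ℕ.≤ deg × wellformed ts ≡ true
    wf i k a ts ok with ∧-split ok
    ... | u , rest with ∧-split rest
    ... | w , ok' = ℕₚ.≡ᵇ⇒≡ _ _ (subst IsTrue (sym u) _) , ℕₚ.≤ᵇ⇒≤ _ _ (subst IsTrue (sym w) _) , ok'

    module _ (y : ℝ) (y≥0 : 0ℝ ≤ y) (far : Far y) where
      V = E (y * (fromℕ m) ⁻¹)
      t = fromℕ q * V * (fromℕ p) ⁻¹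
      0≤y/m : 0ℝ ≤ y * (fromℕ m) ⁻¹
      0≤y/m = 0≤* y≥0 (<⇒≤ (inv-pos (0<fromℕ 0<m)))
      V≥0 : 0ℝ ≤ V
      V≥0 = 0≤E 0≤y/m
      t≥0 : 0ℝ ≤ t
      t≥0 = 0≤* (0≤* (0≤ℕ q) V≥0) (<⇒≤ (inv-pos (0<fromℕ 0<p)))
      t≤1 : t ≤ 1ℝ
      t≤1 = ≤-trans (*-mono-≤ʳ _ (<⇒≤ (inv-pos (0<fromℕ 0<p))) far) (≡⇒≤ (*-inv⁺ (0<fromℕ 0<p)))
      pt : fromℕ p * t ≡ fromℕ q * V
      pt = trans (solve 3 (λ p x i → p :* (x :* i) := x :* (p :* i)) refl (fromℕ p) (fromℕ q * V) ((fromℕ p) ⁻¹)) (trans (cong (fromℕ q * V *_) (*-inv⁺ (0<fromℕ 0<p))) (*-identityʳ _))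

      E-term : ∀ i k → double i ℕ.* (v ℕ.+ k) ≡ m → E (y * (fromℕ (double i)) ⁻¹) ≡ V ^ v * V ^ k
      E-term i k eq = trans (cong E arg) (trans (E-× (v ℕ.+ k) 0≤y/m) (^-+ V v k))
        where
          arg : y * (fromℕ (double i)) ⁻¹ ≡ fromℕ (v ℕ.+ k) * (y * (fromℕ m) ⁻¹)
          arg = trans (cong (y *_) (sym (inv-uniq (0<ℕ (b ℕ.+ i ℕ.+ suc (b ℕ.+ i))) (trans (sym (*-assoc _ _ _)) (trans (cong (_* (fromℕ m) ⁻¹) (trans (sym (fromℕ-* (double i) (v ℕ.+ k))) (cong fromℕ eq))) (*-inv⁺ (0<fromℕ 0<m))))))) (solve 3 (λ y a i → y :* (a :* i) := a :* (y :* i)) refl y (fromℕ (v ℕ.+ k)) ((fromℕ m) ⁻¹))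

      direct-eval : ∀ ts → wellformed ts ≡ true → fromℕ q ^ deg * eval ts y ≡ - (V ^ v * ⟪ (λ i → t ^ i) ⟫ (direct ts) 0)
      direct-eval [] ok = solve 2 (λ a b → a :* K 0 := :- (b :* K 0)) refl (fromℕ q ^ deg) (V ^ v)
      direct-eval ((i , k , a) ∷ ts) ok = let (eq , k≤ , ok') = wf i k a ts ok ; c = p ℕ.^ k ℕ.* q ℕ.^ (deg ℕ.∸ k) in
        trans (distribˡ _ _ _) (trans (cong₂ _+_ (trans (cong (λ u → fromℕ q ^ deg * (fromℤ a * u)) (E-term i k eq)) (trans (solve 4 (λ d a x y → d :* (a :* (x :* y)) := x :* (a :* (d :* y))) refl (fromℕ q ^ deg) (fromℤ a) (V ^ v) (V ^ k)) (cong (λ u → V ^ v * (fromℤ a * u)) (power k k≤)))) (direct-eval ts ok'))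
          (trans (solve 5 (λ w a c x y → w :* (a :* (c :* x)) :+ :- (w :* y) := :- (w :* ((:- (a :* c)) :* x :+ y))) refl (V ^ v) (fromℤ a) (fromℕ c) (t ^ k) _)
            (cong (λ u → - (V ^ v * u)) (sym (trans (⟪⟫-⊞ _ (monomial k (ℤ.- (a ℤ.* ℤ.+ c))) (direct ts) 0) (cong (_+ ⟪ (λ i → t ^ i) ⟫ (direct ts) 0) (trans (⟪⟫-monomial _ k (ℤ.- (a ℤ.* ℤ.+ c)) 0) (cong₂ _*_ (trans (fromℤ-neg (a ℤ.* ℤ.+ c)) (cong -_ (fromℤ-* a (ℤ.+ c)))) (cong (t ^_) (ℕₚ.+-identityʳ k))))))))))
        where
          power : ∀ k → k ℕ.≤ deg → fromℕ q ^ deg * V ^ k ≡ fromℕ (p ℕ.^ k ℕ.* q ℕ.^ (deg ℕ.∸ k)) * t ^ k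
          power k k≤ = trans (cong (λ j → fromℕ q ^ j * V ^ k) (sym (ℕₚ.m+[n∸m]≡n k≤))) (trans (cong (_* V ^ k) (^-+ (fromℕ q) k (deg ℕ.∸ k))) (trans (solve 3 (λ x y z → x :* y :* z := (x :* z) :* y) refl _ _ _)
             (trans (cong (_* fromℕ q ^ (deg ℕ.∸ k)) (trans (sym (*-^ (fromℕ q) V k)) (trans (cong (_^ k) (sym pt)) (*-^ (fromℕ p) t k))))
               (trans (solve 3 (λ x y z → (x :* y) :* z := (x :* z) :* y) refl _ _ _) (cong (_* t ^ k) (sym (trans (fromℕ-* (p ℕ.^ k) _) (cong₂ _*_ (fromℕ-^ p k) (fromℕ-^ q (deg ℕ.∸ k))))))))))

  eval≤0 : ∀ ts c g → wellformed ts ≡ true → certify c (direct ts) g (ℤ.+ 0) ≡ true → 0ℝ < fromℤ c → ∀ y → 0ℝ ≤ y → Far y → eval ts y ≤ 0ℝ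
  eval≤0 ts c g ok cert c>0 y y≥0 far = *-cancel-≤ˡ (fromℕ q ^ deg) (0<^ deg (0<fromℕ 0<q)) (≤-trans (≡⇒≤ (direct-eval y y≥0 far ts ok))
      (≤-trans (neg-mono-≤ (0≤* (0≤^ v (V≥0 y y≥0 far)) (0≤-cancelˡ (fromℤ c) c>0 (certify-unit-interval c (direct ts) g cert (t≥0 y y≥0 far) (t≤1 y y≥0 far))))) (≡⇒≤ (solve 1 (λ x → :- K 0 := x :* K 0) refl (fromℕ q ^ deg)))))

  module Density (n : ℕ) (n≡h+h : n ≡ h ℕ.+ h) (d : Fin n → ℝ) (d>0 : ∀ i → 0ℝ < d i) where
    open Kernel n h n≡h+h d d>0
    open Moments n h n≡h+h d d>0
    open GaussSum
    open GaussIntegral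

    module _ {A : Set} (zs : List A) (ω : A → ℝ) (y : A → Fin n → ℝ) where
      open Weighted b zs ω y

      -- At equal widths e, Φ is (2e)^(-h) exp(-dist/2e), so the weights in `fourier` reproduce
      -- exactly the terms of f.
      θ-eval : ∀ ts → ⟪ θ ⟫ (fourier ts) 0 ≡ ∑ zs (λ z → ∑ zs (λ z' → (ω z * ω z') * eval ts (dist (y z) (y z'))))
      θ-eval [] = sym (trans (∑-cong zs (λ z → trans (∑-cong zs (λ z' → zeroʳ _)) (∑-zero zs))) (∑-zero zs))
      θ-eval ((i , k , a) ∷ ts) = trans (⟪⟫-⊞ θ (monomial i A') (fourier ts) 0) (trans (cong₂ _+_ (trans (⟪⟫-monomial θ i A' 0) (trans (cong₂ _*_ (trans (fromℤ-* a (ℤ.+ (double i ℕ.^ h))) (cong (fromℤ a *_) (fromℕ-^ (double i) h))) (cong θ (ℕₚ.+-identityʳ i))) spread)) (θ-eval ts))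
           (trans (sym (∑-+ zs)) (∑-cong zs (λ z → trans (sym (∑-+ zs)) (∑-cong zs (λ z' → sym (distribˡ _ _ _)))))))
        where
          A' = a ℤ.* ℤ.+ (double i ℕ.^ h)
          T′ = (fromℕ (double i)) ⁻¹
          unit′ : fromℕ (double i) ^ h * T′ ^ h ≡ 1ℝ
          unit′ = trans (sym (*-^ (fromℕ (double i)) T′ h)) (trans (cong (_^ h) (*-inv⁺ (0<ℕ (b ℕ.+ i ℕ.+ suc (b ℕ.+ i))))) (1^ h))
          spread : fromℤ a * fromℕ (double i) ^ h * θ i ≡ ∑ zs (λ z → ∑ zs (λ z' → (ω z * ω z') * (fromℤ a * E (dist (y z) (y z') * T′))))
          spread = trans (sym (∑-*ˡ zs _)) (∑-cong zs (λ z → trans (sym (∑-*ˡ zs _)) (∑-cong zs (λ z' → trans (solve 5 (λ a x w t e → a :* x :* (w :* (t :* e)) := w :* (a :* e) :* (x :* t)) refl (fromℤ a) (fromℕ (double i) ^ h) (ω z * ω z') (T′ ^ h) (E (dist (y z) (y z') * T′))) (trans (cong ((ω z * ω z') * (fromℤ a * E (dist (y z) (y z') * T′)) *_) unit′) (*-identityʳ _))))))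

      -- The half of the Cohn-Elkies argument in direct space: f is nonpositive at far pairs, so
      -- only the diagonal terms f(0) ω² survive.
      θ≤ : ∀ ts c g → wellformed ts ≡ true → certify c (direct ts) g (ℤ.+ 0) ≡ true → 0ℝ < fromℤ c → (∀ z → 0ℝ ≤ ω z) → AllPairs (λ z z' → Far (dist (y z) (y z'))) zs →
        ⟪ θ ⟫ (fourier ts) 0 ≤ fromℤ (total ts) * ∑ zs (λ z → ω z * ω z)
      θ≤ ts c g ok cert c>0 ω≥0 far = ≤-trans (≡⇒≤ (θ-eval ts)) (≤-trans (offdiag zs (λ z z' → (ω z * ω z') * eval ts (dist (y z) (y z'))) (AllPairs.map (λ {z} {z'} f → neg z z' f , neg z' z (subst Far (dist-sym (y z) (y z')) f)) far))
           (≡⇒≤ (trans (∑-cong zs (λ z → trans (cong (λ t → (ω z * ω z) * eval ts t) (dist-0 (y z))) (trans (cong ((ω z * ω z) *_) (eval-0 ts)) (*-comm _ _)))) (∑-*ˡ zs _))))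
        where
          neg : ∀ z z' → Far (dist (y z) (y z')) → (ω z * ω z') * eval ts (dist (y z) (y z')) ≤ 0ℝ
          neg z z' f = ≤-trans (*-mono-≤ˡ _ (0≤* (ω≥0 z) (ω≥0 z')) (eval≤0 ts c g ok cert c>0 _ (0≤dist _ _) f)) (≡⇒≤ (zeroʳ _))

 -- The linear programming density bound by Gaussian averaging.

 module GaussianDensity (b v deg m p q h : ℕ) (0<m : 0 ℕ.< m) (0<p : 0 ℕ.< p) (0<q : 0 ℕ.< q)
                       (n : ℕ) (n≡h+h : n ≡ h ℕ.+ h) (d : Fin n → RealField.Carrier R) (d>0 : ∀ i → RealField._<_ R (RealField.0ℝ R) (d i)) where
  open Field
  open Sums
  open Exponential
  open Combination b v deg m p q h
  open IntegerPolynomials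
  open CompleteMonotonicity
  open HeatKernel
  open HeatMoments
  open GaussSum
  open GaussIntegral
  open CombinationBounds b v deg m p q h 0<m 0<p 0<q
  open Density n n≡h+h d d>0
  open Kernel n h n≡h+h d d>0
  open Moments n h n≡h+h d d>0

  ⟶-⟪⟫ : ∀ g k {s : ℕ → ℕ → ℝ} {l : ℕ → ℝ} → (∀ i → i ℕ.< k ℕ.+ length g → s i ⟶ l i) → (λ N → ⟪ (λ i → s i N) ⟫ g k) ⟶ ⟪ l ⟫ g k
  ⟶-⟪⟫ [] k h = ⟶-const 0ℝ
  ⟶-⟪⟫ (a ∷ g) k h = ⟶-+ (⟶-*ˡ (fromℤ a) (h k (ℕₚ.m<m+n k (ℕ.s≤s ℕ.z≤n)))) (⟶-⟪⟫ g (suc k) (λ i lt → h i (ℕₚ.≤-trans lt (ℕₚ.≤-reflexive (sym (ℕₚ.+-suc k (length g)))))))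

  ⟶-squeeze : ∀ {s x u l} → s ⟶ l → u ⟶ l → (∀ N → s N ≤ x N) → (∀ N → x N ≤ u N) → x ⟶ l
  ⟶-squeeze {s} {x} {u} {l} (C , C≥0 , f) (D , D≥0 , g) lo hi = C + D , 0≤+ C≥0 D≥0 , λ N →
      ≤-trans (hi N) (≤-trans (proj₁ (g N)) (≤-by (C * ν′ N) (0≤* C≥0 (<⇒≤ (0<ν′ N))) (solve 4 (λ l c d v → l :+ (c :+ d) :* v := l :+ d :* v :+ c :* v) refl l C D (ν′ N)))) ,
      ≤-trans (proj₂ (f N)) (≤-trans (+-mono-≤ʳ _ (lo N)) (≤-by (D * ν′ N) (0≤* D≥0 (<⇒≤ (0<ν′ N))) (solve 4 (λ l c d v → l :+ (c :+ d) :* v := l :+ c :* v :+ d :* v) refl (x N) C D (ν′ N))))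

  ⟶-subsequence : ∀ a {s l} → s ⟶ l → (λ N → s (N ℕ.+ a)) ⟶ l
  ⟶-subsequence a {s} {l} (C , C≥0 , f) = C , C≥0 , λ N → ≤-trans (proj₁ (f (N ℕ.+ a))) (+-mono-≤ (≤-refl {l}) (small N)) , ≤-trans (proj₂ (f (N ℕ.+ a))) (+-mono-≤ (≤-refl {s (N ℕ.+ a)}) (small N))
    where
      small : ∀ N → C * ν′ (N ℕ.+ a) ≤ C * ν′ N
      small N = *-mono-≤ˡ C C≥0 (inv-mono (0<ℕ N) (fromℕ-mono-≤ (ℕ.s≤s (ℕₚ.m≤m+n N a))))

  ⟶-^ : ∀ k {s l} → (∀ N → 0ℝ ≤ s N) → 0ℝ ≤ l → s ⟶ l → (λ N → s N ^ k) ⟶ l ^ k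
  ⟶-^ k {s} {l} s≥0 l≥0 f = subst ((λ N → s N ^ k) ⟶_) (Π-const k l) (⟶-cong (λ N → Π-const k (s N)) (⟶-Π k (λ _ → s≥0) (λ _ → l≥0) (λ _ → f)))

  -- The end points of the cell [z, z + 1] nearest to 0 and farthest from it.
  near far : ℤ → ℝ
  near (ℤ.+ k) = fromℕ k
  near -[1+ k ] = - fromℕ k
  far (ℤ.+ k) = fromℕ (suc k)
  far -[1+ k ] = - fromℕ (suc k)

  InUnitCell : ℝ → ℤ → Set
  InUnitCell x z = fromℤ z ≤ x × x ≤ fromℤ z + 1ℝ

  private
    neg-suc : ∀ k → - fromℕ (suc k) + 1ℝ ≡ - fromℕ k
    neg-suc k = solve 1 (λ k → :- (𝟙 :+ k) :+ 𝟙 := :- k) refl (fromℕ k)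

  near-cell : ∀ z → InUnitCell (near z) z
  near-cell (ℤ.+ k) = ≤-refl , ≤-by 1ℝ 0≤1 refl
  near-cell -[1+ k ] = ≤-by 1ℝ 0≤1 (sym (neg-suc k)) , ≡⇒≤ (sym (neg-suc k))

  far-cell : ∀ z → InUnitCell (far z) z
  far-cell (ℤ.+ k) = ≤-by 1ℝ 0≤1 (+-comm _ _) , ≡⇒≤ (+-comm _ _)
  far-cell -[1+ k ] = ≤-refl , ≤-by 1ℝ 0≤1 refl

  near-far : ∀ z {x} → InUnitCell x z → near z * near z ≤ x * x × x * x ≤ far z * far z
  near-far (ℤ.+ k) {x} (lo , hi) = *-mono-≤ (0≤ℕ k) x≥0 lo lo , *-mono-≤ x≥0 (0≤ℕ (suc k)) hi' hi'
    where
      x≥0 = ≤-trans (0≤ℕ k) lo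
      hi' : x ≤ fromℕ (suc k)
      hi' = ≤-trans hi (≡⇒≤ (+-comm _ _))
  near-far -[1+ k ] {x} (lo , hi) = subst₂ _≤_ (sq (fromℕ k)) (sq′ x) (*-mono-≤ (0≤ℕ k) -x≥0 k≤ k≤) , subst₂ _≤_ (sq′ x) (sq (fromℕ (suc k))) (*-mono-≤ -x≥0 (0≤ℕ (suc k)) ≤k ≤k)
    where
      sq : ∀ x → x * x ≡ - x * - x
      sq x = solve 1 (λ x → x :* x := :- x :* :- x) refl x
      sq′ : ∀ x → - x * - x ≡ x * x
      sq′ x = sym (sq x)
      k≤ : fromℕ k ≤ - x
      k≤ = ≤-trans (≡⇒≤ (sym (-‿involutive _))) (neg-mono-≤ (≤-trans hi (≡⇒≤ (neg-suc k))))
      -x≥0 = ≤-trans (0≤ℕ k) k≤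
      ≤k : - x ≤ fromℕ (suc k)
      ≤k = ≤-trans (neg-mono-≤ lo) (≡⇒≤ (-‿involutive _))

  gaussian-grid : ∀ {a} → 0ℝ < a → (c : ℤ → ℝ) → (∀ z → InUnitCell (c z) z) → (W : ℕ → ℕ) → (∀ N → suc N ℕ.* suc N ℕ.< W N) →
    (λ N → ν′ N * ∑ (win (W N) (W N)) (λ z → E (a * ((c z * ν′ N) * (c z * ν′ N))))) ⟶ G a
  gaussian-grid {a} a>0 c cell W big = G-riemann a>0 _ (λ p N → W N , W N , (λ z → c z * ν′ N) , (λ z → *-mono-≤ʳ (ν′ N) (<⇒≤ (0<ν′ N)) (proj₁ (cell z)) , *-mono-≤ʳ (ν′ N) (<⇒≤ (0<ν′ N)) (proj₂ (cell z))) , big N , big N , refl)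

  L : ℝ
  L = Π n (λ i → G (d i * fromℕ 2))

  L>0 : 0ℝ < L
  L>0 = 0<Π n (λ i → G-pos (*-pos (d>0 i) (0<ℕ 1)))

  module _ (y : (Fin n → ℤ) → Fin n → ℝ) (y-cell : ∀ k i → InUnitCell (y k i) (k i)) (A : ℕ) where

    -- Sized for the step 1/(N + A + 1), since sums with widths shifted by up to A are compared on
    -- the same grid.
    K′ : ℕ → ℕ
    K′ N = suc (suc (N ℕ.+ A) ℕ.* suc (N ℕ.+ A))

    grid : ℕ → List (Fin n → ℤ)
    grid N = box n (win (K′ N) (K′ N))

    α : ℕ → ℝ
    α N = ν′ N * ν′ N

    α>0 : ∀ N → 0ℝ < α N
    α>0 N = *-pos (0<ν′ N) (0<ν′ N)

    0⃗ : Fin n → ℝ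
    0⃗ _ = 0ℝ

    private
      2d>0 : ∀ i → 0ℝ < d i * fromℕ 2
      2d>0 i = *-pos (d>0 i) (0<ℕ 1)

      ΣE : ℕ → ℝ → ℝ
      ΣE N σ = ∑ (grid N) (λ k → E (dist (y k) 0⃗ * σ))

      axis : (ℤ → ℝ) → ℕ → ℕ → Fin n → ℝ
      axis c N M i = ν′ M * ∑ (win (K′ N) (K′ N)) (λ z → E (d i * fromℕ 2 * ((c z * ν′ M) * (c z * ν′ M))))

      cells : (ℤ → ℝ) → ℕ → ℕ → ℝ
      cells c N M = Π n (axis c N M)

      cells-box : ∀ c N M → cells c N M ≡ ν′ M ^ n * ∑ (grid N) (λ k → Π n (λ i → E (d i * fromℕ 2 * ((c (k i) * ν′ M) * (c (k i) * ν′ M)))))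
      cells-box c N M = trans (Π-* n {λ _ → ν′ M} {λ i → ∑ (win (K′ N) (K′ N)) (λ z → E (d i * fromℕ 2 * ((c z * ν′ M) * (c z * ν′ M))))}) (cong₂ _*_ (Π-const n (ν′ M)) (sym (∑-box n (win (K′ N) (K′ N)) (λ i z → E (d i * fromℕ 2 * ((c z * ν′ M) * (c z * ν′ M)))))))

      0≤dy² : ∀ i t → 0ℝ ≤ d i * (t * t)
      0≤dy² i t = 0≤* (<⇒≤ (d>0 i)) (0≤sq t)

      -- Each point is replaced by the corner of its cell nearest to 0, where the Gaussian is
      -- larger; `below` uses the farthest corner. Both corner sums factor over the axes.
      above : ∀ N M σ → 0ℝ ≤ σ → fromℕ 2 * α M ≤ σ → ν′ M ^ n * ΣE N σ ≤ cells near N M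
      above N M σ σ≥0 le = ≤-trans (*-mono-≤ˡ _ (0≤^ n (<⇒≤ (0<ν′ M))) (∑-mono (grid N) (λ k → ≤-trans (≡⇒≤ (E-dist (y k) 0⃗ σ≥0)) (Π-mono n (λ i → 0≤E (0≤* (0≤dy² i (y k i - 0ℝ)) σ≥0)) (λ i → E-mono (0≤* (<⇒≤ (2d>0 i)) (0≤sq _)) (term k i))))))
                            (≡⇒≤ (sym (cells-box near N M)))
        where
          term : ∀ k i → d i * fromℕ 2 * ((near (k i) * ν′ M) * (near (k i) * ν′ M)) ≤ d i * ((y k i - 0ℝ) * (y k i - 0ℝ)) * σ
          term k i = ≤-trans (≡⇒≤ (solve 3 (λ d c v → d :* K 2 :* ((c :* v) :* (c :* v)) := d :* (c :* c) :* (K 2 :* (v :* v))) refl (d i) (near (k i)) (ν′ M)))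
             (*-mono-≤ (0≤dy² i (near (k i))) σ≥0 (*-mono-≤ˡ (d i) (<⇒≤ (d>0 i)) (≤-trans (proj₁ (near-far (k i) (y-cell k i))) (≡⇒≤ (solve 1 (λ y → y :* y := (y :- K 0) :* (y :- K 0)) refl (y k i))))) le)

      below : ∀ N σ → 0ℝ ≤ σ → σ ≤ fromℕ 2 * α N → cells far N N ≤ ν′ N ^ n * ΣE N σ
      below N σ σ≥0 le = ≤-trans (≡⇒≤ (cells-box far N N)) (*-mono-≤ˡ _ (0≤^ n (<⇒≤ (0<ν′ N))) (∑-mono (grid N) (λ k → ≤-trans (Π-mono n (λ i → 0≤E (0≤* (<⇒≤ (2d>0 i)) (0≤sq _))) (λ i → E-mono (0≤* (0≤dy² i (y k i - 0ℝ)) σ≥0) (term k i))) (≡⇒≤ (sym (E-dist (y k) 0⃗ σ≥0))))))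
        where
          term : ∀ k i → d i * ((y k i - 0ℝ) * (y k i - 0ℝ)) * σ ≤ d i * fromℕ 2 * ((far (k i) * ν′ N) * (far (k i) * ν′ N))
          term k i = ≤-trans (*-mono-≤ (0≤dy² i (y k i - 0ℝ)) (0≤* (0≤ℕ 2) (<⇒≤ (α>0 N))) (*-mono-≤ˡ (d i) (<⇒≤ (d>0 i)) (≤-trans (≡⇒≤ (solve 1 (λ y → (y :- K 0) :* (y :- K 0) := y :* y) refl (y k i))) (proj₂ (near-far (k i) (y-cell k i))))) le)
             (≡⇒≤ (solve 3 (λ d c v → d :* (c :* c) :* (K 2 :* (v :* v)) := d :* K 2 :* ((c :* v) :* (c :* v))) refl (d i) (far (k i)) (ν′ N)))

      cells≥0 : ∀ c N M i → 0ℝ ≤ axis c N M i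
      cells≥0 c N M i = 0≤* (<⇒≤ (0<ν′ M)) (0≤∑ (win (K′ N) (K′ N)) (λ z → 0≤E (0≤* (<⇒≤ (2d>0 i)) (0≤sq _))))

      0≤cells : ∀ c N M → 0ℝ ≤ cells c N M
      0≤cells c N M = 0≤Π n {axis c N M} (cells≥0 c N M)

      big : ∀ a → a ℕ.≤ A → ∀ N → suc (N) ℕ.* suc N ℕ.< K′ (N ℕ.∸ a)
      big a a≤A N = ℕ.s≤s (ℕₚ.*-mono-≤ (ℕ.s≤s le) (ℕ.s≤s le))
        where
          le : N ℕ.≤ N ℕ.∸ a ℕ.+ A
          le = ℕₚ.≤-trans (ℕₚ.m≤n+m∸n N a) (ℕₚ.≤-trans (ℕₚ.≤-reflexive (ℕₚ.+-comm a (N ℕ.∸ a))) (ℕₚ.+-monoʳ-≤ (N ℕ.∸ a) a≤A))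

      cells-limit : ∀ c → (∀ z → InUnitCell (c z) z) → ∀ a → a ℕ.≤ A → (λ N → cells c N (N ℕ.+ a)) ⟶ L
      cells-limit c cell a a≤A = ⟶-cong {λ N → cells c (N ℕ.+ a ℕ.∸ a) (N ℕ.+ a)} {λ N → cells c N (N ℕ.+ a)} (λ N → cong (λ M → cells c M (N ℕ.+ a)) (ℕₚ.m+n∸n≡m N a))
        (⟶-subsequence a {λ N → cells c (N ℕ.∸ a) N} (⟶-Π n {λ i N → axis c (N ℕ.∸ a) N i} (λ i N → cells≥0 c (N ℕ.∸ a) N i) (λ i → <⇒≤ (G-pos (2d>0 i))) (λ i → gaussian-grid (2d>0 i) c cell (λ N → K′ (N ℕ.∸ a)) (big a a≤A))))

      cells-limit₀ : ∀ c → (∀ z → InUnitCell (c z) z) → (λ N → cells c N N) ⟶ L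
      cells-limit₀ c cell = ⟶-cong (λ N → cong (cells c N) (ℕₚ.+-identityʳ N)) (cells-limit c cell 0 ℕ.z≤n)

    private
     -- The widths (N + 1)² + a and (N + 1)² differ by a bounded amount, so their ratio ρ tends to 1
     -- and the normalised sums have a limit independent of a.
     module Shifted (a : ℕ) (a≤A : a ℕ.≤ A) where
      R′ : ℕ → ℕ
      R′ N = a ℕ.+ suc N ℕ.* suc N
      τ′ : ℕ → ℝ
      τ′ N = (fromℕ (R′ N)) ⁻¹
      n′ : ℕ → ℝ
      n′ N = fromℕ (suc N)
      nv : ∀ N → n′ N * ν′ N ≡ 1ℝ
      nv N = *-inv⁺ (0<ℕ N)
      0<R′ : ∀ N → 0ℝ < fromℕ (R′ N)
      0<R′ N = <-≤-trans (0<ℕ (N ℕ.+ N ℕ.* suc N)) (fromℕ-mono-≤ (ℕₚ.m≤n+m (suc N ℕ.* suc N) a))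
      0<τ′ : ∀ N → 0ℝ < τ′ N
      0<τ′ N = inv-pos (0<R′ N)
      α-inv : ∀ N → α N ≡ (fromℕ (suc N ℕ.* suc N)) ⁻¹
      α-inv N = sym (trans (cong _⁻¹ (fromℕ-* (suc N) (suc N))) (inv-* (0<ℕ N) (0<ℕ N)))
      τ≤α : ∀ N → τ′ N ≤ α N
      τ≤α N = ≤-trans (inv-mono (0<ℕ (N ℕ.+ N ℕ.* suc N)) (fromℕ-mono-≤ (ℕₚ.m≤n+m (suc N ℕ.* suc N) a))) (≡⇒≤ (sym (α-inv N)))
      grow : ∀ N → R′ N ℕ.≤ suc (N ℕ.+ a) ℕ.* suc (N ℕ.+ a)
      grow N = ℕₚ.≤-trans (ℕₚ.≤-trans (ℕₚ.≤-reflexive (ℕₚ.+-comm a (suc N ℕ.* suc N))) (ℕₚ.+-monoʳ-≤ (suc N ℕ.* suc N) (ℕₚ.m≤m+n a ((N ℕ.+ N ℕ.+ 1) ℕ.* a ℕ.+ a ℕ.* a))))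
         (ℕₚ.≤-reflexive (S.solve 2 (λ N a → (S.con 1 S.:+ N) S.:* (S.con 1 S.:+ N) S.:+ (a S.:+ ((N S.:+ N S.:+ S.con 1) S.:* a S.:+ a S.:* a)) S.:= (S.con 1 S.:+ (N S.:+ a)) S.:* (S.con 1 S.:+ (N S.:+ a))) refl N a))
        where module S = Data.Nat.Solver.+-*-Solver
      αa≤τ : ∀ N → α (N ℕ.+ a) ≤ τ′ N
      αa≤τ N = ≤-trans (≡⇒≤ (α-inv (N ℕ.+ a))) (inv-mono (0<R′ N) (fromℕ-mono-≤ (grow N)))
      αa≤α : ∀ N → α (N ℕ.+ a) ≤ α N
      αa≤α N = ≤-trans (αa≤τ N) (τ≤α N)
      ρ : ℕ → ℝ
      ρ N = n′ N * n′ N * τ′ N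
      α-cancel : ∀ N → n′ N * n′ N * α N ≡ 1ℝ
      α-cancel N = trans (solve 2 (λ n v → n :* n :* (v :* v) := (n :* v) :* (n :* v)) refl (n′ N) (ν′ N)) (trans (cong₂ _*_ (nv N) (nv N)) (*-identityʳ 1ℝ))
      ρ≥0 : ∀ N → 0ℝ ≤ ρ N
      ρ≥0 N = 0≤* (0≤sq (n′ N)) (<⇒≤ (0<τ′ N))
      ρ≤1 : ∀ N → ρ N ≤ 1ℝ
      ρ≤1 N = ≤-trans (*-mono-≤ˡ _ (0≤sq (n′ N)) (τ≤α N)) (≡⇒≤ (α-cancel N))
      1-ρ : ∀ N → 1ℝ ≤ ρ N + fromℕ a * ν′ N
      1-ρ N = ≤-trans (≡⇒≤ (sym (trans (+-comm _ _) (trans (sym (distribʳ (τ′ N) (fromℕ a) (n′ N * n′ N))) (trans (cong (_* τ′ N) (trans (cong (fromℕ a +_) (sym (fromℕ-* (suc N) (suc N)))) (sym (fromℕ-+ a _)))) (*-inv⁺ (0<R′ N)))))))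
            (+-mono-≤ (≤-refl {ρ N}) (*-mono-≤ˡ (fromℕ a) (0≤ℕ a) (≤-trans (τ≤α N) (≤-trans (*-mono-≤ˡ (ν′ N) (<⇒≤ (0<ν′ N)) (ν′≤1 N)) (≡⇒≤ (*-identityʳ _))))))
      ρ→1 : ρ ⟶ 1ℝ
      ρ→1 = fromℕ a , 0≤ℕ a , λ N → ≤-trans (ρ≤1 N) (≤-by (fromℕ a * ν′ N) (0≤* (0≤ℕ a) (<⇒≤ (0<ν′ N))) refl) , 1-ρ N
      ς : ℕ → ℝ
      ς N = 1ℝ + fromℕ a * ν′ N
      ς≥0 : ∀ N → 0ℝ ≤ ς N
      ς≥0 N = 0≤+ 0≤1 (0≤* (0≤ℕ a) (<⇒≤ (0<ν′ N)))
      ς→1 : ς ⟶ 1ℝ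
      ς→1 = fromℕ a , 0≤ℕ a , λ N → ≤-refl , ≤-by (fromℕ a * ν′ N + fromℕ a * ν′ N) (0≤+ (0≤* (0≤ℕ a) (<⇒≤ (0<ν′ N))) (0≤* (0≤ℕ a) (<⇒≤ (0<ν′ N)))) (+-assoc _ _ _)
      ςν : ∀ N → ς N * ν′ (N ℕ.+ a) ≡ ν′ N
      ςν N = trans (cong (λ t → (t + fromℕ a * ν′ N) * ν′ (N ℕ.+ a)) (sym (nv N))) (trans (solve 4 (λ n a v w → (n :* v :+ a :* v) :* w := v :* ((n :+ a) :* w)) refl (n′ N) (fromℕ a) (ν′ N) (ν′ (N ℕ.+ a))) (trans (cong (λ t → ν′ N * (t * ν′ (N ℕ.+ a))) (sym (fromℕ-+ (suc N) a))) (trans (cong (ν′ N *_) (nv (N ℕ.+ a))) (*-identityʳ _))))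
      x : ℕ → ℝ
      x N = ρ N ^ h * (ν′ N ^ n * ΣE N (α N + τ′ N))
      x→L : x ⟶ L
      x→L = ⟶-squeeze {λ N → ρ N ^ h * cells far N N} {x} {λ N → ς N ^ n * cells near N (N ℕ.+ a)}
          (subst ((λ N → ρ N ^ h * cells far N N) ⟶_) (trans (cong (_* L) (1^ h)) (*-identityˡ L)) (⟶-* {λ N → ρ N ^ h} {λ N → cells far N N} (λ N → 0≤^ h (ρ≥0 N)) (λ N → 0≤cells far N N) (0≤^ h 0≤1) (<⇒≤ L>0) (⟶-^ h ρ≥0 0≤1 ρ→1) (cells-limit₀ far far-cell)))
          (subst ((λ N → ς N ^ n * cells near N (N ℕ.+ a)) ⟶_) (trans (cong (_* L) (1^ n)) (*-identityˡ L)) (⟶-* {λ N → ς N ^ n} {λ N → cells near N (N ℕ.+ a)} (λ N → 0≤^ n (ς≥0 N)) (λ N → 0≤cells near N (N ℕ.+ a)) (0≤^ n 0≤1) (<⇒≤ L>0) (⟶-^ n ς≥0 0≤1 ς→1) (cells-limit near near-cell a a≤A)))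
          (λ N → *-mono-≤ˡ _ (0≤^ h (ρ≥0 N)) (below N (α N + τ′ N) (σ≥0 N) (≤-trans (+-mono-≤ (≤-refl {α N}) (τ≤α N)) (≡⇒≤ (solve 1 (λ a → a :+ a := K 2 :* a) refl (α N))))))
          (λ N → ≤-trans (*-mono-≤ʳ _ (0≤* (0≤^ n (<⇒≤ (0<ν′ N))) (ΣE≥0 N)) (^≤1 h (ρ≥0 N) (ρ≤1 N))) (≤-trans (≡⇒≤ (trans (*-identityˡ _) (trans (cong (_* ΣE N (α N + τ′ N)) (trans (cong (_^ n) (sym (ςν N))) (*-^ (ς N) (ν′ (N ℕ.+ a)) n))) (*-assoc _ _ _))))
                  (*-mono-≤ˡ _ (0≤^ n (ς≥0 N)) (above N (N ℕ.+ a) (α N + τ′ N) (σ≥0 N) (≤-trans (≡⇒≤ (solve 1 (λ a → K 2 :* a := a :+ a) refl (α (N ℕ.+ a)))) (+-mono-≤ (αa≤α N) (αa≤τ N)))))))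
        where
          σ≥0 : ∀ N → 0ℝ ≤ α N + τ′ N
          σ≥0 N = 0≤+ (<⇒≤ (α>0 N)) (<⇒≤ (0<τ′ N))
          ΣE≥0 : ∀ N → 0ℝ ≤ ΣE N (α N + τ′ N)
          ΣE≥0 N = 0≤∑ (grid N) (λ k → 0≤E (0≤* (0≤dist (y k) 0⃗) (σ≥0 N)))

    -- A Gaussian cutoff whose width grows with N; it replaces counting points in a large ball.
    ω : ℕ → (Fin n → ℤ) → ℝ
    ω N k = E (dist (y k) 0⃗ * α N)

    ω≥0 : ∀ N k → 0ℝ ≤ ω N k
    ω≥0 N k = 0≤E (0≤* (0≤dist (y k) 0⃗) (<⇒≤ (α>0 N)))

    -- The test Gaussian matches the cutoff `ω N`: its width is (N + 1)², stored as the predecessor.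
    wide : ℕ → Point
    wide N = N ℕ.+ N ℕ.* suc N , 0⃗

    correlation : ℕ → ℕ → ℝ
    correlation e N = ∑ (grid N) (λ k → ω N k * Φ (e , y k) (wide N))

    correlation→L : ∀ e → suc e ℕ.≤ A → correlation e ⟶ L
    correlation→L e e<A = ⟶-cong (λ N → sym (eq N)) x→L
      where
        open Shifted (suc e) e<A
        eq : ∀ N → correlation e N ≡ x N
        eq N = trans (∑-cong (grid N) (λ k → trans (solve 3 (λ w t e → w :* (t :* e) := t :* (w :* e)) refl (ω N k) (τ′ N ^ h) (E (dist (y k) 0⃗ * τ′ N))) (cong (τ′ N ^ h *_) (trans (sym (E-+ (0≤* (0≤dist (y k) 0⃗) (<⇒≤ (α>0 N))) (0≤* (0≤dist (y k) 0⃗) (<⇒≤ (0<τ′ N))))) (cong E (sym (distribˡ (dist (y k) 0⃗) (α N) (τ′ N))))))))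
              (trans (∑-*ˡ (grid N) (τ′ N ^ h)) (trans (cong (_* ΣE N (α N + τ′ N)) coeff) (*-assoc _ _ _)))
          where
            coeff : τ′ N ^ h ≡ ρ N ^ h * ν′ N ^ n
            coeff = sym (trans (cong (λ t → ρ N ^ h * ν′ N ^ t) n≡h+h) (trans (cong (ρ N ^ h *_) (trans (^-+ (ν′ N) h h) (sym (*-^ (ν′ N) (ν′ N) h)))) (trans (sym (*-^ (ρ N) (α N) h)) (cong (_^ h) (trans (solve 3 (λ m t a → m :* t :* a := (m :* a) :* t) refl (n′ N * n′ N) (τ′ N) (α N)) (trans (cong (_* τ′ N) (α-cancel N)) (*-identityˡ _)))))))

    mass : ℕ → ℝ
    mass N = ν′ N ^ n * ∑ (grid N) (λ k → ω N k * ω N k)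

    mass≤ : ∀ N → mass N ≤ cells near N N
    mass≤ N = ≤-trans (≡⇒≤ (cong (ν′ N ^ n *_) (∑-cong (grid N) (λ k → trans (sym (E-+ (0≤* (0≤dist (y k) 0⃗) (<⇒≤ (α>0 N))) (0≤* (0≤dist (y k) 0⃗) (<⇒≤ (α>0 N))))) (cong E (sym (distribˡ (dist (y k) 0⃗) (α N) (α N))))))))
                (above N N (α N + α N) (0≤+ (<⇒≤ (α>0 N)) (<⇒≤ (α>0 N))) (≡⇒≤ (solve 1 (λ a → K 2 :* a := a :+ a) refl (α N))))

    Φ-wide : ∀ N → fromℕ 2 ^ h * Φ (wide N) (wide N) ≡ ν′ N ^ n
    Φ-wide N = trans (cong (λ t → fromℕ 2 ^ h * (T′ ^ h * E (t * T′))) (dist-0 0⃗)) (trans (cong (λ t → fromℕ 2 ^ h * (T′ ^ h * t)) (trans (cong E (zeroˡ T′)) E0)) (trans (cong (fromℕ 2 ^ h *_) (*-identityʳ _)) (trans (sym (*-^ (fromℕ 2) T′ h)) (trans (cong (_^ h) 2T) (trans (*-^ (ν′ N) (ν′ N) h) (trans (sym (^-+ (ν′ N) h h)) (cong (ν′ N ^_) (sym n≡h+h))))))))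
      where
        M = suc N ℕ.* suc N
        T′ = (fromℕ (M ℕ.+ M)) ⁻¹
        2T : fromℕ 2 * T′ ≡ ν′ N * ν′ N
        2T = trans (inv-uniq (0<ℕ (N ℕ.+ N ℕ.* suc N)) (trans (solve 2 (λ m t → m :* (K 2 :* t) := (m :+ m) :* t) refl (fromℕ M) T′) (trans (cong (_* T′) (sym (fromℕ-+ M M))) (*-inv⁺ (0<ℕ (N ℕ.+ N ℕ.* suc N ℕ.+ M)))))) (trans (cong _⁻¹ (fromℕ-* (suc N) (suc N))) (inv-* (0<ℕ N) (0<ℕ N)))

    -- The bound of κ H² by the energy of θ, from `energy-bound`, meets the bound of that energy by
    -- f(0) times the sum of ω², from `θ≤`. After multiplication by 2^h, H tends to γ L, the mass is
    -- bounded by sums tending to L, and 2^h L = 𝒢.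
    density : ∀ ts c g κ g′ → wellformed ts ≡ true → certify c (direct ts) g′ (ℤ.+ 0) ≡ true → certify c (fourier ts) g κ ≡ true →
      0ℝ < fromℤ c → 0ℝ ≤ fromℤ κ → 0ℝ ≤ fromℤ (total ts) →
      length (quotient (scale c (fourier ts)) (g ⊛ g)) ℕ.∸ 1 ℕ.+ (b ℕ.+ (length g ℕ.+ length g)) ℕ.≤ A →
      (∀ N → AllPairs (λ k k' → Far (dist (y k) (y k'))) (grid N)) →
      fromℤ κ * (⟪ (λ _ → 1ℝ) ⟫ g 0 * ⟪ (λ _ → 1ℝ) ⟫ g 0) * 𝒢 ≤ fromℤ c * fromℤ (total ts)
    density ts c g κ g′ wf cert′ cert c>0 κ≥0 tot≥0 D≤A farpairs = *-cancel-≤ˡ L L>0 (≤-trans (≡⇒≤ rearrange) (≤-trans (⟶-≤ lhs rhs ineq) (≡⇒≤ (*-comm _ L))))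
      where
        D = length (quotient (scale c (fourier ts)) (g ⊛ g)) ℕ.∸ 1
        γ = ⟪ (λ _ → 1ℝ) ⟫ g 0
        F = fromℤ c * fromℤ (total ts)
        F≥0 = 0≤* (<⇒≤ c>0) tot≥0
        two = fromℕ 2 ^ h
        H : ℕ → ℝ
        H N = ⟪ (λ i → correlation (D ℕ.+ (b ℕ.+ (i ℕ.+ i))) N) ⟫ g 0
        Mean = γ * L
        H→ : H ⟶ Mean
        H→ = subst (H ⟶_) (trans (⟪⟫-cong (λ i → sym (*-identityʳ L)) g 0) (trans (⟪⟫-*ˡ L (λ _ → 1ℝ) g 0) (*-comm L γ))) (⟶-⟪⟫ g 0 (λ i i< → correlation→L (D ℕ.+ (b ℕ.+ (i ℕ.+ i))) (ℕₚ.≤-trans (le i i<) D≤A)))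
          where
            le : ∀ i → i ℕ.< length g → suc (D ℕ.+ (b ℕ.+ (i ℕ.+ i))) ℕ.≤ D ℕ.+ (b ℕ.+ (length g ℕ.+ length g))
            le i i< = ℕₚ.≤-trans (ℕₚ.≤-reflexive (trans (sym (ℕₚ.+-suc D _)) (cong (D ℕ.+_) (sym (ℕₚ.+-suc b (i ℕ.+ i)))))) (ℕₚ.+-monoʳ-≤ D (ℕₚ.+-monoʳ-≤ b (ℕₚ.+-mono-≤ i< (ℕₚ.<⇒≤ i<))))
        -- H² is bounded below by its tangent at the limit.
        lhs : (λ N → two * fromℤ κ * (fromℕ 2 * Mean) * H N + two * fromℤ κ * (- (Mean * Mean))) ⟶ two * fromℤ κ * (fromℕ 2 * Mean) * Mean + two * fromℤ κ * (- (Mean * Mean))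
        lhs = ⟶-+ (⟶-*ˡ (two * fromℤ κ * (fromℕ 2 * Mean)) H→) (⟶-const _)
        rhs : (λ N → F * cells near N N) ⟶ F * L
        rhs = ⟶-*ˡ F (cells-limit₀ near near-cell)
        ineq : ∀ N → two * fromℤ κ * (fromℕ 2 * Mean) * H N + two * fromℤ κ * (- (Mean * Mean)) ≤ F * cells near N N
        ineq N = ≤-trans (≤-by (two * fromℤ κ * ((H N - Mean) * (H N - Mean))) (0≤* (0≤* (0≤^ h (0≤ℕ 2)) κ≥0) (0≤sq _)) (solve 4 (λ t k m h → t :* (k :* (h :* h)) := t :* k :* (K 2 :* m) :* h :+ t :* k :* (:- (m :* m)) :+ t :* k :* ((h :- m) :* (h :- m))) refl two (fromℤ κ) Mean (H N)))
           (≤-trans (*-mono-≤ˡ two (0≤^ h (0≤ℕ 2)) (≤-trans (energy-bound c (fourier ts) g κ cert κ≥0 (wide N)) (*-mono-≤ʳ _ (0≤Φ (wide N) (wide N)) (*-mono-≤ˡ (fromℤ c) (<⇒≤ c>0) (θ≤ (grid N) (ω N) y ts c g′ wf cert′ c>0 (ω≥0 N) (farpairs N))))))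
             (≤-trans (≡⇒≤ (trans (solve 5 (λ t c f s w → t :* (c :* (f :* s) :* w) := c :* f :* ((t :* w) :* s)) refl two (fromℤ c) (fromℤ (total ts)) (∑ (grid N) (λ k → ω N k * ω N k)) (Φ (wide N) (wide N))) (cong (λ t → F * (t * ∑ (grid N) (λ k → ω N k * ω N k))) (Φ-wide N)))) (*-mono-≤ˡ F F≥0 (mass≤ N))))
          where
            open Weighted b (grid N) (ω N) y
        rearrange : L * (fromℤ κ * (γ * γ) * 𝒢) ≡ two * fromℤ κ * (fromℕ 2 * Mean) * Mean + two * fromℤ κ * (- (Mean * Mean))
        rearrange = trans (cong (λ t → L * (fromℤ κ * (γ * γ) * t)) (sym (𝒢-scale (0<ℕ 1)))) (solve 4 (λ l k g t → l :* (k :* (g :* g) :* (l :* t)) := t :* k :* (K 2 :* (g :* l)) :* (g :* l) :+ t :* k :* (:- ((g :* l) :* (g :* l)))) refl L (fromℤ κ) γ two)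

 -- One point of Λ, and one of Λ*, for each unit cell of a Gram-Schmidt frame.

 module LatticePoints where
  open Lattice

  private
    Σ-cong : ∀ k {f g : Fin k → ℝ} → (∀ i → f i ≡ g i) → Σ[ k ] f ≡ Σ[ k ] g
    Σ-cong zero p = refl
    Σ-cong (suc k) p = cong₂ _+_ (p zero) (Σ-cong k (p ∘ suc))

    Σ-- : ∀ k {f g : Fin k → ℝ} → Σ[ k ] (λ i → f i - g i) ≡ Σ[ k ] f - Σ[ k ] g
    Σ-- zero = solve 0 (K 0 := K 0 :- K 0) refl
    Σ-- (suc k) {f} {g} = trans (cong (f zero - g zero +_) (Σ-- k)) (solve 4 (λ a b x y → a :- b :+ (x :- y) := a :+ x :- (b :+ y)) refl (f zero) (g zero) _ _)

    0≤Σ : ∀ k {f : Fin k → ℝ} → (∀ i → 0ℝ ≤ f i) → 0ℝ ≤ Σ[ k ] f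
    0≤Σ zero p = ≤-refl
    0≤Σ (suc k) p = 0≤+ (p zero) (0≤Σ k (p ∘ suc))

    term≤Σ : ∀ k {f : Fin k → ℝ} → (∀ i → 0ℝ ≤ f i) → ∀ i → f i ≤ Σ[ k ] f
    term≤Σ (suc k) {f} p zero = ≤-by (Σ[ k ] (f ∘ suc)) (0≤Σ k (p ∘ suc)) refl
    term≤Σ (suc k) {f} p (suc i) = ≤-trans (term≤Σ k (p ∘ suc) i) (≤-by (f zero) (p zero) (+-comm _ _))

  integer-+ : ∀ {x y} → IsInteger x → IsInteger y → IsInteger (x + y)
  integer-+ (a , refl) (b , refl) = a ℤ.+ b , sym (fromℤ-+ a b)

  integer-neg : ∀ {x} → IsInteger x → IsInteger (- x)
  integer-neg (a , refl) = ℤ.- a , sym (fromℤ-neg a)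

  integer-*ℤ : ∀ c {x} → IsInteger x → IsInteger (fromℤ c * x)
  integer-*ℤ c (a , refl) = c ℤ.* a , sym (fromℤ-* c a)

  -- the floor of x; being an integer is only provable under a double negation
  private
    Below : ℝ → ℝ → Set
    Below x w = (w ≤ x - 1ℝ) ⊎ (∃ λ z → w ≡ fromℤ z × w ≤ x)

    below-bound : ∀ x w → Below x w → w ≤ x
    below-bound x w (inj₁ p) = ≤-trans p (≤-by 1ℝ 0≤1 (solve 1 (λ x → x := x :- 𝟙 :+ 𝟙) refl x))
    below-bound x w (inj₂ (_ , _ , p)) = p

    greatest : ∀ x → ¬ ¬ (∃ λ z → fromℤ z ≤ x × x < fromℤ z + 1ℝ)
    greatest x = archimedes x >>= λ { (U , xU) → archimedes (- x) >>= λ { (B , xB) → pure (search B (U ℕ.+ B) (lower B xB) (subst (λ t → x < t) (sym (trans (cong (_- fromℕ B) (fromℕ-+ U B)) (solve 2 (λ u b → u :+ b :- b := u) refl (fromℕ U) (fromℕ B)))) xU)) } }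
      where
        lower : ∀ B → - x < fromℕ B → - fromℕ B ≤ x
        lower B p = ≤-trans (neg-mono-≤ (<⇒≤ p)) (≡⇒≤ (-‿involutive x))
        search : ∀ B M → - fromℕ B ≤ x → x < fromℕ M - fromℕ B → ∃ λ z → fromℤ z ≤ x × x < fromℤ z + 1ℝ
        search B zero lo hi = ⊥-elim (lo (subst (x <_) (+-identityˡ _) hi))
        search B (suc M) lo hi with (fromℕ M - fromℕ B) ≤? x
        ... | inj₂ q = search B M lo q
        ... | inj₁ q = ℤ.+ M ℤ.- ℤ.+ B , subst (_≤ x) (sym val) q , subst (x <_) (trans (solve 2 (λ m b → 𝟙 :+ m :- b := m :- b :+ 𝟙) refl (fromℕ M) (fromℕ B)) (cong (_+ 1ℝ) (sym val))) hi
          where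
            val : fromℤ (ℤ.+ M ℤ.- ℤ.+ B) ≡ fromℕ M - fromℕ B
            val = trans (fromℤ-+ (ℤ.+ M) (ℤ.- ℤ.+ B)) (cong (fromℕ M +_) (fromℤ-neg (ℤ.+ B)))

  abstract
    floor : ℝ → ℝ
    -- The first alternative of `Below` makes the set inhabited without exhibiting an integer below
    -- x.
    floor x = proj₁ (lub (Below x) (x - 1ℝ , inj₁ ≤-refl) (x , below-bound x))

    floor-spec : ∀ x → ¬ ¬ (∃ λ z → floor x ≡ fromℤ z × fromℤ z ≤ x × x < fromℤ z + 1ℝ)
    floor-spec x = greatest x >>= λ { (z , lo , hi) → pure (z , ≤-antisym (proj₂ (proj₂ S) (fromℤ z) (upper z hi)) (proj₁ (proj₂ S) (fromℤ z) (inj₂ (z , refl , lo))) , lo , hi) }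
      where
        S : ∃ λ u → (∀ w → Below x w → ¬ (u < w)) × (∀ c → (∀ w → Below x w → ¬ (c < w)) → ¬ (c < u))
        S = lub (Below x) (x - 1ℝ , inj₁ ≤-refl) (x , below-bound x)
        upper : ∀ z → x < fromℤ z + 1ℝ → ∀ w → Below x w → w ≤ fromℤ z
        upper z hi w (inj₁ p) = ≤-trans p (<⇒≤ (subst (x - 1ℝ <_) (solve 1 (λ z → z :+ 𝟙 :- 𝟙 := z) refl (fromℤ z)) (+-mono-< (- 1ℝ) hi)))
        upper z hi w (inj₂ (z' , refl , p)) = fromℤ-mono-≤ (ℤₚ.≤-trans (ℤₚ.i<j⇒i≤pred[j] (fromℤ-cancel-< {z'} {z ℤ.+ ℤ.+ 1} (≤-<-trans p (subst (x <_) (sym (trans (fromℤ-+ z (ℤ.+ 1)) (cong (fromℤ z +_) (+-identityʳ 1ℝ)))) hi)))) (ℤₚ.≤-reflexive (trans (cong ℤ.pred (ℤₚ.+-comm z (ℤ.+ 1))) (ℤₚ.pred-suc z))))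

  floor-integer : ∀ x → ¬ ¬ IsInteger (floor x)
  floor-integer x = floor-spec x >>= λ { (z , e , _) → pure (z , e) }

  floor≤ : ∀ x → floor x ≤ x
  floor≤ x = ≤-stable (floor-spec x >>= λ { (z , e , lo , _) → pure (≤-trans (≡⇒≤ e) lo) })

  <floor+1 : ∀ x → x < floor x + 1ℝ
  <floor+1 x with compare x (floor x + 1ℝ)
  ... | tri< p _ _ = p
  ... | tri≈ p _ _ = ⊥-elim (floor-spec x (λ { (z , e , _ , hi) → p (subst (λ t → x < t + 1ℝ) (sym e) hi) }))
  ... | tri> p _ _ = ⊥-elim (floor-spec x (λ { (z , e , _ , hi) → p (subst (λ t → x < t + 1ℝ) (sym e) hi) }))

  -- The point of the coset o + ℤ in the half-open cell (t, t + 1].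
  place : ℝ → ℤ → ℝ
  place o t = floor (fromℤ t + 1ℝ - o) + o

  place≤ : ∀ o t → place o t ≤ fromℤ t + 1ℝ
  place≤ o t = ≤-trans (+-mono-≤ʳ o (floor≤ _)) (≡⇒≤ (solve 2 (λ x o → x :- o :+ o := x) refl (fromℤ t + 1ℝ) o))

  <place : ∀ o t → fromℤ t < place o t
  <place o t = 0<⇒< (subst (0ℝ <_) (solve 3 (λ t o f → f :+ 𝟙 :- (t :+ 𝟙 :- o) := f :+ o :- t) refl (fromℤ t) o (floor (fromℤ t + 1ℝ - o))) (<⇒0< (<floor+1 (fromℤ t + 1ℝ - o))))

  private
    disjoint : ∀ {s t x} → ¬ (s ≡ t) → fromℤ s < x → x ≤ fromℤ s + 1ℝ → fromℤ t < x → x ≤ fromℤ t + 1ℝ → ⊥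
    disjoint {s} {t} ne ps ps' pt pt' with ℤₚ.<-cmp s t
    ... | tri≈ _ e _ = ne e
    ... | tri< lt _ _ = ≤-trans ps' (≤-trans (≡⇒≤ (trans (+-comm _ _) (sym (trans (fromℤ-+ (ℤ.+ 1) s) (cong (_+ fromℤ s) (+-identityʳ 1ℝ)))))) (fromℤ-mono-≤ (ℤₚ.i<j⇒suc[i]≤j lt))) pt
    ... | tri> _ _ gt = ≤-trans pt' (≤-trans (≡⇒≤ (trans (+-comm _ _) (sym (trans (fromℤ-+ (ℤ.+ 1) t) (cong (_+ fromℤ t) (+-identityʳ 1ℝ)))))) (fromℤ-mono-≤ (ℤₚ.i<j⇒suc[i]≤j gt))) ps

  module _ {n : ℕ} where

    combination : ∀ {k} → (Fin k → Vec n) → (Fin k → ℝ) → Vec n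
    combination {k} b c j = Σ[ k ] (λ i → c i * b i j)

    combination-· : ∀ {k} (b : Fin k → Vec n) c w → combination b c · w ≡ Σ[ k ] (λ i → c i * (b i · w))
    combination-· {zero} b c w = 𝟎-· w
    combination-· {suc k} b c w = trans (⊕-· (c zero ⊙ b zero) (combination (b ∘ suc) (c ∘ suc)) w) (cong₂ _+_ (⊙-· (c zero) (b zero) w) (combination-· (b ∘ suc) (c ∘ suc) w))

    Independent : ∀ {k} → (Fin k → Vec n) → Set
    Independent {k} b = ∀ c → (∀ j → combination b c j ≡ 0ℝ) → ∀ i → c i ≡ 0ℝ

    -- one step of Gram–Schmidt
    slope : ∀ {k} → (Fin (suc k) → Vec n) → Fin k → ℝ
    slope b j = (b (suc j) · b zero) * (norm (b zero)) ⁻¹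

    rest : ∀ {k} → (Fin (suc k) → Vec n) → Fin k → Vec n
    rest b j = b (suc j) ⊖ slope b j ⊙ b zero

    -- Squared lengths of the Gram-Schmidt vectors; `triangular` gives the coordinates of a
    -- combination in their frame.
    gram : ∀ {k} → (Fin k → Vec n) → Fin k → ℝ
    gram b zero = norm (b zero)
    gram b (suc i) = gram (rest b) i

    triangular : ∀ {k} → (Fin k → Vec n) → (Fin k → ℝ) → Fin k → ℝ
    triangular {suc k} b c zero = c zero + Σ[ k ] (λ j → slope b j * c (suc j))
    triangular b c (suc i) = triangular (rest b) (c ∘ suc) i

    private
      split : ∀ {k} (b : Fin (suc k) → Vec n) c j → combination b c j ≡ triangular b c zero * b zero j + combination (rest b) (c ∘ suc) j
      split {k} b c j = trans (cong (c zero * b zero j +_) (go k (slope b) (c ∘ suc) (λ i → b (suc i) j) (b zero j))) (solve 4 (λ c u s r → c :* u :+ (s :* u :+ r) := (c :+ s) :* u :+ r) refl (c zero) (b zero j) _ _)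
        where
          go : ∀ k (μ c x : Fin k → ℝ) u → Σ[ k ] (λ i → c i * x i) ≡ Σ[ k ] (λ i → μ i * c i) * u + Σ[ k ] (λ i → c i * (x i - μ i * u))
          go zero μ c x u = solve 1 (λ u → K 0 := K 0 :* u :+ K 0) refl u
          go (suc k) μ c x u = trans (cong (c zero * x zero +_) (go k (μ ∘ suc) (c ∘ suc) (x ∘ suc) u)) (solve 6 (λ c x m u s r → c :* x :+ (s :* u :+ r) := (m :* c :+ s) :* u :+ (c :* (x :- m :* u) :+ r)) refl (c zero) (x zero) (μ zero) u _ _)

      b₀>0 : ∀ {k} (b : Fin (suc k) → Vec n) → Independent b → 0ℝ < norm (b zero)
      b₀>0 {k} b ind = norm-pos (b zero) (λ z → 0≢1 (sym (ind e (λ j → trans (cong (1ℝ * b zero j +_) (Σ-zero k (λ i → zeroˡ _))) (trans (+-identityʳ _) (trans (*-identityˡ _) (z j)))) zero)))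
        where
          e : Fin (suc k) → ℝ
          e zero = 1ℝ
          e (suc _) = 0ℝ

      rest-independent : ∀ {k} (b : Fin (suc k) → Vec n) → Independent b → Independent (rest b)
      rest-independent {k} b ind c z i = ind c' (λ j → trans (split b c' j) (trans (cong₂ _+_ (trans (cong (_* b zero j) (solve 1 (λ s → :- s :+ s := K 0) refl s)) (zeroˡ _)) (z j)) (+-identityˡ 0ℝ))) (suc i)
        where
          s = Σ[ k ] (λ j → slope b j * c j)
          c' : Fin (suc k) → ℝ
          c' zero = - s
          c' (suc i) = c i

      slope-norm : ∀ {k} (b : Fin (suc k) → Vec n) → Independent b → ∀ j → slope b j * norm (b zero) ≡ b (suc j) · b zero
      slope-norm b ind j = trans (*-assoc _ _ _) (trans (cong ((b (suc j) · b zero) *_) (trans (*-comm _ _) (*-inv⁺ (b₀>0 b ind)))) (*-identityʳ _))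

      orthogonal : ∀ {k} (b : Fin (suc k) → Vec n) → Independent b → ∀ j → rest b j · b zero ≡ 0ℝ
      orthogonal b ind j = trans (⊖-· (b (suc j)) (slope b j ⊙ b zero) (b zero)) (trans (cong (λ t → (b (suc j) · b zero) - t) (trans (⊙-· (slope b j) (b zero) (b zero)) (slope-norm b ind j))) (-‿inverseʳ _))

    gram>0 : ∀ {k} (b : Fin k → Vec n) → Independent b → ∀ i → 0ℝ < gram b i
    gram>0 b ind zero = b₀>0 b ind
    gram>0 b ind (suc i) = gram>0 (rest b) (rest-independent b ind) i

    private
      pythagoras : ∀ (u v : Vec n) a → v · u ≡ 0ℝ → norm (a ⊙ u ⊕ v) ≡ norm u * (a * a) + norm v
      pythagoras u v a vu = trans (⊕-· (a ⊙ u) v (a ⊙ u ⊕ v)) (trans (cong₂ _+_ (trans (⊙-· a u (a ⊙ u ⊕ v)) (cong (a *_) (trans (·-comm u (a ⊙ u ⊕ v)) (trans (⊕-· (a ⊙ u) v u) (cong₂ _+_ (⊙-· a u u) vu)))))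
           (trans (·-comm v (a ⊙ u ⊕ v)) (trans (⊕-· (a ⊙ u) v v) (cong (_+ norm v) (trans (⊙-· a u v) (cong (a *_) (trans (·-comm u v) vu)))))))
           (solve 3 (λ a n v → a :* (a :* n :+ K 0) :+ (a :* K 0 :+ v) := n :* (a :* a) :+ v) refl a (norm u) (norm v)))

    norm-combination : ∀ {k} (b : Fin k → Vec n) → Independent b → ∀ c → norm (combination b c) ≡ Σ[ k ] (λ i → gram b i * (triangular b c i * triangular b c i))
    norm-combination {zero} b ind c = 𝟎-· _
    norm-combination {suc k} b ind c = trans (·-cong (split b c) (split b c)) (trans (pythagoras (b zero) (combination (rest b) (c ∘ suc)) (triangular b c zero) perp) (cong (norm (b zero) * (triangular b c zero * triangular b c zero) +_) (norm-combination (rest b) (rest-independent b ind) (c ∘ suc))))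
      where
        perp : combination (rest b) (c ∘ suc) · b zero ≡ 0ℝ
        perp = trans (combination-· (rest b) (c ∘ suc) (b zero)) (Σ-zero k (λ i → trans (cong (c (suc i) *_) (orthogonal b ind i)) (zeroʳ _)))

    triangular-- : ∀ {k} (b : Fin k → Vec n) c c' i → triangular b (λ j → c j - c' j) i ≡ triangular b c i - triangular b c' i
    triangular-- {suc k} b c c' zero = trans (cong (c zero - c' zero +_) (trans (Σ-cong k (λ j → solve 3 (λ s x y → s :* (x :- y) := s :* x :- s :* y) refl (slope b j) (c (suc j)) (c' (suc j)))) (Σ-- k))) (solve 4 (λ a b x y → a :- b :+ (x :- y) := a :+ x :- (b :+ y)) refl (c zero) (c' zero) _ _)
    triangular-- b c c' (suc i) = triangular-- (rest b) (c ∘ suc) (c' ∘ suc) i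

    -- integer coefficients of the lattice point whose triangular coordinates lie in the cell t
    coefficients : ∀ {k} → (Fin k → Vec n) → (Fin k → ℤ) → Fin k → ℝ
    coefficients {suc k} b t zero = floor (fromℤ (t zero) + 1ℝ - Σ[ k ] (λ j → slope b j * coefficients (rest b) (t ∘ suc) j))
    coefficients b t (suc j) = coefficients (rest b) (t ∘ suc) j

    coefficients-integer : ∀ {k} (b : Fin k → Vec n) t i → ¬ ¬ IsInteger (coefficients b t i)
    coefficients-integer b t zero = floor-integer _
    coefficients-integer b t (suc i) = coefficients-integer (rest b) (t ∘ suc) i

    primal : ∀ {k} → (Fin k → Vec n) → (Fin k → ℤ) → Fin k → ℝ
    primal b t = triangular b (coefficients b t)

    -- A coordinate involves its own coefficient with factor 1 and otherwise later ones only.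
    -- Choosing the coefficients from the last to the first puts each coordinate into its cell.
    primal-cell : ∀ {k} (b : Fin k → Vec n) t i → fromℤ (t i) < primal b t i × primal b t i ≤ fromℤ (t i) + 1ℝ
    primal-cell {suc k} b t zero = <place (Σ[ k ] (λ j → slope b j * coefficients (rest b) (t ∘ suc) j)) (t zero) , place≤ (Σ[ k ] (λ j → slope b j * coefficients (rest b) (t ∘ suc) j)) (t zero)
    primal-cell b t (suc i) = primal-cell (rest b) (t ∘ suc) i

    -- for the dual lattice: the vector w with GS coordinates η, and the coordinates in the cell t for
    -- which all b_j · w + o_j are integers
    dualVector : ∀ {k} → (Fin k → Vec n) → (Fin k → ℝ) → Vec n
    dualVector {zero} b η = 𝟎
    dualVector {suc k} b η = (η zero * (norm (b zero)) ⁻¹) ⊙ b zero ⊕ dualVector (rest b) (η ∘ suc)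

    dual : ∀ {k} → (Fin k → Vec n) → (Fin k → ℝ) → (Fin k → ℤ) → Fin k → ℝ
    dual b o t zero = place (- o zero) (t zero)
    dual b o t (suc i) = dual (rest b) (λ j → o (suc j) + slope b j * place (- o zero) (t zero)) (t ∘ suc) i

    dual-cell : ∀ {k} (b : Fin k → Vec n) o t i → fromℤ (t i) < dual b o t i × dual b o t i ≤ fromℤ (t i) + 1ℝ
    dual-cell b o t zero = <place (- o zero) (t zero) , place≤ (- o zero) (t zero)
    dual-cell b o t (suc i) = dual-cell (rest b) _ (t ∘ suc) i

    private
      dualVector-⊥ : ∀ {k} (b : Fin k → Vec n) η u → (∀ j → b j · u ≡ 0ℝ) → dualVector b η · u ≡ 0ℝ
      dualVector-⊥ {zero} b η u p = 𝟎-· u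
      dualVector-⊥ {suc k} b η u p = trans (⊕-· ((η zero * (norm (b zero)) ⁻¹) ⊙ b zero) (dualVector (rest b) (η ∘ suc)) u) (trans (cong₂ _+_ (trans (⊙-· (η zero * (norm (b zero)) ⁻¹) (b zero) u) (trans (cong (_ *_) (p zero)) (zeroʳ _)))
          (dualVector-⊥ (rest b) (η ∘ suc) u (λ j → trans (⊖-· (b (suc j)) (slope b j ⊙ b zero) u) (trans (cong₂ _-_ (p (suc j)) (trans (⊙-· (slope b j) (b zero) u) (trans (cong (_ *_) (p zero)) (zeroʳ _)))) (-‿inverseʳ 0ℝ))))) (+-identityˡ 0ℝ))

      b₀·dual : ∀ {k} (b : Fin (suc k) → Vec n) → Independent b → ∀ η → b zero · dualVector b η ≡ η zero
      b₀·dual b ind η = trans (·-comm (b zero) (dualVector b η)) (trans (⊕-· ((η zero * (norm (b zero)) ⁻¹) ⊙ b zero) (dualVector (rest b) (η ∘ suc)) (b zero)) (trans (cong₂ _+_ (trans (⊙-· (η zero * (norm (b zero)) ⁻¹) (b zero) (b zero)) (trans (*-assoc _ _ _) (trans (cong (η zero *_) (trans (*-comm _ _) (*-inv⁺ (b₀>0 b ind)))) (*-identityʳ _)))) (dualVector-⊥ (rest b) (η ∘ suc) (b zero) (orthogonal b ind))) (+-identityʳ _)))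

      bⱼ·dual : ∀ {k} (b : Fin (suc k) → Vec n) → Independent b → ∀ η j → b (suc j) · dualVector b η ≡ slope b j * η zero + rest b j · dualVector (rest b) (η ∘ suc)
      bⱼ·dual b ind η j = trans (solve 2 (λ x y → x := y :+ (x :- y)) refl (b (suc j) · w) (slope b j * η zero)) (cong (slope b j * η zero +_) (sym eq))
        where
          w = dualVector b η
          w' = dualVector (rest b) (η ∘ suc)
          perp : rest b j · w ≡ rest b j · w'
          perp = trans (·-comm (rest b j) w) (trans (⊕-· ((η zero * (norm (b zero)) ⁻¹) ⊙ b zero) w' (rest b j)) (trans (cong (_+ (w' · rest b j)) (trans (⊙-· (η zero * (norm (b zero)) ⁻¹) (b zero) (rest b j)) (trans (cong (_ *_) (trans (·-comm (b zero) (rest b j)) (orthogonal b ind j))) (zeroʳ _)))) (trans (+-identityˡ _) (·-comm w' (rest b j)))))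
          eq : rest b j · w' ≡ b (suc j) · w - slope b j * η zero
          eq = trans (sym perp) (trans (⊖-· (b (suc j)) (slope b j ⊙ b zero) w) (cong (λ t → b (suc j) · w - t) (trans (⊙-· (slope b j) (b zero) w) (cong (slope b j *_) (b₀·dual b ind η)))))

    -- The dual frame is triangular in the opposite order: b_j · w involves the coordinates up to j.
    -- They are fixed from the first to the last, and the offset o carries the part already fixed.
    dual-integer : ∀ {k} (b : Fin k → Vec n) → Independent b → ∀ o t j → ¬ ¬ IsInteger (b j · dualVector b (dual b o t) + o j)
    dual-integer b ind o t zero = floor-integer (fromℤ (t zero) + 1ℝ - (- o zero)) >>= λ i → pure (subst IsInteger (sym (trans (cong (_+ o zero) (b₀·dual b ind (dual b o t))) (solve 2 (λ f o → f :+ (:- o) :+ o := f) refl (floor (fromℤ (t zero) + 1ℝ - (- o zero))) (o zero)))) i)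
    dual-integer b ind o t (suc j) = dual-integer (rest b) (rest-independent b ind) (λ j → o (suc j) + slope b j * place (- o zero) (t zero)) (t ∘ suc) j >>= λ i → pure (subst IsInteger (sym (trans (cong (_+ o (suc j)) (bⱼ·dual b ind (dual b o t) j)) (solve 3 (λ s x o → s :+ x :+ o := x :+ (o :+ s)) refl (slope b j * dual b o t zero) _ (o (suc j))))) i)

    norm-dualVector : ∀ {k} (b : Fin k → Vec n) → Independent b → ∀ η → norm (dualVector b η) ≡ Σ[ k ] (λ i → (gram b i) ⁻¹ * (η i * η i))
    norm-dualVector {zero} b ind η = 𝟎-· 𝟎
    norm-dualVector {suc k} b ind η = trans (pythagoras (b zero) (dualVector (rest b) (η ∘ suc)) (η zero * i₀) (dualVector-⊥ (rest b) (η ∘ suc) (b zero) (orthogonal b ind)))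
        (cong₂ _+_ (trans (solve 3 (λ n e i → n :* (e :* i :* (e :* i)) := (n :* i) :* (i :* (e :* e))) refl (norm (b zero)) (η zero) i₀) (trans (cong (_* (i₀ * (η zero * η zero))) (*-inv⁺ (b₀>0 b ind))) (*-identityˡ _))) (norm-dualVector (rest b) (rest-independent b ind) (η ∘ suc)))
      where i₀ = (norm (b zero)) ⁻¹

    dualVector-- : ∀ {k} (b : Fin k → Vec n) η η' j → dualVector b (λ i → η i - η' i) j ≡ dualVector b η j - dualVector b η' j
    dualVector-- {zero} b η η' j = solve 0 (K 0 := K 0 :- K 0) refl
    dualVector-- {suc k} b η η' j = trans (cong (((η zero - η' zero) * (norm (b zero)) ⁻¹) * b zero j +_) (dualVector-- (rest b) (η ∘ suc) (η' ∘ suc) j)) (solve 6 (λ a b i u x y → (a :- b) :* i :* u :+ (x :- y) := a :* i :* u :+ x :- (b :* i :* u :+ y)) refl (η zero) (η' zero) ((norm (b zero)) ⁻¹) (b zero j) _ _)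

    private
      positive-sum : ∀ {k} (w x : Fin k → ℝ) → (∀ i → 0ℝ < w i) → ∀ i → ¬ (x i ≡ 0ℝ) → 0ℝ < Σ[ k ] (λ i → w i * (x i * x i))
      positive-sum {k} w x w>0 i ne = <-≤-trans (*-pos (w>0 i) sq>0) (term≤Σ k (λ i → 0≤* (<⇒≤ (w>0 i)) (0≤sq (x i))) i)
        where
          sq>0 : 0ℝ < x i * x i
          sq>0 with compare 0ℝ (x i)
          ... | tri< p _ _ = *-pos p p
          ... | tri≈ _ e _ = ⊥-elim (ne (sym e))
          ... | tri> _ _ p = subst (0ℝ <_) (solve 1 (λ x → :- x :* :- x := x :* x) refl (x i)) (*-pos p' p')
            where p' = subst (0ℝ <_) (+-identityˡ (- x i)) (<⇒0< p)

    -- The two lattice points differ because their i-th coordinates lie in disjoint half-open cells.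
    -- Integrality of the coefficients is doubly negated, which the inequality tolerates.
    primal-separated : ∀ (b : Fin n → Vec n) → Independent b → ∀ m → (∀ v → InLattice b v → NonZero v → m ≤ normᵈ v) →
      ∀ t t' i → ¬ (t i ≡ t' i) → m ≤ Σ[ n ] (λ i → gram b i * ((primal b t i - primal b t' i) * (primal b t i - primal b t' i)))
    primal-separated b ind m minimal t t' i ne = ≤-stable (¬¬∀Fin n (coefficients-integer b t) >>= λ z → ¬¬∀Fin n (coefficients-integer b t') >>= λ z' → pure (go z z'))
      where
        c : Fin n → ℝ
        c j = coefficients b t j - coefficients b t' j
        v = combination b c
        normv : norm v ≡ Σ[ n ] (λ i → gram b i * ((primal b t i - primal b t' i) * (primal b t i - primal b t' i)))
        normv = trans (norm-combination b ind c) (Σ-cong n (λ i → cong (λ x → gram b i * (x * x)) (triangular-- b (coefficients b t) (coefficients b t') i)))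
        apart : ¬ (primal b t i - primal b t' i ≡ 0ℝ)
        apart e = let (l , u) = primal-cell b t i ; (l' , u') = primal-cell b t' i ; eq = trans (solve 2 (λ x y → x := (x :- y) :+ y) refl (primal b t i) (primal b t' i)) (trans (cong (_+ primal b t' i) e) (+-identityˡ _)) in
                    disjoint {t i} {t' i} ne l u (subst (fromℤ (t' i) <_) (sym eq) l') (subst (_≤ fromℤ (t' i) + 1ℝ) (sym eq) u')
        go : (∀ j → IsInteger (coefficients b t j)) → (∀ j → IsInteger (coefficients b t' j)) → m ≤ _
        go z z' = ≤-trans (minimal v ((λ j → proj₁ (int j)) , λ j → Σ-cong n (λ i → cong (_* b i j) (proj₂ (int i)))) (⊙-NonZero (subst (0ℝ <_) (sym normv) (positive-sum (gram b) _ (gram>0 b ind) i apart)))) (≡⇒≤ (trans (sym (·-def v v)) normv))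
          where
            int : ∀ j → IsInteger (c j)
            int j = integer-+ (z j) (integer-neg (z' j))

    dual-separated : ∀ (b : Fin n → Vec n) → Independent b → ∀ m → (∀ v → InDual b v → NonZero v → m ≤ normᵈ v) →
      ∀ t t' i → ¬ (t i ≡ t' i) → let η = dual b (λ _ → 0ℝ) in m ≤ Σ[ n ] (λ i → (gram b i) ⁻¹ * ((η t i - η t' i) * (η t i - η t' i)))
    dual-separated b ind m minimal t t' i ne = ≤-stable (¬¬∀Fin n (dual-integer b ind (λ _ → 0ℝ) t) >>= λ z → ¬¬∀Fin n (dual-integer b ind (λ _ → 0ℝ) t') >>= λ z' → pure (go z z'))
      where
        η = dual b (λ _ → 0ℝ)
        v = dualVector b (λ i → η t i - η t' i)
        normv : norm v ≡ Σ[ n ] (λ i → (gram b i) ⁻¹ * ((η t i - η t' i) * (η t i - η t' i)))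
        normv = norm-dualVector b ind (λ i → η t i - η t' i)
        apart : ¬ (η t i - η t' i ≡ 0ℝ)
        apart e = let (l , u) = dual-cell b (λ _ → 0ℝ) t i ; (l' , u') = dual-cell b (λ _ → 0ℝ) t' i ; eq = trans (solve 2 (λ x y → x := (x :- y) :+ y) refl (η t i) (η t' i)) (trans (cong (_+ η t' i) e) (+-identityˡ _)) in
                    disjoint {t i} {t' i} ne l u (subst (fromℤ (t' i) <_) (sym eq) l') (subst (_≤ fromℤ (t' i) + 1ℝ) (sym eq) u')
        go : (∀ j → IsInteger (b j · dualVector b (η t) + 0ℝ)) → (∀ j → IsInteger (b j · dualVector b (η t') + 0ℝ)) → m ≤ _
        go z z' = ≤-trans (minimal v inDual (⊙-NonZero (subst (0ℝ <_) (sym normv) (positive-sum (λ i → (gram b i) ⁻¹) _ (λ i → inv-pos (gram>0 b ind i)) i apart)))) (≡⇒≤ (trans (sym (·-def v v)) normv))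
          where
            int : ∀ j → IsInteger (b j · v)
            int j = subst IsInteger (sym (trans (·-cong {u = b j} (λ _ → refl) (dualVector-- b (η t) (η t'))) (trans (·-⊖ (b j) (dualVector b (η t)) (dualVector b (η t'))) (solve 2 (λ x y → x :- y := (x :+ K 0) :+ (:- (y :+ K 0))) refl _ _)))) (integer-+ (z j) (integer-neg (z' j)))
            sum-int : ∀ k (x : Fin k → ℝ) (c : Fin k → ℤ) → (∀ i → IsInteger (x i)) → IsInteger (Σ[ k ] (λ i → fromℤ (c i) * x i))
            sum-int zero x c h = ℤ.+ 0 , refl
            sum-int (suc k) x c h = integer-+ (integer-*ℤ (c zero) (h zero)) (sum-int k (x ∘ suc) (c ∘ suc) (h ∘ suc))
            inDual : InDual b v
            inDual x (c , e) = subst IsInteger (sym (trans (sym (·-def x v)) (trans (·-cong e (λ _ → refl)) (combination-· b (fromℤ ∘ c) v)))) (sum-int n (λ i → b i · v) c int)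

 -- Numerical data of the auxiliary function.

 module Certificate where
  open IntegerPolynomials
  -- The widths e = 24 + i divide 10080 and range from 24 to 180, so the exponents 10080/e of V =
  -- exp(-y/20160) run from 56 to 420 = 56 + 364.
  open Combination 23 56 364 20160 15 16 8

  terms : Terms
  terms =
    (0 , 364 , ℤ.+ 33844224000676212688359) ∷
    (4 , 304 , -[1+ 6712237427751155674302512 ]) ∷
    (6 , 280 , ℤ.+ 73429267036763630609828162) ∷
    (8 , 259 , -[1+ 346656122429944416164204967 ]) ∷
    (11 , 232 , ℤ.+ 3755509569022648013751907443) ∷
    (12 , 224 , -[1+ 5542599703561908310432771621 ]) ∷
    (16 , 196 , ℤ.+ 11860040084123910972729092353) ∷
    (18 , 184 , -[1+ 20383914361313829920111784469 ]) ∷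
    (21 , 168 , ℤ.+ 21325127949283370240678814560) ∷
    (24 , 154 , -[1+ 15222315998561106235391954235 ]) ∷
    (32 , 124 , ℤ.+ 26470904159485324434578238682) ∷
    (36 , 112 , -[1+ 73332253246450028348665905725 ]) ∷
    (39 , 104 , ℤ.+ 80263301019550093965793685010) ∷
    (46 , 88 , -[1+ 140323270978326654332084028691 ]) ∷
    (48 , 84 , ℤ.+ 135362534757489888018099501478) ∷
    (56 , 70 , -[1+ 61823964696245715278254118391 ]) ∷
    (60 , 64 , ℤ.+ 54871010077630152502310243667) ∷
    (66 , 56 , -[1+ 24806143179486607039075124295 ]) ∷
    (72 , 49 , ℤ.+ 9812896944637724529590510788) ∷
    (81 , 40 , -[1+ 3109481621947307149227516471 ]) ∷
    (88 , 34 , ℤ.+ 1491631886578925820036234201) ∷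
    (96 , 28 , -[1+ 547571136077145735398858778 ]) ∷
    (102 , 24 , ℤ.+ 169837800554424728001226735) ∷
    (116 , 16 , -[1+ 20952518370653373703427611 ]) ∷
    (120 , 14 , ℤ.+ 9773059019702731510444169) ∷
    (136 , 7 , -[1+ 237152922623216227950555 ]) ∷
    (144 , 4 , ℤ.+ 43887168031873917661049) ∷
    (156 , 0 , -[1+ 1306692317413861422264 ]) ∷
    []

  -- Fixed-point coefficients with leading coefficient 2^80. The square then has leading coefficient
  -- 2^160 = `scaling`, so the division by it starts exactly.
  fourierRoots : List ℤ
  fourierRoots =
    -[1+ 42764104356420590430663 ] ∷
    ℤ.+ 499692390486827967146707 ∷
    -[1+ 2471053705321501460466860 ] ∷
    ℤ.+ 6707879815011371366640054 ∷
    -[1+ 10801288685066847420632259 ] ∷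
    ℤ.+ 10322203221544170621887273 ∷
    -[1+ 5423171649712036933966911 ] ∷
    ℤ.+ 1208925819614629174706176 ∷
    []

  directRoots : List ℤ
  directRoots =
    ℤ.+ 404415580718435335795412 ∷
    -[1+ 2930325238454845083011015 ] ∷
    ℤ.+ 8824482047196147525317645 ∷
    -[1+ 14137866798666314767276349 ] ∷
    ℤ.+ 12710082916746675834136499 ∷
    -[1+ 6079707545978522576497125 ] ∷
    ℤ.+ 1208925819614629174706176 ∷
    []

  scaling : ℤ
  scaling = ℤ.+ (2 ℕ.^ 160)

  κ : ℕ
  κ = 45645938043256990783636653244071105077139938

  terms-wellformed : wellformed terms ≡ true
  terms-wellformed = refl

  fourier-certified : certify scaling (fourier terms) fourierRoots (ℤ.+ κ) ≡ true
  fourier-certified = refl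

  direct-certified : certify scaling (direct terms) directRoots (ℤ.+ 0) ≡ true
  direct-certified = refl

 -- A rational lower bound for the square root of π.

 module GaussNumeric (S : ℕ) .{{S≢0 : ℕ.NonZero S}} (wn wd : ℕ) .{{wd≢0 : ℕ.NonZero wd}} where
  -- fixed-point lower bound (scale S) for x Σ y^…, following x ↦ x y, y ↦ (wn / wd) y
  accumulate : ℕ → ℕ → ℕ → ℕ → ℕ
  accumulate zero p q acc = acc
  accumulate (suc K) p q acc = let p' = p ℕ.* q ℕ./ S in accumulate K p' (q ℕ.* wn ℕ./ wd) (acc ℕ.+ p')

 module SquareRootπ where
  open Field
  open Sums
  open Exponential
  open GaussSum
  open GaussIntegral

  fromℕ-^ : ∀ a k → fromℕ (a ℕ.^ k) ≡ fromℕ a ^ k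
  fromℕ-^ a zero = +-identityʳ 1ℝ
  fromℕ-^ a (suc k) = trans (fromℕ-* a (a ℕ.^ k)) (cong (fromℕ a *_) (fromℕ-^ a k))

  div≤ : ∀ a d .{{_ : ℕ.NonZero d}} → fromℕ (a ℕ./ d) * fromℕ d ≤ fromℕ a
  div≤ a d = ≤-trans (≡⇒≤ (sym (fromℕ-* (a ℕ./ d) d))) (fromℕ-mono-≤ (m/n*n≤m a d))

  module _ (S : ℕ) .{{S≢0 : ℕ.NonZero S}} (wn wd : ℕ) .{{wd≢0 : ℕ.NonZero wd}} (w : ℝ) (w≥0 : 0ℝ ≤ w) (w² : fromℕ wn ≤ fromℕ wd * (w * w)) where
    open GaussNumeric S wn wd
    private
      s = fromℕ S
      positive : ∀ d .{{_ : ℕ.NonZero d}} → 0ℝ < fromℕ d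
      positive (suc d) = 0<ℕ d

    -- p and q stay below S w^(k²) and S w^(2k+1): one has (k + 1)² = k² + (2k + 1), consecutive
    -- values of q differ by w², and all divisions round down.
    accumulate-sound : ∀ K k p q acc → fromℕ p ≤ s * w ^ (k ℕ.* k) → fromℕ q ≤ s * w ^ (k ℕ.+ suc k) →
      fromℕ (accumulate K p q acc) ≤ fromℕ acc + s * ∑ (range K) (λ j → w ^ ((suc k ℕ.+ j) ℕ.* (suc k ℕ.+ j)))
    accumulate-sound zero k p q acc hp hq = ≡⇒≤ (solve 2 (λ a s → a := a :+ s :* K 0) refl (fromℕ acc) s)
    accumulate-sound (suc M) k p q acc hp hq = ≤-trans (accumulate-sound M (suc k) p' q' (acc ℕ.+ p') hp' hq') (≤-trans (≡⇒≤ (cong (_+ s * Θ) (fromℕ-+ acc p'))) (≤-trans (+-mono-≤ (+-mono-≤ (≤-refl {fromℕ acc}) hp') (≤-refl {s * Θ})) (≡⇒≤ eq)))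
      where
        p' = p ℕ.* q ℕ./ S
        q' = q ℕ.* wn ℕ./ wd
        Θ = ∑ (range M) (λ j → w ^ ((suc (suc k) ℕ.+ j) ℕ.* (suc (suc k) ℕ.+ j)))
        hp' : fromℕ p' ≤ s * w ^ (suc k ℕ.* suc k)
        hp' = *-cancel-≤ʳ s (positive S) (≤-trans (div≤ (p ℕ.* q) S) (≤-trans (≡⇒≤ (fromℕ-* p q)) (≤-trans (*-mono-≤ (0≤ℕ p) (0≤* (0≤ℕ S) (0≤^ (k ℕ.+ suc k) w≥0)) hp hq) (≡⇒≤ (trans (solve 3 (λ s x y → s :* x :* (s :* y) := s :* (x :* y) :* s) refl s (w ^ (k ℕ.* k)) (w ^ (k ℕ.+ suc k))) (cong (λ t → s * t * s) (trans (sym (^-+ w (k ℕ.* k) (k ℕ.+ suc k))) (cong (w ^_) (Sq.solve 1 (λ k → k Sq.:* k Sq.:+ (k Sq.:+ (Sq.con 1 Sq.:+ k)) Sq.:= (Sq.con 1 Sq.:+ k) Sq.:* (Sq.con 1 Sq.:+ k)) refl k)))))))))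
          where module Sq = Data.Nat.Solver.+-*-Solver
        hq' : fromℕ q' ≤ s * w ^ (suc k ℕ.+ suc (suc k))
        hq' = *-cancel-≤ʳ (fromℕ wd) (positive wd) (≤-trans (div≤ (q ℕ.* wn) wd) (≤-trans (≡⇒≤ (fromℕ-* q wn)) (≤-trans (*-mono-≤ (0≤ℕ q) (0≤* (0≤ℕ wd) (0≤* w≥0 w≥0)) hq w²) (≡⇒≤ (trans (solve 4 (λ s x d w → s :* x :* (d :* (w :* w)) := s :* (w :* (w :* x)) :* d) refl s (w ^ (k ℕ.+ suc k)) (fromℕ wd) w) (cong (λ t → s * (w ^ t) * fromℕ wd) (cong suc (sym (ℕₚ.+-suc k (suc k))))))))))
        eq : fromℕ acc + s * w ^ (suc k ℕ.* suc k) + s * Θ ≡ fromℕ acc + s * ∑ (range (suc M)) (λ j → w ^ ((suc k ℕ.+ j) ℕ.* (suc k ℕ.+ j)))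
        eq = trans (solve 4 (λ a s x t → a :+ s :* x :+ s :* t := a :+ s :* (x :+ t)) refl (fromℕ acc) s (w ^ (suc k ℕ.* suc k)) Θ) (cong (λ t → fromℕ acc + s * t) (sym (trans (∑-range-shift M (λ j → w ^ ((suc k ℕ.+ j) ℕ.* (suc k ℕ.+ j)))) (cong₂ _+_ (cong (λ i → w ^ (i ℕ.* i)) (ℕₚ.+-identityʳ (suc k))) (∑-cong (range M) (λ j → cong (λ i → w ^ (i ℕ.* i)) (ℕₚ.+-suc (suc k) j)))))))

  -- Left Riemann sums with exp(-1/n²) ≥ (n² - 1)/n².
  √π-bound : ∀ N M K S .{{_ : ℕ.NonZero S}} wn wd .{{_ : ℕ.NonZero wd}} q₀ p₁ q₁ → suc N ℕ.* suc N ≡ suc M → wn ≡ M ℕ.* M → wd ≡ suc M ℕ.* suc M → q₀ ℕ.* suc M ℕ.≤ S ℕ.* M →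
    p₁ ℕ.* (suc N ℕ.* S) ℕ.≤ 2 ℕ.* GaussNumeric.accumulate S wn wd K S q₀ 0 ℕ.* q₁ → fromℕ p₁ ≤ fromℕ q₁ * G 1ℝ
  √π-bound N M K S wn wd q₀ p₁ q₁ eqM refl refl hq₀ check = *-cancel-≤ʳ (n * s) (*-pos (0<ℕ N) s>0) (≤-trans (≡⇒≤ (trans (cong (fromℕ p₁ *_) (sym (fromℕ-* (suc N) S))) (sym (fromℕ-* p₁ (suc N ℕ.* S))))) (≤-trans (fromℕ-mono-≤ check) (≤-trans (≡⇒≤ (trans (fromℕ-* (2 ℕ.* A) q₁) (cong (_* fromℕ q₁) (fromℕ-* 2 A)))) (≤-trans (*-mono-≤ʳ (fromℕ q₁) (0≤ℕ q₁) main) (≡⇒≤ (solve 4 (λ n s g q → n :* s :* g :* q := q :* g :* (n :* s)) refl n s (G 1ℝ) (fromℕ q₁)))))))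
    where
      n = fromℕ (suc N)
      s = fromℕ S
      s>0 : 0ℝ < s
      s>0 = go S
        where
          go : ∀ S .{{_ : ℕ.NonZero S}} → 0ℝ < fromℕ S
          go (suc S) = 0<ℕ S
      A = GaussNumeric.accumulate S (M ℕ.* M) (suc M ℕ.* suc M) K S q₀ 0
      v = ν′ N
      v² = v * v
      nv : n * v ≡ 1ℝ
      nv = *-inv⁺ (0<ℕ N)
      mv : fromℕ (suc M) * v² ≡ 1ℝ
      mv = trans (cong (_* v²) (trans (cong fromℕ (sym eqM)) (fromℕ-* (suc N) (suc N)))) (trans (solve 2 (λ n v → n :* n :* (v :* v) := (n :* v) :* (n :* v)) refl n v) (trans (cong₂ _*_ nv nv) (*-identityʳ 1ℝ)))
      v²≥0 = 0≤sq v
      w = E v²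
      w≥0 = 0≤E v²≥0
      mw : fromℕ M ≤ fromℕ (suc M) * w
      mw = ≤-trans (≡⇒≤ (trans (solve 1 (λ m → m := (𝟙 :+ m) :- 𝟙) refl (fromℕ M)) (trans (cong (λ t → fromℕ (suc M) - t) (sym mv)) (solve 2 (λ m v → m :- m :* v := m :* (𝟙 :- v)) refl (fromℕ (suc M)) v²)))) (*-mono-≤ˡ _ (0≤ℕ (suc M)) (1-x≤E v²≥0))
      ww : fromℕ (M ℕ.* M) ≤ fromℕ (suc M ℕ.* suc M) * (w * w)
      ww = ≤-trans (≡⇒≤ (fromℕ-* M M)) (≤-trans (*-mono-≤ (0≤ℕ M) (0≤* (0≤ℕ (suc M)) w≥0) mw mw) (≡⇒≤ (trans (solve 2 (λ m w → m :* w :* (m :* w) := m :* m :* (w :* w)) refl (fromℕ (suc M)) w) (cong (_* (w * w)) (sym (fromℕ-* (suc M) (suc M)))))))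
      qw : fromℕ q₀ ≤ s * w ^ 1
      qw = *-cancel-≤ʳ (fromℕ (suc M)) (0<ℕ M) (≤-trans (≡⇒≤ (sym (fromℕ-* q₀ (suc M)))) (≤-trans (fromℕ-mono-≤ hq₀) (≤-trans (≡⇒≤ (fromℕ-* S M)) (≤-trans (*-mono-≤ˡ s (0≤ℕ S) mw) (≡⇒≤ (solve 3 (λ s m w → s :* (m :* w) := s :* (w :* 𝟙) :* m) refl s (fromℕ (suc M)) w))))))
      Σw = ∑ (range K) (λ j → w ^ (suc j ℕ.* suc j))
      A≤ : fromℕ A ≤ s * Σw
      A≤ = ≤-trans (accumulate-sound S (M ℕ.* M) (suc M ℕ.* suc M) w w≥0 ww K 0 S q₀ 0 (≡⇒≤ (sym (*-identityʳ s))) qw) (≡⇒≤ (+-identityˡ _))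
      sample : ∀ j → w ^ (suc j ℕ.* suc j) ≡ E (1ℝ * (fromℕ (suc j) * v * (fromℕ (suc j) * v)))
      sample j = trans (sym (E-× (suc j ℕ.* suc j) v²≥0)) (cong E (trans (cong (_* v²) (fromℕ-* (suc j) (suc j))) (solve 2 (λ j v → j :* j :* (v :* v) := 𝟙 :* (j :* v :* (j :* v))) refl (fromℕ (suc j)) v)))
      main : fromℕ 2 * fromℕ A ≤ n * s * G 1ℝ
      main = ≤-trans (*-mono-≤ˡ (fromℕ 2) (0≤ℕ 2) (≤-trans A≤ (≡⇒≤ (trans (sym (*-identityˡ _)) (trans (cong (_* (s * Σw)) (sym nv)) (solve 4 (λ n v s x → n :* v :* (s :* x) := n :* s :* (v :* x)) refl n v s Σw))))))
         (≤-trans (≡⇒≤ (trans (solve 3 (λ t x y → t :* (x :* y) := x :* (t :* y)) refl (fromℕ 2) (n * s) (v * Σw)) (cong (λ t → n * s * (fromℕ 2 * (v * t))) (∑-cong (range K) sample)))) (*-mono-≤ˡ (n * s) (0≤* (0≤ℕ (suc N)) (0≤ℕ S)) (G-lower 0<1 N K)))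

 -- The product of the density bounds for Λ and Λ*.

 module MinimumProduct (b v deg m p q h : ℕ) (0<m : 0 ℕ.< m) (0<p : 0 ℕ.< p) (0<q : 0 ℕ.< q) (n : ℕ) (n≡h+h : n ≡ h ℕ.+ h) where
  open Lattice
  open Exponential
  open Combination b v deg m p q h
  open IntegerPolynomials
  open CompleteMonotonicity
  open HeatKernel
  open GaussSum
  open GaussIntegral
  open CombinationBounds b v deg m p q h 0<m 0<p 0<q using (Far)
  open LatticePoints
  open SquareRootπ

  private
    Differ : ∀ {k} → (Fin k → ℤ) → (Fin k → ℤ) → Set
    Differ t t' = ∃ λ i → ¬ (t i ≡ t' i)

    range-distinct : ∀ K → AllPairs (λ i j → ¬ (i ≡ j)) (range K)
    range-distinct zero = []
    range-distinct (suc K) = All.tabulate (λ p e → ℕₚ.<-irrefl (sym e) (range-< K p)) ∷ range-distinct K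

    win-distinct : ∀ s s' → AllPairs (λ i j → ¬ (i ≡ j)) (win s s')
    win-distinct s s' = AllPairsₚ.++⁺ (AllPairsₚ.map⁺ (AllPairs.map (λ ne e → ne (ℤₚ.+-injective e)) (range-distinct s'))) (AllPairsₚ.map⁺ (AllPairs.map (λ ne e → ne (ℤₚ.-[1+-injective e)) (range-distinct s)))
      (Allₚ.map⁺ (All.universal (λ _ → Allₚ.map⁺ (All.universal (λ _ ()) (range s))) (range s')))

    box-distinct : ∀ k {zs : List ℤ} → AllPairs (λ i j → ¬ (i ≡ j)) zs → AllPairs Differ (box k zs)
    box-distinct zero d = [] ∷ []
    box-distinct (suc k) {zs} d = go zs d
      where
        B = box k zs
        B-distinct = box-distinct k d
        others : ∀ {z} zs → All (λ z' → ¬ (z ≡ z')) zs → All (λ t → ¬ (z ≡ t zero)) (concatMap (λ z → map (cons z) B) zs)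
        others [] [] = []
        others (z ∷ zs) (ne ∷ nes) = Allₚ.++⁺ (Allₚ.map⁺ (All.universal (λ _ → ne) B)) (others zs nes)
        go : ∀ zs → AllPairs (λ i j → ¬ (i ≡ j)) zs → AllPairs Differ (concatMap (λ z → map (cons z) B) zs)
        go [] [] = []
        go (z ∷ zs) (ne ∷ nes) = AllPairsₚ.++⁺ (AllPairsₚ.map⁺ (AllPairs.map (λ { (i , e) → suc i , e }) B-distinct)) (go zs nes)
           (Allₚ.map⁺ (All.universal (λ _ → All.map (λ e → zero , e) (others zs ne)) B))

  module _ (ts : Terms) (c : ℤ) (g : List ℤ) (κ : ℤ) (g′ : List ℤ) (wf : wellformed ts ≡ true) (cert′ : certify c (direct ts) g′ (ℤ.+ 0) ≡ true) (cert : certify c (fourier ts) g κ ≡ true)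
           (c>0 : 0ℝ < fromℤ c) (κ≥0 : 0ℝ ≤ fromℤ κ) (tot≥0 : 0ℝ ≤ fromℤ (total ts)) (Y : ℝ) (Y>0 : 0ℝ < Y) (far : ∀ y → Y ≤ y → Far y) where

    X Θ : ℝ
    X = fromℤ κ * (⟪ (λ _ → 1ℝ) ⟫ g 0 * ⟪ (λ _ → 1ℝ) ⟫ g 0)
    Θ = fromℤ c * fromℤ (total ts)

    -- The form is rescaled by Y / μ, so that the minimal distance μ becomes Y, from which on `Far`
    -- holds.
    separated⇒sparse : (w : Fin n → ℝ) → (∀ i → 0ℝ < w i) → ∀ {μ} → 0ℝ < μ → (y : (Fin n → ℤ) → Fin n → ℝ) → (∀ t i → fromℤ (t i) < y t i × y t i ≤ fromℤ (t i) + 1ℝ) →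
      (∀ t t' i → ¬ (t i ≡ t' i) → μ ≤ Σ[ n ] (λ i → w i * ((y t i - y t' i) * (y t i - y t' i)))) →
      X * Π n (λ i → G (w i * (Y * μ ⁻¹))) ≤ Θ
    separated⇒sparse w w>0 {μ} μ>0 y cell sep = density y closed A ts c g κ g′ wf cert′ cert c>0 κ≥0 tot≥0 ℕₚ.≤-refl
        (λ N → AllPairs.map (λ { {t} {t'} (i , ne) → far _ (≤-trans (≡⇒≤ scale-Y) (≤-trans (*-mono-≤ˡ ς (<⇒≤ ς>0) (sep t t' i ne)) (≡⇒≤ (trans (Σ-scale n (λ i → w i) (λ i → (y t i - y t' i) * (y t i - y t' i))) (sym (Kernel.dist-Σ n h n≡h+h d d>0 (y t) (y t'))))))) }) (box-distinct n (win-distinct (K′ y closed A N) (K′ y closed A N))))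
      where
        closed : ∀ t i → fromℤ (t i) ≤ y t i × y t i ≤ fromℤ (t i) + 1ℝ
        closed t i = <⇒≤ (proj₁ (cell t i)) , proj₂ (cell t i)
        A = length (quotient (scale c (fourier ts)) (g ⊛ g)) ℕ.∸ 1 ℕ.+ (b ℕ.+ (length g ℕ.+ length g))
        ς = Y * μ ⁻¹
        ς>0 = *-pos Y>0 (inv-pos μ>0)
        d : Fin n → ℝ
        d i = w i * ς
        d>0 : ∀ i → 0ℝ < d i
        d>0 i = *-pos (w>0 i) ς>0
        open GaussianDensity b v deg m p q h 0<m 0<p 0<q n n≡h+h d d>0 using (density; K′)
        scale-Y : Y ≡ ς * μ
        scale-Y = sym (trans (*-assoc _ _ _) (trans (cong (Y *_) (trans (*-comm _ _) (*-inv⁺ μ>0))) (*-identityʳ Y)))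
        Σ-scale : ∀ k (w x : Fin k → ℝ) → ς * Σ[ k ] (λ i → w i * x i) ≡ Σ[ k ] (λ i → w i * ς * x i)
        Σ-scale zero w x = zeroʳ ς
        Σ-scale (suc k) w x = trans (distribˡ _ _ _) (cong₂ _+_ (solve 3 (λ s w x → s :* (w :* x) := w :* s :* x) refl ς (w zero) (x zero)) (Σ-scale k (w ∘ suc) (x ∘ suc)))

    -- The weights of the dual form are the inverses of the Gram-Schmidt weights of Λ, so they
    -- cancel in the product and leave (π² μ μ* / Y²)^n. The squares of both bounds are multiplied
    -- because G is known through G².
    product-bound : (bs : Fin n → Vec n) → Independent bs → ∀ {μ μ*} → 0ℝ < μ → 0ℝ < μ* →
      (∀ u → InLattice bs u → NonZero u → μ ≤ normᵈ u) → (∀ u → InDual bs u → NonZero u → μ* ≤ normᵈ u) → 0ℝ ≤ X →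
      X * X * (X * X) * ((G 1ℝ * G 1ℝ * (G 1ℝ * G 1ℝ)) ^ n * (μ * μ*) ^ n) ≤ Θ * Θ * (Θ * Θ) * (Y * Y) ^ n
    product-bound bs ind {μ} {μ*} μ>0 μ*>0 minimal minimal* X≥0 = ≤-trans (≡⇒≤ eq) (*-mono-≤ʳ _ (0≤^ n (0≤sq Y)) (*-mono-≤ (0≤sq (X * P)) (0≤* Θ≥0 Θ≥0) (*-mono-≤ XP≥0 Θ≥0 hP hP) (*-mono-≤ XP*≥0 Θ≥0 hP* hP*)))
      where
        w = gram bs
        ς = Y * μ ⁻¹
        ς* = Y * μ* ⁻¹
        ς>0 = *-pos Y>0 (inv-pos μ>0)
        ς*>0 = *-pos Y>0 (inv-pos μ*>0)
        w>0 = gram>0 bs ind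
        P = Π n (λ i → G (w i * ς))
        P* = Π n (λ i → G ((w i) ⁻¹ * ς*))
        P≥0 : 0ℝ ≤ P
        P≥0 = 0≤Π n (λ i → <⇒≤ (G-pos (*-pos (w>0 i) ς>0)))
        P*≥0 : 0ℝ ≤ P*
        P*≥0 = 0≤Π n (λ i → <⇒≤ (G-pos (*-pos (inv-pos (w>0 i)) ς*>0)))
        XP≥0 = 0≤* X≥0 P≥0
        XP*≥0 = 0≤* X≥0 P*≥0
        Θ≥0 : 0ℝ ≤ Θ
        Θ≥0 = 0≤* (<⇒≤ c>0) tot≥0
        hP : X * P ≤ Θ
        hP = separated⇒sparse w w>0 μ>0 (primal bs) (primal-cell bs) (primal-separated bs ind μ minimal)
        hP* : X * P* ≤ Θ
        hP* = separated⇒sparse (λ i → (w i) ⁻¹) (λ i → inv-pos (w>0 i)) μ*>0 (dual bs (λ _ → 0ℝ)) (dual-cell bs (λ _ → 0ℝ)) (dual-separated bs ind μ* minimal*)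
        Γ = G 1ℝ
        Γ⁴ = Γ * Γ * (Γ * Γ)
        term : ∀ i → Γ⁴ * (μ * μ*) ≡ G (w i * ς) * G (w i * ς) * (G ((w i) ⁻¹ * ς*) * G ((w i) ⁻¹ * ς*)) * (Y * Y)
        term i = trans (cong (_* (μ * μ*)) (cong₂ _*_ (trans (sym (*-identityˡ (Γ * Γ))) (G-scale 0<1 (*-pos (w>0 i) ς>0))) (trans (sym (*-identityˡ (Γ * Γ))) (G-scale 0<1 (*-pos (inv-pos (w>0 i)) ς*>0)))))
           (trans (solve 9 (λ w i y j k g h m n → w :* (y :* j) :* (g :* g) :* (i :* (y :* k) :* (h :* h)) :* (m :* n) := (w :* i) :* (m :* j) :* (n :* k) :* (g :* g :* (h :* h) :* (y :* y))) refl (w i) ((w i) ⁻¹) Y (μ ⁻¹) (μ* ⁻¹) (G (w i * ς)) (G ((w i) ⁻¹ * ς*)) μ μ*)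
             (trans (cong₂ (λ x y → x * y * Z) (trans (cong₂ _*_ (*-inv⁺ (w>0 i)) (*-inv⁺ μ>0)) (*-identityʳ 1ℝ)) (*-inv⁺ μ*>0)) (trans (cong (_* Z) (*-identityʳ 1ℝ)) (*-identityˡ Z))))
          where Z = G (w i * ς) * G (w i * ς) * (G ((w i) ⁻¹ * ς*) * G ((w i) ⁻¹ * ς*)) * (Y * Y)
        products : Γ⁴ ^ n * (μ * μ*) ^ n ≡ P * P * (P* * P*) * (Y * Y) ^ n
        products = trans (sym (*-^ Γ⁴ (μ * μ*) n)) (trans (sym (Π-const n (Γ⁴ * (μ * μ*)))) (trans (Π-cong n term) (trans (Π-* n) (cong₂ _*_ (trans (Π-* n) (cong₂ _*_ (Π-* n) (Π-* n))) (Π-const n (Y * Y))))))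
        eq : X * X * (X * X) * (Γ⁴ ^ n * (μ * μ*) ^ n) ≡ X * P * (X * P) * (X * P* * (X * P*)) * (Y * Y) ^ n
        eq = trans (cong (X * X * (X * X) *_) products) (solve 4 (λ x p q y → x :* x :* (x :* x) :* (p :* p :* (q :* q) :* y) := x :* p :* (x :* p) :* (x :* q :* (x :* q)) :* y) refl X P P* ((Y * Y) ^ n))

  -- Compares the fourth powers in integers: p₁/q₁ ≤ √π and Y = M₂/M₁.
  numeric : ∀ {X Θ Y r : ℝ} x t p₁ q₁ M₁ M₂ rn rd → X ≡ fromℕ x → Θ ≡ fromℕ t → fromℕ p₁ ≤ fromℕ q₁ * G 1ℝ → fromℕ M₁ * Y ≡ fromℕ M₂ → 0ℝ ≤ r →
    X * X * (X * X) * ((G 1ℝ * G 1ℝ * (G 1ℝ * G 1ℝ)) ^ n * r ^ n) ≤ Θ * Θ * (Θ * Θ) * (Y * Y) ^ n →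
    t ℕ.* t ℕ.* (t ℕ.* t) ℕ.* (q₁ ℕ.* q₁ ℕ.* (q₁ ℕ.* q₁) ℕ.* rd ℕ.* (M₂ ℕ.* M₂)) ℕ.^ n ℕ.< x ℕ.* x ℕ.* (x ℕ.* x) ℕ.* (p₁ ℕ.* p₁ ℕ.* (p₁ ℕ.* p₁) ℕ.* rn ℕ.* (M₁ ℕ.* M₁)) ℕ.^ n →
    fromℕ rd * r < fromℕ rn
  numeric {X} {Θ} {Y} {r} x t p₁ q₁ M₁ M₂ rn rd refl refl hπ hY r≥0 h lt with (fromℕ rn) ≤? (fromℕ rd * r)
  ... | inj₂ less = less
  ... | inj₁ le = ⊥-elim (ℕₚ.<-irrefl refl (ℕₚ.<-≤-trans lt (fromℕ-cancel-≤ chain)))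
    where
      Γ = G 1ℝ
      Γ≥0 = <⇒≤ (G-pos 0<1)
      b₀ = q₁ ℕ.* q₁ ℕ.* (q₁ ℕ.* q₁) ℕ.* rd ℕ.* (M₂ ℕ.* M₂)
      a₀ = p₁ ℕ.* p₁ ℕ.* (p₁ ℕ.* p₁) ℕ.* rn ℕ.* (M₁ ℕ.* M₁)
      four : ∀ k → fromℕ (k ℕ.* k ℕ.* (k ℕ.* k)) ≡ fromℕ k * fromℕ k * (fromℕ k * fromℕ k)
      four k = trans (fromℕ-* (k ℕ.* k) (k ℕ.* k)) (cong₂ _*_ (fromℕ-* k k) (fromℕ-* k k))
      cast : ∀ p r M → fromℕ (p ℕ.* p ℕ.* (p ℕ.* p) ℕ.* r ℕ.* (M ℕ.* M)) ≡ fromℕ p * fromℕ p * (fromℕ p * fromℕ p) * fromℕ r * (fromℕ M * fromℕ M)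
      cast p r M = trans (fromℕ-* (p ℕ.* p ℕ.* (p ℕ.* p) ℕ.* r) (M ℕ.* M)) (cong₂ _*_ (trans (fromℕ-* (p ℕ.* p ℕ.* (p ℕ.* p)) r) (cong (_* fromℕ r) (four p))) (fromℕ-* M M))
      full : ∀ k a → fromℕ (k ℕ.* k ℕ.* (k ℕ.* k) ℕ.* a ℕ.^ n) ≡ fromℕ k * fromℕ k * (fromℕ k * fromℕ k) * fromℕ a ^ n
      full k a = trans (fromℕ-* (k ℕ.* k ℕ.* (k ℕ.* k)) (a ℕ.^ n)) (cong₂ _*_ (four k) (fromℕ-^ a n))
      X′ = fromℕ x
      T′ = fromℕ t
      Q = fromℕ q₁
      D = Q * Q * (Q * Q) * fromℕ rd * (fromℕ M₁ * fromℕ M₁)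
      D≥0 : 0ℝ ≤ D
      D≥0 = 0≤* (0≤* (0≤sq (Q * Q)) (0≤ℕ rd)) (0≤sq (fromℕ M₁))
      base : fromℕ a₀ ≤ Γ * Γ * (Γ * Γ) * r * D
      base = ≤-trans (≡⇒≤ (cast p₁ rn M₁)) (≤-trans (*-mono-≤ʳ _ (0≤sq (fromℕ M₁)) (*-mono-≤ (0≤sq _) (0≤* (0≤ℕ rd) r≥0) (*-mono-≤ (0≤sq _) (0≤sq _) sq sq) le)) (≡⇒≤ (solve 5 (λ q g d r m → q :* g :* (q :* g) :* (q :* g :* (q :* g)) :* (d :* r) :* m := g :* g :* (g :* g) :* r :* (q :* q :* (q :* q) :* d :* m)) refl Q Γ (fromℕ rd) r (fromℕ M₁ * fromℕ M₁))))
        where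
          sq : fromℕ p₁ * fromℕ p₁ ≤ Q * Γ * (Q * Γ)
          sq = *-mono-≤ (0≤ℕ p₁) (0≤* (0≤ℕ q₁) Γ≥0) hπ hπ
      YD : (Y * Y) ^ n * D ^ n ≡ fromℕ b₀ ^ n
      YD = trans (sym (*-^ (Y * Y) D n)) (cong (_^ n) (trans (solve 4 (λ y q d m → y :* y :* (q :* d :* (m :* m)) := q :* d :* (m :* y :* (m :* y))) refl Y (Q * Q * (Q * Q)) (fromℕ rd) (fromℕ M₁)) (trans (cong (λ u → Q * Q * (Q * Q) * fromℕ rd * (u * u)) hY) (sym (cast q₁ rd M₂)))))
      chain : fromℕ (x ℕ.* x ℕ.* (x ℕ.* x) ℕ.* a₀ ℕ.^ n) ≤ fromℕ (t ℕ.* t ℕ.* (t ℕ.* t) ℕ.* b₀ ℕ.^ n)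
      chain = ≤-trans (≡⇒≤ (full x a₀)) (≤-trans (*-mono-≤ˡ _ (0≤sq (X′ * X′)) (≤-trans (^-mono-≤ n (0≤ℕ a₀) base) (≡⇒≤ (trans (*-^ (Γ * Γ * (Γ * Γ) * r) D n) (cong (_* D ^ n) (*-^ (Γ * Γ * (Γ * Γ)) r n))))))
          (≤-trans (≡⇒≤ (sym (*-assoc (X′ * X′ * (X′ * X′)) _ (D ^ n)))) (≤-trans (*-mono-≤ʳ (D ^ n) (0≤^ n D≥0) h) (≡⇒≤ (trans (*-assoc (T′ * T′ * (T′ * T′)) _ (D ^ n)) (trans (cong (T′ * T′ * (T′ * T′) *_) YD) (sym (full t b₀))))))))

 -- The bound r < 46/5.

 module MinimumProductBound where
  open Lattice
  open Exponential
  open GaussIntegral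
  open IntegerPolynomials
  open CompleteMonotonicity
  open LatticePoints using (Independent)
  open SquareRootπ

  private
    0<fromℕ : ∀ {k} → 0 ℕ.< k → 0ℝ < fromℕ k
    0<fromℕ {suc k} _ = 0<ℕ k

    sumℤ : List ℤ → ℤ
    sumℤ [] = ℤ.+ 0
    sumℤ (a ∷ p) = a ℤ.+ sumℤ p

    sumℤ-⟪⟫ : ∀ p k → ⟪ (λ _ → 1ℝ) ⟫ p k ≡ fromℤ (sumℤ p)
    sumℤ-⟪⟫ [] k = refl
    sumℤ-⟪⟫ (a ∷ p) k = trans (cong₂ _+_ (*-identityʳ _) (sumℤ-⟪⟫ p (suc k))) (sym (fromℤ-+ a (sumℤ p)))

  -- Y / m = k a / B is a value with exp(-Y/m) ≤ p/q, verified by raising exp(-a/B) ≤ B / (B + a) to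
  -- the power k.
  module Threshold (p q m a B k : ℕ) (0<m : 0 ℕ.< m) (0<a : 0 ℕ.< a) (0<B : 0 ℕ.< B) (0<k : 0 ℕ.< k) (check : q ℕ.* B ℕ.^ k ℕ.≤ p ℕ.* (B ℕ.+ a) ℕ.^ k) where

    private
      y₀ = fromℕ a * (fromℕ B) ⁻¹
      y₀>0 = *-pos (0<fromℕ 0<a) (inv-pos (0<fromℕ 0<B))

    Y : ℝ
    Y = fromℕ m * (fromℕ k * y₀)

    Y>0 : 0ℝ < Y
    Y>0 = *-pos (0<fromℕ 0<m) (*-pos (0<fromℕ 0<k) y₀>0)

    Y-value : ∀ M₁ → M₁ ℕ.* k ≡ B → fromℕ M₁ * Y ≡ fromℕ (m ℕ.* a)
    Y-value M₁ eq = trans (solve 5 (λ M m k a i → M :* (m :* (k :* (a :* i))) := m :* a :* ((M :* k) :* i)) refl (fromℕ M₁) (fromℕ m) (fromℕ k) (fromℕ a) ((fromℕ B) ⁻¹))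
      (trans (cong (λ t → fromℕ m * fromℕ a * (t * (fromℕ B) ⁻¹)) (trans (sym (fromℕ-* M₁ k)) (cong fromℕ eq))) (trans (cong (fromℕ m * fromℕ a *_) (*-inv⁺ (0<fromℕ 0<B))) (trans (*-identityʳ _) (sym (fromℕ-* m a)))))

    far : ∀ y → Y ≤ y → fromℕ q * E (y * (fromℕ m) ⁻¹) ≤ fromℕ p
    far y Y≤y = ≤-trans (*-mono-≤ˡ (fromℕ q) (0≤ℕ q) (E-mono ky≥0 (*-cancel-≤ˡ (fromℕ m) (0<fromℕ 0<m) (≤-trans Y≤y (≡⇒≤ (sym (trans (solve 3 (λ m y i → m :* (y :* i) := y :* (m :* i)) refl (fromℕ m) y ((fromℕ m) ⁻¹)) (trans (cong (y *_) (*-inv⁺ (0<fromℕ 0<m))) (*-identityʳ y)))))))))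
       (*-cancel-≤ʳ (fromℕ (B ℕ.+ a) ^ k) (0<^ k (0<fromℕ (ℕₚ.≤-trans 0<B (ℕₚ.m≤m+n B a)))) (≤-trans (≡⇒≤ (trans (*-assoc _ _ _) (cong (fromℕ q *_) (trans (cong (_* fromℕ (B ℕ.+ a) ^ k) (E-× k (<⇒≤ y₀>0))) (sym (*-^ (E y₀) (fromℕ (B ℕ.+ a)) k))))))
          (≤-trans (*-mono-≤ˡ (fromℕ q) (0≤ℕ q) (^-mono-≤ k (0≤* (0≤E (<⇒≤ y₀>0)) (0≤ℕ (B ℕ.+ a))) one)) (≤-trans (≡⇒≤ (trans (cong (fromℕ q *_) (sym (fromℕ-^ B k))) (sym (fromℕ-* q (B ℕ.^ k))))) (≤-trans (fromℕ-mono-≤ check) (≡⇒≤ (trans (fromℕ-* p _) (cong (fromℕ p *_) (fromℕ-^ (B ℕ.+ a) k)))))))))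
      where
        ky≥0 : 0ℝ ≤ fromℕ k * y₀
        ky≥0 = 0≤* (0≤ℕ k) (<⇒≤ y₀>0)
        one : E y₀ * fromℕ (B ℕ.+ a) ≤ fromℕ B
        one = ≤-trans (≡⇒≤ (trans (cong (E y₀ *_) (trans (fromℕ-+ B a) (trans (cong (fromℕ B +_) (trans (sym (*-identityʳ _)) (trans (cong (fromℕ a *_) (sym (*-inv⁺ (0<fromℕ 0<B)))) (solve 3 (λ a b i → a :* (b :* i) := b :* (a :* i)) refl (fromℕ a) (fromℕ B) ((fromℕ B) ⁻¹))))) (solve 2 (λ b y → b :+ b :* y := b :* (𝟙 :+ y)) refl (fromℕ B) y₀)))) (solve 3 (λ e b y → e :* (b :* y) := b :* (e :* y)) refl (E y₀) (fromℕ B) (1ℝ + y₀))))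
                (≤-trans (*-mono-≤ˡ (fromℕ B) (0≤ℕ B) (E≤inv (<⇒≤ y₀>0))) (≡⇒≤ (*-identityʳ _)))

  module _ (b v deg m p q h : ℕ) (0<m : 0 ℕ.< m) (0<p : 0 ℕ.< p) (0<q : 0 ℕ.< q) (n : ℕ) (n≡h+h : n ≡ h ℕ.+ h) where
    open Combination b v deg m p q h
    open MinimumProduct b v deg m p q h 0<m 0<p 0<q n n≡h+h

    certified-bound : (ts : Terms) (c : ℤ) (g g′ : List ℤ) (κ γ c₀ t₀ : ℕ) → wellformed ts ≡ true → certify c (direct ts) g′ (ℤ.+ 0) ≡ true → certify c (fourier ts) g (ℤ.+ κ) ≡ true →
      sumℤ g ≡ ℤ.+ γ → c ≡ ℤ.+ c₀ → total ts ≡ ℤ.+ t₀ → 0 ℕ.< c₀ →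
      (a B k : ℕ) (0<a : 0 ℕ.< a) (0<B : 0 ℕ.< B) (0<k : 0 ℕ.< k) → q ℕ.* B ℕ.^ k ℕ.≤ p ℕ.* (B ℕ.+ a) ℕ.^ k →
      (p₁ q₁ M₁ rn rd : ℕ) → M₁ ℕ.* k ≡ B → fromℕ p₁ ≤ fromℕ q₁ * G 1ℝ →
      (let t = c₀ ℕ.* t₀ ; x = κ ℕ.* (γ ℕ.* γ) ; M₂ = m ℕ.* a in
       t ℕ.* t ℕ.* (t ℕ.* t) ℕ.* (q₁ ℕ.* q₁ ℕ.* (q₁ ℕ.* q₁) ℕ.* rd ℕ.* (M₂ ℕ.* M₂)) ℕ.^ n ℕ.< x ℕ.* x ℕ.* (x ℕ.* x) ℕ.* (p₁ ℕ.* p₁ ℕ.* (p₁ ℕ.* p₁) ℕ.* rn ℕ.* (M₁ ℕ.* M₁)) ℕ.^ n) →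
      (bs : Fin n → Vec n) → Independent bs → ∀ {μ μ*} → 0ℝ < μ → 0ℝ < μ* →
      (∀ u → InLattice bs u → NonZero u → μ ≤ normᵈ u) → (∀ u → InDual bs u → NonZero u → μ* ≤ normᵈ u) →
      fromℕ rd * (μ * μ*) < fromℕ rn
    certified-bound ts c g g′ κ γ c₀ t₀ wf cert′ cert γ≡ refl t≡ 0<c₀ a B k 0<a 0<B 0<k check p₁ q₁ M₁ rn rd M₁k hπ lt bs ind μ>0 μ*>0 minimal minimal* =
      numeric (κ ℕ.* (γ ℕ.* γ)) (c₀ ℕ.* t₀) p₁ q₁ M₁ (m ℕ.* a) rn rd X≡ T≡ hπ (Y-value M₁ M₁k) (<⇒≤ (*-pos μ>0 μ*>0))
        (product-bound ts c g (ℤ.+ κ) g′ wf cert′ cert (0<fromℕ 0<c₀) (0≤ℕ κ) (subst (0ℝ ≤_) (cong fromℤ (sym t≡)) (0≤ℕ t₀)) Y Y>0 far bs ind μ>0 μ*>0 minimal minimal* (subst (0ℝ ≤_) (sym X≡) (0≤ℕ (κ ℕ.* (γ ℕ.* γ))))) lt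
      where
        open Threshold p q m a B k 0<m 0<a 0<B 0<k check
        X≡ : fromℕ κ * (⟪ (λ _ → 1ℝ) ⟫ g 0 * ⟪ (λ _ → 1ℝ) ⟫ g 0) ≡ fromℕ (κ ℕ.* (γ ℕ.* γ))
        X≡ = trans (cong (λ t → fromℕ κ * (t * t)) (trans (sumℤ-⟪⟫ g 0) (cong fromℤ γ≡))) (sym (trans (fromℕ-* κ (γ ℕ.* γ)) (cong (fromℕ κ *_) (fromℕ-* γ γ))))
        T≡ : fromℕ c₀ * fromℤ (total ts) ≡ fromℕ (c₀ ℕ.* t₀)
        T≡ = trans (cong (λ t → fromℕ c₀ * fromℤ t) t≡) (sym (fromℕ-* c₀ t₀))

  open Certificate

  private
    √π≥ : fromℕ 17722 ≤ fromℕ 10000 * G 1ℝ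
    -- Step 1/4096, cut off at 13200/4096 ≈ 3.22, fixed-point scale 2^64. The target 1.7722 lies
    -- just below √π ≈ 1.77245.
    √π≥ = √π-bound 4095 16777215 13200 18446744073709551616 281474943156225 281474976710656 18446742974197923840 17722 10000 refl refl refl (ℕₚ.≤ᵇ⇒≤ _ _ _) (ℕₚ.≤ᵇ⇒≤ _ _ _)

  minimum-product<46/5 : (bs : Fin 16 → Vec 16) → Independent bs → ∀ {μ μ*} → 0ℝ < μ → 0ℝ < μ* →
    (∀ u → InLattice bs u → NonZero u → μ ≤ normᵈ u) → (∀ u → InDual bs u → NonZero u → μ* ≤ normᵈ u) → fromℕ 5 * (μ * μ*) < fromℕ 46
  -- 423102200192724883513 is g(1) and 45991370213546706057 is f(0). The number 1291/20000 exceeds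
  -- log(16/15), as 256 factors 1 + 1291/5120000 confirm.
  minimum-product<46/5 = certified-bound 23 56 364 20160 15 16 8 (ℕ.s≤s ℕ.z≤n) (ℕ.s≤s ℕ.z≤n) (ℕ.s≤s ℕ.z≤n) 16 refl terms scaling fourierRoots directRoots κ 423102200192724883513 (2 ℕ.^ 160) 45991370213546706057
    terms-wellformed direct-certified fourier-certified refl refl refl (ℕₚ.<ᵇ⇒< _ _ _) 1291 5120000 256 (ℕ.s≤s ℕ.z≤n) (ℕ.s≤s ℕ.z≤n) (ℕ.s≤s ℕ.z≤n) (ℕₚ.≤ᵇ⇒≤ _ _ _) 17722 10000 20000 46 5 refl √π≥ (ℕₚ.<ᵇ⇒< _ _ _)

 -- With r A = 6 (A + 12 k) and 3 s (A + 12 k) = 8 A², the pair (r , s) is determined by (k , A).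
 module Enumeration where

  quot : ℕ → ℕ → ℕ
  quot a zero = 0
  quot a (suc d) = a ℕ./ suc d

  D : ℕ → ℕ → ℕ
  D k A = A ℕ.+ 12 ℕ.* k

  matches : ℕ → ℕ → ℕ → Entry → Bool
  matches k A s (p , q , t , lo , hi) = (p ℕ.* A ℕ.≡ᵇ q ℕ.* (6 ℕ.* D k A)) ∧ ((s ℕ.≡ᵇ t ℕ.* quot s t) ∧ ((lo ℕ.≤ᵇ quot s t) ∧ (quot s t ℕ.≤ᵇ hi)))

  tabulated : ℕ → ℕ → ℕ → List Entry → Bool
  tabulated k A s [] = false
  tabulated k A s (e ∷ es) = matches k A s e ∨ tabulated k A s es

  -- the code bound for (x + p/q)² (x - c), with r = R / A
  code : ℕ → ℕ → ℕ → ℕ → ℕ → Bool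
  code A R n₂ p q = n₂ ℕ.* (4 ℕ.* p ℕ.* q ℕ.* (R ℕ.∸ 4 ℕ.* A)) ℕ.≤ᵇ 15 ℕ.* ((p ℕ.+ q) ℕ.* (p ℕ.+ q)) ℕ.* R ℕ.+ n₂ ℕ.* ((q ℕ.* q ℕ.+ 15 ℕ.* (p ℕ.* p)) ℕ.* (R ℕ.∸ 8 ℕ.* A))

  codes : ℕ → ℕ → ℕ → Bool
  codes A R n₂ = code A R n₂ 1 1 ∧ (code A R n₂ 3 5 ∧ (code A R n₂ 8 15 ∧ (code A R n₂ 1 2 ∧ code A R n₂ 2 5)))

  -- A lower bound for n₂. The test 24k < A means r < 9, where n₃ = 0 and n₂ = k; otherwise n₃ ≤ 1
  -- leaves n₂ ≥ k - 6.
  second : ℕ → ℕ → ℕ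
  second k A = if 24 ℕ.* k ℕ.<ᵇ A then k else k ℕ.∸ 6

  -- 36k < A means r < 8: there the dimension and simplex bounds apply, beyond it the code bounds.
  admissible : ℕ → ℕ → Bool
  admissible k A = if 36 ℕ.* k ℕ.<ᵇ A then (k ℕ.≤ᵇ 16) ∧ (2 ℕ.* k ℕ.* A ℕ.≤ᵇ 72 ℕ.* (k ℕ.* k) ℕ.+ 6 ℕ.* A ℕ.+ 72 ℕ.* k)
                   else codes A (6 ℕ.* D k A) (second k A)

  -- The cases that `FirstShell` excludes: 2808k ≤ 5A is 39r ≤ 239, and n₁ = A - 4k since shell 3 is
  -- empty.
  special : ℕ → ℕ → Bool
  special k A = (k ℕ.≤ᵇ 3) ∧ ((2808 ℕ.* k ℕ.≤ᵇ 5 ℕ.* A) ∧ (1500 ℕ.<ᵇ A ℕ.∸ 4 ℕ.* k))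

  -- 45k < 2A is r < 46/5, and 136 is half of the minimal size 272 of Min(Λ).
  hypotheses : ℕ → ℕ → ℕ → Bool
  hypotheses k A s = (s ℕ.* (3 ℕ.* D k A) ℕ.≡ᵇ 8 ℕ.* (A ℕ.* A)) ∧ ((136 ℕ.≤ᵇ s) ∧ ((45 ℕ.* k ℕ.<ᵇ 2 ℕ.* A) ∧ admissible k A))

  implication : ℕ → ℕ → ℕ → Bool
  implication k A s = not (hypotheses k A s) ∨ (tabulated k A s table ∨ special k A)

  test : ℕ → ℕ → Bool
  test k A = implication k A (quot (8 ℕ.* (A ℕ.* A)) (3 ℕ.* D k A))

  below : ℕ → (ℕ → Bool) → Bool
  below zero f = true
  below (suc n) f = f n ∧ below n f

  -- How many values of A are tested from 22k on. The start 22k is safe because 45k < 2A.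
  limit : ℕ → ℕ
  limit k = if k ℕ.≤ᵇ 3 then 10400 else if k ℕ.≤ᵇ 16 then 760 else 14 ℕ.* k ℕ.+ 1

  row : ℕ → Bool
  row k = (k ℕ.<ᵇ 2) ∨ below (limit k) (λ i → test k (22 ℕ.* k ℕ.+ i))

  -- Opaque, so that the search is not unfolded again where its result is used.
  abstract
    verified : below 76 row ≡ true
    verified = refl

  private
    ∧-fst : ∀ {x y} → x ∧ y ≡ true → x ≡ true
    ∧-fst {true} e = refl

    ∧-snd : ∀ {x y} → x ∧ y ≡ true → y ≡ true
    ∧-snd {true} e = e

    ∨-elim : ∀ {x y} → x ∨ y ≡ true → x ≡ true ⊎ y ≡ true
    ∨-elim {true} e = inj₁ refl
    ∨-elim {false} e = inj₂ e

    toT : ∀ {x} → x ≡ true → IsTrue x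
    toT refl = tt

  fromT : ∀ {x} → IsTrue x → x ≡ true
  fromT {true} _ = refl

  below-sound : ∀ n f → below n f ≡ true → ∀ i → i ℕ.< n → f i ≡ true
  below-sound (suc n) f e i i<n with i ℕₚ.≟ n
  ... | yes refl = ∧-fst e
  ... | no i≢n = below-sound n f (∧-snd {f n} e) i (ℕₚ.≤∧≢⇒< (ℕₚ.≤-pred i<n) i≢n)

  private
    if-true : ∀ {a} {X : Set a} {b} {x y : X} → b ≡ true → (if b then x else y) ≡ x
    if-true refl = refl

    if-false : ∀ {a} {X : Set a} {b} {x y : X} → b ≡ false → (if b then x else y) ≡ y
    if-false refl = refl

    fromF : ∀ {x} → ¬ IsTrue x → x ≡ false
    fromF {true} e = ⊥-elim (e tt)
    fromF {false} e = refl

    ≰ᵇ : ∀ {a b} → ¬ (a ℕ.≤ b) → (a ℕ.≤ᵇ b) ≡ false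
    ≰ᵇ {a} {b} n = fromF (λ t → n (ℕₚ.≤ᵇ⇒≤ a b t))

  -- For k ≤ 3 the divisor A + 12k of 1152 k² is at most 1152 · 9. For larger k either A ≤ 36k, or k
  -- ≤ 16 and (2k - 6) A ≤ 72k² + 72k bounds A.
  limit-bound : ∀ k A → 2 ℕ.≤ k → k ℕ.≤ 75 → D k A ∣ 1152 ℕ.* (k ℕ.* k) → (36 ℕ.* k ℕ.< A → k ℕ.≤ 16 × 2 ℕ.* k ℕ.* A ℕ.≤ 72 ℕ.* (k ℕ.* k) ℕ.+ 6 ℕ.* A ℕ.+ 72 ℕ.* k) → A ℕ.< 22 ℕ.* k ℕ.+ limit k
  limit-bound k A 2≤k k≤75 dvd large with k ℕ.≤? 3
  ... | yes k≤3 = ℕₚ.≤-trans (ℕ.s≤s A≤) (ℕₚ.≤-trans (ℕₚ.≤ᵇ⇒≤ 10369 10400 tt) (ℕₚ.≤-trans (ℕₚ.≤-reflexive (sym (if-true (fromT (ℕₚ.≤⇒≤ᵇ k≤3))))) (ℕₚ.m≤n+m (limit k) (22 ℕ.* k))))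
    where
      A≤ : A ℕ.≤ 10368
      A≤ = ℕₚ.≤-trans (ℕₚ.m≤m+n A (12 ℕ.* k)) (ℕₚ.≤-trans (∣⇒≤ {{ℕₚ.m*n≢0 1152 (k ℕ.* k) {{_}} {{ℕₚ.m*n≢0 k k {{k≢0}} {{k≢0}}}}}} dvd) (ℕₚ.*-monoʳ-≤ 1152 (ℕₚ.*-mono-≤ k≤3 k≤3)))
        where
          k≢0 : ℕ.NonZero k
          k≢0 = ℕ.>-nonZero (ℕₚ.≤-trans (ℕ.s≤s ℕ.z≤n) 2≤k)
  ... | no k≰3 with 36 ℕ.* k ℕ.<? A
  ...   | no small = ℕₚ.≤-trans (ℕ.s≤s (ℕₚ.≮⇒≥ small)) (subst (λ l → suc (36 ℕ.* k) ℕ.≤ 22 ℕ.* k ℕ.+ l) (sym (if-false (≰ᵇ k≰3))) cases)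
    where
      cases : suc (36 ℕ.* k) ℕ.≤ 22 ℕ.* k ℕ.+ (if k ℕ.≤ᵇ 16 then 760 else 14 ℕ.* k ℕ.+ 1)
      cases with k ℕ.≤? 16
      ... | yes k≤16 = subst (λ l → suc (36 ℕ.* k) ℕ.≤ 22 ℕ.* k ℕ.+ l) (sym (if-true (fromT (ℕₚ.≤⇒≤ᵇ k≤16)))) (ℕₚ.≤-trans (ℕₚ.≤-reflexive (S.solve 1 (λ k → S.con 1 S.:+ S.con 36 S.:* k S.:= S.con 22 S.:* k S.:+ (S.con 14 S.:* k S.:+ S.con 1)) refl k)) (ℕₚ.+-monoʳ-≤ (22 ℕ.* k) (ℕₚ.≤-trans (ℕₚ.+-monoˡ-≤ 1 (ℕₚ.*-monoʳ-≤ 14 k≤16)) (ℕₚ.≤ᵇ⇒≤ 225 760 tt))))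
        where module S = Data.Nat.Solver.+-*-Solver
      ... | no k≰16 = subst (λ l → suc (36 ℕ.* k) ℕ.≤ 22 ℕ.* k ℕ.+ l) (sym (if-false (≰ᵇ k≰16))) (ℕₚ.≤-reflexive (S.solve 1 (λ k → S.con 1 S.:+ S.con 36 S.:* k S.:= S.con 22 S.:* k S.:+ (S.con 14 S.:* k S.:+ S.con 1)) refl k))
        where module S = Data.Nat.Solver.+-*-Solver
  ...   | yes big with large big
  ...     | k≤16 , h = subst (λ l → suc A ℕ.≤ 22 ℕ.* k ℕ.+ l) (sym (trans (if-false (≰ᵇ k≰3)) (if-true (fromT (ℕₚ.≤⇒≤ᵇ k≤16))))) (ℕₚ.≰⇒> contra)
    where
      -- At A = 22k + 760 the last inequality already fails; this is evaluated for every k up to 16.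
      slope : ℕ → Bool
      slope k = (k ℕ.≤ᵇ 3) ∨ (72 ℕ.* (k ℕ.* k) ℕ.+ 72 ℕ.* k ℕ.<ᵇ (2 ℕ.* k ℕ.∸ 6) ℕ.* (22 ℕ.* k ℕ.+ 760))
      A≤ : (2 ℕ.* k ℕ.∸ 6) ℕ.* A ℕ.≤ 72 ℕ.* (k ℕ.* k) ℕ.+ 72 ℕ.* k
      A≤ = ℕₚ.≤-trans (ℕₚ.≤-reflexive (ℕₚ.*-distribʳ-∸ A (2 ℕ.* k) 6)) (ℕₚ.m≤n+o⇒m∸n≤o (2 ℕ.* k ℕ.* A) (6 ℕ.* A) (ℕₚ.≤-trans h (ℕₚ.≤-reflexive (S.solve 3 (λ x A y → x S.:+ S.con 6 S.:* A S.:+ y S.:= S.con 6 S.:* A S.:+ (x S.:+ y)) refl (72 ℕ.* (k ℕ.* k)) A (72 ℕ.* k)))))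
        where module S = Data.Nat.Solver.+-*-Solver
      contra : ¬ (22 ℕ.* k ℕ.+ 760 ℕ.≤ A)
      contra le with ∨-elim {k ℕ.≤ᵇ 3} (below-sound 17 slope refl k (ℕ.s≤s k≤16))
      ... | inj₁ e = k≰3 (ℕₚ.≤ᵇ⇒≤ k 3 (toT e))
      ... | inj₂ e = ℕₚ.<⇒≱ (ℕₚ.<ᵇ⇒< _ _ (toT e)) (ℕₚ.≤-trans (ℕₚ.*-monoʳ-≤ (2 ℕ.* k ℕ.∸ 6) le) A≤)

  private
    zero-tail : ∀ d → 3 ℕ.* d ≡ 0 → d ≡ 0
    zero-tail zero _ = refl

  quot-* : ∀ s d → ¬ (d ≡ 0) → quot (s ℕ.* d) d ≡ s
  quot-* s zero d≢0 = ⊥-elim (d≢0 refl)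
  quot-* s (suc d) _ = m*n/n≡m s (suc d)

  private
    modus-ponens : ∀ {h t u} → not h ∨ (t ∨ u) ≡ true → h ≡ true → t ≡ true ⊎ u ≡ true
    modus-ponens {true} e refl = ∨-elim e

  enumerate : ∀ k A s → 2 ℕ.≤ k → k ℕ.≤ 75 → 22 ℕ.* k ℕ.≤ A → A ℕ.< 22 ℕ.* k ℕ.+ limit k → s ℕ.* (3 ℕ.* D k A) ≡ 8 ℕ.* (A ℕ.* A) → hypotheses k A s ≡ true →
    tabulated k A s table ≡ true ⊎ special k A ≡ true
  enumerate k A s 2≤k k≤75 lo hi eq hyp = modus-ponens {hypotheses k A s} {tabulated k A s table} {special k A} (subst (λ s₀ → implication k A s₀ ≡ true) s₀≡s tested) hyp
    where
      in-row : below (limit k) (λ i → test k (22 ℕ.* k ℕ.+ i)) ≡ true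
      in-row = [ (λ e → ⊥-elim (ℕₚ.<⇒≱ (ℕₚ.<ᵇ⇒< k 2 (toT e)) 2≤k)) , id ]′ (∨-elim {k ℕ.<ᵇ 2} {below (limit k) (λ i → test k (22 ℕ.* k ℕ.+ i))} (below-sound 76 row verified k (ℕ.s≤s k≤75)))
      tested : test k A ≡ true
      tested = subst (λ A → test k A ≡ true) (ℕₚ.m+[n∸m]≡n lo) (below-sound (limit k) (λ i → test k (22 ℕ.* k ℕ.+ i)) in-row (A ℕ.∸ 22 ℕ.* k) (ℕₚ.+-cancelˡ-< (22 ℕ.* k) (A ℕ.∸ 22 ℕ.* k) (limit k) (subst (ℕ._< 22 ℕ.* k ℕ.+ limit k) (sym (ℕₚ.m+[n∸m]≡n lo)) hi)))
      D≢0 : ¬ (3 ℕ.* D k A ≡ 0)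
      D≢0 z = ℕₚ.<⇒≢ (ℕₚ.≤-trans (ℕ.s≤s ℕ.z≤n) (ℕₚ.≤-trans (ℕₚ.*-monoʳ-≤ 12 2≤k) (ℕₚ.m≤n+m (12 ℕ.* k) A))) (sym (zero-tail (D k A) z))
      s₀≡s : quot (8 ℕ.* (A ℕ.* A)) (3 ℕ.* D k A) ≡ s
      s₀≡s = trans (cong (λ t → quot t (3 ℕ.* D k A)) (sym eq)) (quot-* s (3 ℕ.* D k A) D≢0)

 -- From the arithmetic of A and k to the table.

 module Classification (r : ℝ) (A k n₁ n₂ n₃ s : ℕ)
  (A≡ : A ≡ n₁ ℕ.+ 4 ℕ.* n₂ ℕ.+ 9 ℕ.* n₃) (k≡ : k ≡ n₂ ℕ.+ 6 ℕ.* n₃) (r>0 : 0ℝ < r) (r<46/5 : fromℕ 5 * r < fromℕ 46)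
  (rs≡16A : r * fromℕ s ≡ fromℕ 16 * fromℕ A) (rrs≡96[A+12k] : r * (r * fromℕ s) ≡ fromℕ 96 * (fromℕ A + fromℕ 12 * fromℕ k)) (136≤s : 136 ℕ.≤ s)
  (n₃≤1 : n₃ ℕ.≤ 1) (n₃≡0 : r < fromℕ 9 → n₃ ≡ 0) (single⇒r≡4 : n₂ ≡ 1 → n₃ ≡ 0 → r ≡ fromℕ 4)
  (n₂≤16 : r < fromℕ 8 → n₂ ℕ.≤ 16) (n₂[8-r]≤r : fromℕ n₂ * (fromℕ 8 - r) ≤ r)
  (codeBound : ∀ p q → 2 ℕ.* q ℕ.≤ 5 ℕ.* p → fromℕ 8 ≤ r →
    fromℕ n₂ * (fromℕ 4 * fromℕ p * fromℕ q * (r - fromℕ 4) - (fromℕ q * fromℕ q + fromℕ 15 * (fromℕ p * fromℕ p)) * (r - fromℕ 8))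
      ≤ fromℕ 15 * ((fromℕ p + fromℕ q) * (fromℕ p + fromℕ q)) * r)
  (n₁≤1500 : fromℕ 6 ≤ r → fromℕ 39 * r ≤ fromℕ 239 → n₃ ≡ 0 → n₂ ℕ.≤ 3 → n₁ ℕ.≤ 1500)
  where
  open Enumeration
  open Conclusion R

  private
    a = fromℕ A
    κ = fromℕ k

    s>0 : 0ℝ < fromℕ s
    s>0 = <-≤-trans (0<ℕ 135) (fromℕ-mono-≤ 136≤s)

    a>0 : 0ℝ < a
    a>0 = *-cancel-<ˡ (fromℕ 16) (0<ℕ 15) (subst₂ _<_ (sym (zeroʳ _)) rs≡16A (*-pos r>0 s>0))

    -- The fourth-moment identity is r times the left side of the second-moment identity, which
    -- eliminates s.
    ra : r * a ≡ fromℕ 6 * (a + fromℕ 12 * κ)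
    ra = *-cancelˡ (fromℕ 16) (0<⇒≢ (0<ℕ 15)) (trans (solve 2 (λ r a → K 16 :* (r :* a) := r :* (K 16 :* a)) refl r a) (trans (cong (r *_) (sym (rs≡16A))) (trans (rrs≡96[A+12k]) (solve 1 (λ t → K 96 :* t := K 16 :* (K 6 :* t)) refl (a + fromℕ 12 * κ)))))

    ra′ : r * a ≡ fromℕ 6 * a + fromℕ 72 * κ
    ra′ = trans ra (solve 2 (λ a k → K 6 :* (a :+ K 12 :* k) := K 6 :* a :+ K 72 :* k) refl a κ)

    fromℕ-R : fromℕ (6 ℕ.* D k A) ≡ r * a
    fromℕ-R = trans (fromℕ-* 6 (D k A)) (trans (cong (fromℕ 6 *_) (trans (fromℕ-+ A (12 ℕ.* k)) (cong (a +_) (fromℕ-* 12 k)))) (sym ra))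

    sizes : s ℕ.* (3 ℕ.* D k A) ≡ 8 ℕ.* (A ℕ.* A)
    sizes = fromℕ-inj (*-cancelˡ (fromℕ 2) (0<⇒≢ (0<ℕ 1)) (trans (cong (fromℕ 2 *_) (trans (fromℕ-* s (3 ℕ.* D k A)) (cong (fromℕ s *_) (fromℕ-* 3 (D k A)))))
        (trans (solve 2 (λ s d → K 2 :* (s :* (K 3 :* d)) := s :* (K 6 :* d)) refl (fromℕ s) (fromℕ (D k A))) (trans (cong (fromℕ s *_) (trans (sym (fromℕ-* 6 (D k A))) fromℕ-R)) (trans (solve 3 (λ s r a → s :* (r :* a) := (r :* s) :* a) refl (fromℕ s) r a)
          (trans (cong (_* a) (rs≡16A)) (trans (solve 1 (λ a → K 16 :* a :* a := K 2 :* (K 8 :* (a :* a))) refl a) (cong (fromℕ 2 *_) (sym (trans (fromℕ-* 8 (A ℕ.* A)) (cong (fromℕ 8 *_) (fromℕ-* A A))))))))))))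

    r-below : ∀ c → 72 ℕ.* k ℕ.+ 6 ℕ.* A ℕ.< c ℕ.* A → r < fromℕ c
    r-below c h = *-cancel-<ˡ a a>0 (subst₂ _<_ (trans (fromℕ-+ (72 ℕ.* k) (6 ℕ.* A)) (trans (cong₂ _+_ (fromℕ-* 72 k) (fromℕ-* 6 A)) (trans (+-comm _ _) (trans (sym ra′) (*-comm r a))))) (trans (fromℕ-* c A) (*-comm (fromℕ c) a)) (fromℕ-mono-< h))

    r-above : ∀ c → c ℕ.* A ℕ.≤ 72 ℕ.* k ℕ.+ 6 ℕ.* A → fromℕ c ≤ r
    r-above c h = *-cancel-≤ˡ a a>0 (subst₂ _≤_ (trans (fromℕ-* c A) (*-comm (fromℕ c) a)) (trans (fromℕ-+ (72 ℕ.* k) (6 ℕ.* A)) (trans (cong₂ _+_ (fromℕ-* 72 k) (fromℕ-* 6 A)) (trans (+-comm _ _) (trans (sym ra′) (*-comm r a))))) (fromℕ-mono-≤ h))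

    6≤r : fromℕ 6 ≤ r
    6≤r = r-above 6 (ℕₚ.m≤n+m (6 ℕ.* A) (72 ℕ.* k))

    45k<2A : 45 ℕ.* k ℕ.< 2 ℕ.* A
    45k<2A = fromℕ-cancel-< (*-cancel-<ˡ (fromℕ 8) (0<ℕ 7) (subst₂ _<_ (trans (solve 2 (λ a k → K 5 :* (K 6 :* a :+ K 72 :* k) :- K 30 :* a := K 8 :* (K 45 :* k)) refl a κ) (cong (fromℕ 8 *_) (sym (fromℕ-* 45 k))))
        (trans (solve 1 (λ a → K 46 :* a :- K 30 :* a := K 8 :* (K 2 :* a)) refl a) (cong (fromℕ 8 *_) (sym (fromℕ-* 2 A))))
        (+-mono-< (- (fromℕ 30 * a)) (subst₂ _<_ (trans (solve 2 (λ a r → a :* (K 5 :* r) := K 5 :* (r :* a)) refl a r) (cong (fromℕ 5 *_) ra′)) (*-comm a (fromℕ 46)) (*-mono-<ˡ a a>0 r<46/5)))))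

    n₃-small : 24 ℕ.* k ℕ.< A → n₃ ≡ 0
    n₃-small h = n₃≡0 (r-below 9 (ℕₚ.≤-trans (ℕₚ.+-monoˡ-< (6 ℕ.* A) (ℕₚ.≤-trans (ℕₚ.≤-reflexive (cong suc (ℕₚ.*-assoc 3 24 k))) (ℕₚ.*-monoʳ-< 3 h))) (ℕₚ.≤-reflexive (sym (ℕₚ.*-distribʳ-+ A 3 6)))))

    k≡n₂ : n₃ ≡ 0 → k ≡ n₂
    k≡n₂ e = trans k≡ (trans (cong (λ t → n₂ ℕ.+ 6 ℕ.* t) e) (ℕₚ.+-identityʳ n₂))

    36⇒24 : 36 ℕ.* k ℕ.< A → 24 ℕ.* k ℕ.< A
    36⇒24 h = ℕₚ.≤-<-trans (ℕₚ.*-monoˡ-≤ k (ℕₚ.≤ᵇ⇒≤ 24 36 tt)) h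

    large : 36 ℕ.* k ℕ.< A → k ℕ.≤ 16 × 2 ℕ.* k ℕ.* A ℕ.≤ 72 ℕ.* (k ℕ.* k) ℕ.+ 6 ℕ.* A ℕ.+ 72 ℕ.* k
    large h = subst (ℕ._≤ 16) (sym k≡′) (n₂≤16 r<8) , fromℕ-cancel-≤ (subst₂ _≤_ lhs rhs (+-mono-≤ʳ (fromℕ 72 * (κ * κ)) (*-mono-≤ˡ a (<⇒≤ a>0) (subst (λ t → t * (fromℕ 8 - r) ≤ r) (cong fromℕ (sym k≡′)) n₂[8-r]≤r))))
      where
        k≡′ = k≡n₂ (n₃-small (36⇒24 h))
        r<8 : r < fromℕ 8
        r<8 = r-below 8 (ℕₚ.≤-trans (ℕₚ.+-monoˡ-< (6 ℕ.* A) (ℕₚ.≤-trans (ℕₚ.≤-reflexive (cong suc (ℕₚ.*-assoc 2 36 k))) (ℕₚ.*-monoʳ-< 2 h))) (ℕₚ.≤-reflexive (sym (ℕₚ.*-distribʳ-+ A 2 6))))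
        lhs : a * (κ * (fromℕ 8 - r)) + fromℕ 72 * (κ * κ) ≡ fromℕ (2 ℕ.* k ℕ.* A)
        lhs = trans (solve 3 (λ a k r → a :* (k :* (K 8 :- r)) :+ K 72 :* (k :* k) := k :* (K 8 :* a :- r :* a) :+ K 72 :* (k :* k)) refl a κ r) (trans (cong (λ t → κ * (fromℕ 8 * a - t) + fromℕ 72 * (κ * κ)) ra′)
               (trans (solve 2 (λ a k → k :* (K 8 :* a :- (K 6 :* a :+ K 72 :* k)) :+ K 72 :* (k :* k) := K 2 :* k :* a) refl a κ) (sym (trans (fromℕ-* (2 ℕ.* k) A) (cong (_* a) (fromℕ-* 2 k))))))
        rhs : a * r + fromℕ 72 * (κ * κ) ≡ fromℕ (72 ℕ.* (k ℕ.* k) ℕ.+ 6 ℕ.* A ℕ.+ 72 ℕ.* k)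
        rhs = trans (cong (_+ fromℕ 72 * (κ * κ)) (trans (*-comm a r) ra′)) (trans (solve 3 (λ a k q → K 6 :* a :+ K 72 :* k :+ K 72 :* q := K 72 :* q :+ K 6 :* a :+ K 72 :* k) refl a κ (κ * κ))
               (sym (trans (fromℕ-+ (72 ℕ.* (k ℕ.* k) ℕ.+ 6 ℕ.* A) (72 ℕ.* k)) (cong₂ _+_ (trans (fromℕ-+ (72 ℕ.* (k ℕ.* k)) (6 ℕ.* A)) (cong₂ _+_ (trans (fromℕ-* 72 (k ℕ.* k)) (cong (fromℕ 72 *_) (fromℕ-* k k))) (fromℕ-* 6 A))) (fromℕ-* 72 k)))))

    second≤ : second k A ℕ.≤ n₂
    second≤ with 24 ℕ.* k ℕ.<? A
    ... | yes h = subst (ℕ._≤ n₂) (sym (ifT (fromT (ℕₚ.<⇒<ᵇ h)))) (ℕₚ.≤-reflexive (k≡n₂ (n₃-small h)))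
      where
        ifT : ∀ {c} → c ≡ true → (if c then k else k ℕ.∸ 6) ≡ k
        ifT refl = refl
    ... | no h = subst (ℕ._≤ n₂) (sym (ifF (24 ℕ.* k ℕ.<ᵇ A) (λ t → h (ℕₚ.<ᵇ⇒< _ _ t)))) (ℕₚ.m≤n+o⇒m∸n≤o k 6 (ℕₚ.≤-trans (ℕₚ.≤-reflexive k≡) (ℕₚ.≤-trans (ℕₚ.+-monoʳ-≤ n₂ (ℕₚ.*-monoʳ-≤ 6 n₃≤1)) (ℕₚ.≤-reflexive (ℕₚ.+-comm n₂ 6)))))
      where
        ifF : ∀ c → ¬ IsTrue c → (if c then k else k ℕ.∸ 6) ≡ k ℕ.∸ 6
        ifF true e = ⊥-elim (e tt)
        ifF false e = refl

    module Small (small : A ℕ.≤ 36 ℕ.* k) where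
      8A≤ : 8 ℕ.* A ℕ.≤ 72 ℕ.* k ℕ.+ 6 ℕ.* A
      8A≤ = ℕₚ.≤-trans (ℕₚ.≤-reflexive (ℕₚ.*-distribʳ-+ A 2 6)) (ℕₚ.+-monoˡ-≤ (6 ℕ.* A) (ℕₚ.≤-trans (ℕₚ.*-monoʳ-≤ 2 small) (ℕₚ.≤-reflexive (sym (ℕₚ.*-assoc 2 36 k)))))

      8≤r : fromℕ 8 ≤ r
      8≤r = r-above 8 8A≤

      8A≤R : 8 ℕ.* A ℕ.≤ 6 ℕ.* D k A
      8A≤R = fromℕ-cancel-≤ (subst₂ _≤_ (trans (*-comm a (fromℕ 8)) (sym (fromℕ-* 8 A))) (trans (*-comm a r) (sym fromℕ-R)) (*-mono-≤ˡ a (<⇒≤ a>0) 8≤r))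

      ∸-value : ∀ c → c ℕ.≤ 8 → fromℕ (6 ℕ.* D k A ℕ.∸ c ℕ.* A) ≡ a * (r - fromℕ c)
      ∸-value c c≤8 = trans (solve 2 (λ x y → x := (x :+ y) :- y) refl _ (fromℕ (c ℕ.* A))) (trans (cong₂ _-_ (trans (sym (fromℕ-+ (6 ℕ.* D k A ℕ.∸ c ℕ.* A) (c ℕ.* A))) (trans (cong fromℕ (ℕₚ.m∸n+n≡m (ℕₚ.≤-trans (ℕₚ.*-monoˡ-≤ A c≤8) 8A≤R))) fromℕ-R)) (fromℕ-* c A)) (solve 3 (λ r a c → r :* a :- c :* a := a :* (r :- c)) refl r a (fromℕ c)))

      -- `second` is only a lower bound for n₂. If the bracket c is at most 0 the inequality is
      -- trivial, otherwise it is monotone in the size of the shell.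
      weaken : ∀ {x y c B} → 0ℝ ≤ x → x ≤ y → 0ℝ ≤ B → y * c ≤ B → x * c ≤ B
      weaken {x} {y} {c} x≥0 x≤y B≥0 h with c ≤? 0ℝ
      ... | inj₁ c≤0 = ≤-trans (≤-trans (*-mono-≤ˡ x x≥0 c≤0) (≡⇒≤ (zeroʳ x))) B≥0
      ... | inj₂ c>0 = ≤-trans (*-mono-≤ʳ c (<⇒≤ c>0) x≤y) h

      code-holds : ∀ p q → 2 ℕ.* q ℕ.≤ 5 ℕ.* p → code A (6 ℕ.* D k A) (second k A) p q ≡ true
      code-holds p q 2q≤5p = fromT (ℕₚ.≤⇒≤ᵇ {second k A ℕ.* (4 ℕ.* p ℕ.* q ℕ.* (M̂ ℕ.∸ 4 ℕ.* A))} {15 ℕ.* ((p ℕ.+ q) ℕ.* (p ℕ.+ q)) ℕ.* M̂ ℕ.+ second k A ℕ.* ((q ℕ.* q ℕ.+ 15 ℕ.* (p ℕ.* p)) ℕ.* (M̂ ℕ.∸ 8 ℕ.* A))} (fromℕ-cancel-≤ (subst₂ _≤_ (sym left) (sym right) (+-mono-≤ʳ (n̂ * (a * (ŵ * (r - fromℕ 8)))) (*-mono-≤ˡ a (<⇒≤ a>0) bound)))))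
        where
          n̂ = fromℕ (second k A)
          p̂ = fromℕ p
          q̂ = fromℕ q
          ŵ = q̂ * q̂ + fromℕ 15 * (p̂ * p̂)
          M̂ = 6 ℕ.* D k A
          bound : n̂ * (fromℕ 4 * p̂ * q̂ * (r - fromℕ 4) - ŵ * (r - fromℕ 8)) ≤ fromℕ 15 * ((p̂ + q̂) * (p̂ + q̂)) * r
          bound = weaken (0≤ℕ (second k A)) (fromℕ-mono-≤ second≤) (0≤* (0≤* (0≤ℕ 15) (0≤sq _)) (<⇒≤ r>0)) (codeBound p q 2q≤5p 8≤r)
          left : fromℕ (second k A ℕ.* (4 ℕ.* p ℕ.* q ℕ.* (M̂ ℕ.∸ 4 ℕ.* A))) ≡ a * (n̂ * (fromℕ 4 * p̂ * q̂ * (r - fromℕ 4) - ŵ * (r - fromℕ 8))) + n̂ * (a * (ŵ * (r - fromℕ 8)))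
          left = trans (fromℕ-* (second k A) _) (trans (cong (n̂ *_) (trans (fromℕ-* (4 ℕ.* p ℕ.* q) (M̂ ℕ.∸ 4 ℕ.* A)) (cong₂ _*_ (trans (fromℕ-* (4 ℕ.* p) q) (cong (_* q̂) (fromℕ-* 4 p))) (∸-value 4 (ℕₚ.≤ᵇ⇒≤ 4 8 tt)))))
             (solve 5 (λ n c a x y → n :* (c :* (a :* x)) := a :* (n :* (c :* x :- y)) :+ n :* (a :* y)) refl n̂ (fromℕ 4 * p̂ * q̂) a (r - fromℕ 4) (ŵ * (r - fromℕ 8))))
          right : fromℕ (15 ℕ.* ((p ℕ.+ q) ℕ.* (p ℕ.+ q)) ℕ.* M̂ ℕ.+ second k A ℕ.* ((q ℕ.* q ℕ.+ 15 ℕ.* (p ℕ.* p)) ℕ.* (M̂ ℕ.∸ 8 ℕ.* A))) ≡ a * (fromℕ 15 * ((p̂ + q̂) * (p̂ + q̂)) * r) + n̂ * (a * (ŵ * (r - fromℕ 8)))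
          right = trans (fromℕ-+ (15 ℕ.* ((p ℕ.+ q) ℕ.* (p ℕ.+ q)) ℕ.* M̂) _) (cong₂ _+_
             (trans (fromℕ-* (15 ℕ.* ((p ℕ.+ q) ℕ.* (p ℕ.+ q))) M̂) (trans (cong₂ _*_ (trans (fromℕ-* 15 ((p ℕ.+ q) ℕ.* (p ℕ.+ q))) (cong (fromℕ 15 *_) (trans (fromℕ-* (p ℕ.+ q) (p ℕ.+ q)) (cong₂ _*_ (fromℕ-+ p q) (fromℕ-+ p q))))) fromℕ-R) (solve 3 (λ c r a → c :* (r :* a) := a :* (c :* r)) refl (fromℕ 15 * ((p̂ + q̂) * (p̂ + q̂))) r a)))
             (trans (fromℕ-* (second k A) _) (cong (n̂ *_) (trans (fromℕ-* (q ℕ.* q ℕ.+ 15 ℕ.* (p ℕ.* p)) (M̂ ℕ.∸ 8 ℕ.* A)) (trans (cong₂ _*_ (trans (fromℕ-+ (q ℕ.* q) (15 ℕ.* (p ℕ.* p))) (cong₂ _+_ (fromℕ-* q q) (trans (fromℕ-* 15 (p ℕ.* p)) (cong (fromℕ 15 *_) (fromℕ-* p p))))) (∸-value 8 ℕₚ.≤-refl)) (solve 3 (λ w a x → w :* (a :* x) := a :* (w :* x)) refl ŵ a (r - fromℕ 8)))))))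

      codes-hold : codes A (6 ℕ.* D k A) (second k A) ≡ true
      codes-hold = all-true (code-holds 1 1 (ℕₚ.≤ᵇ⇒≤ 2 5 tt)) (code-holds 3 5 (ℕₚ.≤ᵇ⇒≤ 10 15 tt)) (code-holds 8 15 (ℕₚ.≤ᵇ⇒≤ 30 40 tt)) (code-holds 1 2 (ℕₚ.≤ᵇ⇒≤ 4 5 tt)) (code-holds 2 5 (ℕₚ.≤ᵇ⇒≤ 10 10 tt))
        where
          all-true : ∀ {v w x y z} → v ≡ true → w ≡ true → x ≡ true → y ≡ true → z ≡ true → v ∧ (w ∧ (x ∧ (y ∧ z))) ≡ true
          all-true refl refl refl refl refl = refl

      -- with p/q = 2/5 the code bound gives n₂ (520 - 45 r) ≤ 735 r, and r < 46/5
      n₂≤63 : n₂ ℕ.≤ 63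
      n₂≤63 = ℕₚ.≤-pred (fromℕ-cancel-< (*-cancel-<ˡ (fromℕ 106) (0<ℕ 105) (≤-<-trans (≤-trans (≤-trans (≡⇒≤ (*-comm _ _)) (*-mono-≤ˡ (fromℕ n₂) (0≤ℕ n₂) low)) (≤-trans (≡⇒≤ (cong (fromℕ n₂ *_) (solve 1 (λ r → K 520 :- K 45 :* r := K 4 :* K 2 :* K 5 :* (r :- K 4) :- (K 5 :* K 5 :+ K 15 :* (K 2 :* K 2)) :* (r :- K 8)) refl r))) (codeBound 2 5 (ℕₚ.≤ᵇ⇒≤ _ _ tt) 8≤r))) top)))
        where
          low : fromℕ 106 ≤ fromℕ 520 - fromℕ 45 * r
          low = ≤-by (fromℕ 9 * (fromℕ 46 - fromℕ 5 * r)) (0≤* (0≤ℕ 9) (≤⇒0≤ (<⇒≤ r<46/5))) (solve 1 (λ r → K 520 :- K 45 :* r := K 106 :+ K 9 :* (K 46 :- K 5 :* r)) refl r)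
          top : fromℕ 15 * ((fromℕ 2 + fromℕ 5) * (fromℕ 2 + fromℕ 5)) * r < fromℕ 106 * fromℕ 64
          top = <-trans (subst₂ _<_ (solve 1 (λ r → K 147 :* (K 5 :* r) := K 15 :* ((K 2 :+ K 5) :* (K 2 :+ K 5)) :* r) refl r) (sym (fromℕ-* 147 46)) (*-mono-<ˡ (fromℕ 147) (0<ℕ 146) r<46/5)) (subst (fromℕ (147 ℕ.* 46) <_) (fromℕ-* 106 64) (fromℕ-mono-< (ℕₚ.<ᵇ⇒< 6762 6784 tt)))

    k≤75 : k ℕ.≤ 75
    k≤75 with 36 ℕ.* k ℕ.<? A
    ... | yes h = ℕₚ.≤-trans (proj₁ (large h)) (ℕₚ.≤ᵇ⇒≤ 16 75 tt)
    ... | no h = ℕₚ.≤-trans (ℕₚ.≤-reflexive k≡) (ℕₚ.≤-trans (ℕₚ.+-mono-≤ (Small.n₂≤63 (ℕₚ.≮⇒≥ h)) (ℕₚ.*-monoʳ-≤ 6 n₃≤1)) (ℕₚ.≤ᵇ⇒≤ 69 75 tt))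

    both : ∀ {x y} → x ≡ true → y ≡ true → x ∧ y ≡ true
    both refl refl = refl

    if-true : ∀ {c x y} → c ≡ true → x ≡ true → (if c then x else y) ≡ true
    if-true refl e = e

    if-false : ∀ {c x y} → ¬ IsTrue c → y ≡ true → (if c then x else y) ≡ true
    if-false {true} n _ = ⊥-elim (n tt)
    if-false {false} _ e = e

    compareℕ : ∀ x y → x ℕ.< y ⊎ y ℕ.≤ x
    compareℕ x y with x ℕ.<? y
    ... | yes p = inj₁ p
    ... | no p = inj₂ (ℕₚ.≮⇒≥ p)

    admissible-holds : admissible k A ≡ true
    admissible-holds = [ (λ h → if-true {36 ℕ.* k ℕ.<ᵇ A} {(k ℕ.≤ᵇ 16) ∧ (2 ℕ.* k ℕ.* A ℕ.≤ᵇ 72 ℕ.* (k ℕ.* k) ℕ.+ 6 ℕ.* A ℕ.+ 72 ℕ.* k)} {codes A (6 ℕ.* D k A) (second k A)} (fromT (ℕₚ.<⇒<ᵇ h)) (both (fromT (ℕₚ.≤⇒≤ᵇ (proj₁ (large h)))) (fromT (ℕₚ.≤⇒≤ᵇ (proj₂ (large h))))))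
                       , (λ h → if-false {36 ℕ.* k ℕ.<ᵇ A} {(k ℕ.≤ᵇ 16) ∧ (2 ℕ.* k ℕ.* A ℕ.≤ᵇ 72 ℕ.* (k ℕ.* k) ℕ.+ 6 ℕ.* A ℕ.+ 72 ℕ.* k)} {codes A (6 ℕ.* D k A) (second k A)} (λ t → ℕₚ.<⇒≱ (ℕₚ.<ᵇ⇒< (36 ℕ.* k) A t) h) (Small.codes-hold h)) ]′ (compareℕ (36 ℕ.* k) A)

    hypotheses-hold : hypotheses k A s ≡ true
    hypotheses-hold = both (fromT (ℕₚ.≡⇒≡ᵇ (s ℕ.* (3 ℕ.* D k A)) (8 ℕ.* (A ℕ.* A)) sizes)) (both (fromT (ℕₚ.≤⇒≤ᵇ 136≤s)) (both (fromT (ℕₚ.<⇒<ᵇ 45k<2A)) admissible-holds))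

    -- Modulo D = A + 12k one has A ≡ -12k, so 8A² ≡ 1152k²; and 8A² = 3sD.
    dvd : D k A ∣ 1152 ℕ.* (k ℕ.* k)
    dvd = ∣m+n∣m⇒∣n {D k A} {16 ℕ.* A ℕ.* D k A} (divides (8 ℕ.* D k A ℕ.+ 3 ℕ.* s) (trans eq (sym (ℕₚ.*-distribʳ-+ (D k A) (8 ℕ.* D k A) (3 ℕ.* s))))) (divides (16 ℕ.* A) refl)
      where
        δ = a + fromℕ 12 * κ
        fromℕ-D : fromℕ (D k A) ≡ δ
        fromℕ-D = trans (fromℕ-+ A (12 ℕ.* k)) (cong (a +_) (fromℕ-* 12 k))
        sizes′ : fromℕ s * (fromℕ 3 * δ) ≡ fromℕ 8 * (a * a)
        sizes′ = trans (trans (cong (λ t → fromℕ s * (fromℕ 3 * t)) (sym fromℕ-D)) (sym (trans (fromℕ-* s (3 ℕ.* D k A)) (cong (fromℕ s *_) (fromℕ-* 3 (D k A)))))) (trans (cong fromℕ sizes) (trans (fromℕ-* 8 (A ℕ.* A)) (cong (fromℕ 8 *_) (fromℕ-* A A))))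
        eqℝ : fromℕ 16 * a * δ + fromℕ 1152 * (κ * κ) ≡ fromℕ 8 * δ * δ + fromℕ 3 * fromℕ s * δ
        eqℝ = trans (solve 2 (λ a k → K 16 :* a :* (a :+ K 12 :* k) :+ K 1152 :* (k :* k) := K 8 :* (a :+ K 12 :* k) :* (a :+ K 12 :* k) :+ K 8 :* (a :* a)) refl a κ) (cong (fromℕ 8 * δ * δ +_) (trans (sym sizes′) (solve 2 (λ s d → s :* (K 3 :* d) := K 3 :* s :* d) refl (fromℕ s) δ)))
        eq : 16 ℕ.* A ℕ.* D k A ℕ.+ 1152 ℕ.* (k ℕ.* k) ≡ 8 ℕ.* D k A ℕ.* D k A ℕ.+ 3 ℕ.* s ℕ.* D k A
        eq = fromℕ-inj (trans (trans (fromℕ-+ (16 ℕ.* A ℕ.* D k A) (1152 ℕ.* (k ℕ.* k))) (cong₂ _+_ (trans (fromℕ-* (16 ℕ.* A) (D k A)) (cong₂ _*_ (fromℕ-* 16 A) fromℕ-D)) (trans (fromℕ-* 1152 (k ℕ.* k)) (cong (fromℕ 1152 *_) (fromℕ-* k k)))))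
               (trans eqℝ (sym (trans (fromℕ-+ (8 ℕ.* D k A ℕ.* D k A) (3 ℕ.* s ℕ.* D k A)) (cong₂ _+_ (trans (fromℕ-* (8 ℕ.* D k A) (D k A)) (cong₂ _*_ (trans (fromℕ-* 8 (D k A)) (cong (fromℕ 8 *_) fromℕ-D)) fromℕ-D)) (trans (fromℕ-* (3 ℕ.* s) (D k A)) (cong₂ _*_ (fromℕ-* 3 s) fromℕ-D)))))))

    22k≤A : 22 ℕ.* k ℕ.≤ A
    22k≤A = ℕₚ.*-cancelˡ-≤ 2 (ℕₚ.≤-trans (ℕₚ.≤-reflexive (sym (ℕₚ.*-assoc 2 22 k))) (ℕₚ.≤-trans (ℕₚ.*-monoˡ-≤ k (ℕₚ.≤ᵇ⇒≤ 44 45 tt)) (ℕₚ.<⇒≤ 45k<2A)))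

    ∧-split′ : ∀ {x y} → x ∧ y ≡ true → x ≡ true × y ≡ true
    ∧-split′ {true} e = refl , e

    toT′ : ∀ {x} → x ≡ true → IsTrue x
    toT′ refl = tt

    entry : ∀ e → matches k A s e ≡ true → Matches r s e
    entry (p , q , t , lo , hi) ok = *-cancelˡ a (0<⇒≢ a>0) (trans (solve 3 (λ a r q → a :* (r :* q) := q :* (r :* a)) refl a r (fromℕ q)) (trans (cong (fromℕ q *_) (sym fromℕ-R)) (trans (sym (fromℕ-* q (6 ℕ.* D k A)))
        (trans (cong fromℕ (sym (ℕₚ.≡ᵇ⇒≡ (p ℕ.* A) (q ℕ.* (6 ℕ.* D k A)) (toT′ (proj₁ e₁))))) (trans (fromℕ-* p A) (*-comm (fromℕ p) a))))))
      , quot s t , ℕₚ.≤ᵇ⇒≤ lo (quot s t) (toT′ (proj₁ e₃)) , ℕₚ.≤ᵇ⇒≤ (quot s t) hi (toT′ (proj₂ e₃)) , ℕₚ.≡ᵇ⇒≡ s (t ℕ.* quot s t) (toT′ (proj₁ e₂))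
      where
        e₁ = ∧-split′ {p ℕ.* A ℕ.≡ᵇ q ℕ.* (6 ℕ.* D k A)} {(s ℕ.≡ᵇ t ℕ.* quot s t) ∧ ((lo ℕ.≤ᵇ quot s t) ∧ (quot s t ℕ.≤ᵇ hi))} ok
        e₂ = ∧-split′ {s ℕ.≡ᵇ t ℕ.* quot s t} {(lo ℕ.≤ᵇ quot s t) ∧ (quot s t ℕ.≤ᵇ hi)} (proj₂ e₁)
        e₃ = ∧-split′ {lo ℕ.≤ᵇ quot s t} {quot s t ℕ.≤ᵇ hi} (proj₂ e₂)

    lookup-table : ∀ es → tabulated k A s es ≡ true → Any (Matches r s) es
    lookup-table (e ∷ es) ok with matches k A s e in eq
    ... | true = here (entry e eq)
    ... | false = there (lookup-table es ok)

    special-impossible : special k A ≡ true → ⊥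
    special-impossible ok = ℕₚ.<⇒≱ (subst (1500 ℕ.<_) first (ℕₚ.<ᵇ⇒< 1500 (A ℕ.∸ 4 ℕ.* k) (toT′ (proj₂ rest)))) (n₁≤1500 6≤r 39r≤239 n₃0 (subst (ℕ._≤ 3) k≡′ (ℕₚ.≤ᵇ⇒≤ k 3 (toT′ (proj₁ parts)))))
      where
        parts = ∧-split′ {k ℕ.≤ᵇ 3} {(2808 ℕ.* k ℕ.≤ᵇ 5 ℕ.* A) ∧ (1500 ℕ.<ᵇ A ℕ.∸ 4 ℕ.* k)} ok
        rest = ∧-split′ {2808 ℕ.* k ℕ.≤ᵇ 5 ℕ.* A} {1500 ℕ.<ᵇ A ℕ.∸ 4 ℕ.* k} (proj₂ parts)
        2808k≤5A : 2808 ℕ.* k ℕ.≤ 5 ℕ.* A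
        2808k≤5A = ℕₚ.≤ᵇ⇒≤ (2808 ℕ.* k) (5 ℕ.* A) (toT′ (proj₁ rest))
        n₃0 : n₃ ≡ 0
        n₃0 = n₃-small (fromℕ-cancel-< (*-cancel-<ˡ (fromℕ 117) (0<ℕ 116) (≤-<-trans (≤-trans (≡⇒≤ (trans (cong (fromℕ 117 *_) (fromℕ-* 24 k)) (trans (solve 1 (λ k → K 117 :* (K 24 :* k) := K 2808 :* k) refl κ) (sym (fromℕ-* 2808 k))))) (≤-trans (fromℕ-mono-≤ 2808k≤5A) (≡⇒≤ (fromℕ-* 5 A))))
                 (<-by (fromℕ 112 * a) (*-pos (0<ℕ 111) a>0) (solve 1 (λ a → K 117 :* a := K 5 :* a :+ K 112 :* a) refl a)))))
        k≡′ = k≡n₂ n₃0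
        first : A ℕ.∸ 4 ℕ.* k ≡ n₁
        first = trans (cong₂ (λ t u → t ℕ.∸ 4 ℕ.* u) (trans A≡ (trans (cong (λ t → n₁ ℕ.+ 4 ℕ.* n₂ ℕ.+ 9 ℕ.* t) n₃0) (ℕₚ.+-identityʳ _))) k≡′) (ℕₚ.m+n∸n≡m n₁ (4 ℕ.* n₂))
        39r≤239 : fromℕ 39 * r ≤ fromℕ 239
        39r≤239 = *-cancel-≤ˡ a a>0 (subst₂ _≤_ (trans (solve 2 (λ a k → K 2808 :* k :+ K 234 :* a := K 39 :* (K 6 :* a :+ K 72 :* k)) refl a κ) (trans (cong (fromℕ 39 *_) (sym ra′)) (solve 2 (λ r a → K 39 :* (r :* a) := a :* (K 39 :* r)) refl r a))) (solve 1 (λ a → K 5 :* a :+ K 234 :* a := a :* K 239) refl a)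
          (+-mono-≤ʳ (fromℕ 234 * a) (subst₂ _≤_ (fromℕ-* 2808 k) (fromℕ-* 5 A) (fromℕ-mono-≤ 2808k≤5A))))

  private
    is : ∀ j → k ≡ j ⊎ ¬ (k ≡ j)
    is j with k ℕ.≟ j
    ... | yes e = inj₁ e
    ... | no n = inj₂ n

    zero-case : k ≡ 0 → r * fromℕ 1 ≡ fromℕ 6
    zero-case k0 = *-cancelˡ a (0<⇒≢ a>0) (trans (solve 2 (λ a r → a :* (r :* K 1) := r :* a) refl a r) (trans ra′ (trans (cong (λ t → fromℕ 6 * a + fromℕ 72 * fromℕ t) k0) (solve 1 (λ a → K 6 :* a :+ K 72 :* K 0 := a :* K 6) refl a))))

    -- k = 1 means n₂ = 1 and n₃ = 0, which forces r = 4 against r ≥ 6.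
    one-case : k ≡ 1 → ⊥
    one-case k1 = 6≤r (subst (_< fromℕ 6) (sym (single⇒r≡4 (trans (sym (k≡n₂ n₃≡0′)) k1) n₃≡0′)) (fromℕ-mono-< (ℕₚ.≤ᵇ⇒≤ 5 6 tt)))
      where
        vanishes : ∀ n → n₂ ℕ.+ 6 ℕ.* n ≡ 1 → n ≡ 0
        vanishes zero _ = refl
        vanishes (suc n) e = ⊥-elim (ℕₚ.<⇒≱ (ℕₚ.≤ᵇ⇒≤ 2 6 tt) (ℕₚ.≤-trans (ℕₚ.*-monoʳ-≤ 6 (ℕ.s≤s ℕ.z≤n)) (ℕₚ.≤-trans (ℕₚ.m≤n+m (6 ℕ.* suc n) n₂) (ℕₚ.≤-reflexive e))))
        n₃≡0′ : n₃ ≡ 0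
        n₃≡0′ = vanishes n₃ (trans (sym k≡) k1)

    2≤ : ∀ j → ¬ (j ≡ 0) → ¬ (j ≡ 1) → 2 ℕ.≤ j
    2≤ zero ne _ = ⊥-elim (ne refl)
    2≤ (suc zero) _ ne = ⊥-elim (ne refl)
    2≤ (suc (suc j)) _ _ = ℕ.s≤s (ℕ.s≤s ℕ.z≤n)

    general-case : 2 ℕ.≤ k → Any (Matches r s) table
    general-case 2≤k = [ lookup-table table , ⊥-elim ∘ special-impossible ]′ (enumerate k A s 2≤k k≤75 22k≤A (limit-bound k A 2≤k k≤75 dvd large) sizes hypotheses-hold)

  allowed : Allowed r s
  allowed = [ inj₁ ∘ zero-case , (λ k≢0 → [ ⊥-elim ∘ one-case , (λ k≢1 → inj₂ (general-case (2≤ k k≢0 k≢1))) ]′ (is 1)) ]′ (is 0)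

-- The classification for a strongly perfect lattice, with α a minimal vector of its dual.

theorem3p11 : (R : RealField) → let open RealField R in let open RealDefs R in let open Conclusion R in
    (b : Fin 16 → Vec 16) → LinearlyIndependent b → StronglyPerfect b →
    (m m* : Carrier) → IsMin (InLattice b) m → IsMin (InDual b) m* →
    (L : List (Vec 16)) → EnumMin (InLattice b) m L →
    (s : ℕ) → length L ≡ 2 ℕ.* s →
    Allowed (m * m*) s
theorem3p11 R b ind perfect m m* isMin@((v , v∈ , v≢0 , normv) , minimal) ((α , α∈ , α≢0 , normα) , minimal*) L enum s 2s =
  Classification.allowed r A k n₁ n₂ n₃ s refl refl (*-pos m>0 m*>0) r<46/5 (rs≡16A s 2s) (rrs≡96[A+12k] s 2s) 136≤s
    n₃≤1 n₃≡0 single⇒r≡4 n₂≤16 n₂[8-r]≤r codeBound (λ 6≤r 39r≤239 n₃0 n₂≤3 → FirstShell.n₁≤1500 s 2s 6≤r 39r≤239 n₃0 n₂≤3 ℓ>0)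
  where
    open OverReals R
    open Lattice
    m>0 : 0ℝ < m
    m>0 = subst (0ℝ <_) (trans (·-def v v) normv) (norm-pos v v≢0)
    m*>0 : 0ℝ < m*
    m*>0 = subst (0ℝ <_) (trans (·-def α α) normα) (norm-pos α α≢0)
    r<46/5 : fromℕ 5 * (m * m*) < fromℕ 46
    r<46/5 = MinimumProductBound.minimum-product<46/5 b ind m>0 m*>0 minimal minimal*
    setting : Setting
    setting = record
      { b = b ; m = m ; m>0 = m>0 ; minb = minimal ; L = L ; enum = enum ; design = perfect m L isMin enum
      ; α = α ; m* = m* ; m*>0 = m*>0 ; dualα = α∈ ; normα = trans (·-def α α) normα ; r<46/5 = r<46/5 }
    open Special setting
    -- The list L represents Min(Λ) up to `≈v`, so a member equal to v pointwise is used in place of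
    -- v.
    x : ∃ λ x → x ∈ L × v ≈v x
    x = find (Equivalence.to (proj₁ enum v) (v∈ , v≢0 , normv))
    136≤s : 136 ℕ.≤ s
    136≤s = ℕₚ.*-cancelˡ-≤ 2 (subst (272 ℕ.≤_) 2s (272≤length (proj₁ x) (proj₁ (proj₂ x))))
    ℓ>0 : 0ℝ < ℓ
    ℓ>0 = fromℕ-mono-< (ℕₚ.≤-trans (ℕ.s≤s ℕ.z≤n) (272≤length (proj₁ x) (proj₁ (proj₂ x))))
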